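{- Let $q$ be a prime power and let $\mathcal{A}$ be a central hyperplane arrangement in $\mathbb{F}_q^3$ with $\chi(\mathcal{A},q)\neq0$. (1) If $|\mathcal{A}|=2q-1$, then $\mathcal{A}$ is free if and only if $\chi(\mathcal{A},t)=(t-1)(t-q+1)^2$. (2) If $|\mathcal{A}|=2q-2$, then $\mathcal{A}$ is free if and only if $\chi(\mathcal{A},t)=(t-1)(t-q+1)(t-q+2)$.
   Context: A central hyperplane arrangement $\mathcal{A}$ in $V=\mathbb{F}_q^3$ is a finite set of 2-dimensional linear subspaces. Characteristic polynomial: with $L(\mathcal{A})$ the set of intersections of subsets of $\mathcal{A}$ (including $V$) ordered by reverse inclusion, and Möbius function $\mu(V)=1$, $\mu(X)=-\sum_{Y<X}\mu(Y)$, set $\chi(\mathcal{A},t)=\sum_{X\in L(\mathcal{A})}\mu(X)t^{\dim X}$. Freeness: let $S=\mathbb{F}_q[x_1,x_2,x_3]$, fix for each $H$ a nonzero linear form $\alpha_H$ vanishing on $H$, and let $D(\mathcal{A})=\{\delta=\sum_i f_i\partial/\partial x_i,\ f_i\in S : \delta(\alpha_H)\in\alpha_HS\ \forall H\in\mathcal{A}\}$. $\mathcal{A}$ is free if $D(\mathcal{A})$ is a free $S$-module. -}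

module Defs where

open import Level using (0ℓ)
open import Algebra.Bundles using (CommutativeRing)
open import Data.Nat as ℕ using (ℕ; zero; suc)
open import Data.Nat.Primality using (Prime)
open import Data.Integer as ℤ using (ℤ)
open import Data.Fin using (Fin)
open import Data.List as List using (List; []; _∷_; _++_; map; concatMap; foldr; filterᵇ; zip; length; allFin)
open import Data.Bool.ListAction using (and; all; any)
open import Data.List.Relation.Unary.All using (All)
open import Data.List.Relation.Unary.AllPairs using (AllPairs)
open import Data.Vec as Vec using (Vec)
import Data.Vec.Relation.Unary.All as VecAll
open import Data.Bool using (Bool; true; false; if_then_else_; not; _∧_; _∨_)
open import Data.Product using (Σ; _×_; _,_; proj₁; proj₂)
open import Relation.Nullary using (¬_)
open import Relation.Nullary.Decidable using (⌊_⌋)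
open import Relation.Binary using (Decidable)
open import Relation.Binary.PropositionalEquality using (_≡_)

IsPrimePower : ℕ → Set
IsPrimePower q = Σ ℕ λ p → Σ ℕ λ k → Prime p × (q ≡ p ℕ.^ suc k)

record FiniteField (q : ℕ) : Set₁ where
  field
    commRing : CommutativeRing 0ℓ 0ℓ
  open CommutativeRing commRing public
  field
    _≟_             : Decidable _≈_
    1≉0             : ¬ (1# ≈ 0#)
    inverse         : ∀ x → ¬ (x ≈ 0#) → Σ Carrier λ y → (x * y) ≈ 1#
    enum            : Fin q → Carrier
    enum-injective  : ∀ i j → enum i ≈ enum j → i ≡ j
    enum-surjective : ∀ x → Σ (Fin q) λ i → enum i ≈ x

-- Integer polynomials in t (coefficient lists, ascending degree)

ZPoly : Set
ZPoly = List ℤ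

coeffZ : ZPoly → ℕ → ℤ
coeffZ []       _       = ℤ.0ℤ
coeffZ (a ∷ _)  zero    = a
coeffZ (_ ∷ p)  (suc d) = coeffZ p d

addZ : ZPoly → ZPoly → ZPoly
addZ []       r        = r
addZ p        []       = p
addZ (a ∷ p)  (b ∷ r)  = (a ℤ.+ b) ∷ addZ p r

mulZ : ZPoly → ZPoly → ZPoly
mulZ []      r = []
mulZ (a ∷ p) r = addZ (map (a ℤ.*_) r) (ℤ.0ℤ ∷ mulZ p r)

linZ : ℤ → ZPoly
linZ c = (ℤ.- c) ∷ ℤ.1ℤ ∷ []

target1 : ℕ → ZPoly
target1 q = mulZ (linZ ℤ.1ℤ) (mulZ (linZ (ℤ.+ q ℤ.- ℤ.1ℤ)) (linZ (ℤ.+ q ℤ.- ℤ.1ℤ)))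

target2 : ℕ → ZPoly
target2 q = mulZ (linZ ℤ.1ℤ) (mulZ (linZ (ℤ.+ q ℤ.- ℤ.1ℤ)) (linZ (ℤ.+ q ℤ.- ℤ.+ 2)))

sumℤ : List ℤ → ℤ
sumℤ = foldr ℤ._+_ ℤ.0ℤ

module Arr {q : ℕ} (F : FiniteField q) where
  open FiniteField F

  -- vectors of V = F^3; a linear form a1x1+a2x2+a3x3 is given by its
  -- coefficient vector (a1,a2,a3)
  V3 : Set
  V3 = Carrier × Carrier × Carrier

  _≈₃_ : V3 → V3 → Set
  (a , b , c) ≈₃ (a' , b' , c') = (a ≈ a') × (b ≈ b') × (c ≈ c')

  0₃ : V3
  0₃ = 0# , 0# , 0#

  _·₃_ : Carrier → V3 → V3
  k ·₃ (a , b , c) = (k * a) , (k * b) , (k * c)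

  _+₃_ : V3 → V3 → V3
  (a , b , c) +₃ (a' , b' , c') = (a + a') , (b + b') , (c + c')

  ev : V3 → V3 → Carrier
  ev (a , b , c) (x , y , z) = (a * x) + ((b * y) + (c * z))

  -- A central arrangement in F_q^3: a finite set of hyperplanes (2-dim
  -- linear subspaces), each given by a chosen nonzero defining form α_H;
  -- distinct entries define distinct hyperplanes (non-proportional forms).
  record Arrangement : Set where
    field
      forms    : List V3
      nonzero  : All (λ α → ¬ (α ≈₃ 0₃)) forms
      distinct : AllPairs (λ α β → ¬ (Σ Carrier λ k → α ≈₃ (k ·₃ β))) forms
  open Arrangement public

  size : Arrangement → ℕ
  size A = length (forms A)

  _==_ : Carrier → Carrier → Bool
  x == y = ⌊ x ≟ y ⌋

  isZero₃ : V3 → Bool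
  isZero₃ (a , b , c) = (a == 0#) ∧ ((b == 0#) ∧ (c == 0#))

  elems : List Carrier
  elems = map enum (allFin q)

  points : List V3
  points = concatMap (λ a → concatMap (λ b → map (λ c → a , b , c) elems) elems) elems

  tuples : {X : Set} → ℕ → List X → List (List X)
  tuples zero    xs = [] ∷ []
  tuples (suc d) xs = concatMap (λ x → map (x ∷_) (tuples d xs)) xs

  lincomb : List Carrier → List V3 → V3
  lincomb (c ∷ cs) (v ∷ vs) = (c ·₃ v) +₃ lincomb cs vs
  lincomb _        _        = 0₃

  independentB : List V3 → Bool
  independentB vs =
    all (λ cs → not (isZero₃ (lincomb cs vs)) ∨ all (_== 0#) cs)
             (tuples (length vs) elems)

  -- subsets of V represented by their membership vectors over `points`
  Flat : Set
  Flat = List Bool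

  pointsIn : Flat → List V3
  pointsIn X = map proj₁ (filterᵇ proj₂ (zip points X))

  hasIndep : ℕ → Flat → Bool
  hasIndep d X = any independentB (tuples d (pointsIn X))

  dim : Flat → ℕ
  dim X = if hasIndep 3 X then 3 else
          if hasIndep 2 X then 2 else
          if hasIndep 1 X then 1 else 0

  eqB : Flat → Flat → Bool
  eqB []          []          = true
  eqB (true ∷ x)  (true ∷ y)  = eqB x y
  eqB (false ∷ x) (false ∷ y) = eqB x y
  eqB _           _           = false

  subB : Flat → Flat → Bool
  subB X Y = and (List.zipWith (λ x y → not x ∨ y) X Y)

  dedup : List Flat → List Flat
  dedup []       = []
  dedup (x ∷ xs) = x ∷ filterᵇ (λ y → not (eqB x y)) (dedup xs)

  subsets : {X : Set} → List X → List (List X)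
  subsets []       = [] ∷ []
  subsets (x ∷ xs) = subsets xs ++ map (x ∷_) (subsets xs)

  flatOf : List V3 → Flat
  flatOf B = map (λ p → all (λ α → ev α p == 0#) B) points

  Vflat : Flat
  Vflat = flatOf []

  L : Arrangement → List Flat
  L A = dedup (map flatOf (subsets (forms A)))

  -- Möbius function: μ(V) = 1, μ(X) = - Σ_{Y < X} μ(Y), where Y < X in
  -- reverse inclusion means Y ⊋ X.  Implemented by recursion with fuel;
  -- chains in L(A) have length ≤ 4 (dimensions 0..3), so fuel 4 suffices.

  muFuel : ℕ → List Flat → Flat → ℤ
  muFuel zero    Lf X = ℤ.1ℤ
  muFuel (suc n) Lf X =
    if eqB X Vflat then ℤ.1ℤ
    else ℤ.- sumℤ (map (muFuel n Lf)
                       (filterᵇ (λ Y → subB X Y ∧ not (eqB X Y)) Lf))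

  μ : Arrangement → Flat → ℤ
  μ A X = muFuel 4 (L A) X

  chiCoeff : Arrangement → ℕ → ℤ
  chiCoeff A d = sumℤ (map (μ A) (filterᵇ (λ X → dim X ℕ.≡ᵇ d) (L A)))

  chiAt : Arrangement → ℤ → ℤ
  chiAt A t = sumℤ (map (λ X → μ A X ℤ.* (t ℤ.^ dim X)) (L A))

  ChiIs : Arrangement → ZPoly → Set
  ChiIs A p = ∀ d → chiCoeff A d ≡ coeffZ p d

  -- S = F_q[x1,x2,x3]: polynomials as finite lists of terms c·x^m,
  -- compared by coefficients.

  Mono : Set
  Mono = ℕ × ℕ × ℕ

  monoEq : Mono → Mono → Bool
  monoEq (a , b , c) (a' , b' , c') = (a ℕ.≡ᵇ a') ∧ ((b ℕ.≡ᵇ b') ∧ (c ℕ.≡ᵇ c'))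

  monoMul : Mono → Mono → Mono
  monoMul (a , b , c) (a' , b' , c') = (a ℕ.+ a') , (b ℕ.+ b') , (c ℕ.+ c')

  SPoly : Set
  SPoly = List (Carrier × Mono)

  coeffS : SPoly → Mono → Carrier
  coeffS p m = foldr (λ t acc → if monoEq m (proj₂ t) then proj₁ t + acc else acc) 0# p

  _≈S_ : SPoly → SPoly → Set
  p ≈S r = ∀ m → coeffS p m ≈ coeffS r m

  0S : SPoly
  0S = []

  _+S_ : SPoly → SPoly → SPoly
  p +S r = p ++ r

  _*S_ : SPoly → SPoly → SPoly
  p *S r = concatMap (λ t → map (λ u → (proj₁ t * proj₁ u) , monoMul (proj₂ t) (proj₂ u)) r) p

  constS : Carrier → SPoly
  constS c = (c , 0 , 0 , 0) ∷ []

  formPoly : V3 → SPoly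
  formPoly (a , b , c) = (a , 1 , 0 , 0) ∷ (b , 0 , 1 , 0) ∷ (c , 0 , 0 , 1) ∷ []

  _∣S_ : SPoly → SPoly → Set
  g ∣S h = Σ SPoly λ k → h ≈S (g *S k)

  -- derivations δ = f1 ∂1 + f2 ∂2 + f3 ∂3
  Der : Set
  Der = SPoly × SPoly × SPoly

  applyD : Der → V3 → SPoly
  applyD (f1 , f2 , f3) (a , b , c) =
    (constS a *S f1) +S ((constS b *S f2) +S (constS c *S f3))

  _≈D_ : Der → Der → Set
  (f1 , f2 , f3) ≈D (g1 , g2 , g3) = (f1 ≈S g1) × (f2 ≈S g2) × (f3 ≈S g3)

  0D : Der
  0D = 0S , 0S , 0S

  _+D_ : Der → Der → Der
  (f1 , f2 , f3) +D (g1 , g2 , g3) = (f1 +S g1) , (f2 +S g2) , (f3 +S g3)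

  _·D_ : SPoly → Der → Der
  g ·D (f1 , f2 , f3) = (g *S f1) , (g *S f2) , (g *S f3)

  InD : Arrangement → Der → Set
  InD A δ = All (λ α → formPoly α ∣S applyD δ α) (forms A)

  combD : {k : ℕ} → Vec SPoly k → Vec Der k → Der
  combD gs θs = Vec.foldr _ _+D_ 0D (Vec.zipWith _·D_ gs θs)

  IsFree : Arrangement → Set
  IsFree A =
    Σ ℕ λ k → Σ (Vec Der k) λ θs →
      VecAll.All (InD A) θs
      × (∀ δ → InD A δ → Σ (Vec SPoly k) λ gs → δ ≈D combD gs θs)
      × (∀ (gs : Vec SPoly k) → combD gs θs ≈D 0D → ∀ i → Vec.lookup gs i ≈S 0S)

{-# OPTIONS --safe #-}
-- Let X = (x₁, x₂, x₃), let Q be the product of the forms of A, and let N = X × X^q, whose entries generate the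
-- ideal of all F-rational points. By Möbius inversion χ(A, q) is the number of rational points on no hyperplane;
-- as χ(A, 1) = 0 and the two leading coefficients of χ are 1 and −|A|, this number determines χ. The claims thus
-- say that A is free iff the missed points form one class (|A| = 2q − 1), or two classes (|A| = 2q − 2), up to
-- scalars.
--
-- If so few classes are missed, let f be a form of degree 1 or 2 vanishing on them. Then f Q = v · N for a
-- derivation v of A, and expanding at a missed point s to first order, where X^q is constant, expresses s × v(s)
-- through the gradient of f. Two forms f with suitable gradients at s thus give v, w with det(X, v, w) ≠ 0, and
-- this determinant has the degree of Q, so that X, v, w is a basis by Saito's criterion.
--
-- Conversely, a free A has a homogeneous basis X, v, w, and X^q = g X + m v + l w. The rational points on both
-- m = 0 and l = 0 include the missed points, deg m + deg l = 2q + 1 − |A|, and m, l have no common linear factor,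
-- because the entries of N have none. So the missed points lie in the intersection of two distinct lines, or
-- of a line and a conic not containing it.

module Submission where

open import Level using (0ℓ)
open import Algebra.Bundles using (CommutativeRing)
open import Algebra.Structures using (IsCommutativeRing)
import Algebra.Properties.CommutativeMonoid.Sum
import Algebra.Properties.CommutativeSemiring.Binomial
import Algebra.Properties.CommutativeSemiring.Exp
import Algebra.Properties.Ring
import Algebra.Properties.Semiring.Exp
import Algebra.Properties.Semiring.Mult
import Algebra.Properties.Semiring.Mult.TCOptimised
import Algebra.Properties.Semiring.Sum
import Algebra.Solver.Ring
import Algebra.Solver.Ring.AlmostCommutativeRing as ACR
open import Data.Bool using (Bool; true; false; not; _∧_; _∨_; if_then_else_)
open import Data.Bool.ListAction using (all; any)
open import Data.Bool.Properties using (T-≡; T?)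
open import Data.Empty using (⊥; ⊥-elim)
open import Data.Fin as Fin using (Fin; zero; suc; toℕ; inject₁; fromℕ)
import Data.Fin.Permutation as Perm
import Data.Fin.Properties as FinP
open import Data.Integer as ℤ using (ℤ; +_; -[1+_]; 0ℤ; 1ℤ)
import Data.Integer.Properties as ℤP
open import Data.Integer.Solver using () renaming (module +-*-Solver to ℤSolver)
open import Data.List as List using (List; []; _∷_; _++_; length; map; concatMap; filterᵇ; foldr; zip; tabulate; allFin)
open import Data.List.Membership.Propositional using (_∈_)
import Data.List.Membership.Propositional.Properties as ∈P
import Data.List.Properties as ListP
open import Data.List.Relation.Binary.Pointwise using (Pointwise; []; _∷_)
open import Data.List.Relation.Unary.All as All using (All; []; _∷_)
import Data.List.Relation.Unary.All.Properties as AllP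
open import Data.List.Relation.Unary.AllPairs as AllPairs using (AllPairs; []; _∷_)
import Data.List.Relation.Unary.AllPairs.Properties as AllPairsP
open import Data.List.Relation.Unary.Any as Any using (Any; here; there)
import Data.List.Relation.Unary.Any.Properties as AnyP
import Data.List.Relation.Unary.Unique.Propositional.Properties as UniqueP
open import Data.Maybe using (Maybe; just; nothing)
open import Data.Nat as ℕ using (ℕ; zero; suc; s≤s; z≤n)
open import Data.Nat.Combinatorics using (nCn≡1) renaming (_C_ to _choose_)
import Data.Nat.Properties as ℕP
open import Data.Nat.Solver using () renaming (module +-*-Solver to ℕSolver)
open import Data.Product using (Σ; _×_; _,_; proj₁; proj₂)
open import Data.Product.Properties using (≡-dec)
open import Data.Sum using (_⊎_; inj₁; inj₂; [_,_]′)
open import Data.Unit using (⊤; tt)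
open import Data.Vec as Vec using (Vec; []; _∷_)
import Data.Vec.Relation.Unary.All as VecAll
open import Function using (_∘_)
open import Function.Bundles using (Equivalence; _⇔_; mk⇔)
open import Relation.Nullary using (¬_; yes; no; Dec)
open import Relation.Nullary.Decidable using (¬?)
import Relation.Binary.PropositionalEquality as ≡
import Relation.Binary.Reasoning.Setoid
open ≡ using (_≡_; _≢_)

open import Defs

-- The equation f Q = v · N makes v a derivation because v · N = det(v, X, X^q): for each form α of
-- A, α_j (v · N) is congruent to α(v) N_j modulo α, and some N_j is not divisible by α. Saito's
-- criterion also needs deg v ≤ deg f + |A| - q - 1, so membership in the ideal generated by N is
-- proved by an explicit reduction to normal monomials that records the degrees of the multipliers.
--
-- Freeness supplies a basis without any grading. In place of a graded Nakayama lemma, homogeneous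
-- components of basis elements are chosen so that the coordinate determinant of X, v, w has nonzero
-- constant term; X, v, w then generate up to this factor, and comparing components of one degree
-- turns the factor into a constant.
--
-- χ(A, q) ≠ 0 supplies a missed point. If |A| = 2q - 2, a second class is always missed: with one
-- class, two linear f would yield a nonzero multiple of Q of degree at most 2q - 3. That a line
-- meeting a conic in three missed points divides it is proved by polarisation over the polynomial
-- ring, which covers characteristic two and lines with only three points.

-- Ring identities with integer coefficients over any commutative ring.

module RingSolver (R : CommutativeRing 0ℓ 0ℓ) where
  open CommutativeRing R
  open Algebra.Properties.Ring ring using (-‿distribˡ-*; -‿distribʳ-*; -0#≈0#; -‿+-comm; -‿involutive)
  open Algebra.Properties.Semiring.Mult.TCOptimised semiring using (1+×; ×-homo-+; ×1-homo-*) renaming (_×_ to _times_)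
  open Relation.Binary.Reasoning.Setoid setoid

  -- The canonical map from the integers. With the optimised multiples the images of 0 and 1 compute
  -- to `0#` and `1#`, so `con 0ℤ` and `con 1ℤ` stand for the ring constants themselves, whatever
  -- the characteristic.
  fromℤ : ℤ → Carrier
  fromℤ (+ n)    = n times 1#
  fromℤ -[1+ n ] = - (suc n times 1#)

  private
    cancel : ∀ a b c → (c + a) - (c + b) ≈ a - b
    cancel a b c = begin
      (c + a) - (c + b)       ≈⟨ +-congˡ (sym (-‿+-comm c b)) ⟩
      (c + a) + (- c + - b)   ≈⟨ +-congʳ (+-comm c a) ⟩
      (a + c) + (- c + - b)   ≈⟨ +-assoc a c _ ⟩
      a + (c + (- c + - b))   ≈⟨ +-congˡ (sym (+-assoc c _ _)) ⟩
      a + ((c + - c) + - b)   ≈⟨ +-congˡ (+-congʳ (-‿inverseʳ c)) ⟩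
      a + (0# + - b)          ≈⟨ +-congˡ (+-identityˡ _) ⟩
      a - b                   ∎

    ⊖-homo : ∀ m n → fromℤ (m ℤ.⊖ n) ≈ m times 1# - n times 1#
    ⊖-homo m zero = sym (trans (+-congˡ -0#≈0#) (+-identityʳ _))
    ⊖-homo zero (suc n) = sym (+-identityˡ _)
    ⊖-homo (suc m) (suc n) = begin
      fromℤ (suc m ℤ.⊖ suc n) ≡⟨ ≡.cong fromℤ (ℤP.[1+m]⊖[1+n]≡m⊖n m n) ⟩
      fromℤ (m ℤ.⊖ n)         ≈⟨ ⊖-homo m n ⟩
      m times 1# - n times 1# ≈⟨ sym (cancel _ _ 1#) ⟩
      (1# + m times 1#) - (1# + n times 1#) ≈⟨ +-cong (1+× m 1#) (-‿cong (1+× n 1#)) ⟨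
      suc m times 1# - suc n times 1# ∎

    +-homo : ∀ i j → fromℤ (i ℤ.+ j) ≈ fromℤ i + fromℤ j
    +-homo (+ m) (+ n) = ×-homo-+ 1# m n
    +-homo (+ m) -[1+ n ] = ⊖-homo m (suc n)
    +-homo -[1+ m ] (+ n) = trans (⊖-homo n (suc m)) (+-comm _ _)
    +-homo -[1+ m ] -[1+ n ] = begin
      - (suc (suc (m ℕ.+ n)) times 1#)             ≡⟨ ≡.cong (λ k → - (k times 1#)) (≡.sym (ℕP.+-suc (suc m) n)) ⟩
      - ((suc m ℕ.+ suc n) times 1#)               ≈⟨ -‿cong (×-homo-+ 1# (suc m) (suc n)) ⟩
      - (suc m times 1# + suc n times 1#)          ≈⟨ sym (-‿+-comm _ _) ⟩
      - (suc m times 1#) + - (suc n times 1#)      ∎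

    -‿homo : ∀ i → fromℤ (ℤ.- i) ≈ - fromℤ i
    -‿homo (+ zero)  = sym -0#≈0#
    -‿homo (+ suc n) = refl
    -‿homo -[1+ n ]  = sym (-‿involutive _)

    *-homo⁺ : ∀ m j → fromℤ (+ m ℤ.* j) ≈ m times 1# * fromℤ j
    *-homo⁺ m (+ n) = trans (reflexive (≡.cong fromℤ (≡.sym (ℤP.pos-* m n)))) (×1-homo-* m n)
    *-homo⁺ m -[1+ n ] = begin
      fromℤ (+ m ℤ.* -[1+ n ])          ≡⟨ ≡.cong fromℤ (ℤP.neg-distribʳ-* (+ m) (+ suc n)) ⟨
      fromℤ (ℤ.- (+ m ℤ.* + suc n))     ≈⟨ -‿homo (+ m ℤ.* + suc n) ⟩
      - fromℤ (+ m ℤ.* + suc n)         ≈⟨ -‿cong (*-homo⁺ m (+ suc n)) ⟩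
      - (m times 1# * fromℤ (+ suc n))  ≈⟨ -‿distribʳ-* _ _ ⟩
      m times 1# * fromℤ -[1+ n ]       ∎

    *-homo : ∀ i j → fromℤ (i ℤ.* j) ≈ fromℤ i * fromℤ j
    *-homo (+ m) j = *-homo⁺ m j
    *-homo -[1+ m ] j = begin
      fromℤ (-[1+ m ] ℤ.* j)            ≡⟨ ≡.cong fromℤ (ℤP.neg-distribˡ-* (+ suc m) j) ⟨
      fromℤ (ℤ.- (+ suc m ℤ.* j))       ≈⟨ -‿homo (+ suc m ℤ.* j) ⟩
      - fromℤ (+ suc m ℤ.* j)           ≈⟨ -‿cong (*-homo⁺ (suc m) j) ⟩
      - (suc m times 1# * fromℤ j)      ≈⟨ -‿distribˡ-* _ _ ⟩
      fromℤ -[1+ m ] * fromℤ j          ∎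

  private
    acr = ACR.fromCommutativeRing R

    morphism : ℤ.+-*-rawRing ACR.-Raw-AlmostCommutative⟶ acr
    morphism = record
      { ⟦_⟧ = fromℤ ; +-homo = +-homo ; *-homo = *-homo ; -‿homo = -‿homo
      ; 0-homo = refl ; 1-homo = refl }

    coeff≟ : ∀ i j → Maybe (fromℤ i ≈ fromℤ j)
    coeff≟ i j with i ℤ.≟ j
    ... | yes i≡j = just (reflexive (≡.cong fromℤ i≡j))
    ... | no _    = nothing

  open Algebra.Solver.Ring ℤ.+-*-rawRing acr morphism coeff≟ public
    using (solve; _:=_; _:+_; _:*_; _:-_; :-_; con; Polynomial)

-- Vector algebra in rank three over a commutative ring.

module Vector3 (R : CommutativeRing 0ℓ 0ℓ) where
  open CommutativeRing R
  open RingSolver R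

  R³ : Set
  R³ = Carrier × Carrier × Carrier

  infix 4 _≋_
  _≋_ : R³ → R³ → Set
  (a , b , c) ≋ (a' , b' , c') = (a ≈ a') × (b ≈ b') × (c ≈ c')

  ≋-refl : ∀ {u} → u ≋ u
  ≋-refl = refl , refl , refl

  ≋-sym : ∀ {u v} → u ≋ v → v ≋ u
  ≋-sym (p , r , s) = sym p , sym r , sym s

  ≋-trans : ∀ {u v w} → u ≋ v → v ≋ w → u ≋ w
  ≋-trans (p , r , s) (p' , r' , s') = trans p p' , trans r r' , trans s s'

  infixl 7 _•_ _⨯_ _⊙_
  infixl 6 _⊞_

  _•_ : Carrier → R³ → R³
  k • (a , b , c) = k * a , k * b , k * c

  _⊞_ : R³ → R³ → R³
  (a , b , c) ⊞ (a' , b' , c') = a + a' , b + b' , c + c'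

  _⊙_ : R³ → R³ → Carrier
  (a , b , c) ⊙ (x , y , z) = a * x + (b * y + c * z)

  _⨯_ : R³ → R³ → R³
  (a , b , c) ⨯ (x , y , z) = b * z - c * y , c * x - a * z , a * y - b * x

  det : R³ → R³ → R³ → Carrier
  det u v w = u ⊙ (v ⨯ w)

  𝟘 : R³
  𝟘 = 0# , 0# , 0#

  ⊙-cong : ∀ {u u' v v'} → u ≋ u' → v ≋ v' → u ⊙ v ≈ u' ⊙ v'
  ⊙-cong (a , b , c) (x , y , z) = +-cong (*-cong a x) (+-cong (*-cong b y) (*-cong c z))

  •-cong : ∀ {k k' u u'} → k ≈ k' → u ≋ u' → k • u ≋ k' • u'
  •-cong k (a , b , c) = *-cong k a , *-cong k b , *-cong k c

  ⊞-cong : ∀ {u u' v v'} → u ≋ u' → v ≋ v' → u ⊞ v ≋ u' ⊞ v'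
  ⊞-cong (a , b , c) (x , y , z) = +-cong a x , +-cong b y , +-cong c z

  ⨯-cong : ∀ {u u' v v'} → u ≋ u' → v ≋ v' → u ⨯ v ≋ u' ⨯ v'
  ⨯-cong (a , b , c) (x , y , z) =
    sub (*-cong b z) (*-cong c y) , sub (*-cong c x) (*-cong a z) , sub (*-cong a y) (*-cong b x)
    where
    sub : ∀ {s s' t t'} → s ≈ s' → t ≈ t' → s - t ≈ s' - t'
    sub p r = +-cong p (-‿cong r)

  det-cong : ∀ {u u' v v' w w'} → u ≋ u' → v ≋ v' → w ≋ w' → det u v w ≈ det u' v' w'
  det-cong u v w = ⊙-cong u (⨯-cong v w)

  private
    -- Vectors of solver expressions: the identities below hold coordinate by coordinate, and `eq π`
    -- states one coordinate of a vector identity in this syntax.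
    P³ : ℕ → Set
    P³ n = Polynomial n × Polynomial n × Polynomial n

    _•ₚ_ : ∀ {n} → Polynomial n → P³ n → P³ n
    k •ₚ (a , b , c) = k :* a , k :* b , k :* c

    _⊞ₚ_ _⨯ₚ_ : ∀ {n} → P³ n → P³ n → P³ n
    (a , b , c) ⊞ₚ (a' , b' , c') = a :+ a' , b :+ b' , c :+ c'
    (a , b , c) ⨯ₚ (x , y , z) = b :* z :- c :* y , c :* x :- a :* z , a :* y :- b :* x

    _⊙ₚ_ : ∀ {n} → P³ n → P³ n → Polynomial n
    (a , b , c) ⊙ₚ (x , y , z) = a :* x :+ (b :* y :+ c :* z)

    detₚ : ∀ {n} (u v w : P³ n) → Polynomial n
    detₚ u v w = u ⊙ₚ (v ⨯ₚ w)

    π₁ π₂ π₃ : ∀ {n} → P³ n → Polynomial n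
    π₁ (a , _ , _) = a
    π₂ (_ , b , _) = b
    π₃ (_ , _ , c) = c

  cramer : ∀ u v w δ → det u v w • δ ≋ det δ v w • u ⊞ (det u δ w • v ⊞ det u v δ • w)
  cramer (u₁ , u₂ , u₃) (v₁ , v₂ , v₃) (w₁ , w₂ , w₃) (δ₁ , δ₂ , δ₃) =
    solve 12 (eq π₁) refl u₁ u₂ u₃ v₁ v₂ v₃ w₁ w₂ w₃ δ₁ δ₂ δ₃ ,
    solve 12 (eq π₂) refl u₁ u₂ u₃ v₁ v₂ v₃ w₁ w₂ w₃ δ₁ δ₂ δ₃ ,
    solve 12 (eq π₃) refl u₁ u₂ u₃ v₁ v₂ v₃ w₁ w₂ w₃ δ₁ δ₂ δ₃
    where
    eq : (P³ 12 → Polynomial 12) → _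
    eq π u₁ u₂ u₃ v₁ v₂ v₃ w₁ w₂ w₃ δ₁ δ₂ δ₃ = let u = u₁ , u₂ , u₃ ; v = v₁ , v₂ , v₃ ; w = w₁ , w₂ , w₃ ; δ = δ₁ , δ₂ , δ₃ in
      π (detₚ u v w •ₚ δ) := π ((detₚ δ v w •ₚ u) ⊞ₚ ((detₚ u δ w •ₚ v) ⊞ₚ (detₚ u v δ •ₚ w)))

  -- Cramer's rule for covectors: the three cross products are det(u, v, w) times the dual basis of
  -- u, v, w. It makes a determinant, multiplied by a coordinate of α, a combination of α(u), α(v),
  -- α(w).
  dual-cramer : ∀ u v w α → det u v w • α ≋ (α ⊙ u) • (v ⨯ w) ⊞ ((α ⊙ v) • (w ⨯ u) ⊞ (α ⊙ w) • (u ⨯ v))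
  dual-cramer (u₁ , u₂ , u₃) (v₁ , v₂ , v₃) (w₁ , w₂ , w₃) (α₁ , α₂ , α₃) =
    solve 12 (eq π₁) refl u₁ u₂ u₃ v₁ v₂ v₃ w₁ w₂ w₃ α₁ α₂ α₃ ,
    solve 12 (eq π₂) refl u₁ u₂ u₃ v₁ v₂ v₃ w₁ w₂ w₃ α₁ α₂ α₃ ,
    solve 12 (eq π₃) refl u₁ u₂ u₃ v₁ v₂ v₃ w₁ w₂ w₃ α₁ α₂ α₃
    where
    eq : (P³ 12 → Polynomial 12) → _
    eq π u₁ u₂ u₃ v₁ v₂ v₃ w₁ w₂ w₃ α₁ α₂ α₃ = let u = u₁ , u₂ , u₃ ; v = v₁ , v₂ , v₃ ; w = w₁ , w₂ , w₃ ; α = α₁ , α₂ , α₃ in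
      π (detₚ u v w •ₚ α) := π (((α ⊙ₚ u) •ₚ (v ⨯ₚ w)) ⊞ₚ (((α ⊙ₚ v) •ₚ (w ⨯ₚ u)) ⊞ₚ ((α ⊙ₚ w) •ₚ (u ⨯ₚ v))))

  -- The factor is the 2 × 2 minor of the last two coordinates of the two combinations. Applied to
  -- X^q and a multiple of a unit vector, it relates N to the coefficients m and l of X^q.
  det-comb : ∀ g m l g' m' l' u v w → det u (g • u ⊞ (m • v ⊞ l • w)) (g' • u ⊞ (m' • v ⊞ l' • w)) ≈ (m * l' - l * m') * det u v w
  det-comb g m l g' m' l' (u₁ , u₂ , u₃) (v₁ , v₂ , v₃) (w₁ , w₂ , w₃) = solve 15 (λ g m l g' m' l' u₁ u₂ u₃ v₁ v₂ v₃ w₁ w₂ w₃ → let u = u₁ , u₂ , u₃ ; v = v₁ , v₂ , v₃ ; w = w₁ , w₂ , w₃ in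
      detₚ u ((g •ₚ u) ⊞ₚ ((m •ₚ v) ⊞ₚ (l •ₚ w))) ((g' •ₚ u) ⊞ₚ ((m' •ₚ v) ⊞ₚ (l' •ₚ w))) := (m :* l' :- l :* m') :* detₚ u v w) refl g m l g' m' l' u₁ u₂ u₃ v₁ v₂ v₃ w₁ w₂ w₃

  -- The planes with normals u × v and u × w both contain u. This recovers a determinant from two
  -- cross products with u, which is the form in which the expansion at a missed point delivers v
  -- and w.
  ⨯-⨯-common : ∀ u v w → (u ⨯ v) ⨯ (u ⨯ w) ≋ det u v w • u
  ⨯-⨯-common (u₁ , u₂ , u₃) (v₁ , v₂ , v₃) (w₁ , w₂ , w₃) =
    solve 9 (eq π₁) refl u₁ u₂ u₃ v₁ v₂ v₃ w₁ w₂ w₃ ,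
    solve 9 (eq π₂) refl u₁ u₂ u₃ v₁ v₂ v₃ w₁ w₂ w₃ ,
    solve 9 (eq π₃) refl u₁ u₂ u₃ v₁ v₂ v₃ w₁ w₂ w₃
    where
    eq : (P³ 9 → Polynomial 9) → _
    eq π u₁ u₂ u₃ v₁ v₂ v₃ w₁ w₂ w₃ = let u = u₁ , u₂ , u₃ ; v = v₁ , v₂ , v₃ ; w = w₁ , w₂ , w₃ in
      π ((u ⨯ₚ v) ⨯ₚ (u ⨯ₚ w)) := π (detₚ u v w •ₚ u)

  ⨯-⨯ : ∀ u v w → u ⨯ (v ⨯ w) ≋ (u ⊙ w) • v ⊞ (- (u ⊙ v)) • w
  ⨯-⨯ (u₁ , u₂ , u₃) (v₁ , v₂ , v₃) (w₁ , w₂ , w₃) =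
    solve 9 (eq π₁) refl u₁ u₂ u₃ v₁ v₂ v₃ w₁ w₂ w₃ ,
    solve 9 (eq π₂) refl u₁ u₂ u₃ v₁ v₂ v₃ w₁ w₂ w₃ ,
    solve 9 (eq π₃) refl u₁ u₂ u₃ v₁ v₂ v₃ w₁ w₂ w₃
    where
    eq : (P³ 9 → Polynomial 9) → _
    eq π u₁ u₂ u₃ v₁ v₂ v₃ w₁ w₂ w₃ = let u = u₁ , u₂ , u₃ ; v = v₁ , v₂ , v₃ ; w = w₁ , w₂ , w₃ in
      π (u ⨯ₚ (v ⨯ₚ w)) := π (((u ⊙ₚ w) •ₚ v) ⊞ₚ ((:- (u ⊙ₚ v)) •ₚ w))

  det-rotate : ∀ u v w → det u v w ≈ det v w u
  det-rotate (u₁ , u₂ , u₃) (v₁ , v₂ , v₃) (w₁ , w₂ , w₃) = solve 9 (λ u₁ u₂ u₃ v₁ v₂ v₃ w₁ w₂ w₃ → let u = u₁ , u₂ , u₃ ; v = v₁ , v₂ , v₃ ; w = w₁ , w₂ , w₃ in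
      detₚ u v w := detₚ v w u) refl u₁ u₂ u₃ v₁ v₂ v₃ w₁ w₂ w₃

  ⊙-comm : ∀ u v → u ⊙ v ≈ v ⊙ u
  ⊙-comm (u₁ , u₂ , u₃) (v₁ , v₂ , v₃) = solve 6 (λ u₁ u₂ u₃ v₁ v₂ v₃ → let u = u₁ , u₂ , u₃ ; v = v₁ , v₂ , v₃ in
      u ⊙ₚ v := v ⊙ₚ u) refl u₁ u₂ u₃ v₁ v₂ v₃

  det-repeat₁₂ : ∀ u v → det u u v ≈ 0#
  det-repeat₁₂ (u₁ , u₂ , u₃) (v₁ , v₂ , v₃) = solve 6 (λ u₁ u₂ u₃ v₁ v₂ v₃ → let u = u₁ , u₂ , u₃ ; v = v₁ , v₂ , v₃ in
      detₚ u u v := con ℤ.0ℤ) refl u₁ u₂ u₃ v₁ v₂ v₃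

  det-repeat₁₃ : ∀ u v → det u v u ≈ 0#
  det-repeat₁₃ (u₁ , u₂ , u₃) (v₁ , v₂ , v₃) = solve 6 (λ u₁ u₂ u₃ v₁ v₂ v₃ → let u = u₁ , u₂ , u₃ ; v = v₁ , v₂ , v₃ in
      detₚ u v u := con ℤ.0ℤ) refl u₁ u₂ u₃ v₁ v₂ v₃

  det-comb₁ : ∀ g m l u v w → det (g • u ⊞ (m • v ⊞ l • w)) v w ≈ g * det u v w
  det-comb₁ g m l (u₁ , u₂ , u₃) (v₁ , v₂ , v₃) (w₁ , w₂ , w₃) = solve 12 (λ g m l u₁ u₂ u₃ v₁ v₂ v₃ w₁ w₂ w₃ → let u = u₁ , u₂ , u₃ ; v = v₁ , v₂ , v₃ ; w = w₁ , w₂ , w₃ in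
      detₚ ((g •ₚ u) ⊞ₚ ((m •ₚ v) ⊞ₚ (l •ₚ w))) v w := g :* detₚ u v w) refl g m l u₁ u₂ u₃ v₁ v₂ v₃ w₁ w₂ w₃

  det-comb₂ : ∀ g m l u v w → det u (g • u ⊞ (m • v ⊞ l • w)) w ≈ m * det u v w
  det-comb₂ g m l (u₁ , u₂ , u₃) (v₁ , v₂ , v₃) (w₁ , w₂ , w₃) = solve 12 (λ g m l u₁ u₂ u₃ v₁ v₂ v₃ w₁ w₂ w₃ → let u = u₁ , u₂ , u₃ ; v = v₁ , v₂ , v₃ ; w = w₁ , w₂ , w₃ in
      detₚ u ((g •ₚ u) ⊞ₚ ((m •ₚ v) ⊞ₚ (l •ₚ w))) w := m :* detₚ u v w) refl g m l u₁ u₂ u₃ v₁ v₂ v₃ w₁ w₂ w₃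

  det-comb₃ : ∀ g m l u v w → det u v (g • u ⊞ (m • v ⊞ l • w)) ≈ l * det u v w
  det-comb₃ g m l (u₁ , u₂ , u₃) (v₁ , v₂ , v₃) (w₁ , w₂ , w₃) = solve 12 (λ g m l u₁ u₂ u₃ v₁ v₂ v₃ w₁ w₂ w₃ → let u = u₁ , u₂ , u₃ ; v = v₁ , v₂ , v₃ ; w = w₁ , w₂ , w₃ in
      detₚ u v ((g •ₚ u) ⊞ₚ ((m •ₚ v) ⊞ₚ (l •ₚ w))) := l :* detₚ u v w) refl g m l u₁ u₂ u₃ v₁ v₂ v₃ w₁ w₂ w₃

  det-+₂ : ∀ u v v' w → det u (v ⊞ v') w ≈ det u v w + det u v' w
  det-+₂ (u₁ , u₂ , u₃) (v₁ , v₂ , v₃) (v'₁ , v'₂ , v'₃) (w₁ , w₂ , w₃) = solve 12 (λ u₁ u₂ u₃ v₁ v₂ v₃ v'₁ v'₂ v'₃ w₁ w₂ w₃ → let u = u₁ , u₂ , u₃ ; v = v₁ , v₂ , v₃ ; v' = v'₁ , v'₂ , v'₃ ; w = w₁ , w₂ , w₃ in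
      detₚ u (v ⊞ₚ v') w := detₚ u v w :+ detₚ u v' w) refl u₁ u₂ u₃ v₁ v₂ v₃ v'₁ v'₂ v'₃ w₁ w₂ w₃

  det-+₃ : ∀ u v w w' → det u v (w ⊞ w') ≈ det u v w + det u v w'
  det-+₃ (u₁ , u₂ , u₃) (v₁ , v₂ , v₃) (w₁ , w₂ , w₃) (w'₁ , w'₂ , w'₃) = solve 12 (λ u₁ u₂ u₃ v₁ v₂ v₃ w₁ w₂ w₃ w'₁ w'₂ w'₃ → let u = u₁ , u₂ , u₃ ; v = v₁ , v₂ , v₃ ; w = w₁ , w₂ , w₃ ; w' = w'₁ , w'₂ , w'₃ in
      detₚ u v (w ⊞ₚ w') := detₚ u v w :+ detₚ u v w') refl u₁ u₂ u₃ v₁ v₂ v₃ w₁ w₂ w₃ w'₁ w'₂ w'₃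

  det-planar : ∀ a b c d e f u v → det (a • u ⊞ b • v) (c • u ⊞ d • v) (e • u ⊞ f • v) ≈ 0#
  det-planar a b c d e f (u₁ , u₂ , u₃) (v₁ , v₂ , v₃) = solve 12 (λ a b c d e f u₁ u₂ u₃ v₁ v₂ v₃ → let u = u₁ , u₂ , u₃ ; v = v₁ , v₂ , v₃ in
      detₚ ((a •ₚ u) ⊞ₚ (b •ₚ v)) ((c •ₚ u) ⊞ₚ (d •ₚ v)) ((e •ₚ u) ⊞ₚ (f •ₚ v)) := con ℤ.0ℤ) refl a b c d e f u₁ u₂ u₃ v₁ v₂ v₃

  ⊙-• : ∀ k α u → α ⊙ (k • u) ≈ k * (α ⊙ u)
  ⊙-• k (α₁ , α₂ , α₃) (u₁ , u₂ , u₃) = solve 7 (λ k α₁ α₂ α₃ u₁ u₂ u₃ → let α = α₁ , α₂ , α₃ ; u = u₁ , u₂ , u₃ in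
      α ⊙ₚ (k •ₚ u) := k :* (α ⊙ₚ u)) refl k α₁ α₂ α₃ u₁ u₂ u₃

  combination : R³ → R³ → R³ → R³ → R³
  combination u v w (g , m , l) = g • u ⊞ (m • v ⊞ l • w)

  combination-cong : ∀ u v w {c d} → c ≋ d → combination u v w c ≋ combination u v w d
  combination-cong u v w (g , m , l) = ⊞-cong (•-cong g (≋-refl {u})) (⊞-cong (•-cong m (≋-refl {v})) (•-cong l (≋-refl {w})))

  private
    combinationₚ : ∀ {n} → P³ n → P³ n → P³ n → P³ n → P³ n
    combinationₚ u v w (g , m , l) = (g •ₚ u) ⊞ₚ ((m •ₚ v) ⊞ₚ (l •ₚ w))

  combination-⊞ : ∀ u v w c d → combination u v w (c ⊞ d) ≋ combination u v w c ⊞ combination u v w d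
  combination-⊞ (u₁ , u₂ , u₃) (v₁ , v₂ , v₃) (w₁ , w₂ , w₃) (c₁ , c₂ , c₃) (d₁ , d₂ , d₃) =
    solve 15 (eq π₁) refl u₁ u₂ u₃ v₁ v₂ v₃ w₁ w₂ w₃ c₁ c₂ c₃ d₁ d₂ d₃ ,
    solve 15 (eq π₂) refl u₁ u₂ u₃ v₁ v₂ v₃ w₁ w₂ w₃ c₁ c₂ c₃ d₁ d₂ d₃ ,
    solve 15 (eq π₃) refl u₁ u₂ u₃ v₁ v₂ v₃ w₁ w₂ w₃ c₁ c₂ c₃ d₁ d₂ d₃
    where
    eq : (P³ 15 → Polynomial 15) → _
    eq π u₁ u₂ u₃ v₁ v₂ v₃ w₁ w₂ w₃ c₁ c₂ c₃ d₁ d₂ d₃ = let u = u₁ , u₂ , u₃ ; v = v₁ , v₂ , v₃ ; w = w₁ , w₂ , w₃ ; c = c₁ , c₂ , c₃ ; d = d₁ , d₂ , d₃ in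
      π (combinationₚ u v w (c ⊞ₚ d)) := π (combinationₚ u v w c ⊞ₚ combinationₚ u v w d)

  combination-• : ∀ k u v w c → combination u v w (k • c) ≋ k • combination u v w c
  combination-• k (u₁ , u₂ , u₃) (v₁ , v₂ , v₃) (w₁ , w₂ , w₃) (c₁ , c₂ , c₃) =
    solve 13 (eq π₁) refl k u₁ u₂ u₃ v₁ v₂ v₃ w₁ w₂ w₃ c₁ c₂ c₃ ,
    solve 13 (eq π₂) refl k u₁ u₂ u₃ v₁ v₂ v₃ w₁ w₂ w₃ c₁ c₂ c₃ ,
    solve 13 (eq π₃) refl k u₁ u₂ u₃ v₁ v₂ v₃ w₁ w₂ w₃ c₁ c₂ c₃
    where
    eq : (P³ 13 → Polynomial 13) → _
    eq π k u₁ u₂ u₃ v₁ v₂ v₃ w₁ w₂ w₃ c₁ c₂ c₃ = let u = u₁ , u₂ , u₃ ; v = v₁ , v₂ , v₃ ; w = w₁ , w₂ , w₃ ; c = c₁ , c₂ , c₃ in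
      π (combinationₚ u v w (k •ₚ c)) := π (k •ₚ combinationₚ u v w c)

  e₁ e₂ e₃ : R³
  e₁ = 1# , 0# , 0#
  e₂ = 0# , 1# , 0#
  e₃ = 0# , 0# , 1#

  private
    e₁ₚ e₂ₚ e₃ₚ : ∀ {n} → P³ n
    e₁ₚ = con ℤ.1ℤ , con ℤ.0ℤ , con ℤ.0ℤ
    e₂ₚ = con ℤ.0ℤ , con ℤ.1ℤ , con ℤ.0ℤ
    e₃ₚ = con ℤ.0ℤ , con ℤ.0ℤ , con ℤ.1ℤ

  e₁-⊙ : ∀ u → e₁ ⊙ u ≈ proj₁ u
  e₁-⊙ (u₁ , u₂ , u₃) = solve 3 (λ u₁ u₂ u₃ → let u = u₁ , u₂ , u₃ in
      e₁ₚ ⊙ₚ u := π₁ u) refl u₁ u₂ u₃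

  combination-e₁ : ∀ u v w → combination u v w e₁ ≋ u
  combination-e₁ (u₁ , u₂ , u₃) (v₁ , v₂ , v₃) (w₁ , w₂ , w₃) =
    solve 9 (eq π₁) refl u₁ u₂ u₃ v₁ v₂ v₃ w₁ w₂ w₃ ,
    solve 9 (eq π₂) refl u₁ u₂ u₃ v₁ v₂ v₃ w₁ w₂ w₃ ,
    solve 9 (eq π₃) refl u₁ u₂ u₃ v₁ v₂ v₃ w₁ w₂ w₃
    where
    eq : (P³ 9 → Polynomial 9) → _
    eq π u₁ u₂ u₃ v₁ v₂ v₃ w₁ w₂ w₃ = let u = u₁ , u₂ , u₃ ; v = v₁ , v₂ , v₃ ; w = w₁ , w₂ , w₃ in
      π (combinationₚ u v w e₁ₚ) := π (u)

  e₂-⊙ : ∀ u → e₂ ⊙ u ≈ proj₁ (proj₂ u)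
  e₂-⊙ (u₁ , u₂ , u₃) = solve 3 (λ u₁ u₂ u₃ → let u = u₁ , u₂ , u₃ in
      e₂ₚ ⊙ₚ u := π₂ u) refl u₁ u₂ u₃

  combination-e₂ : ∀ u v w → combination u v w e₂ ≋ v
  combination-e₂ (u₁ , u₂ , u₃) (v₁ , v₂ , v₃) (w₁ , w₂ , w₃) =
    solve 9 (eq π₁) refl u₁ u₂ u₃ v₁ v₂ v₃ w₁ w₂ w₃ ,
    solve 9 (eq π₂) refl u₁ u₂ u₃ v₁ v₂ v₃ w₁ w₂ w₃ ,
    solve 9 (eq π₃) refl u₁ u₂ u₃ v₁ v₂ v₃ w₁ w₂ w₃
    where
    eq : (P³ 9 → Polynomial 9) → _
    eq π u₁ u₂ u₃ v₁ v₂ v₃ w₁ w₂ w₃ = let u = u₁ , u₂ , u₃ ; v = v₁ , v₂ , v₃ ; w = w₁ , w₂ , w₃ in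
      π (combinationₚ u v w e₂ₚ) := π (v)

  e₃-⊙ : ∀ u → e₃ ⊙ u ≈ proj₂ (proj₂ u)
  e₃-⊙ (u₁ , u₂ , u₃) = solve 3 (λ u₁ u₂ u₃ → let u = u₁ , u₂ , u₃ in
      e₃ₚ ⊙ₚ u := π₃ u) refl u₁ u₂ u₃

  combination-e₃ : ∀ u v w → combination u v w e₃ ≋ w
  combination-e₃ (u₁ , u₂ , u₃) (v₁ , v₂ , v₃) (w₁ , w₂ , w₃) =
    solve 9 (eq π₁) refl u₁ u₂ u₃ v₁ v₂ v₃ w₁ w₂ w₃ ,
    solve 9 (eq π₂) refl u₁ u₂ u₃ v₁ v₂ v₃ w₁ w₂ w₃ ,
    solve 9 (eq π₃) refl u₁ u₂ u₃ v₁ v₂ v₃ w₁ w₂ w₃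
    where
    eq : (P³ 9 → Polynomial 9) → _
    eq π u₁ u₂ u₃ v₁ v₂ v₃ w₁ w₂ w₃ = let u = u₁ , u₂ , u₃ ; v = v₁ , v₂ , v₃ ; w = w₁ , w₂ , w₃ in
      π (combinationₚ u v w e₃ₚ) := π (w)

  det-scaled-basis : ∀ k → det (k • e₁) (k • e₂) (k • e₃) ≈ k * (k * k)
  det-scaled-basis k = solve 1 (λ k →
      detₚ (k •ₚ e₁ₚ) (k •ₚ e₂ₚ) (k •ₚ e₃ₚ) := k :* (k :* k)) refl k

  ⊙-nondegenerate : ∀ u → (∀ c → c ⊙ u ≈ 0#) → u ≋ 𝟘
  ⊙-nondegenerate u h = trans (sym (e₁-⊙ u)) (h e₁) , trans (sym (e₂-⊙ u)) (h e₂) , trans (sym (e₃-⊙ u)) (h e₃)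

  -- The signed 3 × 3 minors are the coefficients of the universal relation among four vectors in
  -- rank three.
  cramer-relation : ∀ t u v w → ((- det w u v) • t ⊞ ((- det t w v) • u ⊞ ((- det t u w) • v ⊞ det t u v • w))) ≋ 𝟘
  cramer-relation (t₁ , t₂ , t₃) (u₁ , u₂ , u₃) (v₁ , v₂ , v₃) (w₁ , w₂ , w₃) =
    solve 12 (eq π₁) refl t₁ t₂ t₃ u₁ u₂ u₃ v₁ v₂ v₃ w₁ w₂ w₃ ,
    solve 12 (eq π₂) refl t₁ t₂ t₃ u₁ u₂ u₃ v₁ v₂ v₃ w₁ w₂ w₃ ,
    solve 12 (eq π₃) refl t₁ t₂ t₃ u₁ u₂ u₃ v₁ v₂ v₃ w₁ w₂ w₃
    where
    eq : (P³ 12 → Polynomial 12) → _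
    eq π t₁ t₂ t₃ u₁ u₂ u₃ v₁ v₂ v₃ w₁ w₂ w₃ = let t = t₁ , t₂ , t₃ ; u = u₁ , u₂ , u₃ ; v = v₁ , v₂ , v₃ ; w = w₁ , w₂ , w₃ in
      π (((:- detₚ w u v) •ₚ t) ⊞ₚ (((:- detₚ t w v) •ₚ u) ⊞ₚ (((:- detₚ t u w) •ₚ v) ⊞ₚ (detₚ t u v •ₚ w)))) := π (con ℤ.0ℤ , con ℤ.0ℤ , con ℤ.0ℤ)

  -- Once det(t, u, v) = 0 this is a relation among t, u, v. Its coefficients pair an arbitrary c
  -- with the 2 × 2 minors, so independence makes t × u vanish.
  cramer-relation₃ : ∀ t u v c → ((det c u v) • t ⊞ ((det t c v) • u ⊞ ((det t u c) • v ⊞ 0# • c))) ≋ det t u v • c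
  cramer-relation₃ (t₁ , t₂ , t₃) (u₁ , u₂ , u₃) (v₁ , v₂ , v₃) (c₁ , c₂ , c₃) =
    solve 12 (eq π₁) refl t₁ t₂ t₃ u₁ u₂ u₃ v₁ v₂ v₃ c₁ c₂ c₃ ,
    solve 12 (eq π₂) refl t₁ t₂ t₃ u₁ u₂ u₃ v₁ v₂ v₃ c₁ c₂ c₃ ,
    solve 12 (eq π₃) refl t₁ t₂ t₃ u₁ u₂ u₃ v₁ v₂ v₃ c₁ c₂ c₃
    where
    eq : (P³ 12 → Polynomial 12) → _
    eq π t₁ t₂ t₃ u₁ u₂ u₃ v₁ v₂ v₃ c₁ c₂ c₃ = let t = t₁ , t₂ , t₃ ; u = u₁ , u₂ , u₃ ; v = v₁ , v₂ , v₃ ; c = c₁ , c₂ , c₃ in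
      π (((detₚ c u v) •ₚ t) ⊞ₚ (((detₚ t c v) •ₚ u) ⊞ₚ (((detₚ t u c) •ₚ v) ⊞ₚ (con ℤ.0ℤ •ₚ c)))) := π (detₚ t u v •ₚ c)

  -- Once t × u = 0 this is a relation between t and u. The zero multiples of v and w give it the
  -- four-term shape that `Independent₄` tests.
  cramer-relation₂ : ∀ t u v w c → ((c ⊙ u) • t ⊞ ((- (c ⊙ t)) • u ⊞ (0# • v ⊞ 0# • w))) ≋ c ⨯ (t ⨯ u)
  cramer-relation₂ (t₁ , t₂ , t₃) (u₁ , u₂ , u₃) (v₁ , v₂ , v₃) (w₁ , w₂ , w₃) (c₁ , c₂ , c₃) =
    solve 15 (eq π₁) refl t₁ t₂ t₃ u₁ u₂ u₃ v₁ v₂ v₃ w₁ w₂ w₃ c₁ c₂ c₃ ,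
    solve 15 (eq π₂) refl t₁ t₂ t₃ u₁ u₂ u₃ v₁ v₂ v₃ w₁ w₂ w₃ c₁ c₂ c₃ ,
    solve 15 (eq π₃) refl t₁ t₂ t₃ u₁ u₂ u₃ v₁ v₂ v₃ w₁ w₂ w₃ c₁ c₂ c₃
    where
    eq : (P³ 15 → Polynomial 15) → _
    eq π t₁ t₂ t₃ u₁ u₂ u₃ v₁ v₂ v₃ w₁ w₂ w₃ c₁ c₂ c₃ = let t = t₁ , t₂ , t₃ ; u = u₁ , u₂ , u₃ ; v = v₁ , v₂ , v₃ ; w = w₁ , w₂ , w₃ ; c = c₁ , c₂ , c₃ in
      π (((c ⊙ₚ u) •ₚ t) ⊞ₚ (((:- (c ⊙ₚ t)) •ₚ u) ⊞ₚ ((con ℤ.0ℤ •ₚ v) ⊞ₚ (con ℤ.0ℤ •ₚ w)))) := π (c ⨯ₚ (t ⨯ₚ u))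

  scaled-first : ∀ t u v w → (1# • t ⊞ (0# • u ⊞ (0# • v ⊞ 0# • w))) ≋ t
  scaled-first (t₁ , t₂ , t₃) (u₁ , u₂ , u₃) (v₁ , v₂ , v₃) (w₁ , w₂ , w₃) =
    solve 12 (eq π₁) refl t₁ t₂ t₃ u₁ u₂ u₃ v₁ v₂ v₃ w₁ w₂ w₃ ,
    solve 12 (eq π₂) refl t₁ t₂ t₃ u₁ u₂ u₃ v₁ v₂ v₃ w₁ w₂ w₃ ,
    solve 12 (eq π₃) refl t₁ t₂ t₃ u₁ u₂ u₃ v₁ v₂ v₃ w₁ w₂ w₃
    where
    eq : (P³ 12 → Polynomial 12) → _
    eq π t₁ t₂ t₃ u₁ u₂ u₃ v₁ v₂ v₃ w₁ w₂ w₃ = let t = t₁ , t₂ , t₃ ; u = u₁ , u₂ , u₃ ; v = v₁ , v₂ , v₃ ; w = w₁ , w₂ , w₃ in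
      π ((con ℤ.1ℤ •ₚ t) ⊞ₚ ((con ℤ.0ℤ •ₚ u) ⊞ₚ ((con ℤ.0ℤ •ₚ v) ⊞ₚ (con ℤ.0ℤ •ₚ w)))) := π (t)

  det-as-⊙ : ∀ t u c → det t u c ≈ c ⊙ (t ⨯ u)
  det-as-⊙ (t₁ , t₂ , t₃) (u₁ , u₂ , u₃) (c₁ , c₂ , c₃) = solve 9 (λ t₁ t₂ t₃ u₁ u₂ u₃ c₁ c₂ c₃ → let t = t₁ , t₂ , t₃ ; u = u₁ , u₂ , u₃ ; c = c₁ , c₂ , c₃ in
      detₚ t u c := c ⊙ₚ (t ⨯ₚ u)) refl t₁ t₂ t₃ u₁ u₂ u₃ c₁ c₂ c₃

  𝟘-• : ∀ k u → k ≈ 0# → k • u ≋ 𝟘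
  𝟘-• k (a , b , c) k≈0 = z a , z b , z c
    where
    z : ∀ a → k * a ≈ 0#
    z a = trans (*-congʳ k≈0) (zeroˡ a)

  ⨯-𝟘 : ∀ u v → v ≋ 𝟘 → u ⨯ v ≋ 𝟘
  ⨯-𝟘 u@(a , b , c) v v≋𝟘 = ≋-trans (⨯-cong (≋-refl {u}) v≋𝟘) (z b c , z c a , z a b)
    where
    z : ∀ a b → a * 0# - b * 0# ≈ 0#
    z a b = solve 2 (λ a b → a :* con ℤ.0ℤ :- b :* con ℤ.0ℤ := con ℤ.0ℤ) refl a b

  Independent₄ : R³ → R³ → R³ → R³ → Set
  Independent₄ t u v w = ∀ a b c d → a • t ⊞ (b • u ⊞ (c • v ⊞ d • w)) ≋ 𝟘 → (a ≈ 0#) × (b ≈ 0#) × (c ≈ 0#) × (d ≈ 0#)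

  -- The coefficients of successively shorter relations are the minors of (t, u, v), which therefore all vanish.
  independent₄⇒trivial : ∀ t u v w → Independent₄ t u v w → 1# ≈ 0#
  independent₄⇒trivial t u v w indep = proj₁ (indep 1# 0# 0# 0# (≋-trans (scaled-first t u v w) t≋𝟘))
    where
    tuv≈0 : det t u v ≈ 0#
    tuv≈0 = proj₂ (proj₂ (proj₂ (indep _ _ _ _ (cramer-relation t u v w))))
    padded : ∀ c → det c u v • t ⊞ (det t c v • u ⊞ (det t u c • v ⊞ 0# • w)) ≋ 𝟘
    padded c = ≋-trans (⊞-cong ≋-refl (⊞-cong ≋-refl (⊞-cong ≋-refl (≋-trans (𝟘-• 0# w refl) (≋-sym (𝟘-• 0# c refl))))))
      (≋-trans (cramer-relation₃ t u v c) (𝟘-• (det t u v) c tuv≈0))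
    t⨯u≋𝟘 : t ⨯ u ≋ 𝟘
    t⨯u≋𝟘 = ⊙-nondegenerate (t ⨯ u) λ c → trans (sym (det-as-⊙ t u c)) (proj₁ (proj₂ (proj₂ (indep _ _ _ _ (padded c)))))
    t≋𝟘 : t ≋ 𝟘
    t≋𝟘 = ⊙-nondegenerate t λ c → trans (solve 1 (λ x → x := :- (:- x)) refl (c ⊙ t))
      (trans (-‿cong (proj₁ (proj₂ (indep _ _ _ _ (≋-trans (cramer-relation₂ t u v w c) (⨯-𝟘 c (t ⨯ u) t⨯u≋𝟘)))))) (solve 0 (:- con ℤ.0ℤ := con ℤ.0ℤ) refl))

-- The commutative ring of polynomials in three variables, and evaluation in F-algebras.

module Polynomials {q : ℕ} (F : FiniteField q) where
  open FiniteField F hiding (_≟_)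
  open Arr F
  open Algebra.Properties.Ring ring using (-0#≈0#; -‿+-comm)

  infix 4 _≟ᵐ_
  _≟ᵐ_ : (m m' : Mono) → Dec (m ≡ m')
  _≟ᵐ_ = ≡-dec ℕ._≟_ (≡-dec ℕ._≟_ ℕ._≟_)

  private
    ≡ᵇ-refl : ∀ a → (a ℕ.≡ᵇ a) ≡ true
    ≡ᵇ-refl a = Equivalence.to T-≡ (ℕP.≡⇒≡ᵇ a a ≡.refl)

  monoEq-refl : ∀ m → monoEq m m ≡ true
  monoEq-refl (a , b , c) rewrite ≡ᵇ-refl a | ≡ᵇ-refl b | ≡ᵇ-refl c = ≡.refl

  monoEq-≢ : ∀ {m m'} → m ≢ m' → monoEq m m' ≡ false
  monoEq-≢ {a , b , c} {a' , b' , c'} m≢m'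
    with a ℕ.≡ᵇ a' in p | b ℕ.≡ᵇ b' in r | c ℕ.≡ᵇ c' in s
  ... | false | _ | _ = ≡.refl
  ... | true | false | _ = ≡.refl
  ... | true | true | false = ≡.refl
  ... | true | true | true = ⊥-elim (m≢m' (≡.cong₂ _,_ (eq a a' p) (≡.cong₂ _,_ (eq b b' r) (eq c c' s))))
    where
    eq : ∀ x y → (x ℕ.≡ᵇ y) ≡ true → x ≡ y
    eq x y h = ℕP.≡ᵇ⇒≡ x y (Equivalence.from T-≡ h)

  coeffS-≡ : ∀ c m p → coeffS ((c , m) ∷ p) m ≡ c + coeffS p m
  coeffS-≡ c m p rewrite monoEq-refl m = ≡.refl

  coeffS-≢ : ∀ c {μ m} p → m ≢ μ → coeffS ((c , μ) ∷ p) m ≡ coeffS p m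
  coeffS-≢ c p m≢μ rewrite monoEq-≢ m≢μ = ≡.refl

  monoMul-comm : ∀ m m' → monoMul m m' ≡ monoMul m' m
  monoMul-comm (a , b , c) (a' , b' , c') =
    ≡.cong₂ _,_ (ℕP.+-comm a a') (≡.cong₂ _,_ (ℕP.+-comm b b') (ℕP.+-comm c c'))

  monoMul-assoc : ∀ m m' m'' → monoMul (monoMul m m') m'' ≡ monoMul m (monoMul m' m'')
  monoMul-assoc (a , b , c) (a' , b' , c') (a'' , b'' , c'') =
    ≡.cong₂ _,_ (ℕP.+-assoc a a' a'') (≡.cong₂ _,_ (ℕP.+-assoc b b' b'') (ℕP.+-assoc c c' c''))

  negS : SPoly → SPoly
  negS = map (λ t → - proj₁ t , proj₂ t)

  coeffS-negS : ∀ p m → coeffS (negS p) m ≈ - coeffS p m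
  coeffS-negS [] m = sym -0#≈0#
  coeffS-negS ((c , μ) ∷ p) m with m ≟ᵐ μ
  ... | yes ≡.refl rewrite coeffS-≡ c m p | coeffS-≡ (- c) m (negS p) =
        trans (+-congˡ (coeffS-negS p m)) (-‿+-comm c _)
  ... | no m≢μ rewrite coeffS-≢ c p m≢μ | coeffS-≢ (- c) (negS p) m≢μ = coeffS-negS p m

  coeffS-++ : ∀ p r m → coeffS (p ++ r) m ≈ coeffS p m + coeffS r m
  coeffS-++ [] r m = sym (+-identityˡ _)
  coeffS-++ ((c , μ) ∷ p) r m with m ≟ᵐ μ
  ... | yes ≡.refl rewrite coeffS-≡ c m p | coeffS-≡ c m (p ++ r) =
        trans (+-congˡ (coeffS-++ p r m)) (sym (+-assoc _ _ _))
  ... | no m≢μ rewrite coeffS-≢ c p m≢μ | coeffS-≢ c (p ++ r) m≢μ = coeffS-++ p r m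

  -- Evaluation is written once for F-algebras and used for three of them: F for values, S for
  -- substitutions, and the dual numbers over F for derivatives.
  record Algebra : Set₁ where
    field
      ringA  : CommutativeRing 0ℓ 0ℓ
    open CommutativeRing ringA using () renaming
      (Carrier to A; _≈_ to _≈A_; _+_ to _+A_; _*_ to _*A_; 0# to 0A; 1# to 1A)
    field
      ι      : Carrier → A
      ι-cong : ∀ {x y} → x ≈ y → ι x ≈A ι y
      ι-+    : ∀ x y → ι (x + y) ≈A (ι x +A ι y)
      ι-*    : ∀ x y → ι (x * y) ≈A (ι x *A ι y)
      ι-0    : ι 0# ≈A 0A
      ι-1    : ι 1# ≈A 1A

  base : Algebra
  base = record
    { ringA = commRing ; ι = λ x → x ; ι-cong = λ p → p
    ; ι-+ = λ _ _ → refl ; ι-* = λ _ _ → refl ; ι-0 = refl ; ι-1 = refl }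

  -- lin p φ is the value at p of the linear functional with x^m ↦ φ m.
  module Linear (𝔸 : Algebra) where
    open Algebra 𝔸
    module R = CommutativeRing ringA
    open R using () renaming (Carrier to A; _≈_ to _≈A_; _+_ to _+A_; _*_ to _*A_; 0# to 0A)
    open RingSolver ringA
    open Relation.Binary.Reasoning.Setoid R.setoid

    lin : SPoly → (Mono → A) → A
    lin p φ = foldr (λ t acc → (ι (proj₁ t) *A φ (proj₂ t)) +A acc) 0A p

    lin-congʳ : ∀ p {φ ψ} → (∀ m → φ m ≈A ψ m) → lin p φ ≈A lin p ψ
    lin-congʳ [] h = R.refl
    lin-congʳ ((c , m) ∷ p) h = R.+-cong (R.*-congˡ (h m)) (lin-congʳ p h)

    lin-++ : ∀ p r φ → lin (p ++ r) φ ≈A (lin p φ +A lin r φ)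
    lin-++ [] r φ = R.sym (R.+-identityˡ _)
    lin-++ (t ∷ p) r φ = R.trans (R.+-congˡ (lin-++ p r φ)) (R.sym (R.+-assoc _ _ _))

    lin-0 : ∀ p → lin p (λ _ → 0A) ≈A 0A
    lin-0 [] = R.refl
    lin-0 (t ∷ p) = R.trans (R.+-cong (R.zeroʳ _) (lin-0 p)) (R.+-identityˡ _)

    lin-+ : ∀ p φ ψ → lin p (λ m → φ m +A ψ m) ≈A (lin p φ +A lin p ψ)
    lin-+ [] φ ψ = R.sym (R.+-identityˡ _)
    lin-+ ((c , m) ∷ p) φ ψ = R.trans (R.+-congˡ (lin-+ p φ ψ))
      (solve 5 (λ c a b s t → c :* (a :+ b) :+ (s :+ t) := (c :* a :+ s) :+ (c :* b :+ t))
        R.refl (ι c) (φ m) (ψ m) _ _)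

    lin-* : ∀ p k φ → lin p (λ m → k *A φ m) ≈A (k *A lin p φ)
    lin-* [] k φ = R.sym (R.zeroʳ k)
    lin-* ((c , m) ∷ p) k φ = R.trans (R.+-congˡ (lin-* p k φ))
      (solve 4 (λ c k a s → c :* (k :* a) :+ k :* s := k :* (c :* a :+ s)) R.refl (ι c) k (φ m) _)

    -- Interchange of two finite sums; commutativity of polynomial multiplication rests on it.
    lin-swap : ∀ p r (φ : Mono → Mono → A) → lin p (λ m → lin r (φ m)) ≈A lin r (λ m' → lin p (λ m → φ m m'))
    lin-swap [] r φ = R.sym (lin-0 r)
    lin-swap ((c , m) ∷ p) r φ = begin
      (ι c *A lin r (φ m)) +A lin p (λ m → lin r (φ m))
        ≈⟨ R.+-cong (R.sym (lin-* r (ι c) (φ m))) (lin-swap p r φ) ⟩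
      lin r (λ m' → ι c *A φ m m') +A lin r (λ m' → lin p (λ m → φ m m'))
        ≈⟨ lin-+ r _ _ ⟨
      lin r (λ m' → (ι c *A φ m m') +A lin p (λ m → φ m m')) ∎

    lin-*S : ∀ p r φ → lin (p *S r) φ ≈A lin p (λ m → lin r (λ m' → φ (monoMul m m')))
    lin-*S [] r φ = R.refl
    lin-*S ((c , m) ∷ p) r φ = R.trans (lin-++ (map _ r) (p *S r) φ) (R.+-cong (term r) (lin-*S p r φ))
      where
      term : ∀ r → lin (map (λ u → (c * proj₁ u) , monoMul m (proj₂ u)) r) φ
                   ≈A (ι c *A lin r (λ m' → φ (monoMul m m')))
      term [] = R.sym (R.zeroʳ _)
      term ((d , m') ∷ r) = R.trans (R.+-cong (R.*-congʳ (ι-* c d)) (term r))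
        (solve 4 (λ c d a s → c :* d :* a :+ c :* s := c :* (d :* a :+ s)) R.refl (ι c) (ι d) _ _)

    private
      -- A term list may repeat a monomial, so all terms with monomial μ are removed at once; their
      -- coefficients add up to `coeffS p μ`.
      remove : Mono → SPoly → SPoly
      remove μ [] = []
      remove μ ((c , m) ∷ p) with m ≟ᵐ μ
      ... | yes _ = remove μ p
      ... | no _  = (c , m) ∷ remove μ p

      remove-length : ∀ μ p → length (remove μ p) ℕ.≤ length p
      remove-length μ [] = z≤n
      remove-length μ ((c , m) ∷ p) with m ≟ᵐ μ
      ... | yes _ = ℕP.m≤n⇒m≤1+n (remove-length μ p)
      ... | no _  = s≤s (remove-length μ p)

      lin-remove : ∀ μ p φ → lin p φ ≈A ((ι (coeffS p μ) *A φ μ) +A lin (remove μ p) φ)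
      lin-remove μ [] φ = R.sym (R.trans (R.+-identityʳ _) (R.trans (R.*-congʳ ι-0) (R.zeroˡ _)))
      lin-remove μ ((c , m) ∷ p) φ with m ≟ᵐ μ
      ... | yes ≡.refl rewrite coeffS-≡ c m p = R.trans (R.+-congˡ (lin-remove m p φ))
        (R.trans (solve 4 (λ c d a s → c :* a :+ (d :* a :+ s) := (c :+ d) :* a :+ s) R.refl (ι c) _ (φ m) _)
          (R.+-congʳ (R.*-congʳ (R.sym (ι-+ c _)))))
      ... | no m≢μ rewrite coeffS-≢ c p (m≢μ ∘ ≡.sym) = R.trans (R.+-congˡ (lin-remove μ p φ))
        (solve 3 (λ a b s → a :+ (b :+ s) := b :+ (a :+ s)) R.refl _ _ _)

      coeffS-remove : ∀ μ p → coeffS (remove μ p) μ ≈ 0#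
      coeffS-remove μ [] = refl
      coeffS-remove μ ((c , m) ∷ p) with m ≟ᵐ μ
      ... | yes _ = coeffS-remove μ p
      ... | no m≢μ = trans (reflexive (coeffS-≢ c (remove μ p) (m≢μ ∘ ≡.sym))) (coeffS-remove μ p)

      coeffS-remove-≢ : ∀ {μ ν} p → ν ≢ μ → coeffS (remove μ p) ν ≈ coeffS p ν
      coeffS-remove-≢ [] _ = refl
      coeffS-remove-≢ {μ} {ν} ((c , m) ∷ p) ν≢μ with m ≟ᵐ μ
      ... | yes ≡.refl rewrite coeffS-≢ c p ν≢μ = coeffS-remove-≢ p ν≢μ
      ... | no _ with ν ≟ᵐ m
      ...   | yes ≡.refl rewrite coeffS-≡ c ν p | coeffS-≡ c ν (remove μ p) = +-congˡ (coeffS-remove-≢ p ν≢μ)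
      ...   | no ν≢m rewrite coeffS-≢ c p ν≢m | coeffS-≢ c (remove μ p) ν≢m = coeffS-remove-≢ p ν≢μ

      -- Induction on a bound for the length: the list freed of its head's monomial is shorter, but
      -- not a structural part of the original list.
      lin-zero : ∀ n p → length p ℕ.≤ n → (∀ m → coeffS p m ≈ 0#) → ∀ φ → lin p φ ≈A 0A
      lin-zero n [] _ h φ = R.refl
      lin-zero (suc n) ((c , m) ∷ p) (s≤s l) h φ = begin
        lin ((c , m) ∷ p) φ ≈⟨ lin-remove m ((c , m) ∷ p) φ ⟩
        (ι (coeffS ((c , m) ∷ p) m) *A φ m) +A lin (remove m ((c , m) ∷ p)) φ
          ≈⟨ R.+-cong (R.trans (R.*-congʳ (R.trans (ι-cong (h m)) ι-0)) (R.zeroˡ _)) rest ⟩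
        0A +A 0A ≈⟨ R.+-identityˡ _ ⟩
        0A ∎
        where
        vanish : ∀ ν → coeffS (remove m ((c , m) ∷ p)) ν ≈ 0#
        vanish ν with ν ≟ᵐ m
        ... | yes ≡.refl = coeffS-remove m ((c , m) ∷ p)
        ... | no ν≢m     = trans (coeffS-remove-≢ ((c , m) ∷ p) ν≢m) (h ν)
        shorter : length (remove m ((c , m) ∷ p)) ℕ.≤ n
        shorter with m ≟ᵐ m
        ... | yes _ = ℕP.≤-trans (remove-length m p) l
        ... | no m≢m = ⊥-elim (m≢m ≡.refl)
        rest = lin-zero n (remove m ((c , m) ∷ p)) shorter vanish φ

    private
      ι-inverse : ∀ x → (ι x +A ι (- x)) ≈A 0A
      ι-inverse x = R.trans (R.sym (ι-+ x (- x))) (R.trans (ι-cong (-‿inverseʳ x)) ι-0)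

      lin-inverse : ∀ p φ → (lin (negS p) φ +A lin p φ) ≈A 0A
      lin-inverse [] φ = R.+-identityˡ _
      lin-inverse ((c , m) ∷ p) φ = begin
        ((ι (- c) *A φ m) +A lin (negS p) φ) +A ((ι c *A φ m) +A lin p φ)
          ≈⟨ solve 5 (λ c d a s t → (d :* a :+ s) :+ (c :* a :+ t) := (c :+ d) :* a :+ (s :+ t)) R.refl
               (ι c) (ι (- c)) (φ m) _ _ ⟩
        ((ι c +A ι (- c)) *A φ m) +A (lin (negS p) φ +A lin p φ)
          ≈⟨ R.+-cong (R.trans (R.*-congʳ (ι-inverse c)) (R.zeroˡ _)) (lin-inverse p φ) ⟩
        0A +A 0A ≈⟨ R.+-identityˡ _ ⟩
        0A ∎

    -- All coefficients of p - r are zero, so every functional kills it. Functionals, and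
    -- evaluations in particular, are thus well defined on polynomials rather than on term lists.
    lin-congˡ : ∀ p r → p ≈S r → ∀ φ → lin p φ ≈A lin r φ
    lin-congˡ p r h φ = begin
      lin p φ                                     ≈⟨ R.+-identityʳ _ ⟨
      lin p φ +A 0A                               ≈⟨ R.+-congˡ (lin-inverse r φ) ⟨
      lin p φ +A (lin (negS r) φ +A lin r φ)      ≈⟨ R.+-assoc _ _ _ ⟨
      (lin p φ +A lin (negS r) φ) +A lin r φ      ≈⟨ R.+-congʳ (lin-++ p (negS r) φ) ⟨
      lin (p ++ negS r) φ +A lin r φ              ≈⟨ R.+-congʳ (lin-zero _ (p ++ negS r) ℕP.≤-refl zero' φ) ⟩
      0A +A lin r φ                               ≈⟨ R.+-identityˡ _ ⟩
      lin r φ                                     ∎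
      where
      zero' : ∀ m → coeffS (p ++ negS r) m ≈ 0#
      zero' m = trans (coeffS-++ p (negS r) m)
        (trans (+-cong (h m) (coeffS-negS r m)) (-‿inverseʳ _))

  open Linear base using () renaming (lin to linF; lin-congʳ to linF-congʳ; lin-congˡ to linF-congˡ;
    lin-*S to linF-*S; lin-swap to linF-swap; lin-++ to linF-++)

  indicator : Mono → Mono → Carrier
  indicator m μ = if monoEq m μ then 1# else 0#

  coeffS-linear : ∀ p m → coeffS p m ≈ linF p (indicator m)
  coeffS-linear [] m = refl
  coeffS-linear ((c , μ) ∷ p) m with m ≟ᵐ μ
  ... | yes ≡.refl rewrite monoEq-refl m = +-cong (sym (*-identityʳ c)) (coeffS-linear p m)
  ... | no m≢μ rewrite monoEq-≢ m≢μ =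
    trans (coeffS-linear p m) (sym (trans (+-congʳ (zeroʳ c)) (+-identityˡ _)))

  -- A record, so that unification can read the two polynomials off an equation.
  infix 4 _≃_
  record _≃_ (p r : SPoly) : Set where
    constructor coeffwise
    field coeffs : p ≈S r
  open _≃_ public

  -- Coefficients are themselves functionals. The ring axioms can therefore be checked on arbitrary
  -- functionals, where products turn into iterated sums.
  fromLin : ∀ {p r} → (∀ φ → linF p φ ≈ linF r φ) → p ≃ r
  fromLin {p} {r} h = coeffwise λ m →
    trans (coeffS-linear p m) (trans (h (indicator m)) (sym (coeffS-linear r m)))

  toLin : ∀ {p r} → p ≃ r → ∀ φ → linF p φ ≈ linF r φ
  toLin {p} {r} h φ = linF-congˡ p r (coeffs h) φ

  1S : SPoly
  1S = constS 1#

  private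
    *S-comm : ∀ p r → p *S r ≃ r *S p
    *S-comm p r = fromLin λ φ → trans (linF-*S p r φ) (trans (linF-swap p r _)
      (trans (linF-congʳ r λ m' → linF-congʳ p λ m → reflexive (≡.cong φ (monoMul-comm m m'))) (sym (linF-*S r p φ))))

    *S-assoc : ∀ p r s → (p *S r) *S s ≃ p *S (r *S s)
    *S-assoc p r s = fromLin λ φ → trans (linF-*S (p *S r) s φ) (trans (linF-*S p r _)
      (sym (trans (linF-*S p (r *S s) φ) (linF-congʳ p λ m → trans (linF-*S r s _)
        (linF-congʳ r λ m' → linF-congʳ s λ m'' → reflexive (≡.cong φ (≡.sym (monoMul-assoc m m' m''))))))))

    *S-cong : ∀ {p p' r r'} → p ≃ p' → r ≃ r' → p *S r ≃ p' *S r'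
    *S-cong {p} {p'} {r} {r'} h k = fromLin λ φ → trans (linF-*S p r φ) (trans (toLin h _)
      (trans (linF-congʳ p' λ m → toLin k _) (sym (linF-*S p' r' φ))))

    *S-identityˡ : ∀ p → 1S *S p ≃ p
    *S-identityˡ p = fromLin λ φ → trans (linF-*S 1S p φ) (trans (+-identityʳ _) (*-identityˡ _))

    *S-distribʳ : ∀ s p r → (p +S r) *S s ≃ (p *S s) +S (r *S s)
    *S-distribʳ s p r = fromLin λ φ → trans (linF-*S (p ++ r) s φ) (trans (linF-++ p r _)
      (sym (trans (linF-++ (p *S s) (r *S s) φ) (+-cong (linF-*S p s φ) (linF-*S r s φ)))))

    ≃-refl : ∀ {p} → p ≃ p
    ≃-refl = coeffwise λ _ → refl
    ≃-sym : ∀ {p r} → p ≃ r → r ≃ p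
    ≃-sym h = coeffwise λ m → sym (coeffs h m)
    ≃-trans : ∀ {p r s} → p ≃ r → r ≃ s → p ≃ s
    ≃-trans h k = coeffwise λ m → trans (coeffs h m) (coeffs k m)

    +S-cong : ∀ {p p' r r'} → p ≃ p' → r ≃ r' → p +S r ≃ p' +S r'
    +S-cong {p} {p'} {r} {r'} h k = coeffwise λ m →
      trans (coeffS-++ p r m) (trans (+-cong (coeffs h m) (coeffs k m)) (sym (coeffS-++ p' r' m)))

    +S-assoc : ∀ p r s → (p +S r) +S s ≃ p +S (r +S s)
    +S-assoc p r s = fromLin λ φ → trans (linF-++ (p ++ r) s φ) (trans (+-congʳ (linF-++ p r φ))
      (trans (+-assoc _ _ _) (sym (trans (linF-++ p (r ++ s) φ) (+-congˡ (linF-++ r s φ))))))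

    +S-comm : ∀ p r → p +S r ≃ r +S p
    +S-comm p r = coeffwise λ m → trans (coeffS-++ p r m) (trans (+-comm _ _) (sym (coeffS-++ r p m)))

    +S-inverseʳ : ∀ p → p +S negS p ≃ 0S
    +S-inverseʳ p = coeffwise λ m → trans (coeffS-++ p (negS p) m) (trans (+-congˡ (coeffS-negS p m)) (-‿inverseʳ _))

    negS-cong : ∀ {p r} → p ≃ r → negS p ≃ negS r
    negS-cong {p} {r} h = coeffwise λ m →
      trans (coeffS-negS p m) (trans (-‿cong (coeffs h m)) (sym (coeffS-negS r m)))

  -- Opaque copies of the polynomial operations: without them unification unfolds the list operations.
  infixl 6 _+ₚ_
  infixl 7 _*ₚ_
  opaque
    _+ₚ_ _*ₚ_ : SPoly → SPoly → SPoly
    p +ₚ r = p +S r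
    p *ₚ r = p *S r

    negₚ : SPoly → SPoly
    negₚ = negS

    ∷-+ₚ : ∀ t p → t ∷ p ≡ (t ∷ []) +ₚ p
    ∷-+ₚ t p = ≡.refl

    coeffS-+ₚ : ∀ p r m → coeffS (p +ₚ r) m ≈ coeffS p m + coeffS r m
    coeffS-+ₚ = coeffS-++

    coeffS-negₚ : ∀ p m → coeffS (negₚ p) m ≈ - coeffS p m
    coeffS-negₚ = coeffS-negS

    term-* : ∀ c d m m' → ((c , m) ∷ []) *ₚ ((d , m') ∷ []) ≡ (c * d , monoMul m m') ∷ []
    term-* c d m m' = ≡.refl

    coeffS-constS-* : ∀ c p m → coeffS (constS c *ₚ p) m ≈ c * coeffS p m
    coeffS-constS-* c p m = trans (coeffS-linear (constS c *S p) m) (trans (linF-*S (constS c) p (indicator m))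
      (trans (+-identityʳ _) (*-congˡ (sym (coeffS-linear p m)))))

    polyIsCommutativeRing : IsCommutativeRing _≃_ _+ₚ_ _*ₚ_ negₚ 0S 1S
    polyIsCommutativeRing = record
      { isRing = record
        { +-isAbelianGroup = record
          { isGroup = record
            { isMonoid = record
              { isSemigroup = record
                { isMagma = record
                  { isEquivalence = record { refl = ≃-refl ; sym = ≃-sym ; trans = ≃-trans }
                  ; ∙-cong = +S-cong }
                ; assoc = +S-assoc }
              ; identity = (λ _ → ≃-refl) , (λ p → ≃-trans (+S-comm p 0S) ≃-refl) }
            ; inverse = (λ p → ≃-trans (+S-comm (negS p) p) (+S-inverseʳ p)) , +S-inverseʳ
            ; ⁻¹-cong = negS-cong }
          ; comm = +S-comm }
        ; *-cong = *S-cong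
        ; *-assoc = *S-assoc
        ; *-identity = *S-identityˡ , (λ p → ≃-trans (*S-comm p 1S) (*S-identityˡ p))
        ; distrib = (λ s p r → ≃-trans (*S-comm s (p +S r)) (≃-trans (*S-distribʳ s p r)
                      (+S-cong (*S-comm p s) (*S-comm r s)))) , *S-distribʳ }
      ; *-comm = *S-comm }

  polyRing : CommutativeRing 0ℓ 0ℓ
  polyRing = record { isCommutativeRing = polyIsCommutativeRing }

  module S = CommutativeRing polyRing

  opaque
    unfolding _+ₚ_

    constS-+ : ∀ x y → constS (x + y) ≃ constS x +ₚ constS y
    constS-+ x y = fromLin λ φ → trans (+-congʳ (distribʳ _ x y)) (+-assoc _ _ _)

    constS-* : ∀ x y → constS (x * y) ≃ constS x *ₚ constS y
    constS-* x y = S.refl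

  term-cong : ∀ {c d m} → c ≈ d → (c , m) ∷ [] ≃ (d , m) ∷ []
  term-cong c≈d = fromLin λ φ → +-congʳ (*-congʳ c≈d)

  constS-0 : constS 0# ≃ 0S
  constS-0 = fromLin λ φ → trans (+-congʳ (zeroˡ _)) (+-identityʳ _)

  polyAlgebra : Algebra
  polyAlgebra = record
    { ringA = polyRing ; ι = constS ; ι-cong = term-cong
    ; ι-+ = constS-+ ; ι-* = constS-* ; ι-0 = constS-0 ; ι-1 = S.refl }

  module Eval (𝔸 : Algebra) where
    open Algebra 𝔸
    open Linear 𝔸
    private module V = Vector3 ringA
    open R using () renaming (Carrier to A; _≈_ to _≈A_; _+_ to _+A_; _*_ to _*A_; -_ to -A_; 0# to 0A)
    open V using (R³; _⊙_; _≋_)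
    open Algebra.Properties.Semiring.Exp R.semiring using (_^_; ^-homo-*; ^-congˡ)
    open RingSolver ringA
    open Relation.Binary.Reasoning.Setoid R.setoid

    monomial : R³ → Mono → A
    monomial (x , y , z) (a , b , c) = (x ^ a) *A ((y ^ b) *A (z ^ c))

    monomial-* : ∀ s m m' → monomial s (monoMul m m') ≈A (monomial s m *A monomial s m')
    monomial-* (x , y , z) (a , b , c) (a' , b' , c') = begin
      (x ^ (a ℕ.+ a')) *A ((y ^ (b ℕ.+ b')) *A (z ^ (c ℕ.+ c')))
        ≈⟨ R.*-cong (^-homo-* x a a') (R.*-cong (^-homo-* y b b') (^-homo-* z c c')) ⟩
      ((x ^ a) *A (x ^ a')) *A (((y ^ b) *A (y ^ b')) *A ((z ^ c) *A (z ^ c')))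
        ≈⟨ solve 6 (λ a a' b b' c c' → (a :* a') :* ((b :* b') :* (c :* c')) := (a :* (b :* c)) :* (a' :* (b' :* c')))
             R.refl (x ^ a) (x ^ a') (y ^ b) (y ^ b') (z ^ c) (z ^ c') ⟩
      ((x ^ a) *A ((y ^ b) *A (z ^ c))) *A ((x ^ a') *A ((y ^ b') *A (z ^ c'))) ∎

    monomial-cong : ∀ {s s'} → s ≋ s' → ∀ m → monomial s m ≈A monomial s' m
    monomial-cong (x , y , z) (a , b , c) = R.*-cong (^-congˡ a x) (R.*-cong (^-congˡ b y) (^-congˡ c z))

    eval : R³ → SPoly → A
    eval s p = lin p (monomial s)

    eval-cong : ∀ s {p r} → p ≃ r → eval s p ≈A eval s r
    eval-cong s {p} {r} h = lin-congˡ p r (coeffs h) _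

    eval-congˡ : ∀ {s s'} p → s ≋ s' → eval s p ≈A eval s' p
    eval-congˡ p h = lin-congʳ p (monomial-cong h)

    opaque
     unfolding _+ₚ_

     eval-+ : ∀ s p r → eval s (p +ₚ r) ≈A (eval s p +A eval s r)
     eval-+ s p r = lin-++ p r _

    opaque
     unfolding _*ₚ_

     eval-* : ∀ s p r → eval s (p *ₚ r) ≈A (eval s p *A eval s r)
     eval-* s p r = begin
       eval s (p *S r)                                              ≈⟨ lin-*S p r _ ⟩
       lin p (λ m → lin r (λ m' → monomial s (monoMul m m')))       ≈⟨ lin-congʳ p (λ m → R.trans (lin-congʳ r (λ m' → monomial-* s m m')) (lin-* r _ _)) ⟩
       lin p (λ m → monomial s m *A eval s r)                       ≈⟨ lin-congʳ p (λ m → R.*-comm _ _) ⟩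
       lin p (λ m → eval s r *A monomial s m)                       ≈⟨ lin-* p _ _ ⟩
       eval s r *A eval s p                                         ≈⟨ R.*-comm _ _ ⟩
       eval s p *A eval s r                                         ∎

    private
      ι-neg : ∀ x → ι (- x) ≈A (-A ι x)
      ι-neg x = begin
        ι (- x)                          ≈⟨ R.+-identityˡ _ ⟨
        0A +A ι (- x)                    ≈⟨ R.+-congʳ (R.-‿inverseˡ (ι x)) ⟨
        ((-A ι x) +A ι x) +A ι (- x)     ≈⟨ R.+-assoc _ _ _ ⟩
        (-A ι x) +A (ι x +A ι (- x))     ≈⟨ R.+-congˡ (R.trans (R.sym (ι-+ x (- x))) (R.trans (ι-cong (-‿inverseʳ x)) ι-0)) ⟩
        (-A ι x) +A 0A                   ≈⟨ R.+-identityʳ _ ⟩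
        -A ι x                           ∎

    opaque
     unfolding negₚ

     eval-neg : ∀ s p → eval s (negₚ p) ≈A (-A eval s p)
     eval-neg s [] = solve 0 (con ℤ.0ℤ := :- con ℤ.0ℤ) R.refl
     eval-neg s ((c , m) ∷ p) = R.trans (R.+-cong (R.*-congʳ (ι-neg c)) (eval-neg s p))
       (solve 3 (λ c a s → (:- c) :* a :+ (:- s) := :- (c :* a :+ s)) R.refl (ι c) _ _)

    eval-const : ∀ s c → eval s (constS c) ≈A ι c
    eval-const s c = solve 1 (λ c → c :* (con ℤ.1ℤ :* (con ℤ.1ℤ :* con ℤ.1ℤ)) :+ con ℤ.0ℤ := c) R.refl (ι c)

    ι³ : V3 → R³
    ι³ (a , b , c) = ι a , ι b , ι c

    eval-form : ∀ s α → eval s (formPoly α) ≈A (ι³ α ⊙ s)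
    eval-form (x , y , z) (a , b , c) =
      solve 6 (λ a b c x y z → a :* ((x :* con ℤ.1ℤ) :* (con ℤ.1ℤ :* con ℤ.1ℤ)) :+ (b :* (con ℤ.1ℤ :* ((y :* con ℤ.1ℤ) :* con ℤ.1ℤ))
          :+ (c :* (con ℤ.1ℤ :* (con ℤ.1ℤ :* (z :* con ℤ.1ℤ))) :+ con ℤ.0ℤ))
        := a :* x :+ (b :* y :+ c :* z)) R.refl (ι a) (ι b) (ι c) x y z

-- Absence of zero divisors in F.

module FieldLemmas {q : ℕ} (F : FiniteField q) where
  open FiniteField F
  open RingSolver commRing

  no-zero-divisors : ∀ {x y} → x * y ≈ 0# → ¬ (x ≈ 0#) → y ≈ 0#
  no-zero-divisors {x} {y} xy≈0 x≉0 with inverse x x≉0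
  ... | x⁻¹ , xx⁻¹≈1 = trans (sym (*-identityˡ y)) (trans (*-congʳ (sym xx⁻¹≈1))
    (trans (solve 3 (λ x i y → x :* i :* y := i :* (x :* y)) refl x x⁻¹ y) (trans (*-congˡ xy≈0) (zeroʳ _))))

  product-≉0 : ∀ {x y} → ¬ (x ≈ 0#) → ¬ (y ≈ 0#) → ¬ (x * y ≈ 0#)
  product-≉0 x≉0 y≉0 xy≈0 = y≉0 (no-zero-divisors xy≈0 x≉0)

-- Gradings, and absence of zero divisors among polynomials.

module Domain {q : ℕ} (F : FiniteField q) where
  open FiniteField F hiding (_≟_)
  open FiniteField F using (_≟_)
  open Arr F hiding (μ; L; dim; size; _+S_; _*S_)
  open Polynomials F
  open FieldLemmas F
  open Relation.Binary.Reasoning.Setoid S.setoid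

  coeffS-absent : ∀ p m → All (λ t → m ≢ proj₂ t) p → coeffS p m ≈ 0#
  coeffS-absent [] m [] = refl
  coeffS-absent ((c , μ) ∷ p) m (m≢μ ∷ h) = trans (reflexive (coeffS-≢ c p m≢μ)) (coeffS-absent p m h)

  -- Only monomials listed in p can have a nonzero coefficient, so finitely many tests decide
  -- whether p is zero.
  nonzero-coeff : ∀ p → (p ≃ 0S) ⊎ Σ Mono λ m → ¬ (coeffS p m ≈ 0#)
  nonzero-coeff p with All.all? (λ t → coeffS p (proj₂ t) ≟ 0#) p
  ... | yes h = inj₁ (coeffwise zero-everywhere)
    where
    zero-everywhere : ∀ m → coeffS p m ≈ 0#
    zero-everywhere m with All.all? (λ t → ¬? (m ≟ᵐ proj₂ t)) p
    ... | yes absent = coeffS-absent p m absent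
    ... | no present with AllP.¬All⇒Any¬ (λ t → ¬? (m ≟ᵐ proj₂ t)) p present
    ...   | any = find any h
      where
      find : ∀ {r} → Any (λ t → ¬ (m ≢ proj₂ t)) r → All (λ t → coeffS p (proj₂ t) ≈ 0#) r → coeffS p m ≈ 0#
      find (here {t} ¬m≢) (e ∷ _) with m ≟ᵐ proj₂ t
      ... | yes ≡.refl = e
      ... | no m≢ = ⊥-elim (¬m≢ m≢)
      find (there a) (_ ∷ es) = find a es
  ... | no ¬h = inj₂ (witness (AllP.¬All⇒Any¬ (λ t → coeffS p (proj₂ t) ≟ 0#) p ¬h))
    where
    witness : ∀ {r} → Any (λ t → ¬ (coeffS p (proj₂ t) ≈ 0#)) r → Σ Mono λ m → ¬ (coeffS p m ≈ 0#)
    witness (here {t} ≉0) = proj₂ t , ≉0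
    witness (there a) = witness a

  infix 4 _≟0S
  _≟0S : ∀ p → Dec (p ≃ 0S)
  p ≟0S with nonzero-coeff p
  ... | inj₁ p≃0 = yes p≃0
  ... | inj₂ (m , c≉0) = no λ p≃0 → c≉0 (coeffs p≃0 m)

  -- An additive degree function on monomials. Total degree grades D(A); the partial degrees isolate
  -- leading terms and detect which variables occur.
  record Weight : Set where
    field
      weight   : Mono → ℕ
      weight-* : ∀ m m' → weight (monoMul m m') ≡ weight m ℕ.+ weight m'

  degree₁ degree₂ degree₃ degree : Weight
  degree₁ = record { weight = λ (a , _ , _) → a ; weight-* = λ _ _ → ≡.refl }
  degree₂ = record { weight = λ (_ , b , _) → b ; weight-* = λ _ _ → ≡.refl }
  degree₃ = record { weight = λ (_ , _ , c) → c ; weight-* = λ _ _ → ≡.refl }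
  degree  = record
    { weight = λ (a , b , c) → a ℕ.+ (b ℕ.+ c)
    ; weight-* = λ (a , b , c) (a' , b' , c') →
        solve 6 (λ a b c a' b' c' → (a :+ a') :+ ((b :+ b') :+ (c :+ c')) := (a :+ (b :+ c)) :+ (a' :+ (b' :+ c')))
          ≡.refl a b c a' b' c' }
    where
    open ℕSolver

  module Graded (W : Weight) where
    open Weight W

    part : (ℕ → Bool) → SPoly → SPoly
    part f [] = []
    part f (t ∷ p) = if f (weight (proj₂ t)) then t ∷ part f p else part f p

    coeffS-part-true : ∀ f p m → f (weight m) ≡ true → coeffS (part f p) m ≈ coeffS p m
    coeffS-part-true f [] m h = refl
    coeffS-part-true f ((c , μ) ∷ p) m h with m ≟ᵐ μ
    ... | yes ≡.refl rewrite h | coeffS-≡ c m p | coeffS-≡ c m (part f p) = +-congˡ (coeffS-part-true f p m h)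
    ... | no m≢μ rewrite coeffS-≢ c p m≢μ with f (weight μ)
    ...   | true rewrite coeffS-≢ c (part f p) m≢μ = coeffS-part-true f p m h
    ...   | false = coeffS-part-true f p m h

    coeffS-part-false : ∀ f p m → f (weight m) ≡ false → coeffS (part f p) m ≈ 0#
    coeffS-part-false f [] m h = refl
    coeffS-part-false f ((c , μ) ∷ p) m h with f (weight μ) in e
    ... | false = coeffS-part-false f p m h
    ... | true with m ≟ᵐ μ
    ...   | yes ≡.refl with () ← ≡.trans (≡.sym h) e
    ...   | no m≢μ rewrite coeffS-≢ c (part f p) m≢μ = coeffS-part-false f p m h

    part-cong : ∀ f {p r} → p ≃ r → part f p ≃ part f r
    part-cong f {p} {r} h = coeffwise go
      where
      go : ∀ m → coeffS (part f p) m ≈ coeffS (part f r) m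
      go m with f (weight m) in e
      ... | true  = trans (coeffS-part-true f p m e) (trans (coeffs h m) (sym (coeffS-part-true f r m e)))
      ... | false = trans (coeffS-part-false f p m e) (sym (coeffS-part-false f r m e))

    part-++ : ∀ f p r → part f (p ++ r) ≡ part f p ++ part f r
    part-++ f [] r = ≡.refl
    part-++ f (t ∷ p) r with f (weight (proj₂ t))
    ... | true = ≡.cong (t ∷_) (part-++ f p r)
    ... | false = part-++ f p r

    opaque
      unfolding _+ₚ_

      part-+ : ∀ f p r → part f (p +ₚ r) ≡ part f p +ₚ part f r
      part-+ = part-++

    Terms : (ℕ → Set) → SPoly → Set
    Terms P = All (λ t → P (weight (proj₂ t)))

    part-terms : ∀ f p → Terms (λ k → f k ≡ true) (part f p)
    part-terms f [] = []
    part-terms f (t ∷ p) with f (weight (proj₂ t)) in e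
    ... | true = e ∷ part-terms f p
    ... | false = part-terms f p

    part-all : ∀ f {p} → Terms (λ k → f k ≡ true) p → part f p ≡ p
    part-all f [] = ≡.refl
    part-all f (h ∷ hs) rewrite h = ≡.cong (_ ∷_) (part-all f hs)

    part-none : ∀ f {p} → Terms (λ k → f k ≡ false) p → part f p ≡ []
    part-none f [] = ≡.refl
    part-none f (h ∷ hs) rewrite h = part-none f hs

    opaque
      unfolding _+ₚ_

      Terms-+ : ∀ {P p r} → Terms P p → Terms P r → Terms P (p +ₚ r)
      Terms-+ = AllP.++⁺

      Terms-* : ∀ (P Q R : ℕ → Set) → (∀ {a b} → P a → Q b → R (a ℕ.+ b)) →
        ∀ {p r} → Terms P p → Terms Q r → Terms R (p *ₚ r)
      Terms-* P Q R f [] hr = []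
      Terms-* P Q R f {(c , μ) ∷ p} (h ∷ hp) hr = AllP.++⁺ (AllP.map⁺ (All.map (λ {t} k →
        ≡.subst R (≡.sym (weight-* μ (proj₂ t))) (f h k)) hr)) (Terms-* P Q R f hp hr)

    -- Stated up to `≃` and not for the listed terms, which may cancel; so it is invariant under
    -- equality of polynomials.
    Supported : (ℕ → Bool) → SPoly → Set
    Supported f p = part f p ≃ p

    supported : ∀ f p → (∀ m → f (weight m) ≡ false → coeffS p m ≈ 0#) → Supported f p
    supported f p h = coeffwise go
      where
      go : ∀ m → coeffS (part f p) m ≈ coeffS p m
      go m with f (weight m) in e
      ... | true  = coeffS-part-true f p m e
      ... | false = trans (coeffS-part-false f p m e) (sym (h m e))

    supported⁻ : ∀ f p → Supported f p → ∀ m → f (weight m) ≡ false → coeffS p m ≈ 0#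
    supported⁻ f p h m e = trans (sym (coeffs h m)) (coeffS-part-false f p m e)

    Supported-terms : ∀ f {p} → Terms (λ k → f k ≡ true) p → Supported f p
    Supported-terms f h = S.reflexive (part-all f h)

    Supported-resp : ∀ f {p r} → p ≃ r → Supported f p → Supported f r
    Supported-resp f h s = S.trans (part-cong f (S.sym h)) (S.trans s h)

    Supported-part : ∀ f p → Supported f (part f p)
    Supported-part f p = Supported-terms f (part-terms f p)

    Supported-+ : ∀ f p r → Supported f p → Supported f r → Supported f (p +ₚ r)
    Supported-+ f p r h k = S.trans (S.reflexive (part-+ f p r)) (S.+-cong h k)

    Supported-* : ∀ f g h p r → (∀ {a b} → f a ≡ true → g b ≡ true → h (a ℕ.+ b) ≡ true) →
      Supported f p → Supported g r → Supported h (p *ₚ r)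
    Supported-* f g h p r imp sp sr = Supported-resp h (S.*-cong sp sr)
      (Supported-terms h (Terms-* (λ k → f k ≡ true) (λ k → g k ≡ true) (λ k → h k ≡ true) imp (part-terms f p) (part-terms g r)))

    Supported-weaken : ∀ f g p → (∀ {a} → f a ≡ true → g a ≡ true) → Supported f p → Supported g p
    Supported-weaken f g p imp sp = Supported-resp g sp (Supported-terms g (All.map (λ {t} → imp {weight (proj₂ t)}) (part-terms f p)))

    Supported-neg : ∀ f p → Supported f p → Supported f (negₚ p)
    Supported-neg f p h = supported f (negₚ p) λ m e → trans (coeffS-negₚ p m)
      (trans (-‿cong (supported⁻ f p h m e)) -0#≈0#)
      where open Algebra.Properties.Ring ring using (-0#≈0#)

    only below upto : ℕ → ℕ → Bool
    only k j  = k ℕ.≡ᵇ j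
    below k j = j ℕ.<ᵇ k
    upto k j  = j ℕ.<ᵇ suc k

    only-true : ∀ {k j} → k ≡ j → only k j ≡ true
    only-true {k} {j} e = Equivalence.to T-≡ (ℕP.≡⇒≡ᵇ k j e)
    only-true⁻ : ∀ {k j} → only k j ≡ true → k ≡ j
    only-true⁻ {k} {j} e = ℕP.≡ᵇ⇒≡ k j (Equivalence.from T-≡ e)
    only-false : ∀ {k j} → k ≢ j → only k j ≡ false
    only-false {k} {j} ne with k ℕ.≡ᵇ j in e
    ... | false = ≡.refl
    ... | true = ⊥-elim (ne (only-true⁻ {k} {j} e))
    below-true : ∀ {k j} → j ℕ.< k → below k j ≡ true
    below-true h = Equivalence.to T-≡ (ℕP.<⇒<ᵇ h)
    below-true⁻ : ∀ {k j} → below k j ≡ true → j ℕ.< k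
    below-true⁻ {k} {j} e = ℕP.<ᵇ⇒< j k (Equivalence.from T-≡ e)
    below-false : ∀ {k j} → ¬ (j ℕ.< k) → below k j ≡ false
    below-false {k} {j} ne with j ℕ.<ᵇ k in e
    ... | false = ≡.refl
    ... | true = ⊥-elim (ne (below-true⁻ {k} {j} e))

    comp : ℕ → SPoly → SPoly
    comp k = part (only k)

    -- Zero is homogeneous of every degree and bounded by every degree; arguments about exact
    -- degrees carry a separate hypothesis that the polynomial is nonzero.
    Homogeneous Bounded : ℕ → SPoly → Set
    Homogeneous k = Supported (only k)
    Bounded k = Supported (upto k)

    Hom⇒Bounded : ∀ {k} p → Homogeneous k p → Bounded k p
    Hom⇒Bounded {k} p = Supported-weaken (only k) (upto k) p
      λ {a} e → below-true (s≤s (ℕP.≤-reflexive (≡.sym (only-true⁻ {k} {a} e))))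

    Bounded-mono : ∀ {k l} p → k ℕ.≤ l → Bounded k p → Bounded l p
    Bounded-mono {k} {l} p k≤l = Supported-weaken (upto k) (upto l) p
      λ {i} e → below-true (ℕP.≤-trans (below-true⁻ {suc k} {i} e) (s≤s k≤l))

    Hom-* : ∀ {a b} p r → Homogeneous a p → Homogeneous b r → Homogeneous (a ℕ.+ b) (p *ₚ r)
    Hom-* {a} {b} p r = Supported-* (only a) (only b) (only (a ℕ.+ b)) p r
      λ {i} {j} h k → only-true (≡.cong₂ ℕ._+_ (only-true⁻ {a} {i} h) (only-true⁻ {b} {j} k))

    Bounded-* : ∀ {a b} p r → Bounded a p → Bounded b r → Bounded (a ℕ.+ b) (p *ₚ r)
    Bounded-* {a} {b} p r = Supported-* (upto a) (upto b) (upto (a ℕ.+ b)) p r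
      λ {i} {j} h k → below-true (s≤s (ℕP.+-mono-≤ (ℕP.≤-pred (below-true⁻ {suc a} {i} h)) (ℕP.≤-pred (below-true⁻ {suc b} {j} k))))

    private
      split : ∀ {a} p → Bounded a p → p ≃ comp a p +ₚ part (below a) p
      split {a} p bp = coeffwise λ m → sym (trans (coeffS-+ₚ (comp a p) (part (below a) p) m) (go m))
        where
        go : ∀ m → coeffS (comp a p) m + coeffS (part (below a) p) m ≈ coeffS p m
        go m with a ℕ.≟ weight m
        ... | yes e = trans (+-cong (coeffS-part-true (only a) p m (only-true e))
                (coeffS-part-false (below a) p m (below-false λ lt → ℕP.<-irrefl (≡.sym e) lt))) (+-identityʳ _)
        ... | no ne with weight m ℕ.<? a
        ...   | yes lt = trans (+-cong (coeffS-part-false (only a) p m (only-false ne))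
                   (coeffS-part-true (below a) p m (below-true lt))) (+-identityˡ _)
        ...   | no ge = trans (+-cong (coeffS-part-false (only a) p m (only-false ne))
                   (coeffS-part-false (below a) p m (below-false ge))) (trans (+-identityˡ _)
                   (sym (supported⁻ (upto a) p bp m (below-false λ lt → ge (ℕP.≤∧≢⇒< (ℕP.≤-pred lt) (ne ∘ ≡.sym))))))

    -- Split each factor into its top component and a lower part: every product other than that of
    -- the two top components has weight below a + b.
    comp-top-* : ∀ {a b} p r → Bounded a p → Bounded b r → comp (a ℕ.+ b) (p *ₚ r) ≃ comp a p *ₚ comp b r
    comp-top-* {a} {b} p r bp br = begin
      comp (a ℕ.+ b) (p *ₚ r)                                    ≈⟨ part-cong (only (a ℕ.+ b)) expand ⟩
      comp (a ℕ.+ b) (pt *ₚ rt +ₚ (pt *ₚ rl +ₚ pl *ₚ (rt +ₚ rl))) ≡⟨ part-+ (only (a ℕ.+ b)) (pt *ₚ rt) _ ⟩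
      comp (a ℕ.+ b) (pt *ₚ rt) +ₚ comp (a ℕ.+ b) (pt *ₚ rl +ₚ pl *ₚ (rt +ₚ rl))
        ≡⟨ ≡.cong₂ _+ₚ_ (part-all (only (a ℕ.+ b)) top) (part-none (only (a ℕ.+ b)) (Terms-+ {λ k → only (a ℕ.+ b) k ≡ false} {pt *ₚ rl} {pl *ₚ (rt +ₚ rl)} low₁ low₂)) ⟩
      pt *ₚ rt +ₚ 0S                                             ≈⟨ S.+-identityʳ _ ⟩
      pt *ₚ rt                                                   ∎
      where
      pt = comp a p
      pl = part (below a) p
      rt = comp b r
      rl = part (below b) r
      expand : p *ₚ r ≃ pt *ₚ rt +ₚ (pt *ₚ rl +ₚ pl *ₚ (rt +ₚ rl))
      expand = S.trans (S.*-cong (split p bp) (split r br))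
        (solve 4 (λ pt pl rt rl → (pt :+ pl) :* (rt :+ rl) := pt :* rt :+ (pt :* rl :+ pl :* (rt :+ rl))) S.refl pt pl rt rl)
        where open RingSolver polyRing
      top : Terms (λ k → only (a ℕ.+ b) k ≡ true) (pt *ₚ rt)
      top = Terms-* (λ k → only a k ≡ true) (λ k → only b k ≡ true) (λ k → only (a ℕ.+ b) k ≡ true) (λ {i} {j} h k → only-true (≡.cong₂ ℕ._+_ (only-true⁻ {a} {i} h) (only-true⁻ {b} {j} k)))
              (part-terms (only a) p) (part-terms (only b) r)
      less : ∀ {k} → k ℕ.< a ℕ.+ b → only (a ℕ.+ b) k ≡ false
      less lt = only-false λ e → ℕP.<-irrefl (≡.sym e) lt
      low₁ : Terms (λ k → only (a ℕ.+ b) k ≡ false) (pt *ₚ rl)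
      low₁ = Terms-* (λ k → only a k ≡ true) (λ k → below b k ≡ true) (λ k → only (a ℕ.+ b) k ≡ false) (λ {i} {j} h k → less (ℕP.+-mono-≤-< (ℕP.≤-reflexive (≡.sym (only-true⁻ {a} {i} h))) (below-true⁻ {b} {j} k)))
               (part-terms (only a) p) (part-terms (below b) r)
      low₂ : Terms (λ k → only (a ℕ.+ b) k ≡ false) (pl *ₚ (rt +ₚ rl))
      low₂ = Terms-* (λ k → below a k ≡ true) (ℕ._≤ b) (λ k → only (a ℕ.+ b) k ≡ false) (λ {i} {j} h k → less (ℕP.+-mono-<-≤ (below-true⁻ {a} {i} h) k)) (part-terms (below a) p)
               (Terms-+ {ℕ._≤ b} {rt} {rl} (All.map (λ {t} e → ℕP.≤-reflexive (≡.sym (only-true⁻ {b} {weight (proj₂ t)} e))) (part-terms (only b) r))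
                         (All.map (λ {t} e → ℕP.<⇒≤ (below-true⁻ {b} {weight (proj₂ t)} e)) (part-terms (below b) r)))

    Top : ℕ → SPoly → Set
    Top k p = Bounded k p × ¬ (comp k p ≃ 0S)

    private
      syntactic-bound : ∀ p → Σ ℕ λ k → Terms (ℕ._≤ k) p
      syntactic-bound [] = 0 , []
      syntactic-bound (t ∷ p) with syntactic-bound p
      ... | k , h = weight (proj₂ t) ℕ.⊔ k , ℕP.m≤m⊔n _ k ∷ All.map (λ l → ℕP.≤-trans l (ℕP.m≤n⊔m (weight (proj₂ t)) k)) h

      -- Lowers the bound as long as the component at the bound vanishes; a nonzero polynomial stops
      -- this at its exact weight.
      descend : ∀ k p → Bounded k p → ¬ (p ≃ 0S) → Σ ℕ λ a → Top a p
      descend k p bp p≄0 with comp k p ≟0S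
      ... | no c≄0 = k , bp , c≄0
      descend zero p bp p≄0 | yes c≃0 = ⊥-elim (p≄0 (S.trans (S.sym bp') c≃0))
        where
        bp' : comp 0 p ≃ p
        bp' = Supported-weaken (upto 0) (only 0) p (λ {a} e → only-true (≡.sym (ℕP.n≤0⇒n≡0 (ℕP.≤-pred (below-true⁻ {1} {a} e))))) bp
      descend (suc k) p bp p≄0 | yes c≃0 = descend k p (supported (upto k) p go) p≄0
        where
        go : ∀ m → upto k (weight m) ≡ false → coeffS p m ≈ 0#
        go m e with suc k ℕ.≟ weight m
        ... | yes eq = trans (sym (coeffS-part-true (only (suc k)) p m (only-true eq))) (coeffs c≃0 m)
        ... | no ne = supported⁻ (upto (suc k)) p bp m (below-false λ lt → contra (ℕP.≤∧≢⇒< (ℕP.≤-pred lt) (ne ∘ ≡.sym)))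
          where
          contra : ¬ (weight m ℕ.< suc k)
          contra lt with () ← ≡.trans (≡.sym e) (below-true lt)

    bounded : ∀ p → Σ ℕ λ k → Bounded k p
    bounded p with syntactic-bound p
    ... | k , h = k , Supported-terms (upto k) (All.map (λ l → below-true (s≤s l)) h)

    top : ∀ p → ¬ (p ≃ 0S) → Σ ℕ λ k → Top k p
    top p p≄0 = descend _ p (proj₂ (bounded p)) p≄0

  private
    module G₁ = Graded degree₁
    module G₂ = Graded degree₂
    module G₃ = Graded degree₃

    -- For any a, b, c this is the single term with that monomial; for successive top degrees it is
    -- the lexicographic leading term.
    leading : SPoly → ℕ → ℕ → ℕ → SPoly
    leading p a b c = G₃.comp c (G₂.comp b (G₁.comp a p))

    leading-term : ∀ p a b c → leading p a b c ≃ (coeffS p (a , b , c) , a , b , c) ∷ []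
    leading-term p a b c = coeffwise go
      where
      p₁ = G₁.comp a p
      p₂ = G₂.comp b p₁
      go : ∀ m → coeffS (leading p a b c) m ≈ coeffS ((coeffS p (a , b , c) , a , b , c) ∷ []) m
      go m with m ≟ᵐ (a , b , c)
      ... | yes ≡.refl rewrite coeffS-≡ (coeffS p (a , b , c)) m [] =
        trans (G₃.coeffS-part-true (G₃.only c) p₂ m (G₃.only-true {c} ≡.refl))
        (trans (G₂.coeffS-part-true (G₂.only b) p₁ m (G₂.only-true {b} ≡.refl))
        (trans (G₁.coeffS-part-true (G₁.only a) p m (G₁.only-true {a} ≡.refl)) (sym (+-identityʳ _))))
      ... | no m≢ rewrite coeffS-≢ (coeffS p (a , b , c)) [] m≢ = off m m≢
        where
        off : ∀ m → m ≢ (a , b , c) → coeffS (leading p a b c) m ≈ 0#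
        off m@(a' , b' , c') m≢ with c ℕ.≟ c'
        ... | no ne = G₃.coeffS-part-false (G₃.only c) p₂ m (G₃.only-false ne)
        ... | yes ≡.refl with b ℕ.≟ b'
        ...   | no ne = trans (G₃.coeffS-part-true (G₃.only c) p₂ m (G₃.only-true {c} ≡.refl))
                  (G₂.coeffS-part-false (G₂.only b) p₁ m (G₂.only-false ne))
        ...   | yes ≡.refl with a ℕ.≟ a'
        ...     | no ne = trans (G₃.coeffS-part-true (G₃.only c) p₂ m (G₃.only-true {c} ≡.refl))
                  (trans (G₂.coeffS-part-true (G₂.only b) p₁ m (G₂.only-true {b} ≡.refl))
                  (G₁.coeffS-part-false (G₁.only a) p m (G₁.only-false ne)))
        ...     | yes ≡.refl = ⊥-elim (m≢ ≡.refl)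

  -- Lexicographic leading terms multiply, one variable at a time, so the leading coefficient of the
  -- product is a product of two nonzero elements of F.
  product-≄0 : ∀ {p r} → ¬ (p ≃ 0S) → ¬ (r ≃ 0S) → ¬ (p *ₚ r ≃ 0S)
  product-≄0 {p} {r} p≄0 r≄0 pr≃0
    with a , ba , p₁≄0 ← G₁.top p p≄0 | a' , ba' , r₁≄0 ← G₁.top r r≄0
    with b , bb , p₂≄0 ← G₂.top (G₁.comp a p) p₁≄0 | b' , bb' , r₂≄0 ← G₂.top (G₁.comp a' r) r₁≄0
    with c , bc , p₃≄0 ← G₃.top (G₂.comp b (G₁.comp a p)) p₂≄0 | c' , bc' , r₃≄0 ← G₃.top (G₂.comp b' (G₁.comp a' r)) r₂≄0
    = product-≉0 {x} {y} (nz p₃≄0 (leading-term p a b c)) (nz r₃≄0 (leading-term r a' b' c'))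
        (trans (sym (+-identityʳ _)) (trans (reflexive (≡.sym (coeffS-≡ (x * y) μ []))) (coeffs terms≃0 μ)))
    where
    x = coeffS p (a , b , c)
    y = coeffS r (a' , b' , c')
    μ = monoMul (a , b , c) (a' , b' , c')
    nz : ∀ {s l m} → ¬ (l ≃ 0S) → l ≃ (s , m) ∷ [] → ¬ (s ≈ 0#)
    nz {s} {l} {m} l≄0 e s≈0 = l≄0 (S.trans e (fromLin λ φ → trans (+-identityʳ _) (trans (*-congʳ s≈0) (zeroˡ _))))
    step₁ : G₁.comp a p *ₚ G₁.comp a' r ≃ 0S
    step₁ = S.trans (S.sym (G₁.comp-top-* p r ba ba')) (G₁.part-cong _ pr≃0)
    step₂ : G₂.comp b (G₁.comp a p) *ₚ G₂.comp b' (G₁.comp a' r) ≃ 0S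
    step₂ = S.trans (S.sym (G₂.comp-top-* (G₁.comp a p) (G₁.comp a' r) bb bb')) (G₂.part-cong _ step₁)
    step₃ : leading p a b c *ₚ leading r a' b' c' ≃ 0S
    step₃ = S.trans (S.sym (G₃.comp-top-* (G₂.comp b (G₁.comp a p)) (G₂.comp b' (G₁.comp a' r)) bc bc')) (G₃.part-cong _ step₂)
    terms≃0 : (x * y , μ) ∷ [] ≃ 0S
    terms≃0 = S.trans (S.sym (S.reflexive (term-* x y (a , b , c) (a' , b' , c')))) (S.trans (S.sym (S.*-cong (leading-term p a b c) (leading-term r a' b' c'))) step₃)

-- Fermat's identity and the additivity of the q-th power.

module Frobenius {q : ℕ} (F : FiniteField q) where
  open FiniteField F hiding (zero)
  open FieldLemmas F
  open RingSolver commRing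
  open Polynomials F using (Algebra; base)
  open Algebra.Properties.Semiring.Exp semiring using (_^_; ^-congˡ)

  index : Carrier → Fin q
  index x = proj₁ (enum-surjective x)

  enum-index : ∀ x → enum (index x) ≈ x
  enum-index x = proj₂ (enum-surjective x)

  index-cong : ∀ {x y} → x ≈ y → index x ≡ index y
  index-cong {x} {y} x≈y = enum-injective _ _ (trans (enum-index x) (trans x≈y (sym (enum-index y))))

  index-enum : ∀ i → index (enum i) ≡ i
  index-enum i = enum-injective _ _ (enum-index (enum i))

  1<q : 1 ℕ.< q
  1<q = go (index 0#) (index 1#) λ e → 1≉0 (trans (sym (enum-index 1#)) (trans (reflexive (≡.cong enum (≡.sym e))) (enum-index 0#)))
    where
    go : ∀ {n} (i j : Fin n) → i ≢ j → 1 ℕ.< n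
    go {suc zero} zero zero i≢j = ⊥-elim (i≢j ≡.refl)
    go {suc (suc n)} _ _ _ = s≤s (s≤s z≤n)

  horner : List Carrier → Carrier → Carrier
  horner []       x = 0#
  horner (c ∷ cs) x = c + x * horner cs x

  private
    -- Synthetic division by x - a: `remainder` is the value at a, and `quotient` collects the
    -- partial values.
    remainder : Carrier → Carrier → List Carrier → Carrier
    remainder a c []       = c
    remainder a c (d ∷ cs) = c + a * remainder a d cs

    quotient : Carrier → Carrier → List Carrier → List Carrier
    quotient a c []       = []
    quotient a c (d ∷ cs) = remainder a d cs ∷ quotient a d cs

    length-quotient : ∀ a c cs → length (quotient a c cs) ≡ length cs
    length-quotient a c [] = ≡.refl
    length-quotient a c (d ∷ cs) = ≡.cong suc (length-quotient a d cs)

    division : ∀ a c cs x → horner (c ∷ cs) x ≈ remainder a c cs + (x - a) * horner (quotient a c cs) x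
    division a c [] x = +-congˡ (trans (zeroʳ x) (sym (zeroʳ (x - a))))
    division a c (d ∷ cs) x = trans (+-congˡ (*-congˡ (division a d cs x)))
      (solve 5 (λ c x a r h → c :+ x :* (r :+ (x :- a) :* h) := (c :+ a :* r) :+ (x :- a) :* (r :+ x :* h)) refl
        c x a (remainder a d cs) (horner (quotient a d cs) x))

    zero-division : ∀ a c cs → remainder a c cs ≈ 0# → All (_≈ 0#) (quotient a c cs) → All (_≈ 0#) (c ∷ cs)
    zero-division a c [] r≈0 [] = r≈0 ∷ []
    zero-division a c (d ∷ cs) r≈0 (r'≈0 ∷ zs) =
      trans (sym (trans (+-congˡ (trans (*-congˡ r'≈0) (zeroʳ a))) (+-identityʳ c))) r≈0 ∷ zero-division a d cs r'≈0 zs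

    -- Divide by x - a for the first root a. The other roots are distinct from a, hence roots of the
    -- quotient, which has one coefficient fewer.
    roots : ∀ cs xs → length cs ℕ.≤ length xs → AllPairs (λ x y → ¬ (x ≈ y)) xs →
            All (λ x → horner cs x ≈ 0#) xs → All (_≈ 0#) cs
    roots [] xs _ _ _ = []
    roots (c ∷ cs) (a ∷ xs) (s≤s l) (a≉ ∷ distinct) (ha ∷ hs) = zero-division a c cs r≈0
        (roots (quotient a c cs) xs (≡.subst (ℕ._≤ length xs) (≡.sym (length-quotient a c cs)) l) distinct
          (All.zipWith other (a≉ , hs)))
      where
      r≈0 : remainder a c cs ≈ 0#
      r≈0 = trans (sym (trans (division a c cs a) (trans (+-congˡ (trans (*-congʳ (-‿inverseʳ a)) (zeroˡ _))) (+-identityʳ _)))) ha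
      other : ∀ {x} → ¬ (a ≈ x) × horner (c ∷ cs) x ≈ 0# → horner (quotient a c cs) x ≈ 0#
      other {x} (a≉x , hx) = no-zero-divisors
        (trans (sym (+-identityˡ _)) (trans (+-congʳ (sym r≈0)) (trans (sym (division a c cs x)) hx)))
        λ x-a≈0 → a≉x (sym (trans (solve 2 (λ x a → x := (x :- a) :+ a) refl x a) (trans (+-congʳ x-a≈0) (+-identityˡ a))))

  elements-distinct : AllPairs (λ x y → ¬ (x ≈ y)) (map enum (allFin q))
  elements-distinct = AllPairsP.map⁺ (AllPairs.map (λ i≢j e → i≢j (enum-injective _ _ e)) (UniqueP.allFin⁺ q))

  length-elements : length (map enum (allFin q)) ≡ q
  length-elements = ≡.trans (ListP.length-map enum (allFin q)) (ListP.length-tabulate (λ i → i))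

  vanishing⇒zero : ∀ cs → length cs ℕ.≤ q → (∀ x → horner cs x ≈ 0#) → All (_≈ 0#) cs
  vanishing⇒zero cs l h = roots cs (map enum (allFin q)) (≡.subst (length cs ℕ.≤_) (≡.sym length-elements) l)
    elements-distinct (AllP.map⁺ (All.universal (λ i → h (enum i)) (allFin q)))

  private
    module ∏ = Algebra.Properties.CommutativeMonoid.Sum *-commutativeMonoid

    ∏-single : ∀ {n} (i : Fin n) (f : Fin n → Carrier) → (∀ j → j ≢ i → f j ≈ 1#) → ∏.sum f ≈ f i
    ∏-single {suc n} zero f h = trans (*-congˡ (trans (∏.sum-cong-≋ (λ j → h (suc j) λ ())) (∏.sum-replicate-zero n))) (*-identityʳ _)
    ∏-single {suc n} (suc i) f h = trans (*-congʳ (h zero λ ())) (trans (*-identityˡ _)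
      (∏-single i (f ∘ suc) λ j j≢i → h (suc j) (j≢i ∘ FinP.suc-injective)))

    ∏-const : ∀ n x → ∏.sum {n} (λ _ → x) ≈ x ^ n
    ∏-const zero x = refl
    ∏-const (suc n) x = *-congˡ (∏-const n x)

    ∏-≉0 : ∀ {n} (f : Fin n → Carrier) → (∀ i → ¬ (f i ≈ 0#)) → ¬ (∏.sum f ≈ 0#)
    ∏-≉0 {zero} f h = 1≉0
    ∏-≉0 {suc n} f h = product-≉0 (h zero) (∏-≉0 (f ∘ suc) (h ∘ suc))

    pick : ∀ {y} → Dec (y ≈ 0#) → Carrier → Carrier → Carrier
    pick (yes _) u v = u
    pick (no _)  u v = v

    -- Replaces zero by one, so that the product over all of F is the product of the nonzero
    -- elements.
    unit : Carrier → Carrier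
    unit y = pick (y ≟ 0#) 1# y

    unit-≉0 : ∀ y → ¬ (unit y ≈ 0#)
    unit-≉0 y with y ≟ 0#
    ... | yes _ = 1≉0
    ... | no y≉0 = y≉0

    unit-cong : ∀ {x y} → x ≈ y → unit x ≈ unit y
    unit-cong {x} {y} x≈y with x ≟ 0# | y ≟ 0#
    ... | yes _ | yes _ = refl
    ... | yes x≈0 | no y≉0 = ⊥-elim (y≉0 (trans (sym x≈y) x≈0))
    ... | no x≉0 | yes y≈0 = ⊥-elim (x≉0 (trans x≈y y≈0))
    ... | no _ | no _ = x≈y

    -- The factor x picked at y = 0 makes the scaling identity hold there too; the product over F
    -- then contributes x^q on the right, and a single x on the left.
    unit-scale : ∀ {x y} → ¬ (x ≈ 0#) → (e : Dec (x * y ≈ 0#)) (d : Dec (y ≈ 0#)) →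
      pick e 1# (x * y) * pick d x 1# ≈ x * pick d 1# y
    unit-scale x≉0 (yes _) (yes _) = *-comm _ _
    unit-scale x≉0 (no xy≉0) (yes y≈0) = ⊥-elim (xy≉0 (trans (*-congˡ y≈0) (zeroʳ _)))
    unit-scale x≉0 (yes xy≈0) (no y≉0) = ⊥-elim (product-≉0 x≉0 y≉0 xy≈0)
    unit-scale x≉0 (no _) (no _) = *-identityʳ _

  -- Multiplication by x permutes F; compare the products of the nonzero elements.
  fermat : ∀ x → x ^ q ≈ x
  fermat x with x ≟ 0#
  ... | yes x≈0 = trans (^-congˡ q x≈0) (trans (zero-power 1<q) (sym x≈0))
    where
    zero-power : ∀ {n} → 1 ℕ.< n → 0# ^ n ≈ 0#
    zero-power (s≤s _) = zeroˡ _
  ... | no x≉0 with inverse x x≉0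
  ...   | x⁻¹ , xx⁻¹≈1 = trans (sym (*-identityʳ _)) (trans (*-congˡ (sym (proj₂ P⁻¹)))
          (trans (sym (*-assoc _ _ _)) (trans (*-congʳ (sym eq)) (trans (*-assoc _ _ _) (trans (*-congˡ (proj₂ P⁻¹)) (*-identityʳ x))))))
    where
    to from : Fin q → Fin q
    to i = index (x * enum i)
    from i = index (x⁻¹ * enum i)
    collapse : ∀ y z i → y * z ≈ 1# → index (y * enum (index (z * enum i))) ≡ i
    collapse y z i yz≈1 = ≡.trans (index-cong (trans (*-congˡ (enum-index _))
      (trans (sym (*-assoc y z _)) (trans (*-congʳ yz≈1) (*-identityˡ _))))) (index-enum i)
    π : Perm.Permutation q q
    π = Perm.permutation to from (λ i → collapse x x⁻¹ i xx⁻¹≈1) (λ i → collapse x⁻¹ x i (trans (*-comm _ _) xx⁻¹≈1))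
    P = ∏.sum (λ i → unit (enum i))
    P⁻¹ = inverse P (∏-≉0 _ (λ i → unit-≉0 (enum i)))
    correction : Carrier → Carrier
    correction y = pick (y ≟ 0#) x 1#
    pointwise : ∀ y → unit (x * y) * correction y ≈ x * unit y
    pointwise y = unit-scale x≉0 ((x * y) ≟ 0#) (y ≟ 0#)
    i₀ = index 0#
    correction-zero : correction (enum i₀) ≈ x
    correction-zero with enum i₀ ≟ 0#
    ... | yes _ = refl
    ... | no ne = ⊥-elim (ne (enum-index 0#))
    correction-other : ∀ j → j ≢ i₀ → correction (enum j) ≈ 1#
    correction-other j j≢i₀ with enum j ≟ 0#
    ... | yes e = ⊥-elim (j≢i₀ (enum-injective _ _ (trans e (sym (enum-index 0#)))))
    ... | no _ = refl
    -- The permutation leaves P unchanged, and the corrections multiply to x, their value at zero.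
    eq : x * P ≈ x ^ q * P
    eq = trans (*-comm x P) (trans (*-cong
           (trans (∏.sum-permute (λ i → unit (enum i)) π) (∏.sum-cong-≋ (λ i → unit-cong (enum-index (x * enum i)))))
           (sym (trans (∏-single i₀ (λ i → correction (enum i)) correction-other) correction-zero)))
         (trans (sym (∏.∑-distrib-+ (λ i → unit (x * enum i)) (λ i → correction (enum i))))
         (trans (∏.sum-cong-≋ (λ i → pointwise (enum i)))
         (trans (∏.∑-distrib-+ (λ _ → x) (λ i → unit (enum i))) (*-congʳ (∏-const q x))))))

  -- The binomial coefficient of x^(i+1) in (x + y)^(n+1), read in F. The two extreme terms are kept
  -- apart in `expansion`.
  middle : ∀ n → Fin n → Carrier
  middle n i = (suc n choose suc (toℕ i)) times 1#
    where open Algebra.Properties.Semiring.Mult semiring renaming (_×_ to _times_)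

  module _ (𝔸 : Algebra) where
    open Algebra 𝔸
    private
      module R = CommutativeRing ringA
      module E = Algebra.Properties.Semiring.Exp R.semiring
      module M = Algebra.Properties.Semiring.Mult R.semiring
      module B = Algebra.Properties.CommutativeSemiring.Binomial R.commutativeSemiring
      module ∑ = Algebra.Properties.CommutativeMonoid.Sum R.+-commutativeMonoid
      open R using () renaming (Carrier to A; _≈_ to _≈A_; _+_ to _+A_; _*_ to _*A_; -_ to -A_; 0# to 0A; 1# to 1A)
      open E using () renaming (_^_ to _^A_)
      open Algebra.Properties.Semiring.Mult semiring using () renaming (_×_ to _times_)
      open Relation.Binary.Reasoning.Setoid R.setoid

      ι-times : ∀ n t → (n M.× t) ≈A (ι (n times 1#) *A t)
      ι-times zero t = R.sym (R.trans (R.*-congʳ ι-0) (R.zeroˡ t))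
      ι-times (suc n) t = R.sym (R.trans (R.*-congʳ (ι-+ 1# _)) (R.trans (R.distribʳ t _ _)
        (R.+-cong (R.trans (R.*-congʳ ι-1) (R.*-identityˡ t)) (R.sym (ι-times n t)))))

    expansion : ∀ n x y → ((x +A y) ^A suc n) ≈A
      ((y ^A suc n) +A (∑.sum {n} (λ i → ι (middle n i) *A ((x ^A suc (toℕ i)) *A (y ^A (n ℕ.∸ toℕ i)))) +A (x ^A suc n)))
    expansion n x y = begin
      (x +A y) ^A suc n ≈⟨ B.theorem (suc n) x y ⟩
      T zero +A ∑.sum (λ i → T (suc i)) ≈⟨ R.+-cong first (R.trans (∑.sum-init-last (λ i → T (suc i))) (R.+-cong (∑.sum-cong-≋ mid) last)) ⟩
      _ ∎
      where
      T = B.binomialTerm x y (suc n)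
      first : T zero ≈A (y ^A suc n)
      first = R.trans (R.+-identityʳ _) (R.*-identityˡ _)
      mid : ∀ i → T (suc (inject₁ i)) ≈A (ι (middle n i) *A ((x ^A suc (toℕ i)) *A (y ^A (n ℕ.∸ toℕ i))))
      mid i rewrite FinP.toℕ-inject₁ i = ι-times (suc n choose suc (toℕ i)) _
      last : T (suc (fromℕ n)) ≈A (x ^A suc n)
      last rewrite FinP.toℕ-fromℕ n | nCn≡1 (suc n) | ℕP.n∸n≡0 n = R.trans (R.+-identityʳ _) (R.*-identityʳ _)

  private
    module ∑F = Algebra.Properties.Semiring.Sum semiring
    open ∑F using (*-distribˡ-sum)

    horner-tabulate : ∀ {n} (f : Fin n → Carrier) x → horner (tabulate f) x ≈ ∑F.sum (λ i → f i * x ^ toℕ i)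
    horner-tabulate {zero} f x = refl
    horner-tabulate {suc n} f x = +-cong (sym (*-identityʳ _)) (trans (*-congˡ (horner-tabulate (f ∘ suc) x))
      (trans (*-distribˡ-sum {n} x (λ i → f (suc i) * x ^ toℕ i)) (∑F.sum-cong-≋ {n} {λ i → x * (f (suc i) * x ^ toℕ i)} {λ i → f (suc i) * x ^ suc (toℕ i)}
        (λ i → solve 3 (λ x f p → x :* (f :* p) := f :* (x :* p)) refl x (f (suc i)) (x ^ toℕ i)))))

    one-power : ∀ n → 1# ^ n ≈ 1#
    one-power zero = refl
    one-power (suc n) = trans (*-identityˡ _) (one-power n)

    -- (x + 1)^q = x^q + 1 for all x in F, so the intermediate binomial coefficients vanish in F.
    middle-vanishes : ∀ n → q ≡ suc n → ∀ i → middle n i ≈ 0#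
    middle-vanishes n q≡1+n i = AllP.tabulate⁻ (All.tail (vanishing⇒zero (0# ∷ tabulate (middle n)) short vanish)) i
      where
      -- A constant term 0 and n = q - 1 middle coefficients: exactly as many coefficients as F has
      -- elements.
      short : length (0# ∷ tabulate (middle n)) ℕ.≤ q
      short = ℕP.≤-reflexive (≡.trans (≡.cong suc (ListP.length-tabulate (middle n))) (≡.sym q≡1+n))
      fermat' : ∀ x → x ^ suc n ≈ x
      fermat' x = ≡.subst (λ k → x ^ k ≈ x) q≡1+n (fermat x)
      mid : Carrier → Carrier
      mid x = ∑F.sum {n} (λ i → middle n i * (x ^ suc (toℕ i) * 1# ^ (n ℕ.∸ toℕ i)))
      mid≈0 : ∀ x → mid x ≈ 0#
      mid≈0 x = trans (solve 2 (λ x m → m := ((con ℤ.1ℤ :+ (m :+ x)) :- (x :+ con ℤ.1ℤ))) refl x (mid x))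
        (trans (+-congʳ (sym (trans (sym (fermat' (x + 1#))) (trans (expansion base n x 1#) (+-cong (one-power (suc n)) (+-congˡ (fermat' x)))))))
          (-‿inverseʳ _))
      vanish : ∀ x → horner (0# ∷ tabulate (middle n)) x ≈ 0#
      vanish x = trans (+-identityˡ _) (trans (*-congˡ (horner-tabulate (middle n) x))
        (trans (*-distribˡ-sum x (λ i → middle n i * x ^ toℕ i))
        (trans (∑F.sum-cong-≋ {n} {λ i → x * (middle n i * x ^ toℕ i)} {λ i → middle n i * (x ^ suc (toℕ i) * 1# ^ (n ℕ.∸ toℕ i))} shift)
          (mid≈0 x))))
        where
        shift : ∀ i → x * (middle n i * x ^ toℕ i) ≈ middle n i * (x ^ suc (toℕ i) * 1# ^ (n ℕ.∸ toℕ i))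
        shift i = trans (solve 3 (λ x m p → x :* (m :* p) := m :* ((x :* p) :* con ℤ.1ℤ)) refl x (middle n i) (x ^ toℕ i))
          (*-congˡ (*-congˡ (sym (one-power (n ℕ.∸ toℕ i)))))

  module _ (𝔸 : Algebra) where
    open Algebra 𝔸
    private
      module R = CommutativeRing ringA
      module E = Algebra.Properties.Semiring.Exp R.semiring
      module E' = Algebra.Properties.CommutativeSemiring.Exp R.commutativeSemiring
      module ∑ = Algebra.Properties.CommutativeMonoid.Sum R.+-commutativeMonoid
      open R using () renaming (Carrier to A; _≈_ to _≈A_; _+_ to _+A_; _*_ to _*A_; 0# to 0A; 1# to 1A)
      open E using () renaming (_^_ to _^A_)

    -- The middle binomial coefficients vanish already in F, hence in every F-algebra.
    frobenius-+ : ∀ x y → ((x +A y) ^A q) ≈A ((x ^A q) +A (y ^A q))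
    frobenius-+ x y = go q ≡.refl 1<q
      where
      go : ∀ k → q ≡ k → 1 ℕ.< k → ((x +A y) ^A k) ≈A ((x ^A k) +A (y ^A k))
      go (suc n) e _ = R.trans (expansion 𝔸 n x y) (R.trans (R.+-congˡ (R.trans (R.+-congʳ
        (R.trans (∑.sum-cong-≋ (λ i → R.trans (R.*-congʳ (R.trans (ι-cong (middle-vanishes n e i)) ι-0)) (R.zeroˡ _)))
          (∑.sum-replicate-zero n))) (R.+-identityˡ _))) (R.+-comm _ _))

    frobenius-ι : ∀ c x → ((ι c *A x) ^A q) ≈A (ι c *A (x ^A q))
    frobenius-ι c x = R.trans (E'.^-distrib-* (ι c) x q) (R.*-congʳ (R.trans (R.sym (ι-power q)) (ι-cong (fermat c))))
      where
      ι-power : ∀ n → ι (c ^ n) ≈A (ι c ^A n)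
      ι-power zero = ι-1
      ι-power (suc n) = R.trans (ι-* c _) (R.*-congˡ (ι-power n))

-- Coordinates, the generic point X and the minors N.

module Variables {q : ℕ} (F : FiniteField q) where
  open FiniteField F hiding (zero; _≟_)
  open Polynomials F
  private
    module VS = Vector3 polyRing
    open Algebra.Properties.Semiring.Exp S.semiring using (_^_)
    R³ = VS.R³

  data Coordinate : Set where
    c₁ c₂ c₃ : Coordinate

  at : {A : Set} → Coordinate → A × A × A → A
  at c₁ (a , _ , _) = a
  at c₂ (_ , b , _) = b
  at c₃ (_ , _ , c) = c

  X : R³
  X = (1# , 1 , 0 , 0) ∷ [] , (1# , 0 , 1 , 0) ∷ [] , (1# , 0 , 0 , 1) ∷ []

  module EvalHomomorphism (𝔸 : Algebra) where
    open Algebra 𝔸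
    open Eval 𝔸
    private
      module R = CommutativeRing ringA
      module V = Vector3 ringA
      open RingSolver ringA
    open Algebra.Properties.Semiring.Exp R.semiring using () renaming (_^_ to _^A_)

    eval³ : V.R³ → R³ → V.R³
    eval³ t (a , b , c) = eval t a , eval t b , eval t c

    eval-variable : ∀ t j → R._≈_ (eval t (at j X)) (at j t)
    eval-variable (x , y , z) c₁ = R.trans (R.+-congʳ (R.*-congʳ ι-1))
      (solve 1 (λ x → con ℤ.1ℤ :* ((x :* con ℤ.1ℤ) :* (con ℤ.1ℤ :* con ℤ.1ℤ)) :+ con ℤ.0ℤ := x) R.refl x)
    eval-variable (x , y , z) c₂ = R.trans (R.+-congʳ (R.*-congʳ ι-1))
      (solve 1 (λ x → con ℤ.1ℤ :* (con ℤ.1ℤ :* ((x :* con ℤ.1ℤ) :* con ℤ.1ℤ)) :+ con ℤ.0ℤ := x) R.refl y)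
    eval-variable (x , y , z) c₃ = R.trans (R.+-congʳ (R.*-congʳ ι-1))
      (solve 1 (λ x → con ℤ.1ℤ :* (con ℤ.1ℤ :* (con ℤ.1ℤ :* (x :* con ℤ.1ℤ))) :+ con ℤ.0ℤ := x) R.refl z)

    eval-X³ : ∀ t → V._≋_ (eval³ t X) t
    eval-X³ t = eval-variable t c₁ , eval-variable t c₂ , eval-variable t c₃

    eval-^ : ∀ t f n → R._≈_ (eval t (f ^ n)) (eval t f ^A n)
    eval-^ t f zero = R.trans (eval-const t 1#) ι-1
    eval-^ t f (suc n) = R.trans (eval-* t f (f ^ n)) (R.*-congˡ (eval-^ t f n))

    eval-⊙ : ∀ t u v → R._≈_ (eval t (u VS.⊙ v)) (eval³ t u V.⊙ eval³ t v)
    eval-⊙ t (a , b , c) (x , y , z) = R.trans (eval-+ t (a *ₚ x) _) (R.+-cong (eval-* t a x)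
      (R.trans (eval-+ t (b *ₚ y) _) (R.+-cong (eval-* t b y) (eval-* t c z))))

    eval-⨯ : ∀ t u v → V._≋_ (eval³ t (u VS.⨯ v)) (eval³ t u V.⨯ eval³ t v)
    eval-⨯ t (a , b , c) (x , y , z) = minor b z c y , minor c x a z , minor a y b x
      where
      minor : ∀ a b c d → R._≈_ (eval t (a *ₚ b +ₚ negₚ (c *ₚ d))) (R._+_ (R._*_ (eval t a) (eval t b)) (R.-_ (R._*_ (eval t c) (eval t d))))
      minor a b c d = R.trans (eval-+ t (a *ₚ b) (negₚ (c *ₚ d))) (R.+-cong (eval-* t a b)
        (R.trans (eval-neg t (c *ₚ d)) (R.-‿cong (eval-* t c d))))

    eval-det : ∀ t u v w → R._≈_ (eval t (VS.det u v w)) (V.det (eval³ t u) (eval³ t v) (eval³ t w))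
    eval-det t u v w = R.trans (eval-⊙ t u (v VS.⨯ w)) (V.⊙-cong {eval³ t u} V.≋-refl (eval-⨯ t v w))

  -- The minors of the matrix with rows X and X^q generate the ideal of all F-points.
  Xq : R³
  Xq = at c₁ X ^ q , at c₂ X ^ q , at c₃ X ^ q

  N : R³
  N = X VS.⨯ Xq

-- Linear forms as primes of the polynomial ring.

module LinearForms {q : ℕ} (F : FiniteField q) where
  open FiniteField F hiding (zero; _≟_)
  open FiniteField F using (_≟_)
  open Arr F hiding (μ; L; dim; size; _+S_; _*S_)
  open Polynomials F
  open Domain F
  open Frobenius F
  open Algebra.Properties.Ring ring using (-0#≈0#)
  open Variables F public
  open EvalHomomorphism polyAlgebra public
  module VF = Vector3 commRing
  module VS = Vector3 polyRing
  open Eval polyAlgebra public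
  open VS using (_⊙_; R³)
  open Algebra.Properties.Semiring.Exp S.semiring using (_^_; ^-congˡ) public
  open RingSolver polyRing
  open Relation.Binary.Reasoning.Setoid S.setoid

  private
    X*T : ∀ m m' → ((1# , m) ∷ []) *ₚ ((1# , m') ∷ []) ≃ (1# , monoMul m m') ∷ []
    X*T m m' = S.trans (S.reflexive (term-* 1# 1# m m')) (term-cong (*-identityˡ 1#))

    power₁ : ∀ n → proj₁ X ^ n ≃ (1# , n , 0 , 0) ∷ []
    power₁ zero = S.refl
    power₁ (suc n) = S.trans (S.*-congˡ {proj₁ X} (power₁ n)) (X*T (1 , 0 , 0) (n , 0 , 0))
    power₂ : ∀ n → at c₂ X ^ n ≃ (1# , 0 , n , 0) ∷ []
    power₂ zero = S.refl
    power₂ (suc n) = S.trans (S.*-congˡ {at c₂ X} (power₂ n)) (X*T (0 , 1 , 0) (0 , n , 0))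
    power₃ : ∀ n → at c₃ X ^ n ≃ (1# , 0 , 0 , n) ∷ []
    power₃ zero = S.refl
    power₃ (suc n) = S.trans (S.*-congˡ {at c₃ X} (power₃ n)) (X*T (0 , 0 , 1) (0 , 0 , n))

  monomial-X : ∀ m → monomial X m ≃ (1# , m) ∷ []
  monomial-X (a , b , c) = S.trans (S.*-cong (power₁ a) (S.trans (S.*-cong (power₂ b) (power₃ c)) (X*T (0 , b , 0) (0 , 0 , c))))
    (S.trans (X*T (a , 0 , 0) (0 , b ℕ.+ 0 , c)) (S.reflexive (≡.cong (λ m → (1# , m) ∷ [])
       (≡.cong₂ _,_ (ℕP.+-identityʳ a) (≡.cong (_, c) (ℕP.+-identityʳ b))))))

  -- X is the generic point. By this and `eval-congruent`, substituting a point congruent to X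
  -- modulo a form gives p modulo that form.
  eval-X : ∀ p → eval X p ≃ p
  eval-X [] = S.refl
  eval-X ((c , m) ∷ p) = S.trans (S.+-cong {constS c *ₚ monomial X m} {(c , m) ∷ []}
    (S.trans (S.*-congˡ {constS c} (monomial-X m)) (S.trans (S.reflexive (term-* c 1# (0 , 0 , 0) m)) (term-cong (*-identityʳ c)))) (eval-X p))
    (S.reflexive (≡.sym (∷-+ₚ (c , m) p)))

  form-⊙ : ∀ α → formPoly α ≃ ι³ α ⊙ X
  form-⊙ α = S.trans (S.sym (eval-X (formPoly α))) (eval-form X α)

  constS-⊙ : ∀ u v → constS (u VF.⊙ v) ≃ ι³ u ⊙ ι³ v
  constS-⊙ (a , b , c) (x , y , z) = S.trans (ι-+ (a * x) _) (S.+-cong (ι-* a x) (S.trans (ι-+ (b * y) _) (S.+-cong (ι-* b y) (ι-* c z))))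
    where open Algebra polyAlgebra

  infix 4 _∣_
  _∣_ : SPoly → SPoly → Set
  g ∣ h = Σ SPoly λ k → h ≃ g *ₚ k

  ∣-resp : ∀ {g h h'} → h ≃ h' → g ∣ h → g ∣ h'
  ∣-resp e (k , p) = k , S.trans (S.sym e) p

  ∣-+ : ∀ {g h h'} → g ∣ h → g ∣ h' → g ∣ h +ₚ h'
  ∣-+ {g} (k , p) (k' , p') = k +ₚ k' , S.trans (S.+-cong p p') (S.sym (S.distribˡ g k k'))

  ∣-*ʳ : ∀ {g h} r → g ∣ h → g ∣ h *ₚ r
  ∣-*ʳ {g} r (k , p) = k *ₚ r , S.trans (S.*-congʳ p) (S.*-assoc g k r)

  ∣-*ˡ : ∀ {g h} r → g ∣ h → g ∣ r *ₚ h
  ∣-*ˡ r d = ∣-resp (S.*-comm _ r) (∣-*ʳ r d)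

  ∣-neg : ∀ {g h} → g ∣ h → g ∣ negₚ h
  ∣-neg {g} {h} (k , p) = negₚ k , S.trans (S.-‿cong p) (solve 2 (λ g k → :- (g :* k) := g :* (:- k)) S.refl g k)

  ∣-trans : ∀ {f g h} → f ∣ g → g ∣ h → f ∣ h
  ∣-trans {f} (k , p) (l , r) = k *ₚ l , S.trans r (S.trans (S.*-congʳ p) (S.*-assoc f k l))

  private
    Congruent : SPoly → SPoly → SPoly → Set
    Congruent β f g = Σ SPoly λ k → f ≃ g +ₚ β *ₚ k

    congruent-* : ∀ {β} f g f' g' → Congruent β f g → Congruent β f' g' → Congruent β (f *ₚ f') (g *ₚ g')
    congruent-* {β} f g f' g' (k , p) (k' , p') = g *ₚ k' +ₚ (k *ₚ g' +ₚ β *ₚ (k *ₚ k')) ,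
      S.trans (S.*-cong p p') (solve 5 (λ g g' b k k' → (g :+ b :* k) :* (g' :+ b :* k') := g :* g' :+ b :* (g :* k' :+ (k :* g' :+ b :* (k :* k'))))
        S.refl g g' β k k')

    congruent-+ : ∀ {β f g f' g'} → Congruent β f g → Congruent β f' g' → Congruent β (f +ₚ f') (g +ₚ g')
    congruent-+ {β} {g = g} {g' = g'} (k , p) (k' , p') = k +ₚ k' , S.trans (S.+-cong p p')
      (solve 5 (λ a b B l' l → (a :+ B :* l') :+ (b :+ B :* l) := (a :+ b) :+ B :* (l' :+ l)) S.refl g g' β k k')

    congruent-refl : ∀ β f → Congruent β f f
    congruent-refl β f = 0S , solve 2 (λ f b → f := f :+ b :* con ℤ.0ℤ) S.refl f β

    congruent-^ : ∀ {β} f g n → Congruent β f g → Congruent β (f ^ n) (g ^ n)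
    congruent-^ {β} f g zero c = congruent-refl β 1S
    congruent-^ f g (suc n) c = congruent-* f g (f ^ n) (g ^ n) c (congruent-^ f g n c)

  eval-congruent : ∀ {β} s t → Congruent β (at c₁ s) (at c₁ t) → Congruent β (at c₂ s) (at c₂ t) →
    Congruent β (at c₃ s) (at c₃ t) → ∀ p → Congruent β (eval s p) (eval t p)
  eval-congruent {β} s t h₁ h₂ h₃ [] = congruent-refl β 0S
  eval-congruent {β} (x , y , z) (x' , y' , z') h₁ h₂ h₃ ((c , (i , j , k)) ∷ p) =
    congruent-+ (congruent-* (constS c) (constS c) _ _ (congruent-refl β (constS c))
        (congruent-* (x ^ i) (x' ^ i) _ _ (congruent-^ x x' i h₁)
          (congruent-* (y ^ j) (y' ^ j) (z ^ k) (z' ^ k) (congruent-^ y y' j h₂) (congruent-^ z z' k h₃))))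
      (eval-congruent (x , y , z) (x' , y' , z') h₁ h₂ h₃ p)

  Nonzero : V3 → Set
  Nonzero α = ¬ (α ≈₃ 0₃)

  pivot : ∀ α → Nonzero α → Σ Coordinate λ j → ¬ (at j α ≈ 0#)
  pivot (a , b , c) α≉0 with a ≟ 0# | b ≟ 0# | c ≟ 0#
  ... | no a≉0 | _ | _ = c₁ , a≉0
  ... | yes _ | no b≉0 | _ = c₂ , b≉0
  ... | yes _ | yes _ | no c≉0 = c₃ , c≉0
  ... | yes a≈0 | yes b≈0 | yes c≈0 = ⊥-elim (α≉0 (a≈0 , b≈0 , c≈0))

  axis : Coordinate → Carrier → V3
  axis c₁ x = x , 0# , 0#
  axis c₂ x = 0# , x , 0#
  axis c₃ x = 0# , 0# , x

  ⊙-axis : ∀ α j x → α VF.⊙ axis j x ≈ at j α * x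
  ⊙-axis (a , b , c) c₁ x = trans (+-congˡ (trans (+-cong (zeroʳ b) (zeroʳ c)) (+-identityˡ _))) (+-identityʳ _)
  ⊙-axis (a , b , c) c₂ x = trans (+-cong (zeroʳ a) (+-congˡ (zeroʳ c))) (trans (+-identityˡ _) (+-identityʳ _))
  ⊙-axis (a , b , c) c₃ x = trans (+-cong (zeroʳ a) (+-congʳ (zeroʳ b))) (trans (+-identityˡ _) (+-identityˡ _))

  section : ∀ α → Nonzero α → Σ V3 λ e → α VF.⊙ e ≈ 1#
  section α α≉0 with pivot α α≉0
  ... | j , αⱼ≉0 with inverse (at j α) αⱼ≉0
  ...   | i , αⱼi≈1 = axis j i , trans (⊙-axis α j i) αⱼi≈1

  -- For α(e) = 1, substituting X − α(X) e for X has kernel (α).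
  projection : V3 → V3 → R³
  projection α (e₁ , e₂ , e₃) = let A = formPoly α ; (x , y , z) = X in
    x +ₚ negₚ (A *ₚ constS e₁) , y +ₚ negₚ (A *ₚ constS e₂) , z +ₚ negₚ (A *ₚ constS e₃)

  eval-projection-form : ∀ α e β → eval (projection α e) (formPoly β) ≃ formPoly β +ₚ negₚ (formPoly α *ₚ constS (β VF.⊙ e))
  eval-projection-form α e@(e₁ , e₂ , e₃) β@(b₁ , b₂ , b₃) = S.trans (eval-form (projection α e) β) (S.trans
    (solve 10 (λ a b c A x y z i j k → a :* (x :- A :* i) :+ (b :* (y :- A :* j) :+ c :* (z :- A :* k))
        := (a :* x :+ (b :* y :+ c :* z)) :- A :* (a :* i :+ (b :* j :+ c :* k))) S.refl
        (constS b₁) (constS b₂) (constS b₃) (formPoly α) (at c₁ X) (at c₂ X) (at c₃ X) (constS e₁) (constS e₂) (constS e₃))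
    (S.+-cong (S.sym (form-⊙ β)) (S.-‿cong (S.*-congˡ {formPoly α} (S.sym (constS-⊙ β e))))))

  eval-projection-self : ∀ α e → α VF.⊙ e ≈ 1# → eval (projection α e) (formPoly α) ≃ 0S
  eval-projection-self α e αe≈1 = S.trans (eval-projection-form α e α)
    (S.trans (S.+-congˡ {formPoly α} (S.-‿cong (S.*-congˡ {formPoly α} (ι-cong αe≈1))))
      (S.trans (S.+-congˡ {formPoly α} (S.-‿cong (S.*-identityʳ (formPoly α)))) (S.-‿inverseʳ (formPoly α))))
    where open Algebra polyAlgebra

  ∣⇒projection : ∀ α e → α VF.⊙ e ≈ 1# → ∀ f → formPoly α ∣ f → eval (projection α e) f ≃ 0S
  ∣⇒projection α e αe≈1 f (k , f≃αk) = S.trans (eval-cong t f≃αk) (S.trans (eval-* t (formPoly α) k)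
    (S.trans (S.*-congʳ (eval-projection-self α e αe≈1)) (S.zeroˡ (eval t k))))
    where t = projection α e

  -- The substituted point is congruent to X modulo α, so f is congruent modulo α to the value
  -- there, which is zero.
  projection⇒∣ : ∀ α e f → eval (projection α e) f ≃ 0S → formPoly α ∣ f
  projection⇒∣ α e@(e₁ , e₂ , e₃) f t≃0 with eval-congruent {formPoly α} X (projection α e) (off (at c₁ X) e₁) (off (at c₂ X) e₂) (off (at c₃ X) e₃) f
    where
    off : ∀ x c → Congruent (formPoly α) x (x +ₚ negₚ (formPoly α *ₚ constS c))
    off x c = constS c , solve 3 (λ x a c → x := (x :- a :* c) :+ a :* c) S.refl x (formPoly α) (constS c)
  ... | k , eq = k , S.trans (S.sym (eval-X f)) (S.trans eq (S.trans (S.+-congʳ t≃0) (S.+-identityˡ _)))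

  -- (α) is the kernel of a substitution into the polynomial ring, which has no zero divisors.
  form-prime : ∀ α → Nonzero α → ∀ f g → formPoly α ∣ f *ₚ g → (formPoly α ∣ f) ⊎ (formPoly α ∣ g)
  form-prime α α≉0 f g α∣fg with section α α≉0
  ... | e , αe≈1 with eval (projection α e) f ≟0S | eval (projection α e) g ≟0S
  ...   | yes f≃0 | _ = inj₁ (projection⇒∣ α e f f≃0)
  ...   | no _ | yes g≃0 = inj₂ (projection⇒∣ α e g g≃0)
  ...   | no f≄0 | no g≄0 = ⊥-elim (product-≄0 f≄0 g≄0
    (S.trans (S.sym (eval-* (projection α e) f g)) (∣⇒projection α e αe≈1 (f *ₚ g) α∣fg)))

  form-injective : ∀ α k β → formPoly α ≃ formPoly β *ₚ constS k → α ≈₃ (k ·₃ β)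
  form-injective (a , b , c) k β@(x , y , z) h = go (1 , 0 , 0) ≡.refl ≡.refl , go (0 , 1 , 0) ≡.refl ≡.refl , go (0 , 0 , 1) ≡.refl ≡.refl
    where
    go : ∀ m {u w} → coeffS (formPoly (a , b , c)) m ≡ u + 0# → coeffS (formPoly β) m ≡ w + 0# → u ≈ k * w
    go m {u} {w} e e' = trans (sym (+-identityʳ u)) (trans (reflexive (≡.sym e)) (trans (coeffs (S.trans h (S.*-comm (formPoly β) (constS k))) m)
      (trans (coeffS-constS-* k (formPoly β) m) (*-congˡ (trans (reflexive e') (+-identityʳ w))))))

  -- The projection along β sends α to α - α(e) β, and kills α because β divides it.
  form-∣-form : ∀ α β → Nonzero β → formPoly β ∣ formPoly α → Σ Carrier λ k → α ≈₃ (k ·₃ β)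
  form-∣-form α β β≉0 β∣α with section β β≉0
  ... | e , βe≈1 = α VF.⊙ e , form-injective α (α VF.⊙ e) β (S.trans
      (solve 2 (λ a b → a := (a :- b) :+ b) S.refl (formPoly α) (formPoly β *ₚ constS (α VF.⊙ e)))
      (S.trans (S.+-congʳ (S.trans (S.sym (eval-projection-form β e α)) (∣⇒projection β e βe≈1 (formPoly α) β∣α))) (S.+-identityˡ _)))

  product : List V3 → SPoly
  product = foldr (λ α p → formPoly α *ₚ p) 1S

  -- Non-proportional forms are non-associate primes: after dividing f by the first form, the
  -- remaining forms still divide the quotient.
  product-∣ : ∀ αs → All Nonzero αs → AllPairs (λ α β → ¬ (Σ Carrier λ k → α ≈₃ (k ·₃ β))) αs →
    ∀ f → All (λ α → formPoly α ∣ f) αs → product αs ∣ f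
  product-∣ [] _ _ f _ = f , S.sym (S.*-identityˡ f)
  product-∣ (α ∷ αs) (α≉0 ∷ nz) (α≁ ∷ distinct) f ((g , f≃αg) ∷ ds)
    with product-∣ αs nz distinct g (All.zipWith step (nz , All.zip (α≁ , ds)))
    where
    step : ∀ {β} → Nonzero β × (¬ (Σ Carrier λ k → α ≈₃ (k ·₃ β)) × (formPoly β ∣ f)) → formPoly β ∣ g
    step {β} (β≉0 , α≁β , β∣f) with form-prime β β≉0 (formPoly α) g (∣-resp f≃αg β∣f)
    ... | inj₁ β∣α = ⊥-elim (α≁β (form-∣-form α β β≉0 β∣α))
    ... | inj₂ β∣g = β∣g
  ... | h , g≃Qh = h , S.trans f≃αg (S.trans (S.*-congˡ {formPoly α} g≃Qh) (S.sym (S.*-assoc (formPoly α) (product αs) h)))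

  form∣product : ∀ αs → All (λ α → formPoly α ∣ product αs) αs
  form∣product [] = []
  form∣product (α ∷ αs) = (product αs , S.refl) ∷ All.map (∣-*ˡ (formPoly α)) (form∣product αs)

  -- The q-th power is additive and fixes the coefficients in F. Hence X^q, like X, is a derivation
  -- of every arrangement.
  form-frobenius : ∀ α → formPoly α ^ q ≃ ι³ α ⊙ Xq
  form-frobenius α@(a , b , c) = begin
    formPoly α ^ q                    ≈⟨ ^-congˡ q (form-⊙ α) ⟩
    (ι³ α ⊙ X) ^ q                    ≈⟨ frobenius-+ polyAlgebra ax (by +ₚ cz) ⟩
    ax ^ q +ₚ (by +ₚ cz) ^ q          ≈⟨ S.+-congˡ {ax ^ q} (frobenius-+ polyAlgebra by cz) ⟩
    ax ^ q +ₚ (by ^ q +ₚ cz ^ q)      ≈⟨ S.+-cong (frobenius-ι polyAlgebra a (at c₁ X)) (S.+-cong (frobenius-ι polyAlgebra b (at c₂ X)) (frobenius-ι polyAlgebra c (at c₃ X))) ⟩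
    ι³ α ⊙ Xq                         ∎
    where
    ax = constS a *ₚ at c₁ X
    by = constS b *ₚ at c₂ X
    cz = constS c *ₚ at c₃ X

  form∣X : ∀ α → formPoly α ∣ ι³ α ⊙ X
  form∣X α = 1S , S.trans (S.sym (form-⊙ α)) (S.sym (S.*-identityʳ _))

  form∣Xq : ∀ α → formPoly α ∣ ι³ α ⊙ Xq
  form∣Xq α = ∣-resp (form-frobenius α) (go q 1<q)
    where
    go : ∀ n → 1 ℕ.< n → formPoly α ∣ formPoly α ^ n
    go (suc n) _ = formPoly α ^ n , S.refl

  private
    minor-≄0 : ∀ (n n' : Mono) → n ≢ n' → (f f' : SPoly) → f ≃ (1# , n) ∷ [] → f' ≃ (1# , n') ∷ [] → ¬ (f +ₚ negₚ f' ≃ 0S)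
    minor-≄0 n n' n≢n' f f' e e' h = 1≉0 (trans (sym (trans (coeffS-+ₚ ((1# , n) ∷ []) (negₚ ((1# , n') ∷ [])) n)
        (trans (+-cong (trans (reflexive (coeffS-≡ 1# n [])) (+-identityʳ 1#)) (trans (coeffS-negₚ ((1# , n') ∷ []) n)
          (-‿cong (reflexive (coeffS-≢ 1# [] n≢n'))))) (trans (+-congˡ -0#≈0#) (+-identityʳ _)))))
      (coeffs (S.trans (S.sym (S.+-cong e (S.-‿cong e'))) h) n))

    x*x^q : ∀ {m m'} f → f ≃ (1# , m') ∷ [] → ((1# , m) ∷ []) *ₚ f ≃ (1# , monoMul m m') ∷ []
    x*x^q {m} {m'} f e = S.trans (S.*-congˡ {(1# , m) ∷ []} e) (X*T m m')

    1≢q : 1 ≢ q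
    1≢q e = ℕP.<-irrefl e 1<q

  -- The two monomials of a minor differ because q ≠ 1.
  N-≄0 : ∀ j → ¬ (at j N ≃ 0S)
  N-≄0 c₁ = minor-≄0 (0 , 1 , q) (0 , q , 1) (λ e → 1≢q (≡.cong (proj₁ ∘ proj₂) e)) _ _
    (x*x^q _ (power₃ q)) (S.trans (x*x^q _ (power₂ q)) (S.refl))
  N-≄0 c₂ = minor-≄0 (q , 0 , 1) (1 , 0 , q) (λ e → 1≢q (≡.sym (≡.cong proj₁ e))) _ _
    (x*x^q _ (power₁ q)) (x*x^q _ (power₃ q))
  N-≄0 c₃ = minor-≄0 (1 , q , 0) (q , 1 , 0) (λ e → 1≢q (≡.cong proj₁ e)) _ _
    (x*x^q _ (power₂ q)) (x*x^q _ (power₁ q))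

  -- If α_j ≠ 0, the projection along the j-th axis changes only the j-th variable, which N_j does
  -- not contain. So N_j is its own image modulo α, and it is nonzero.
  form∤N : ∀ α → Nonzero α → Σ Coordinate λ j → ¬ (formPoly α ∣ at j N)
  form∤N α α≉0 with pivot α α≉0
  ... | j , αⱼ≉0 with inverse (at j α) αⱼ≉0
  ...   | i , αⱼi≈1 = j , λ α∣N → N-≄0 j (S.trans (S.sym (unchanged j)) (∣⇒projection α (axis j i) (trans (⊙-axis α j i) αⱼi≈1) (at j N) α∣N))
    where
    fixed : ∀ x → x +ₚ negₚ (formPoly α *ₚ constS 0#) ≃ x
    fixed x = S.trans (S.+-congˡ {x} (S.-‿cong (S.*-congˡ {formPoly α} constS-0)))
      (solve 2 (λ x a → x :- a :* con ℤ.0ℤ := x) S.refl x (formPoly α))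
    minor : ∀ t f g → eval t f ≃ f → eval t g ≃ g → eval t (f *ₚ g ^ q +ₚ negₚ (g *ₚ f ^ q)) ≃ f *ₚ g ^ q +ₚ negₚ (g *ₚ f ^ q)
    minor t f g e e' = S.trans (eval-+ t (f *ₚ g ^ q) (negₚ (g *ₚ f ^ q))) (S.+-cong (half f g e e')
        (S.trans (eval-neg t (g *ₚ f ^ q)) (S.-‿cong (half g f e' e))))
      where
      half : ∀ f g → eval t f ≃ f → eval t g ≃ g → eval t (f *ₚ g ^ q) ≃ f *ₚ g ^ q
      half f g e e' = S.trans (eval-* t f (g ^ q)) (S.*-cong e (S.trans (eval-^ t g q) (^-congˡ q e')))
    unchanged : ∀ j → eval (projection α (axis j i)) (at j N) ≃ at j N
    unchanged c₁ = minor t (at c₂ X) (at c₃ X) (S.trans (eval-variable t c₂) (fixed _)) (S.trans (eval-variable t c₃) (fixed _))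
      where t = projection α (axis c₁ i)
    unchanged c₂ = minor t (at c₃ X) (at c₁ X) (S.trans (eval-variable t c₃) (fixed _)) (S.trans (eval-variable t c₁) (fixed _))
      where t = projection α (axis c₂ i)
    unchanged c₃ = minor t (at c₁ X) (at c₂ X) (S.trans (eval-variable t c₁) (fixed _)) (S.trans (eval-variable t c₂) (fixed _))
      where t = projection α (axis c₃ i)

-- Derivations of an arrangement and Saito's criterion.

module Derivations {q : ℕ} (F : FiniteField q) where
  open FiniteField F hiding (zero; _≟_)
  open Arr F hiding (μ; L; dim; size)
  open Polynomials F
  open Domain F
  open LinearForms F
  open VS using (_⊙_; _⨯_; _≋_; _•_; _⊞_; R³; det)
  open RingSolver polyRing
  open Relation.Binary.Reasoning.Setoid S.setoid

  1≄0 : ¬ (1S ≃ 0S)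
  1≄0 h = 1≉0 (trans (sym (+-identityʳ 1#)) (coeffs h (0 , 0 , 0)))

  constS-≄0 : ∀ {c} → ¬ (c ≈ 0#) → ¬ (constS c ≃ 0S)
  constS-≄0 {c} c≉0 h = c≉0 (trans (sym (+-identityʳ c)) (coeffs h (0 , 0 , 0)))

  form-≄0 : ∀ {α} → Nonzero α → ¬ (formPoly α ≃ 0S)
  form-≄0 {α} α≉0 h = α≉0 (go (coeffs h (1 , 0 , 0)) , go (coeffs h (0 , 1 , 0)) , go (coeffs h (0 , 0 , 1)))
    where
    go : ∀ {u} → u + 0# ≈ 0# → u ≈ 0#
    go e = trans (sym (+-identityʳ _)) e

  product-forms-≄0 : ∀ {αs} → All Nonzero αs → ¬ (product αs ≃ 0S)
  product-forms-≄0 [] = 1≄0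
  product-forms-≄0 (α≉0 ∷ nz) = product-≄0 (form-≄0 α≉0) (product-forms-≄0 nz)

  ≄0-cancel : ∀ {p} f → ¬ (p ≃ 0S) → p *ₚ f ≃ 0S → f ≃ 0S
  ≄0-cancel f p≄0 pf≃0 with f ≟0S
  ... | yes f≃0 = f≃0
  ... | no f≄0 = ⊥-elim (product-≄0 p≄0 f≄0 pf≃0)

  *-cancelˡ : ∀ p f g → ¬ (p ≃ 0S) → p *ₚ f ≃ p *ₚ g → f ≃ g
  *-cancelˡ p f g p≄0 e = S.trans (solve 2 (λ f g → f := (f :- g) :+ g) S.refl f g)
    (S.trans (S.+-congʳ (≄0-cancel (f +ₚ negₚ g) p≄0 (S.trans (solve 3 (λ p f g → p :* (f :- g) := p :* f :- p :* g) S.refl p f g)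
      (S.trans (S.+-congʳ e) (S.-‿inverseʳ (p *ₚ g)))))) (S.+-identityˡ g))

  constS-cancel : ∀ {α c} f → ¬ (c ≈ 0#) → α ∣ constS c *ₚ f → α ∣ f
  constS-cancel {α} {c} f c≉0 (k , e) with inverse c c≉0
  ... | i , ci≈1 = constS i *ₚ k , S.trans (S.trans (S.sym (S.*-identityˡ f)) (S.*-congʳ {f} (S.sym one)))
      (S.trans (solve 3 (λ i c f → i :* c :* f := i :* (c :* f)) S.refl (constS i) (constS c) f) (S.trans (S.*-congˡ {constS i} e)
        (solve 3 (λ i a k → i :* (a :* k) := a :* (i :* k)) S.refl (constS i) α k)))
    where
    one : constS i *ₚ constS c ≃ 1S
    one = S.trans (S.sym (constS-* i c)) (term-cong (trans (*-comm i c) ci≈1))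

  dual-cramer-at : ∀ j u v w α → det u v w *ₚ at j α ≃
    (α ⊙ u) *ₚ at j (v ⨯ w) +ₚ ((α ⊙ v) *ₚ at j (w ⨯ u) +ₚ (α ⊙ w) *ₚ at j (u ⨯ v))
  dual-cramer-at c₁ u v w α = proj₁ (VS.dual-cramer u v w α)
  dual-cramer-at c₂ u v w α = proj₁ (proj₂ (VS.dual-cramer u v w α))
  dual-cramer-at c₃ u v w α = proj₂ (proj₂ (VS.dual-cramer u v w α))

  at-ι³ : ∀ j α → at j (ι³ α) ≡ constS (at j α)
  at-ι³ c₁ _ = ≡.refl
  at-ι³ c₂ _ = ≡.refl
  at-ι³ c₃ _ = ≡.refl

  -- Cramer's rule for covectors writes α_j det(u, v, w) as a combination of α(u), α(v), α(w), and
  -- some coordinate α_j is a nonzero constant.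
  ∣-det : ∀ α → Nonzero α → ∀ u v w → formPoly α ∣ ι³ α ⊙ u → formPoly α ∣ ι³ α ⊙ v → formPoly α ∣ ι³ α ⊙ w →
    formPoly α ∣ det u v w
  ∣-det α α≉0 u v w du dv dw with pivot α α≉0
  ... | j , αⱼ≉0 = constS-cancel (det u v w) αⱼ≉0 (∣-resp (S.trans (S.sym (dual-cramer-at j u v w (ι³ α)))
      (S.trans (S.reflexive (≡.cong (det u v w *ₚ_) (at-ι³ j α))) (S.*-comm (det u v w) _)))
      (∣-+ (∣-*ʳ _ du) (∣-+ (∣-*ʳ _ dv) (∣-*ʳ _ dw))))

  -- In the same expansion the terms with α(u) and α(w) are multiples of α, so α divides α(v) (u ×
  -- w)_j; being prime, it divides α(v).
  ∣-⨯⇒∣ : ∀ α → Nonzero α → ∀ j u v w → formPoly α ∣ v ⊙ (u ⨯ w) → formPoly α ∣ ι³ α ⊙ u → formPoly α ∣ ι³ α ⊙ w →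
    ¬ (formPoly α ∣ at j (u ⨯ w)) → formPoly α ∣ ι³ α ⊙ v
  ∣-⨯⇒∣ α α≉0 j u v w d du dw α∤ =
    [ (λ h → h) , (λ h → ⊥-elim (α∤ h)) ]′ (form-prime α α≉0 (ι³ α ⊙ v) (at j (u ⨯ w))
      (∣-resp (S.trans (S.+-congʳ {negₚ rest} (dual-cramer-at j v u w (ι³ α)))
          (solve 2 (λ a r → (a :+ r) :- r := a) S.refl ((ι³ α ⊙ v) *ₚ at j (u ⨯ w)) rest))
        (∣-+ (∣-*ʳ (at j (ι³ α)) d) (∣-neg {h = rest} (∣-+ (∣-*ʳ (at j (w ⨯ v)) du) (∣-*ʳ (at j (v ⨯ u)) dw))))))
    where
    rest = (ι³ α ⊙ u) *ₚ at j (w ⨯ v) +ₚ (ι³ α ⊙ w) *ₚ at j (v ⨯ u)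

  ∣-N⇒∣ : ∀ α → Nonzero α → ∀ v → formPoly α ∣ v ⊙ N → formPoly α ∣ ι³ α ⊙ v
  ∣-N⇒∣ α α≉0 v d = ∣-⨯⇒∣ α α≉0 (proj₁ (form∤N α α≉0)) X v Xq d (form∣X α) (form∣Xq α) (proj₂ (form∤N α α≉0))

  module D = Graded degree
  open D using (Homogeneous; Bounded; Top) public

  module Tops (W : Weight) where
    private module G = Graded W

    top-* : ∀ {a b} p r → G.Top a p → G.Top b r → G.Top (a ℕ.+ b) (p *ₚ r)
    top-* {a} {b} p r (bp , p≄0) (br , r≄0) = G.Bounded-* {a} {b} p r bp br ,
      λ e → product-≄0 p≄0 r≄0 (S.trans (S.sym (G.comp-top-* p r bp br)) e)

    top≤bound : ∀ {k l} p → G.Top k p → G.Bounded l p → k ℕ.≤ l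
    top≤bound {k} {l} p (_ , c≄0) b with k ℕ.≤? l
    ... | yes k≤l = k≤l
    ... | no k≰l = ⊥-elim (c≄0 (coeffwise λ m → go m))
      where
      go : ∀ m → coeffS (G.comp k p) m ≈ 0#
      go m with k ℕ.≟ Weight.weight W m
      ... | no ne = G.coeffS-part-false (G.only k) p m (G.only-false ne)
      ... | yes ≡.refl = trans (G.coeffS-part-true (G.only k) p m (G.only-true {k} ≡.refl))
        (G.supported⁻ (G.upto l) p b m (G.below-false λ lt → k≰l (ℕP.≤-pred lt)))

  open Tops degree

  homogeneous-top : ∀ {k} p → Homogeneous k p → ¬ (p ≃ 0S) → Top k p
  homogeneous-top {k} p h p≄0 = D.Hom⇒Bounded {k} p h , λ e → p≄0 (S.trans (S.sym h) e)

  form-homogeneous : ∀ α → Homogeneous 1 (formPoly α)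
  form-homogeneous α = S.refl

  product-homogeneous : ∀ αs → Homogeneous (length αs) (product αs)
  product-homogeneous [] = S.refl
  product-homogeneous (α ∷ αs) = D.Hom-* {1} {length αs} (formPoly α) (product αs) (form-homogeneous α) (product-homogeneous αs)

  bounded-0 : ∀ p → Bounded 0 p → p ≃ constS (coeffS p (0 , 0 , 0))
  bounded-0 p b = coeffwise go
    where
    go : ∀ m → coeffS p m ≈ coeffS (constS (coeffS p (0 , 0 , 0))) m
    go (0 , 0 , 0) = sym (+-identityʳ _)
    go m@(suc a , b' , c) = D.supported⁻ (D.upto 0) p b m ≡.refl
    go m@(0 , suc b' , c) = D.supported⁻ (D.upto 0) p b m ≡.refl
    go m@(0 , 0 , suc c) = D.supported⁻ (D.upto 0) p b m ≡.refl

  module _ (αs : List V3) (nz : All Nonzero αs) where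
    private Q = product αs

    ∣-bounded⇒degree : ∀ {l} K → Q ∣ K → Bounded l K → ¬ (K ≃ 0S) → length αs ℕ.≤ l
    ∣-bounded⇒degree {l} K (h , e) b K≄0 with h ≟0S
    ... | yes h≃0 = ⊥-elim (K≄0 (S.trans e (S.trans (S.*-congˡ {Q} h≃0) (S.zeroʳ Q))))
    ... | no h≄0 with D.top h h≄0
    ...   | k , t = ℕP.≤-trans (ℕP.m≤m+n (length αs) k) (top≤bound {length αs ℕ.+ k} {l} (Q *ₚ h)
            (top-* {length αs} {k} Q h (homogeneous-top {length αs} Q (product-homogeneous αs) (product-forms-≄0 nz)) t)
            (D.Supported-resp (D.upto l) e b))

    -- Degrees add, so if K is nonzero its cofactor has degree zero.
    ∣-bounded⇒scalar : ∀ K → Q ∣ K → Bounded (length αs) K → Σ Carrier λ c → K ≃ constS c *ₚ Q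
    ∣-bounded⇒scalar K (h , e) b with h ≟0S
    ... | yes h≃0 = 0# , S.trans e (S.trans (S.*-congˡ {Q} h≃0) (S.trans (S.zeroʳ Q)
            (S.sym (S.trans (S.*-congʳ {Q} constS-0) (S.zeroˡ Q)))))
    ... | no h≄0 with D.top h h≄0
    ...   | k , t = coeffS h (0 , 0 , 0) , S.trans e (S.trans (S.*-congˡ {Q} (bounded-0 h (≡.subst (λ k → Bounded k h) k≡0 (proj₁ t))))
                      (S.*-comm Q _))
      where
      n+k≤n : length αs ℕ.+ k ℕ.≤ length αs ℕ.+ 0
      n+k≤n = ≡.subst (length αs ℕ.+ k ℕ.≤_) (≡.sym (ℕP.+-identityʳ _)) (top≤bound {length αs ℕ.+ k} {length αs} (Q *ₚ h)
            (top-* {length αs} {k} Q h (homogeneous-top {length αs} Q (product-homogeneous αs) (product-forms-≄0 nz)) t)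
            (D.Supported-resp (D.upto (length αs)) e b))
      k≡0 : k ≡ 0
      k≡0 = ℕP.n≤0⇒n≡0 (ℕP.+-cancelˡ-≤ (length αs) k 0 n+k≤n)

  -- Membership in D(A) phrased with `≃`, and for a bare list of forms so that proofs can recurse on
  -- it.
  InDer : List V3 → R³ → Set
  InDer αs δ = All (λ α → formPoly α ∣ ι³ α ⊙ δ) αs

  opaque
    unfolding _+ₚ_

    toInD : ∀ A {δ} → InDer (forms A) δ → InD A δ
    toInD A = All.map (λ (k , e) → k , coeffs e)

    fromInD : ∀ A {δ} → InD A δ → InDer (forms A) δ
    fromInD A = All.map (λ (k , e) → k , coeffwise e)

  InDer-N : ∀ αs → All Nonzero αs → ∀ v → product αs ∣ v ⊙ N → InDer αs v
  InDer-N αs nz v Q∣vN = All.zipWith (λ {α} (α≉0 , α∣Q) → ∣-N⇒∣ α α≉0 v (∣-trans α∣Q Q∣vN)) (nz , form∣product αs)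

  InDer-X : ∀ αs → InDer αs X
  InDer-X αs = All.universal form∣X αs

  InDer-Xq : ∀ αs → InDer αs Xq
  InDer-Xq αs = All.universal form∣Xq αs

  product∣det : ∀ A u v w → InDer (forms A) u → InDer (forms A) v → InDer (forms A) w → product (forms A) ∣ det u v w
  product∣det A u v w du dv dw = product-∣ (forms A) (nonzero A) (distinct A) (det u v w)
    (All.zipWith (λ {α} (α≉0 , (a , (b , c))) → ∣-det α α≉0 u v w a b c) (nonzero A , All.zip (du , All.zip (dv , dw))))

  comb₃ : (g m l : SPoly) (u v w : R³) → R³
  comb₃ g m l u v w = g • u ⊞ (m • v ⊞ l • w)

  opaque
    unfolding _+ₚ_

    combD⇒comb₃ : ∀ δ g m l u v w → δ ≈D combD (g ∷ m ∷ l ∷ []) (u ∷ v ∷ w ∷ []) → δ ≋ comb₃ g m l u v w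
    combD⇒comb₃ (δ₁ , δ₂ , δ₃) g m l (u₁ , u₂ , u₃) (v₁ , v₂ , v₃) (w₁ , w₂ , w₃) (e₁ , e₂ , e₃) =
      go u₁ v₁ w₁ e₁ , go u₂ v₂ w₂ e₂ , go u₃ v₃ w₃ e₃
      where
      go : ∀ {δ} u v w → δ ≈S ((g *S u) +S ((m *S v) +S ((l *S w) +S 0S))) → δ ≃ g *ₚ u +ₚ (m *ₚ v +ₚ l *ₚ w)
      go u v w e = S.trans (coeffwise e) (S.+-congˡ {g *ₚ u} (S.+-congˡ {m *ₚ v} (S.+-identityʳ (l *ₚ w))))

    comb₃⇒combD : ∀ δ g m l u v w → δ ≋ comb₃ g m l u v w → δ ≈D combD (g ∷ m ∷ l ∷ []) (u ∷ v ∷ w ∷ [])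
    comb₃⇒combD (δ₁ , δ₂ , δ₃) g m l (u₁ , u₂ , u₃) (v₁ , v₂ , v₃) (w₁ , w₂ , w₃) (e₁ , e₂ , e₃) =
      go u₁ v₁ w₁ e₁ , go u₂ v₂ w₂ e₂ , go u₃ v₃ w₃ e₃
      where
      go : ∀ {δ} u v w → δ ≃ g *ₚ u +ₚ (m *ₚ v +ₚ l *ₚ w) → δ ≈S ((g *S u) +S ((m *S v) +S ((l *S w) +S 0S)))
      go u v w e = coeffs (S.trans e (S.+-congˡ {g *ₚ u} (S.+-congˡ {m *ₚ v} (S.sym (S.+-identityʳ (l *ₚ w))))))

  -- Cramer's rule gives the coordinates of δ as quotients of determinants by c Q. Each numerator is
  -- again a determinant of three derivations, so Q divides it.
  saito : ∀ A u v w c → InDer (forms A) u → InDer (forms A) v → InDer (forms A) w →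
    ¬ (c ≈ 0#) → det u v w ≃ constS c *ₚ product (forms A) → IsFree A
  saito A u v w c du dv dw c≉0 detQ = 3 , (u ∷ v ∷ w ∷ []) ,
    (toInD A {u} du VecAll.∷ toInD A {v} dv VecAll.∷ toInD A {w} dw VecAll.∷ VecAll.[]) , spans , independent
    where
    Q = product (forms A)
    Q≄0 = product-forms-≄0 (nonzero A)
    det≄0 : ¬ (det u v w ≃ 0S)
    det≄0 h = product-≄0 (constS-≄0 c≉0) Q≄0 (S.trans (S.sym detQ) h)
    i = proj₁ (inverse c c≉0)
    i*c : constS i *ₚ constS c ≃ 1S
    i*c = S.trans (S.sym (constS-* i c)) (term-cong (trans (*-comm i c) (proj₂ (inverse c c≉0))))
    spans : ∀ δ → InD A δ → Σ (Vec SPoly 3) λ gs → δ ≈D combD gs (u ∷ v ∷ w ∷ [])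
    spans δ@(δ₁ , δ₂ , δ₃) δ∈D = (constS i *ₚ g ∷ constS i *ₚ m ∷ constS i *ₚ l ∷ []) ,
      comb₃⇒combD δ (constS i *ₚ g) (constS i *ₚ m) (constS i *ₚ l) u v w
      ( go δ₁ (proj₁ u) (proj₁ v) (proj₁ w) (proj₁ (VS.cramer u v w δ))
      , go δ₂ (at c₂ u) (at c₂ v) (at c₂ w) (proj₁ (proj₂ (VS.cramer u v w δ)))
      , go δ₃ (at c₃ u) (at c₃ v) (at c₃ w) (proj₂ (proj₂ (VS.cramer u v w δ))))
      where
      δ∈ = fromInD A {δ} δ∈D
      G = product∣det A δ v w δ∈ dv dw
      M = product∣det A u δ w du δ∈ dw
      H = product∣det A u v δ du dv δ∈
      g = proj₁ G
      m = proj₁ M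
      l = proj₁ H
      go : ∀ d x y z → det u v w *ₚ d ≃ det δ v w *ₚ x +ₚ (det u δ w *ₚ y +ₚ det u v δ *ₚ z) →
        d ≃ (constS i *ₚ g) *ₚ x +ₚ ((constS i *ₚ m) *ₚ y +ₚ (constS i *ₚ l) *ₚ z)
      go d x y z e = *-cancelˡ Q d _ Q≄0 (begin
        Q *ₚ d                                ≈⟨ S.*-congʳ {d} (S.sym (S.*-identityˡ Q)) ⟩
        1S *ₚ Q *ₚ d                          ≈⟨ S.*-congʳ {d} (S.*-congʳ {Q} (S.sym i*c)) ⟩
        constS i *ₚ constS c *ₚ Q *ₚ d        ≈⟨ solve 4 (λ i c Q d → i :* c :* Q :* d := i :* (c :* Q :* d)) S.refl (constS i) (constS c) Q d ⟩
        constS i *ₚ (constS c *ₚ Q *ₚ d)      ≈⟨ S.*-congˡ {constS i} (S.*-congʳ {d} (S.sym detQ)) ⟩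
        constS i *ₚ (det u v w *ₚ d)          ≈⟨ S.*-congˡ {constS i} e ⟩
        constS i *ₚ (det δ v w *ₚ x +ₚ (det u δ w *ₚ y +ₚ det u v δ *ₚ z))
          ≈⟨ S.*-congˡ {constS i} (S.+-cong (S.*-congʳ {x} (proj₂ G)) (S.+-cong (S.*-congʳ {y} (proj₂ M)) (S.*-congʳ {z} (proj₂ H)))) ⟩
        constS i *ₚ (Q *ₚ g *ₚ x +ₚ (Q *ₚ m *ₚ y +ₚ Q *ₚ l *ₚ z))
          ≈⟨ solve 8 (λ i Q g m l x y z → i :* (Q :* g :* x :+ (Q :* m :* y :+ Q :* l :* z)) :=
               Q :* (i :* g :* x :+ (i :* m :* y :+ i :* l :* z))) S.refl (constS i) Q g m l x y z ⟩
        Q *ₚ ((constS i *ₚ g) *ₚ x +ₚ ((constS i *ₚ m) *ₚ y +ₚ (constS i *ₚ l) *ₚ z)) ∎)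
    -- Replacing one vector by the vanishing combination multiplies det(u, v, w) by the coefficient
    -- of that vector, which is therefore zero.
    independent : ∀ (gs : Vec SPoly 3) → combD gs (u ∷ v ∷ w ∷ []) ≈D 0D → ∀ i → Vec.lookup gs i ≈S 0S
    independent (g ∷ m ∷ l ∷ []) e = λ
        { zero → coeffs (kill (S.trans (S.sym (VS.det-comb₁ g m l u v w)) (S.trans (VS.det-cong comb≋0 VS.≋-refl VS.≋-refl) (zero₁ v w))))
        ; (suc zero) → coeffs (kill (S.trans (S.sym (VS.det-comb₂ g m l u v w)) (S.trans (VS.det-cong (VS.≋-refl {u}) comb≋0 VS.≋-refl) (zero₂ u w))))
        ; (suc (suc zero)) → coeffs (kill (S.trans (S.sym (VS.det-comb₃ g m l u v w)) (S.trans (VS.det-cong (VS.≋-refl {u}) (VS.≋-refl {v}) comb≋0) (zero₃ u v)))) }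
      where
      comb≋0 = VS.≋-sym (combD⇒comb₃ VS.𝟘 g m l u v w ((λ x → sym (proj₁ e x)) , (λ x → sym (proj₁ (proj₂ e) x)) , (λ x → sym (proj₂ (proj₂ e) x))))
      zero₁ : ∀ v w → det VS.𝟘 v w ≃ 0S
      zero₁ v w = solve 3 (λ a b c → con ℤ.0ℤ :* a :+ (con ℤ.0ℤ :* b :+ con ℤ.0ℤ :* c) := con ℤ.0ℤ) S.refl (at c₁ (v ⨯ w)) (at c₂ (v ⨯ w)) (at c₃ (v ⨯ w))
      zero₂ : ∀ u w → det u VS.𝟘 w ≃ 0S
      zero₂ u w = S.trans (VS.det-rotate u VS.𝟘 w) (zero₁ w u)
      zero₃ : ∀ u v → det u v VS.𝟘 ≃ 0S
      zero₃ u v = S.trans (S.trans (VS.det-rotate u v VS.𝟘) (VS.det-rotate v VS.𝟘 u)) (zero₁ u v)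
      kill : ∀ {g} → g *ₚ det u v w ≃ 0S → g ≃ 0S
      kill {g} h = ≄0-cancel g det≄0 (S.trans (S.*-comm (det u v w) g) h)

-- Derivatives at rational points through dual numbers.

module DualNumbers {q : ℕ} (F : FiniteField q) where
  open FiniteField F hiding (zero; _≟_)
  open Arr F hiding (μ; L; dim; size; _+S_; _*S_)
  open Polynomials F
  open Frobenius F
  open Variables F
  open RingSolver commRing
  private
    module VF = Vector3 commRing
    module VS = Vector3 polyRing

    _≈₂_ : Carrier × Carrier → Carrier × Carrier → Set
    (a , b) ≈₂ (c , d) = (a ≈ c) × (b ≈ d)

  -- The pair (a, b) is a + b ε with ε² = 0.
  dualRing : CommutativeRing 0ℓ 0ℓ
  dualRing = record
    { Carrier = Carrier × Carrier ; _≈_ = _≈₂_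
    ; _+_ = λ (a , b) (c , d) → a + c , b + d
    ; _*_ = λ (a , b) (c , d) → a * c , a * d + b * c
    ; -_ = λ (a , b) → - a , - b ; 0# = 0# , 0# ; 1# = 1# , 0#
    ; isCommutativeRing = record
      { isRing = record
        { +-isAbelianGroup = record
          { isGroup = record
            { isMonoid = record
              { isSemigroup = record
                { isMagma = record
                  { isEquivalence = record { refl = refl , refl ; sym = λ (p , r) → sym p , sym r ; trans = λ (p , r) (s , t) → trans p s , trans r t }
                  ; ∙-cong = λ (p , r) (s , t) → +-cong p s , +-cong r t }
                ; assoc = λ _ _ _ → +-assoc _ _ _ , +-assoc _ _ _ }
              ; identity = (λ _ → +-identityˡ _ , +-identityˡ _) , (λ _ → +-identityʳ _ , +-identityʳ _) }
            ; inverse = (λ _ → -‿inverseˡ _ , -‿inverseˡ _) , (λ _ → -‿inverseʳ _ , -‿inverseʳ _)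
            ; ⁻¹-cong = λ (p , r) → -‿cong p , -‿cong r }
          ; comm = λ _ _ → +-comm _ _ , +-comm _ _ }
        ; *-cong = λ (p , r) (s , t) → *-cong p s , +-cong (*-cong p t) (*-cong r s)
        ; *-assoc = λ (a , b) (c , d) (e , f) → *-assoc _ _ _ ,
            solve 6 (λ a b c d e f → (a :* c) :* f :+ (a :* d :+ b :* c) :* e := a :* (c :* f :+ d :* e) :+ b :* (c :* e)) refl a b c d e f
        ; *-identity = (λ (a , b) → *-identityˡ a , solve 2 (λ a b → con ℤ.1ℤ :* b :+ con ℤ.0ℤ :* a := b) refl a b) ,
                       (λ (a , b) → *-identityʳ a , solve 2 (λ a b → a :* con ℤ.0ℤ :+ b :* con ℤ.1ℤ := b) refl a b)
        ; distrib = (λ (a , b) (c , d) (e , f) → distribˡ _ _ _ ,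
              solve 6 (λ a b c d e f → a :* (d :+ f) :+ b :* (c :+ e) := (a :* d :+ b :* c) :+ (a :* f :+ b :* e)) refl a b c d e f) ,
            (λ (a , b) (c , d) (e , f) → distribʳ _ _ _ ,
              solve 6 (λ a b c d e f → (c :+ e) :* b :+ (d :+ f) :* a := (c :* b :+ d :* a) :+ (e :* b :+ f :* a)) refl a b c d e f) }
      ; *-comm = λ (a , b) (c , d) → *-comm _ _ , solve 4 (λ a b c d → a :* d :+ b :* c := c :* b :+ d :* a) refl a b c d } }

  dualAlgebra : Algebra
  dualAlgebra = record
    { ringA = dualRing ; ι = λ c → c , 0# ; ι-cong = λ p → p , refl
    ; ι-+ = λ _ _ → refl , sym (+-identityˡ _)
    ; ι-* = λ x y → refl , solve 2 (λ x y → con ℤ.0ℤ := x :* con ℤ.0ℤ :+ con ℤ.0ℤ :* y) refl x y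
    ; ι-0 = refl , refl ; ι-1 = refl , refl }

  private
    module VD = Vector3 dualRing
    module R = CommutativeRing dualRing
    module ED = Eval dualAlgebra
    module HD = EvalHomomorphism dualAlgebra
    module EF = Eval base
    module HF = EvalHomomorphism base
    open Algebra.Properties.Semiring.Exp R.semiring using () renaming (_^_ to _^ᴰ_; ^-congˡ to ^ᴰ-congˡ)
    open Algebra.Properties.Semiring.Exp semiring using (_^_)
    open Algebra.Properties.Semiring.Exp S.semiring using () renaming (_^_ to _^S_)

    power-real : ∀ p n → R._≈_ ((p , 0#) ^ᴰ n) (p ^ n , 0#)
    power-real p zero = refl , refl
    power-real p (suc n) = R.trans (R.*-congˡ {p , 0#} (power-real p n)) (refl , solve 2 (λ p x → p :* con ℤ.0ℤ :+ con ℤ.0ℤ :* x := con ℤ.0ℤ) refl p (p ^ n))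

    power-ε : ∀ u n → 1 ℕ.< n → R._≈_ ((0# , u) ^ᴰ n) (0# , 0#)
    power-ε u (suc (suc n)) _ = R.trans (R.sym (R.*-assoc (0# , u) (0# , u) ((0# , u) ^ᴰ n)))
      (R.trans (R.*-congʳ {(0# , u) ^ᴰ n} (zeroˡ 0# , solve 1 (λ u → con ℤ.0ℤ :* u :+ u :* con ℤ.0ℤ := con ℤ.0ℤ) refl u)) (R.zeroˡ ((0# , u) ^ᴰ n)))
    power-ε u (suc zero) (s≤s ())

    -- By additivity the power is p^q + (u ε)^q. The second term vanishes because q ≥ 2, and p^q =
    -- p.
    power-q : ∀ p u → R._≈_ ((p , u) ^ᴰ q) (p , 0#)
    power-q p u = R.trans (^ᴰ-congˡ q (sym (+-identityʳ p) , sym (+-identityˡ u)))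
      (R.trans (frobenius-+ dualAlgebra (p , 0#) (0# , u)) (R.trans (R.+-cong (power-real p q) (power-ε u q 1<q))
        (trans (+-identityʳ _) (fermat p) , +-identityʳ _)))

    point : VF.R³ → VF.R³ → VD.R³
    point (x , y , z) (u , v , w) = (x , u) , (y , v) , (z , w)

    real : ∀ s t p → proj₁ (ED.eval (point s t) p) ≈ EF.eval s p
    real s t [] = refl
    real s t ((c , m) ∷ p) = +-cong (*-congˡ (mono s t m)) (real s t p)
      where
      pow : ∀ x u n → proj₁ ((x , u) ^ᴰ n) ≈ x ^ n
      pow x u zero = refl
      pow x u (suc n) = *-congˡ (pow x u n)
      mono : ∀ s t m → proj₁ (ED.monomial (point s t) m) ≈ EF.monomial s m
      mono (x , y , z) (u , v , w) (a , b , c) = *-cong (pow x u a) (*-cong (pow y v b) (pow z w c))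

  -- The derivative at s in direction t, as the ε-part of the value at s + ε t.
  ∂ : VF.R³ → VF.R³ → SPoly → Carrier
  ∂ s t p = proj₂ (ED.eval (point s t) p)

  ∂-cong : ∀ s t {p r} → p ≃ r → ∂ s t p ≈ ∂ s t r
  ∂-cong s t h = proj₂ (ED.eval-cong (point s t) h)

  ∂-* : ∀ s t p r → ∂ s t (p *ₚ r) ≈ EF.eval s p * ∂ s t r + ∂ s t p * EF.eval s r
  ∂-* s t p r = trans (proj₂ (ED.eval-* (point s t) p r)) (+-cong (*-congʳ (real s t p)) (*-congˡ (real s t r)))

  ∂-form : ∀ s t α → ∂ s t (formPoly α) ≈ α VF.⊙ t
  ∂-form s@(x , y , z) t@(u , v , w) α@(a , b , c) = trans (proj₂ (ED.eval-form (point s t) α))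
    (solve 9 (λ a b c x y z u v w → (a :* u :+ con ℤ.0ℤ :* x) :+ ((b :* v :+ con ℤ.0ℤ :* y) :+ (c :* w :+ con ℤ.0ℤ :* z)) := a :* u :+ (b :* v :+ c :* w))
      refl a b c x y z u v w)

  -- Since X^q has derivative 0 and fixes rational points, N is t ⨯ s to first order.
  ∂-N : ∀ s t v → ∂ s t (v VS.⊙ N) ≈ t VF.⊙ (s VF.⨯ HF.eval³ s v)
  ∂-N s@(x , y , z) t@(a , b , c) v@(v₁ , v₂ , v₃) = trans (proj₂ whole) (trans
      (solve 12 (λ x y z a b c k l m k' l' m' →
          (k :* (y :* con ℤ.0ℤ :+ b :* z :- (z :* con ℤ.0ℤ :+ c :* y)) :+ k' :* (y :* z :- z :* y))
          :+ ((l :* (z :* con ℤ.0ℤ :+ c :* x :- (x :* con ℤ.0ℤ :+ a :* z)) :+ l' :* (z :* x :- x :* z))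
          :+ (m :* (x :* con ℤ.0ℤ :+ a :* y :- (y :* con ℤ.0ℤ :+ b :* x)) :+ m' :* (x :* y :- y :* x)))
          := a :* (y :* m :- z :* l) :+ (b :* (z :* k :- x :* m) :+ c :* (x :* l :- y :* k)))
        refl x y z a b c (re v₁) (re v₂) (re v₃) (∂ s t v₁) (∂ s t v₂) (∂ s t v₃))
      (VF.⊙-cong (VF.≋-refl {t}) (VF.⨯-cong (VF.≋-refl {s}) (real s t v₁ , real s t v₂ , real s t v₃))))
    where
    T = point s t
    re : SPoly → Carrier
    re p = proj₁ (ED.eval T p)
    Xq-value : VD._≋_ (HD.eval³ T Xq) ((x , 0#) , (y , 0#) , (z , 0#))
    Xq-value = go c₁ x a (R.refl) , go c₂ y b R.refl , go c₃ z c R.refl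
      where
      go : ∀ j x u → R._≈_ (at j T) (x , u) → R._≈_ (ED.eval T (at j X ^S q)) (x , 0#)
      go j x u e = R.trans (HD.eval-^ T (at j X) q) (R.trans (^ᴰ-congˡ q (R.trans (HD.eval-variable T j) e)) (power-q x u))
    whole : R._≈_ (ED.eval T (v VS.⊙ N)) (HD.eval³ T v VD.⊙ (T VD.⨯ ((x , 0#) , (y , 0#) , (z , 0#))))
    whole = R.trans (HD.eval-⊙ T v N) (VD.⊙-cong (VD.≋-refl {HD.eval³ T v}) (VD.≋-trans (HD.eval-⨯ T X Xq)
      (VD.⨯-cong (HD.eval-X³ T) Xq-value)))

-- The ideal of polynomials vanishing at all rational points.

module VanishingIdeal {q : ℕ} (F : FiniteField q) where
  open FiniteField F hiding (zero; _≟_)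
  open Arr F hiding (μ; L; dim; size; _+S_; _*S_)
  open Polynomials F
  open Domain F
  open Frobenius F
  open LinearForms F
  open Derivations F
  open VS using (_⊙_; R³; 𝟘)
  open RingSolver polyRing

  module EF = Eval base
  module HF = EvalHomomorphism base
  module LF = Linear base
  open Algebra.Properties.Semiring.Exp semiring using () renaming (_^_ to _^F_)

  T : Mono → SPoly
  T m = (1# , m) ∷ []

  Bounded³ : ℕ → R³ → Set
  Bounded³ k (a , b , c) = Bounded k a × Bounded k b × Bounded k c

  -- Congruence modulo the entries of N with multipliers of degree at most k. The bound has to
  -- survive every step, because it becomes the degree bound on the derivation.
  Reduces : ℕ → SPoly → SPoly → Set
  Reduces k f r = Σ R³ λ v → Bounded³ k v × f ≃ v ⊙ N +ₚ r

  reduces-refl : ∀ {k} f → Reduces k f f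
  reduces-refl {k} f = 𝟘 , (S.refl , S.refl , S.refl) ,
    solve 4 (λ f x y z → f := (con ℤ.0ℤ :* x :+ (con ℤ.0ℤ :* y :+ con ℤ.0ℤ :* z)) :+ f) S.refl f (at c₁ N) (at c₂ N) (at c₃ N)

  reduces-≃ : ∀ {k f f' r r'} → f ≃ f' → r ≃ r' → Reduces k f r → Reduces k f' r'
  reduces-≃ e e' (v , b , h) = v , b , S.trans (S.sym e) (S.trans h (S.+-congˡ {v ⊙ N} e'))

  private
    ⊙N-+ : ∀ (v w : R³) → (v VS.⊞ w) ⊙ N ≃ v ⊙ N +ₚ w ⊙ N
    ⊙N-+ (a , b , c) (d , e , f) = solve 9 (λ a b c d e f x y z → (a :+ d) :* x :+ ((b :+ e) :* y :+ (c :+ f) :* z)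
      := (a :* x :+ (b :* y :+ c :* z)) :+ (d :* x :+ (e :* y :+ f :* z))) S.refl a b c d e f (at c₁ N) (at c₂ N) (at c₃ N)

    ⊙N-• : ∀ k (v : R³) → (k VS.• v) ⊙ N ≃ k *ₚ (v ⊙ N)
    ⊙N-• k (a , b , c) = solve 7 (λ k a b c x y z → (k :* a) :* x :+ ((k :* b) :* y :+ (k :* c) :* z)
      := k :* (a :* x :+ (b :* y :+ c :* z))) S.refl k a b c (at c₁ N) (at c₂ N) (at c₃ N)

    bounded-+ : ∀ {k} v w → Bounded³ k v → Bounded³ k w → Bounded³ k (v VS.⊞ w)
    bounded-+ {k} (a , b , c) (d , e , f) (p , r , s) (p' , r' , s') =
      D.Supported-+ (D.upto k) a d p p' , D.Supported-+ (D.upto k) b e r r' , D.Supported-+ (D.upto k) c f s s'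

    bounded-• : ∀ {k} x v → Bounded³ k v → Bounded³ k (constS x VS.• v)
    bounded-• {k} x (a , b , c) (p , r , s) = go a p , go b r , go c s
      where
      go : ∀ a → Bounded k a → Bounded k (constS x *ₚ a)
      go a = D.Bounded-* {0} {k} (constS x) a S.refl

  reduces-trans : ∀ {k f g r} → Reduces k f g → Reduces k g r → Reduces k f r
  reduces-trans {k} {r = r} (v , b , e) (w , b' , e') = v VS.⊞ w , bounded-+ v w b b' , S.trans e (S.trans (S.+-congˡ {v ⊙ N} e')
    (S.trans (S.sym (S.+-assoc (v ⊙ N) (w ⊙ N) r)) (S.+-congʳ (S.sym (⊙N-+ v w)))))

  reduces-+ : ∀ {k f g r s} → Reduces k f r → Reduces k g s → Reduces k (f +ₚ g) (r +ₚ s)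
  reduces-+ {k} {r = r} {s} (v , b , e) (w , b' , e') = v VS.⊞ w , bounded-+ v w b b' , S.trans (S.+-cong e e')
    (S.trans (solve 4 (λ a r b s → (a :+ r) :+ (b :+ s) := (a :+ b) :+ (r :+ s)) S.refl (v ⊙ N) r (w ⊙ N) s) (S.+-congʳ (S.sym (⊙N-+ v w))))

  reduces-const : ∀ {k f r} x → Reduces k f r → Reduces k (constS x *ₚ f) (constS x *ₚ r)
  reduces-const {k} {r = r} x (v , b , e) = constS x VS.• v , bounded-• x v b , S.trans (S.*-congˡ {constS x} e)
    (S.trans (S.distribˡ (constS x) (v ⊙ N) r) (S.+-congʳ (S.sym (⊙N-• (constS x) v))))

  private
    T-* : ∀ m m' → T m *ₚ T m' ≃ T (monoMul m m')
    T-* m m' = S.trans (S.reflexive (term-* 1# 1# m m')) (term-cong (*-identityˡ 1#))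

    deg : Mono → ℕ
    deg = Weight.weight degree

    T-bounded : ∀ m {k} → deg m ℕ.≤ k → Bounded k (T m)
    T-bounded m {k} le = D.Supported-terms (D.upto k) {T m} (D.below-true (s≤s le) ∷ [])

    -- A rewriting step between monomials is licensed by writing their difference as a multiple of
    -- the entries of N.
    step : ∀ {k} f g m u w → deg m ℕ.≤ k → Σ R³ (λ v → Bounded³ k v × v ⊙ N ≃ T m *ₚ (f +ₚ negₚ g)) →
      f ≃ T u → g ≃ T w → Reduces k (T (monoMul m u)) (T (monoMul m w))
    step f g m u w le (v , b , e) ef eg = v , b , S.trans (S.sym (T-* m u)) (S.trans (S.*-congˡ {T m} (S.sym ef)) (S.trans
      (solve 3 (λ m f g → m :* f := m :* (f :- g) :+ m :* g) S.refl (T m) f g)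
      (S.+-cong (S.sym e) (S.trans (S.*-congˡ {T m} eg) (T-* m w)))))

    zero-bounded : ∀ k → Bounded k 0S
    zero-bounded k = S.refl

    power-T : ∀ j n → at j X ^ n ≃ T (at j ((n , 0 , 0) , (0 , n , 0) , (0 , 0 , n)))
    power-T j zero with j
    ... | c₁ = S.refl
    ... | c₂ = S.refl
    ... | c₃ = S.refl
    power-T c₁ (suc n) = S.trans (S.*-congˡ {at c₁ X} (power-T c₁ n)) (T-* (1 , 0 , 0) (n , 0 , 0))
    power-T c₂ (suc n) = S.trans (S.*-congˡ {at c₂ X} (power-T c₂ n)) (T-* (0 , 1 , 0) (0 , n , 0))
    power-T c₃ (suc n) = S.trans (S.*-congˡ {at c₃ X} (power-T c₃ n)) (T-* (0 , 0 , 1) (0 , 0 , n))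

    variable-*-power : ∀ i j m m' → at i X ≡ T m → at j X ^ q ≃ T m' → at i X *ₚ at j X ^ q ≃ T (monoMul m m')
    variable-*-power i j m m' e e' = S.trans (S.*-cong (S.reflexive e) e') (T-* m m')

    -- The entry z x^q - x z^q of N moves degree q - 1 from x to z.
    step-xz : ∀ {k} a b c → a ℕ.+ (b ℕ.+ c) ℕ.≤ k → Reduces k (T (a ℕ.+ q , b ℕ.+ 0 , c ℕ.+ 1)) (T (a ℕ.+ 1 , b ℕ.+ 0 , c ℕ.+ q))
    step-xz {k} a b c le = step (at c₃ X *ₚ at c₁ X ^ q) (at c₁ X *ₚ at c₃ X ^ q) (a , b , c) (q , 0 , 1) (1 , 0 , q) le
      ((0S , T (a , b , c) , 0S) , (zero-bounded k , T-bounded (a , b , c) le , zero-bounded k) ,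
        solve 4 (λ t n x z → con ℤ.0ℤ :* x :+ (t :* n :+ con ℤ.0ℤ :* z) := t :* n) S.refl (T (a , b , c)) (at c₂ N) (at c₁ N) (at c₃ N))
      (variable-*-power c₃ c₁ (0 , 0 , 1) (q , 0 , 0) ≡.refl (power-T c₁ q))
      (S.trans (variable-*-power c₁ c₃ (1 , 0 , 0) (0 , 0 , q) ≡.refl (power-T c₃ q)) S.refl)

    -- Here and in `step-xy` the entry of N is the new monomial minus the old one, hence the negated
    -- multiplier.
    step-yz : ∀ {k} a b c → a ℕ.+ (b ℕ.+ c) ℕ.≤ k → Reduces k (T (a ℕ.+ 0 , b ℕ.+ q , c ℕ.+ 1)) (T (a ℕ.+ 0 , b ℕ.+ 1 , c ℕ.+ q))
    step-yz {k} a b c le = step (at c₃ X *ₚ at c₂ X ^ q) (at c₂ X *ₚ at c₃ X ^ q) (a , b , c) (0 , q , 1) (0 , 1 , q) le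
      ((negₚ (T (a , b , c)) , 0S , 0S) , (D.Supported-neg (D.upto k) (T (a , b , c)) (T-bounded (a , b , c) le) , zero-bounded k , zero-bounded k) ,
        solve 5 (λ t f g y z → (:- t) :* (g :- f) :+ (con ℤ.0ℤ :* y :+ con ℤ.0ℤ :* z) := t :* (f :- g)) S.refl (T (a , b , c)) (at c₃ X *ₚ at c₂ X ^ q) (at c₂ X *ₚ at c₃ X ^ q) (at c₂ N) (at c₃ N))
      (variable-*-power c₃ c₂ (0 , 0 , 1) (0 , q , 0) ≡.refl (power-T c₂ q))
      (variable-*-power c₂ c₃ (0 , 1 , 0) (0 , 0 , q) ≡.refl (power-T c₃ q))

    step-xy : ∀ {k} a b c → a ℕ.+ (b ℕ.+ c) ℕ.≤ k → Reduces k (T (a ℕ.+ q , b ℕ.+ 1 , c ℕ.+ 0)) (T (a ℕ.+ 1 , b ℕ.+ q , c ℕ.+ 0))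
    step-xy {k} a b c le = step (at c₂ X *ₚ at c₁ X ^ q) (at c₁ X *ₚ at c₂ X ^ q) (a , b , c) (q , 1 , 0) (1 , q , 0) le
      ((0S , 0S , negₚ (T (a , b , c))) , (zero-bounded k , zero-bounded k , D.Supported-neg (D.upto k) (T (a , b , c)) (T-bounded (a , b , c) le)) ,
        solve 5 (λ t f g x y → con ℤ.0ℤ :* x :+ (con ℤ.0ℤ :* y :+ (:- t) :* (g :- f)) := t :* (f :- g)) S.refl (T (a , b , c)) (at c₂ X *ₚ at c₁ X ^ q) (at c₁ X *ₚ at c₂ X ^ q) (at c₁ N) (at c₂ N))
      (variable-*-power c₂ c₁ (0 , 1 , 0) (q , 0 , 0) ≡.refl (power-T c₁ q))
      (variable-*-power c₁ c₂ (1 , 0 , 0) (0 , q , 0) ≡.refl (power-T c₂ q))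

    -- The entries of N have degree q + 1, so a multiplier of degree s acts on monomials of degree q
    -- + 1 + s.
    bound : ∀ {d} s → suc q ℕ.+ s ≡ d → s ℕ.≤ d ℕ.∸ suc q
    bound s ≡.refl = ℕP.≤-reflexive (≡.sym (ℕP.m+n∸m≡n (suc q) s))

    shrink : ∀ a n → a ℕ.+ q ℕ.≤ suc n → a ℕ.+ 1 ℕ.≤ n
    shrink a n le = ℕP.≤-pred (ℕP.≤-trans (ℕP.≤-reflexive (≡.sym (ℕP.+-suc a 1))) (ℕP.≤-trans (ℕP.+-monoʳ-≤ a 1<q) le))

    over : ∀ {a} → ¬ (a ℕ.< q) → Σ ℕ λ a' → a ≡ a' ℕ.+ q
    over {a} a≮q = a ℕ.∸ q , ≡.sym (ℕP.m∸n+n≡m (ℕP.≮⇒≥ a≮q))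

    open ℕSolver using () renaming (solve to solveℕ; _:+_ to _⊕_; con to conℕ; _:=_ to _⊜_)

    cast : ∀ {k m m' r} → m ≡ m' → Reduces k (T m) r → Reduces k (T m') r
    cast ≡.refl h = h

    -- Each step replaces the exponent a' + q of x by a' + 1, which is smaller since q > 1; n bounds
    -- the exponent. The variable z occurs from the start, as it has to absorb the degree.
    reduce-x : ∀ n a b c d → a ℕ.≤ n → a ℕ.+ (b ℕ.+ suc c) ≡ d → Σ ℕ λ a' → Σ ℕ λ c' →
      a' ℕ.< q × a' ℕ.+ (b ℕ.+ suc c') ≡ d × Reduces (d ℕ.∸ suc q) (T (a , b , suc c)) (T (a' , b , suc c'))
    reduce-x n a b c d le e with a ℕ.<? q
    ... | yes a<q = a , c , a<q , e , reduces-refl (T (a , b , suc c))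
    ... | no a≮q with over a≮q
    reduce-x zero _ b c d le e | no a≮q | a' , ≡.refl = ⊥-elim (a≮q (ℕP.≤-<-trans le (ℕP.<⇒≤ 1<q)))
    reduce-x (suc n) _ b c d le e | no a≮q | a' , ≡.refl
      with reduce-x n (a' ℕ.+ 1) b (c ℕ.+ q ℕ.∸ 1) d (shrink a' n le)
             (≡.trans (≡.cong (λ z → a' ℕ.+ 1 ℕ.+ (b ℕ.+ z)) suc-pred) (≡.trans (solveℕ 4 (λ a b c q → a ⊕ conℕ 1 ⊕ (b ⊕ (c ⊕ q)) ⊜ a ⊕ q ⊕ (b ⊕ (conℕ 1 ⊕ c))) ≡.refl a' b c q) e))
      where
      suc-pred : suc (c ℕ.+ q ℕ.∸ 1) ≡ c ℕ.+ q
      suc-pred = ℕP.m+[n∸m]≡n (ℕP.≤-trans (ℕP.<⇒≤ 1<q) (ℕP.m≤n+m q c))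
    ...   | a'' , c'' , lt , e' , r = a'' , c'' , lt , e' , reduces-trans
              (cast (≡.cong₂ _,_ ≡.refl (≡.cong₂ _,_ (ℕP.+-identityʳ b) (ℕP.+-comm c 1)))
                (step-xz a' b c (bound (a' ℕ.+ (b ℕ.+ c)) (≡.trans (solveℕ 4 (λ a b c q → conℕ 1 ⊕ q ⊕ (a ⊕ (b ⊕ c)) ⊜ a ⊕ q ⊕ (b ⊕ (conℕ 1 ⊕ c))) ≡.refl a' b c q) e))))
              (cast (≡.cong₂ _,_ ≡.refl (≡.cong₂ _,_ (≡.sym (ℕP.+-identityʳ b)) (ℕP.m+[n∸m]≡n (ℕP.≤-trans (ℕP.<⇒≤ 1<q) (ℕP.m≤n+m q c))))) r)

    reduce-y : ∀ n a b c d → b ℕ.≤ n → a ℕ.+ (b ℕ.+ suc c) ≡ d → Σ ℕ λ b' → Σ ℕ λ c' →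
      b' ℕ.< q × a ℕ.+ (b' ℕ.+ suc c') ≡ d × Reduces (d ℕ.∸ suc q) (T (a , b , suc c)) (T (a , b' , suc c'))
    reduce-y n a b c d le e with b ℕ.<? q
    ... | yes b<q = b , c , b<q , e , reduces-refl (T (a , b , suc c))
    ... | no b≮q with over b≮q
    reduce-y zero a _ c d le e | no b≮q | b' , ≡.refl = ⊥-elim (b≮q (ℕP.≤-<-trans le (ℕP.<⇒≤ 1<q)))
    reduce-y (suc n) a _ c d le e | no b≮q | b' , ≡.refl
      with reduce-y n a (b' ℕ.+ 1) (c ℕ.+ q ℕ.∸ 1) d (shrink b' n le)
             (≡.trans (≡.cong (λ z → a ℕ.+ (b' ℕ.+ 1 ℕ.+ z)) suc-pred) (≡.trans (solveℕ 4 (λ a b c q → a ⊕ (b ⊕ conℕ 1 ⊕ (c ⊕ q)) ⊜ a ⊕ (b ⊕ q ⊕ (conℕ 1 ⊕ c))) ≡.refl a b' c q) e))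
      where
      suc-pred : suc (c ℕ.+ q ℕ.∸ 1) ≡ c ℕ.+ q
      suc-pred = ℕP.m+[n∸m]≡n (ℕP.≤-trans (ℕP.<⇒≤ 1<q) (ℕP.m≤n+m q c))
    ...   | b'' , c'' , lt , e' , r = b'' , c'' , lt , e' , reduces-trans
              (cast (≡.cong₂ _,_ (ℕP.+-identityʳ a) (≡.cong₂ _,_ ≡.refl (ℕP.+-comm c 1)))
                (step-yz a b' c (bound (a ℕ.+ (b' ℕ.+ c)) (≡.trans (solveℕ 4 (λ a b c q → conℕ 1 ⊕ q ⊕ (a ⊕ (b ⊕ c)) ⊜ a ⊕ (b ⊕ q ⊕ (conℕ 1 ⊕ c))) ≡.refl a b' c q) e))))
              (cast (≡.cong₂ _,_ (≡.sym (ℕP.+-identityʳ a)) (≡.cong₂ _,_ ≡.refl (ℕP.m+[n∸m]≡n (ℕP.≤-trans (ℕP.<⇒≤ 1<q) (ℕP.m≤n+m q c))))) r)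

    reduce-xy : ∀ n a b d → a ℕ.≤ n → a ℕ.+ (suc b ℕ.+ 0) ≡ d → Σ ℕ λ a' → Σ ℕ λ b' →
      a' ℕ.< q × a' ℕ.+ (suc b' ℕ.+ 0) ≡ d × Reduces (d ℕ.∸ suc q) (T (a , suc b , 0)) (T (a' , suc b' , 0))
    reduce-xy n a b d le e with a ℕ.<? q
    ... | yes a<q = a , b , a<q , e , reduces-refl (T (a , suc b , 0))
    ... | no a≮q with over a≮q
    reduce-xy zero _ b d le e | no a≮q | a' , ≡.refl = ⊥-elim (a≮q (ℕP.≤-<-trans le (ℕP.<⇒≤ 1<q)))
    reduce-xy (suc n) _ b d le e | no a≮q | a' , ≡.refl
      with reduce-xy n (a' ℕ.+ 1) (b ℕ.+ q ℕ.∸ 1) d (shrink a' n le)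
             (≡.trans (≡.cong (λ z → a' ℕ.+ 1 ℕ.+ (z ℕ.+ 0)) suc-pred) (≡.trans (solveℕ 3 (λ a b q → a ⊕ conℕ 1 ⊕ (b ⊕ q ⊕ conℕ 0) ⊜ a ⊕ q ⊕ (conℕ 1 ⊕ b ⊕ conℕ 0)) ≡.refl a' b q) e))
      where
      suc-pred : suc (b ℕ.+ q ℕ.∸ 1) ≡ b ℕ.+ q
      suc-pred = ℕP.m+[n∸m]≡n (ℕP.≤-trans (ℕP.<⇒≤ 1<q) (ℕP.m≤n+m q b))
    ...   | a'' , b'' , lt , e' , r = a'' , b'' , lt , e' , reduces-trans
              (cast (≡.cong₂ _,_ ≡.refl (≡.cong₂ _,_ (ℕP.+-comm b 1) ≡.refl))
                (step-xy a' b 0 (bound (a' ℕ.+ (b ℕ.+ 0)) (≡.trans (solveℕ 3 (λ a b q → conℕ 1 ⊕ q ⊕ (a ⊕ (b ⊕ conℕ 0)) ⊜ a ⊕ q ⊕ (conℕ 1 ⊕ b ⊕ conℕ 0)) ≡.refl a' b q) e))))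
              (cast (≡.cong₂ _,_ ≡.refl (≡.cong₂ _,_ (ℕP.m+[n∸m]≡n (ℕP.≤-trans (ℕP.<⇒≤ 1<q) (ℕP.m≤n+m q b))) ≡.refl)) r)

  -- Normal monomials modulo N, sorted by the last variable that occurs.
  NormalX NormalY NormalZ : ℕ → Mono → Set
  NormalX d (a , b , c) = a ≡ d × b ≡ 0 × c ≡ 0
  NormalY d (a , b , c) = a ℕ.< q × (Σ ℕ λ b' → b ≡ suc b') × c ≡ 0 × a ℕ.+ (b ℕ.+ c) ≡ d
  NormalZ d (a , b , c) = a ℕ.< q × b ℕ.< q × (Σ ℕ λ c' → c ≡ suc c') × a ℕ.+ (b ℕ.+ c) ≡ d

  private
    -- If z occurs, x and then y are lowered against z; otherwise, if y occurs, x is lowered against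
    -- y; a pure power of x stays.
    normalise : ∀ d m → deg m ≡ d → Σ Mono λ m' → (NormalX d m' ⊎ NormalY d m' ⊎ NormalZ d m') × Reduces (d ℕ.∸ suc q) (T m) (T m')
    normalise d (a , 0 , 0) e = (a , 0 , 0) , inj₁ (≡.trans (≡.sym (ℕP.+-identityʳ a)) e , ≡.refl , ≡.refl) , reduces-refl (T (a , 0 , 0))
    normalise d (a , suc b , 0) e with reduce-xy a a b d ℕP.≤-refl e
    ... | a' , b' , lt , e' , r = (a' , suc b' , 0) , inj₂ (inj₁ (lt , (b' , ≡.refl) , ≡.refl , e')) , r
    normalise d (a , b , suc c) e with reduce-x a a b c d ℕP.≤-refl e
    ... | a' , c' , lt , e' , r with reduce-y b a' b c' d ℕP.≤-refl e'
    ...   | b'' , c'' , lt' , e'' , r' = (a' , b'' , suc c'') , inj₂ (inj₂ (lt , lt' , (c'' , ≡.refl) , e'')) , reduces-trans r r'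

  Each : (Mono → Set) → SPoly → Set
  Each P = All (λ t → P (proj₂ t))

  private
    normal-form : ∀ d f → Each (λ m → deg m ≡ d) f → Σ SPoly λ r₁ → Σ SPoly λ r₂ → Σ SPoly λ r₃ →
      Each (NormalX d) r₁ × Each (NormalY d) r₂ × Each (NormalZ d) r₃ × Reduces (d ℕ.∸ suc q) f (r₁ +ₚ (r₂ +ₚ r₃))
    normal-form d [] [] = [] , [] , [] , [] , [] , [] , reduces-≃ S.refl (S.sym (S.trans (S.+-identityˡ _) (S.+-identityˡ 0S))) (reduces-refl [])
    normal-form d ((c , m) ∷ f) (e ∷ h) with normal-form d f h | normalise d m e
    ... | r₁ , r₂ , r₃ , n₁ , n₂ , n₃ , r | m' , n , s = place n
      where
      combined : Reduces (d ℕ.∸ suc q) ((c , m) ∷ f) (((c , m') ∷ []) +ₚ (r₁ +ₚ (r₂ +ₚ r₃)))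
      combined = reduces-≃ (S.trans (S.+-congʳ (unit m)) (S.reflexive (≡.sym (∷-+ₚ (c , m) f)))) (S.+-congʳ (unit m')) (reduces-+ (reduces-const c s) r)
        where
        unit : ∀ m → constS c *ₚ T m ≃ (c , m) ∷ []
        unit m = S.trans (S.reflexive (term-* c 1# (0 , 0 , 0) m)) (term-cong (*-identityʳ c))
      t = (c , m') ∷ []
      cons : ∀ r → t +ₚ r ≃ (c , m') ∷ r
      cons r = S.reflexive (≡.sym (∷-+ₚ (c , m') r))
      place : NormalX d m' ⊎ NormalY d m' ⊎ NormalZ d m' → _
      place (inj₁ n) = (c , m') ∷ r₁ , r₂ , r₃ , n ∷ n₁ , n₂ , n₃ ,
        reduces-≃ S.refl (S.trans (S.sym (S.+-assoc t r₁ (r₂ +ₚ r₃))) (S.+-congʳ (cons r₁))) combined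
      place (inj₂ (inj₁ n)) = r₁ , (c , m') ∷ r₂ , r₃ , n₁ , n ∷ n₂ , n₃ , reduces-≃ S.refl
        (S.trans (solve 4 (λ t a b c → t :+ (a :+ (b :+ c)) := a :+ ((t :+ b) :+ c)) S.refl t r₁ r₂ r₃) (S.+-congˡ {r₁} (S.+-congʳ (cons r₂)))) combined
      place (inj₂ (inj₂ n)) = r₁ , r₂ , (c , m') ∷ r₃ , n₁ , n₂ , n ∷ n₃ , reduces-≃ S.refl
        (S.trans (solve 4 (λ t a b c → t :+ (a :+ (b :+ c)) := a :+ (b :+ (t :+ c))) S.refl t r₁ r₂ r₃) (S.+-congˡ {r₁} (S.+-congˡ {r₂} (cons r₃)))) combined

  private
    δ : ℕ → ℕ → Carrier
    δ j k = if j ℕ.≡ᵇ k then 1# else 0#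

    δ-≡ : ∀ {j k} → j ≡ k → δ j k ≡ 1#
    δ-≡ {j} e rewrite D.only-true {j} e = ≡.refl

    δ-≢ : ∀ {j k} → j ≢ k → δ j k ≡ 0#
    δ-≢ {j} ne rewrite D.only-false {j} ne = ≡.refl

    indicator-≡ : ∀ m {m'} → m ≡ m' → indicator m m' ≡ 1#
    indicator-≡ m ≡.refl rewrite monoEq-refl m = ≡.refl

    indicator-≢ : ∀ m {m'} → m ≢ m' → indicator m m' ≡ 0#
    indicator-≢ m ne rewrite monoEq-≢ ne = ≡.refl

    lin-each : ∀ r {φ ψ} → Each (λ m → φ m ≈ ψ m) r → LF.lin r φ ≈ LF.lin r ψ
    lin-each [] [] = refl
    lin-each (t ∷ r) (e ∷ h) = +-cong (*-congˡ e) (lin-each r h)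

    lin-each-0 : ∀ r {φ} → Each (λ m → φ m ≈ 0#) r → LF.lin r φ ≈ 0#
    lin-each-0 r h = trans (lin-each r h) (LF.lin-0 r)

    module _ (w : Mono → ℕ) (ψ : Mono → Carrier) (r : SPoly) where
      -- Here r is read as a polynomial in one variable with exponent w m, where ψ m is the value of
      -- the remaining factors of m. This is its j-th coefficient.
      coefficient : ℕ → Carrier
      coefficient j = LF.lin r (λ m → δ j (w m) * ψ m)

      coefficients : ℕ → ℕ → List Carrier
      coefficients k zero = []
      coefficients k (suc n) = coefficient k ∷ coefficients (suc k) n

      -- Horner's scheme at x for the indicator sequence of i on k, ..., k + n - 1: it equals x^(i -
      -- k) if i lies in this range. It lets a Horner value be computed term by term.
      powers : Carrier → ℕ → ℕ → ℕ → Carrier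
      powers x k zero i = 0#
      powers x k (suc n) i = δ k i + x * powers x (suc k) n i

      powers-below : ∀ x k n i → i ℕ.< k → powers x k n i ≈ 0#
      powers-below x k zero i _ = refl
      powers-below x k (suc n) i lt = trans (+-cong (reflexive (δ-≢ λ e → ℕP.<-irrefl (≡.sym e) lt))
        (trans (*-congˡ (powers-below x (suc k) n i (ℕP.m≤n⇒m≤1+n lt))) (zeroʳ x))) (+-identityˡ 0#)

      powers-^ : ∀ x k n i → i ℕ.< n → powers x k n (k ℕ.+ i) ≈ x ^F i
      powers-^ x k (suc n) zero _ rewrite ℕP.+-identityʳ k = trans (+-cong (reflexive (δ-≡ {k} ≡.refl))
        (trans (*-congˡ (powers-below x (suc k) n k ℕP.≤-refl)) (zeroʳ x))) (+-identityʳ 1#)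
      powers-^ x k (suc n) (suc i) (s≤s lt) rewrite ℕP.+-suc k i = trans (+-congʳ (reflexive (δ-≢ {k} λ e → ℕP.<-irrefl e (s≤s (ℕP.m≤m+n k i)))))
        (trans (+-identityˡ _) (*-congˡ (powers-^ x (suc k) n i lt)))

      horner-coefficients : ∀ x k n → horner (coefficients k n) x ≈ LF.lin r (λ m → powers x k n (w m) * ψ m)
      horner-coefficients x k zero = sym (lin-each-0 r (All.universal (λ _ → zeroˡ _) r))
      horner-coefficients x k (suc n) = trans (+-congˡ (trans (*-congˡ (horner-coefficients x (suc k) n)) (sym (LF.lin-* r x _))))
        (trans (sym (LF.lin-+ r _ _)) (LF.lin-congʳ r λ m → trans (+-congˡ (sym (*-assoc x _ _))) (sym (distribʳ (ψ m) _ _))))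

      all-coefficients : ∀ k n → All (_≈ 0#) (coefficients k n) → ∀ j → j ℕ.< n → coefficient (k ℕ.+ j) ≈ 0#
      all-coefficients k (suc n) (e ∷ _) zero _ rewrite ℕP.+-identityʳ k = e
      all-coefficients k (suc n) (_ ∷ es) (suc j) (s≤s lt) rewrite ℕP.+-suc k j = all-coefficients (suc k) n es j lt

      length-coefficients : ∀ k n → length (coefficients k n) ≡ n
      length-coefficients k zero = ≡.refl
      length-coefficients k (suc n) = ≡.cong suc (length-coefficients (suc k) n)

      -- Exponents below q leave at most q coefficients, so vanishing at every element of F forces
      -- each of them to be zero.
      coefficient-0 : Each (λ m → w m ℕ.< q) r → (∀ x → LF.lin r (λ m → (x ^F w m) * ψ m) ≈ 0#) → ∀ j → coefficient j ≈ 0#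
      coefficient-0 lt vanish j with j ℕ.<? q
      ... | yes j<q = all-coefficients 0 q (vanishing⇒zero (coefficients 0 q) (ℕP.≤-reflexive (length-coefficients 0 q))
              (λ x → trans (horner-coefficients x 0 q) (trans (lin-each r (All.map (λ {t} l → *-congʳ (powers-^ x 0 q (w (proj₂ t)) l)) lt)) (vanish x)))) j j<q
      ... | no j≮q = lin-each-0 r (All.map (λ l → trans (*-congʳ (reflexive (δ-≢ λ e → j≮q (≡.subst (ℕ._< q) (≡.sym e) l)))) (zeroˡ _)) lt)

    ≃0-from-indicators : ∀ r → (∀ m → LF.lin r (indicator m) ≈ 0#) → r ≃ 0S
    ≃0-from-indicators r h = coeffwise λ m → trans (coeffS-linear r m) (h m)

    one^ : ∀ n → 1# ^F n ≈ 1#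
    one^ zero = refl
    one^ (suc n) = trans (*-identityˡ _) (one^ n)

    suc-witness : ∀ {n} → (Σ ℕ λ k → n ≡ suc k) → 0# ^F n ≈ 0#
    suc-witness (k , ≡.refl) = zeroˡ _

    zero-witness : ∀ {n} → n ≡ 0 → 0# ^F n ≈ 1#
    zero-witness ≡.refl = refl

    normalX-zero : ∀ d r → Each (NormalX d) r → EF.eval (1# , 0# , 0#) r ≈ 0# → r ≃ 0S
    normalX-zero d r n ev = ≃0-from-indicators r λ m → trans
        (lin-each r {ψ = λ m' → indicator m (d , 0 , 0) * EF.monomial (1# , 0# , 0#) m'} (All.map (λ { {_ , _} (≡.refl , ≡.refl , ≡.refl) →
          sym (trans (*-congˡ (trans (*-congʳ (one^ d)) (trans (*-identityˡ _) (*-identityˡ _)))) (*-identityʳ _)) }) n))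
        (trans (LF.lin-* r _ _) (trans (*-congˡ ev) (zeroʳ _)))

    -- In degree d the exponent of x determines the monomial x^a y^(d - a), so setting y = 1 loses
    -- no coefficient.
    normalY-zero : ∀ d r → Each (NormalY d) r → (∀ x → EF.eval (x , 1# , 0#) r ≈ 0#) → r ≃ 0S
    normalY-zero d r n ev = ≃0-from-indicators r go
      where
      coefficients-0 : ∀ j → LF.lin r (λ m → δ j (proj₁ m) * 1#) ≈ 0#
      coefficients-0 = coefficient-0 proj₁ (λ _ → 1#) r (All.map proj₁ n) λ x → trans
        (lin-each r (All.map (λ { {_ , _ , b , _} (_ , _ , c≡0 , _) → *-congˡ (sym (trans (*-cong (one^ b) (zero-witness c≡0)) (*-identityˡ 1#))) }) n)) (ev x)
      go : ∀ m → LF.lin r (indicator m) ≈ 0#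
      go m@(a , b , c) with c ℕ.≟ 0 | a ℕ.+ (b ℕ.+ c) ℕ.≟ d
      ... | no c≢0 | _ = lin-each-0 r (All.map (λ { {_ , m'} (_ , _ , c'≡0 , _) → reflexive (indicator-≢ m {m'} λ e → c≢0 (≡.trans (≡.cong (proj₂ ∘ proj₂) e) c'≡0)) }) n)
      ... | yes _ | no ≢d = lin-each-0 r (All.map (λ { {_ , m'} (_ , _ , _ , e') → reflexive (indicator-≢ m {m'} λ e → ≢d (≡.trans (≡.cong deg e) e')) }) n)
      ... | yes ≡.refl | yes e = trans (lin-each r (All.map (λ {t} → match (proj₂ t)) n)) (coefficients-0 a)
        where
        match : ∀ m' → NormalY d m' → indicator m m' ≈ δ a (proj₁ m') * 1#
        match (a' , b' , _) (_ , _ , ≡.refl , e') with a ℕ.≟ a'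
        ... | no ne = trans (reflexive (indicator-≢ m {a' , b' , 0} (ne ∘ ≡.cong proj₁))) (sym (trans (*-congʳ (reflexive (δ-≢ ne))) (zeroˡ _)))
        ... | yes ≡.refl = trans (reflexive (indicator-≡ m (≡.cong (λ b → a , b , 0) (ℕP.+-cancelʳ-≡ 0 b b' (ℕP.+-cancelˡ-≡ a (b ℕ.+ 0) (b' ℕ.+ 0) (≡.trans e (≡.sym e')))))))
              (sym (trans (*-congʳ (reflexive (δ-≡ {a} ≡.refl))) (*-identityˡ _)))

    -- With z = 1, first x and then y is taken as the single variable; both exponents are below q,
    -- and together they determine the monomial in degree d.
    normalZ-zero : ∀ d r → Each (NormalZ d) r → (∀ x y → EF.eval (x , y , 1#) r ≈ 0#) → r ≃ 0S
    normalZ-zero d r n ev = ≃0-from-indicators r go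
      where
      in-x : ∀ y j → LF.lin r (λ m → δ j (proj₁ m) * (y ^F proj₁ (proj₂ m))) ≈ 0#
      in-x y = coefficient-0 proj₁ (λ m → y ^F proj₁ (proj₂ m)) r (All.map proj₁ n) λ x → trans
        (LF.lin-congʳ r λ (a , b , c) → *-congˡ (sym (trans (*-congˡ (one^ c)) (*-identityʳ _)))) (ev x y)
      in-xy : ∀ j k → LF.lin r (λ m → δ k (proj₁ (proj₂ m)) * δ j (proj₁ m)) ≈ 0#
      in-xy j = coefficient-0 (proj₁ ∘ proj₂) (λ m → δ j (proj₁ m)) r (All.map (proj₁ ∘ proj₂) n) λ y →
        trans (LF.lin-congʳ r λ m → *-comm _ _) (in-x y j)
      go : ∀ m → LF.lin r (indicator m) ≈ 0#
      go m@(a , b , c) with a ℕ.+ (b ℕ.+ c) ℕ.≟ d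
      ... | no ≢d = lin-each-0 r (All.map (λ { {_ , m'} (_ , _ , _ , e') → reflexive (indicator-≢ m {m'} λ e → ≢d (≡.trans (≡.cong deg e) e')) }) n)
      ... | yes e = trans (lin-each r (All.map (λ {t} → match (proj₂ t)) n)) (in-xy a b)
        where
        match : ∀ m' → NormalZ d m' → indicator m m' ≈ δ b (proj₁ (proj₂ m')) * δ a (proj₁ m')
        match (a' , b' , c') (_ , _ , _ , e') with a ℕ.≟ a' | b ℕ.≟ b'
        ... | no ne | _ = trans (reflexive (indicator-≢ m (ne ∘ ≡.cong proj₁))) (sym (trans (*-congˡ (reflexive (δ-≢ ne))) (zeroʳ _)))
        ... | yes ≡.refl | no ne = trans (reflexive (indicator-≢ m (ne ∘ ≡.cong (proj₁ ∘ proj₂)))) (sym (trans (*-congʳ (reflexive (δ-≢ ne))) (zeroˡ _)))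
        ... | yes ≡.refl | yes ≡.refl = trans (reflexive (indicator-≡ m (≡.cong (λ c → a , b , c) (ℕP.+-cancelˡ-≡ b c c' (ℕP.+-cancelˡ-≡ a (b ℕ.+ c) (b ℕ.+ c') (≡.trans e (≡.sym e')))))))
              (sym (trans (*-cong (reflexive (δ-≡ {b} ≡.refl)) (reflexive (δ-≡ {a} ≡.refl))) (*-identityˡ _)))

  -- At a rational point X^q takes the same value as X.
  N-at-point : ∀ s → VF._≋_ (HF.eval³ s N) VF.𝟘
  N-at-point s@(x , y , z) = VF.≋-trans (HF.eval-⨯ s X Xq) (VF.≋-trans (VF.⨯-cong (HF.eval-X³ s) (go c₁ , go c₂ , go c₃))
      (VF.≋-trans (minor y z , minor z x , minor x y) VF.≋-refl))
    where
    go : ∀ j → EF.eval s (at j X ^ q) ≈ at j s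
    go j = trans (HF.eval-^ s (at j X) q) (trans (fermat _) (HF.eval-variable s j))
    minor : ∀ a b → a * b - b * a ≈ 0#
    minor a b = trans (+-congˡ (-‿cong (*-comm b a))) (-‿inverseʳ _)

  ⊙N-at-point : ∀ s v → EF.eval s (v ⊙ N) ≈ 0#
  ⊙N-at-point s v = trans (HF.eval-⊙ s v N) (trans (VF.⊙-cong (VF.≋-refl {HF.eval³ s v}) (N-at-point s))
    (trans (+-cong (zeroʳ _) (trans (+-cong (zeroʳ _) (zeroʳ _)) (+-identityˡ 0#))) (+-identityˡ 0#)))

  -- The normal form of f vanishes at all points too. At (1, 0, 0) only powers of x survive, at (x,
  -- 1, 0) only monomials without z, at (x, y, 1) all; so the three classes are shown to be zero in
  -- this order.
  vanishing-ideal : ∀ d f → Homogeneous d f → (∀ s → EF.eval s f ≈ 0#) → Σ R³ λ v → Bounded³ (d ℕ.∸ suc q) v × f ≃ v ⊙ N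
  vanishing-ideal d f hom vanish with normal-form d (D.comp d f) (All.map (λ {t} e → ≡.sym (D.only-true⁻ {d} {deg (proj₂ t)} e)) (D.part-terms (D.only d) f))
  ... | r₁ , r₂ , r₃ , n₁ , n₂ , n₃ , (v , b , e) = v , b ,
        S.trans (S.sym hom) (S.trans e (S.trans (S.+-congˡ {v ⊙ N} (S.+-cong r₁≃0 (S.+-cong r₂≃0 r₃≃0))) (S.trans (S.+-congˡ {v ⊙ N} (S.trans (S.+-identityˡ _) (S.+-identityˡ 0S))) (S.+-identityʳ (v ⊙ N)))))
    where
    total : ∀ s → EF.eval s r₁ + (EF.eval s r₂ + EF.eval s r₃) ≈ 0#
    total s = trans (sym (trans (EF.eval-+ s r₁ (r₂ +ₚ r₃)) (+-congˡ (EF.eval-+ s r₂ r₃))))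
      (trans (sym (+-identityˡ _)) (trans (+-congʳ (sym (⊙N-at-point s v)))
        (trans (sym (EF.eval-+ s (v ⊙ N) (r₁ +ₚ (r₂ +ₚ r₃)))) (trans (EF.eval-cong s (S.trans (S.sym e) hom)) (vanish s)))))
    r₃-off : ∀ x y → EF.eval (x , y , 0#) r₃ ≈ 0#
    r₃-off x y = lin-each-0 r₃ (All.map (λ { {_ , _} (_ , _ , w , _) → trans (*-congˡ (trans (*-congˡ (suc-witness w)) (zeroʳ _))) (zeroʳ _) }) n₃)
    r₂-off : ∀ x → EF.eval (x , 0# , 0#) r₂ ≈ 0#
    r₂-off x = lin-each-0 r₂ (All.map (λ { {_ , _} (_ , w , _ , _) → trans (*-congˡ (trans (*-congʳ (suc-witness w)) (zeroˡ _))) (zeroʳ _) }) n₂)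
    r₁≃0 : r₁ ≃ 0S
    r₁≃0 = normalX-zero d r₁ n₁ (trans (sym (trans (+-congˡ (trans (+-cong (r₂-off 1#) (r₃-off 1# 0#)) (+-identityˡ 0#))) (+-identityʳ _))) (total (1# , 0# , 0#)))
    r₁-off : ∀ s → EF.eval s r₁ ≈ 0#
    r₁-off s = EF.eval-cong s r₁≃0
    r₂≃0 : r₂ ≃ 0S
    r₂≃0 = normalY-zero d r₂ n₂ λ x → trans (sym (trans (+-cong (r₁-off _) (trans (+-congˡ (r₃-off x 1#)) (+-identityʳ _))) (+-identityˡ _))) (total (x , 1# , 0#))
    r₃≃0 : r₃ ≃ 0S
    r₃≃0 = normalZ-zero d r₃ n₃ λ x y → trans (sym (trans (+-cong (r₁-off _) (trans (+-congʳ (EF.eval-cong (x , y , 1#) r₂≃0)) (+-identityˡ _))) (+-identityˡ _))) (total (x , y , 1#))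

-- From few missed points to a basis.

module Construction {q : ℕ} (F : FiniteField q) where
  open FiniteField F hiding (zero; _≟_)
  open FiniteField F using (_≟_)
  open Arr F hiding (μ; L; dim; size; _+S_; _*S_)
  open Polynomials F
  open FieldLemmas F
  open LinearForms F
  open Derivations F
  open DualNumbers F
  open VanishingIdeal F
  open VS using (R³; det)
  open VF using (_≋_; _⨯_; _⊙_; _•_; 𝟘)
  open RingSolver commRing

  Parallel : V3 → V3 → Set
  Parallel u v = u ⨯ v ≋ 𝟘

  Missing : Arrangement → V3 → Set
  Missing A s = ¬ (EF.eval s (product (forms A)) ≈ 0#)

  bounded-det : ∀ {a b} v w → Bounded³ a v → Bounded³ b w → Bounded (1 ℕ.+ (a ℕ.+ b)) (det X v w)
  bounded-det {a} {b} (v₁ , v₂ , v₃) (w₁ , w₂ , w₃) (p₁ , p₂ , p₃) (r₁ , r₂ , r₃) =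
    sum (at c₁ X *ₚ _) _ (times (at c₁ X) _ S.refl (minor v₂ w₃ v₃ w₂ p₂ r₃ p₃ r₂))
      (sum (at c₂ X *ₚ _) _ (times (at c₂ X) _ S.refl (minor v₃ w₁ v₁ w₃ p₃ r₁ p₁ r₃))
        (times (at c₃ X) _ S.refl (minor v₁ w₂ v₂ w₁ p₁ r₂ p₂ r₁)))
    where
    sum : ∀ {k} f g → Bounded k f → Bounded k g → Bounded k (f +ₚ g)
    sum {k} f g = D.Supported-+ (D.upto k) f g
    times : ∀ {k} x f → Bounded 1 x → Bounded k f → Bounded (1 ℕ.+ k) (x *ₚ f)
    times {k} x f = D.Bounded-* {1} {k} x f
    minor : ∀ f g f' g' → Bounded a f → Bounded b g → Bounded a f' → Bounded b g' → Bounded (a ℕ.+ b) (f *ₚ g +ₚ negₚ (f' *ₚ g'))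
    minor f g f' g' p r p' r' = sum (f *ₚ g) (negₚ (f' *ₚ g')) (D.Bounded-* {a} {b} f g p r)
      (D.Supported-neg (D.upto (a ℕ.+ b)) (f' *ₚ g') (D.Bounded-* {a} {b} f' g' p' r'))

  -- The auxiliary form f attached to the point s. That it vanishes at the missed points is encoded
  -- as f Q vanishing at every rational point, the form in which `vanishing-ideal` applies.
  record Witness (A : Arrangement) (s : V3) (d : ℕ) (β : V3) : Set where
    field
      f        : SPoly
      hom      : Homogeneous d f
      vanishes : ∀ t → EF.eval t (f *ₚ product (forms A)) ≈ 0#
      root     : EF.eval s f ≈ 0#
      gradient : ∀ t → ∂ s t f ≈ β ⊙ t

  ⊙-ext : ∀ u v → (∀ t → t ⊙ u ≈ t ⊙ v) → u ≋ v
  ⊙-ext u v h = go c₁ , go c₂ , go c₃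
    where
    basis : ∀ j u → axis j 1# ⊙ u ≈ at j u
    basis j u = trans (VF.⊙-comm (axis j 1#) u) (trans (⊙-axis u j 1#) (*-identityʳ _))
    go : ∀ j → at j u ≈ at j v
    go j = trans (sym (basis j u)) (trans (h (axis j 1#)) (basis j v))

  •-at : ∀ j k u → at j (k • u) ≡ k * at j u
  •-at c₁ k u = ≡.refl
  •-at c₂ k u = ≡.refl
  •-at c₃ k u = ≡.refl

  ≋-at : ∀ j {u v} → u ≋ v → at j u ≈ at j v
  ≋-at c₁ (e , _ , _) = e
  ≋-at c₂ (_ , e , _) = e
  ≋-at c₃ (_ , _ , e) = e

  module _ (A : Arrangement) (s : V3) (s-missing : Missing A s) (s≉0 : Nonzero s) where
    private
      Q = product (forms A)
      n = length (forms A)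
      Qs = EF.eval s Q

    module _ {d β} (W : Witness A s d β) where
      open Witness W
      private
        ideal = vanishing-ideal (d ℕ.+ n) (f *ₚ Q) (D.Hom-* {d} {n} f Q hom (product-homogeneous (forms A))) vanishes

      derivation : R³
      derivation = proj₁ ideal

      derivation-bounded : Bounded³ (d ℕ.+ n ℕ.∸ suc q) derivation
      derivation-bounded = proj₁ (proj₂ ideal)

      derivation-InDer : InDer (forms A) derivation
      derivation-InDer = InDer-N (forms A) (nonzero A) derivation (f , S.trans (S.sym (proj₂ (proj₂ ideal))) (S.*-comm f Q))

      -- Differentiate f Q = v · N at s along t: the left side gives Q(s) (β · t) because f(s) = 0,
      -- the right side t · (s × v(s)).
      derivation-at-s : s ⨯ HF.eval³ s derivation ≋ Qs • β
      derivation-at-s = ⊙-ext _ _ λ t → trans (sym (∂-N s t derivation)) (trans (sym (∂-cong s t (proj₂ (proj₂ ideal))))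
        (trans (∂-* s t f Q) (trans (+-cong (trans (*-congʳ root) (zeroˡ _)) (*-congʳ (gradient t))) (trans (+-identityˡ _) (scale t)))))
        where
        scale : ∀ t → (β ⊙ t) * Qs ≈ t ⊙ (Qs • β)
        scale (x , y , z) = let (a , b , c) = β in
          solve 7 (λ a b c x y z k → (a :* x :+ (b :* y :+ c :* z)) :* k := x :* (k :* a) :+ (y :* (k :* b) :+ z :* (k :* c))) refl a b c x y z Qs

    -- The product (s × v(s)) × (s × w(s)) equals det(s, v(s), w(s)) s on the one hand and Q(s)² κ s
    -- on the other, which is nonzero.
    independent-at-s : ∀ {d d' β β' κ} (W : Witness A s d β) (W' : Witness A s d' β') → β ⨯ β' ≋ κ • s → ¬ (κ ≈ 0#) →
      ¬ (EF.eval s (det X (derivation W) (derivation W')) ≈ 0#)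
    independent-at-s {β = β} {β'} {κ} W W' β×β' κ≉0 zero-det = product-≉0 (product-≉0 s-missing s-missing) (product-≉0 κ≉0 sⱼ≉0)
        (trans (*-congˡ (reflexive (≡.sym (•-at j κ s)))) (trans (*-congˡ (sym (≋-at j β×β')))
        (trans (reflexive (≡.sym (•-at j (Qs * Qs) (β ⨯ β')))) (trans (≋-at j chain) (trans (reflexive (•-at j _ s)) (trans (*-congʳ det≈0) (zeroˡ _)))))))
      where
      j = proj₁ (pivot s s≉0)
      sⱼ≉0 = proj₂ (pivot s s≉0)
      v = HF.eval³ s (derivation W)
      w = HF.eval³ s (derivation W')
      det≈0 : VF.det s v w ≈ 0#
      det≈0 = trans (VF.det-cong (VF.≋-sym (HF.eval-X³ s)) (VF.≋-refl {v}) (VF.≋-refl {w})) (trans (sym (HF.eval-det s X (derivation W) (derivation W'))) zero-det)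
      scale : ∀ k u v → (k * k) • (u ⨯ v) ≋ (k • u) ⨯ (k • v)
      scale k (a , b , c) (x , y , z) = minor b z c y , minor c x a z , minor a y b x
        where
        minor : ∀ b z c y → k * k * (b * z - c * y) ≈ (k * b) * (k * z) - (k * c) * (k * y)
        minor b z c y = solve 5 (λ k b z c y → k :* k :* (b :* z :- c :* y) := (k :* b) :* (k :* z) :- (k :* c) :* (k :* y)) refl k b z c y
      chain : (Qs * Qs) • (β ⨯ β') ≋ VF.det s v w • s
      chain = VF.≋-trans (scale Qs β β') (VF.≋-trans (VF.⨯-cong (VF.≋-sym (derivation-at-s W)) (VF.≋-sym (derivation-at-s W')))
        (VF.⨯-⨯-common s v w))

    module _ {d d' β β' κ} (W : Witness A s d β) (W' : Witness A s d' β') (β×β' : β ⨯ β' ≋ κ • s) (κ≉0 : ¬ (κ ≈ 0#)) where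
      private
        v = derivation W
        w = derivation W'
        K = det X v w
        bound = 1 ℕ.+ ((d ℕ.+ n ℕ.∸ suc q) ℕ.+ (d' ℕ.+ n ℕ.∸ suc q))
        K-bounded : Bounded bound K
        K-bounded = bounded-det {d ℕ.+ n ℕ.∸ suc q} {d' ℕ.+ n ℕ.∸ suc q} v w (derivation-bounded W) (derivation-bounded W')
        Q∣K : Q ∣ K
        Q∣K = product∣det A X v w (InDer-X (forms A)) (derivation-InDer W) (derivation-InDer W')
        K-at-s : ¬ (EF.eval s K ≈ 0#)
        K-at-s = independent-at-s W W' β×β' κ≉0

      -- Here det(X, v, w) is a multiple of Q of degree at most |A|, hence a scalar multiple; the
      -- scalar is nonzero because the determinant does not vanish at s.
      witnesses⇒free : bound ≡ n → IsFree A
      witnesses⇒free bound≡n = saito A X v w c (InDer-X (forms A)) (derivation-InDer W) (derivation-InDer W')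
          (λ c≈0 → K-at-s (trans (EF.eval-cong s K≃cQ) (trans (EF.eval-* s (constS c) Q) (trans (*-congʳ (trans (EF.eval-const s c) c≈0)) (zeroˡ _))))) K≃cQ
        where
        scalar = ∣-bounded⇒scalar (forms A) (nonzero A) K Q∣K (≡.subst (λ k → Bounded k K) bound≡n K-bounded)
        c = proj₁ scalar
        K≃cQ = proj₂ scalar

      -- A nonzero multiple of Q has degree at least |A|. This later excludes a single missed class
      -- when |A| = 2q - 2.
      witnesses⇒many-forms : n ℕ.≤ bound
      witnesses⇒many-forms = ∣-bounded⇒degree (forms A) (nonzero A) K Q∣K K-bounded λ K≃0 → K-at-s (EF.eval-cong s K≃0)

  evF-form : ∀ s α → EF.eval s (formPoly α) ≈ α ⊙ s
  evF-form = EF.eval-form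

  form-witness : ∀ A s ℓ → ℓ ⊙ s ≈ 0# → (∀ t → Missing A t → ℓ ⊙ t ≈ 0#) → Witness A s 1 ℓ
  form-witness A s ℓ ℓs≈0 h = record
    { f = formPoly ℓ ; hom = form-homogeneous ℓ
    ; vanishes = λ t → trans (EF.eval-* t (formPoly ℓ) (product (forms A))) (go t)
    ; root = trans (evF-form s ℓ) ℓs≈0
    ; gradient = λ t → ∂-form s t ℓ }
    where
    go : ∀ t → EF.eval t (formPoly ℓ) * EF.eval t (product (forms A)) ≈ 0#
    go t with EF.eval t (product (forms A)) ≟ 0#
    ... | yes e = trans (*-congˡ e) (zeroʳ _)
    ... | no missing = trans (*-congʳ (trans (evF-form t ℓ) (h t missing))) (zeroˡ _)

  -- By the product rule the gradient of ℓ h at a point s with ℓ(s) = 0 is h(s) ℓ.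
  conic-witness : ∀ A s ℓ h → ℓ ⊙ s ≈ 0# → (∀ t → Missing A t → (ℓ ⊙ t ≈ 0#) ⊎ (h ⊙ t ≈ 0#)) → Witness A s 2 ((h ⊙ s) • ℓ)
  conic-witness A s ℓ h ℓs≈0 hyp = record
    { f = formPoly ℓ *ₚ formPoly h ; hom = D.Hom-* {1} {1} (formPoly ℓ) (formPoly h) (form-homogeneous ℓ) (form-homogeneous h)
    ; vanishes = λ t → trans (EF.eval-* t (formPoly ℓ *ₚ formPoly h) (product (forms A))) (trans (*-congʳ (EF.eval-* t (formPoly ℓ) (formPoly h))) (go t))
    ; root = trans (EF.eval-* s (formPoly ℓ) (formPoly h)) (trans (*-congʳ (trans (evF-form s ℓ) ℓs≈0)) (zeroˡ _))
    ; gradient = λ t → trans (∂-* s t (formPoly ℓ) (formPoly h)) (trans (+-cong (trans (*-congʳ (trans (evF-form s ℓ) ℓs≈0)) (zeroˡ _))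
        (*-cong (∂-form s t ℓ) (evF-form s h))) (trans (+-identityˡ _) (scale t))) }
    where
    scale : ∀ t → (ℓ ⊙ t) * (h ⊙ s) ≈ ((h ⊙ s) • ℓ) ⊙ t
    scale (x , y , z) = let (a , b , c) = ℓ in
      solve 7 (λ a b c x y z k → (a :* x :+ (b :* y :+ c :* z)) :* k := k :* a :* x :+ (k :* b :* y :+ k :* c :* z)) refl a b c x y z (h ⊙ s)
    go : ∀ t → EF.eval t (formPoly ℓ) * EF.eval t (formPoly h) * EF.eval t (product (forms A)) ≈ 0#
    go t with EF.eval t (product (forms A)) ≟ 0#
    ... | yes e = trans (*-congˡ e) (zeroʳ _)
    ... | no missing with hyp t missing
    ...   | inj₁ e = trans (*-congʳ (trans (*-congʳ (trans (evF-form t ℓ) e)) (zeroˡ _))) (zeroˡ _)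
    ...   | inj₂ e = trans (*-congʳ (trans (*-congˡ (trans (evF-form t h) e)) (zeroʳ _))) (zeroˡ _)

  missing-nonzero : ∀ A s → 1 ℕ.≤ length (forms A) → Missing A s → Nonzero s
  missing-nonzero A s 1≤n missing s≈0 = missing (go (forms A) 1≤n)
    where
    go : ∀ αs → 1 ℕ.≤ length αs → EF.eval s (product αs) ≈ 0#
    go (α@(a , b , c) ∷ αs) _ = trans (EF.eval-* s (formPoly α) (product αs)) (trans (*-congʳ (trans (evF-form s α)
      (trans (VF.⊙-cong (VF.≋-refl {α}) s≈0) (solve 3 (λ a b c → a :* con ℤ.0ℤ :+ (b :* con ℤ.0ℤ :+ c :* con ℤ.0ℤ) := con ℤ.0ℤ) refl a b c)))) (zeroˡ _))

  ⨯-⊙ : ∀ u e v → (u ⨯ e) ⊙ v ≈ e ⊙ (v ⨯ u)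
  ⨯-⊙ u e v = trans (VF.⊙-comm (u ⨯ e) v) (trans (VF.det-rotate v u e) (VF.det-rotate u e v))

  ⨯-self : ∀ u → u ⨯ u ≋ 𝟘
  ⨯-self (a , b , c) = minor b c , minor c a , minor a b
    where
    minor : ∀ b c → b * c - c * b ≈ 0#
    minor b c = solve 2 (λ b c → b :* c :- c :* b := con ℤ.0ℤ) refl b c

  parallel-sym : ∀ u v → Parallel u v → Parallel v u
  parallel-sym (a , b , c) (x , y , z) (e₁ , e₂ , e₃) = flip b z c y e₁ , flip c x a z e₂ , flip a y b x e₃
    where
    flip : ∀ b z c y → b * z - c * y ≈ 0# → y * c - z * b ≈ 0#
    flip b z c y e = trans (solve 4 (λ b z c y → y :* c :- z :* b := :- (b :* z :- c :* y)) refl b z c y)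
      (trans (-‿cong e) (solve 0 (:- con ℤ.0ℤ := con ℤ.0ℤ) refl))

  ⊙-zeroʳ : ∀ e v → v ≋ 𝟘 → e ⊙ v ≈ 0#
  ⊙-zeroʳ e@(a , b , c) v v≋0 = trans (VF.⊙-cong (VF.≋-refl {e}) v≋0)
    (solve 3 (λ a b c → a :* con ℤ.0ℤ :+ (b :* con ℤ.0ℤ :+ c :* con ℤ.0ℤ) := con ℤ.0ℤ) refl a b c)

  form-at-parallel : ∀ u e v → Parallel u v → (u ⨯ e) ⊙ v ≈ 0#
  form-at-parallel u e v p = trans (⨯-⊙ u e v) (⊙-zeroʳ e (v ⨯ u) (parallel-sym u v p))

  -- Some coordinate of P is nonzero, and the other two axes complete P to a basis; in cyclic order
  -- the determinant is that coordinate.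
  frame : ∀ P → Nonzero P → Σ Coordinate λ j → Σ Coordinate λ j' → ¬ (VF.det P (axis j 1#) (axis j' 1#) ≈ 0#)
  frame P P≉0 with pivot P P≉0
  frame P@(a , b , c) _ | c₁ , a≉0 = c₂ , c₃ , λ e → a≉0 (trans (solve 3 (λ a b c →
    a := a :* (con ℤ.1ℤ :* con ℤ.1ℤ :- con ℤ.0ℤ :* con ℤ.0ℤ) :+ (b :* (con ℤ.0ℤ :* con ℤ.0ℤ :- con ℤ.0ℤ :* con ℤ.1ℤ) :+ c :* (con ℤ.0ℤ :* con ℤ.0ℤ :- con ℤ.1ℤ :* con ℤ.0ℤ))) refl a b c) e)
  frame P@(a , b , c) _ | c₂ , b≉0 = c₃ , c₁ , λ e → b≉0 (trans (solve 3 (λ a b c →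
    b := a :* (con ℤ.0ℤ :* con ℤ.0ℤ :- con ℤ.1ℤ :* con ℤ.0ℤ) :+ (b :* (con ℤ.1ℤ :* con ℤ.1ℤ :- con ℤ.0ℤ :* con ℤ.0ℤ) :+ c :* (con ℤ.0ℤ :* con ℤ.0ℤ :- con ℤ.0ℤ :* con ℤ.1ℤ))) refl a b c) e)
  frame P@(a , b , c) _ | c₃ , c≉0 = c₁ , c₂ , λ e → c≉0 (trans (solve 3 (λ a b c →
    c := a :* (con ℤ.0ℤ :* con ℤ.0ℤ :- con ℤ.0ℤ :* con ℤ.1ℤ) :+ (b :* (con ℤ.0ℤ :* con ℤ.0ℤ :- con ℤ.1ℤ :* con ℤ.0ℤ) :+ c :* (con ℤ.1ℤ :* con ℤ.1ℤ :- con ℤ.0ℤ :* con ℤ.0ℤ))) refl a b c) e)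

  module OneClass (A : Arrangement) (P : V3) (missing : Missing A P) (P≉0 : Nonzero P)
                  (only-P : ∀ R → Missing A R → Parallel P R) where
    private
      e = axis (proj₁ (frame P P≉0)) 1#
      f = axis (proj₁ (proj₂ (frame P P≉0))) 1#
      W : ∀ e → Witness A P 1 (P ⨯ e)
      W e = form-witness A P (P ⨯ e) (form-at-parallel P e P (⨯-self P)) λ R R-missing → form-at-parallel P e R (only-P R R-missing)

    -- Two lines through P each give a derivation of degree at most |A| - q. The hypothesis says
    -- that the determinant then has degree |A|, as it does for |A| = 2q - 1.
    one-class⇒free : 1 ℕ.+ ((length (forms A) ℕ.∸ q) ℕ.+ (length (forms A) ℕ.∸ q)) ≡ length (forms A) → IsFree A
    one-class⇒free = witnesses⇒free A P missing P≉0 (W e) (W f) (VF.⨯-⨯-common P e f) (proj₂ (proj₂ (frame P P≉0)))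

    one-class⇒many-forms : length (forms A) ℕ.≤ 1 ℕ.+ ((length (forms A) ℕ.∸ q) ℕ.+ (length (forms A) ℕ.∸ q))
    one-class⇒many-forms = witnesses⇒many-forms A P missing P≉0 (W e) (W f) (VF.⨯-⨯-common P e f) (proj₂ (proj₂ (frame P P≉0)))

  module _ (A : Arrangement) (P R : V3) (P-missing : Missing A P) (P≉0 : Nonzero P) (P∦R : ¬ Parallel P R)
           (only : ∀ t → Missing A t → Parallel P t ⊎ Parallel R t) where
    -- Only one line passes through both classes. The second form is therefore a pair of lines, one
    -- through P and one through R, at the cost of one degree: for |A| = 2q - 2 the total is 1 + (q
    -- - 2) + (q - 1).
    two-classes⇒free : 1 ℕ.+ ((length (forms A) ℕ.∸ q) ℕ.+ (1 ℕ.+ length (forms A) ℕ.∸ q)) ≡ length (forms A) → IsFree A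
    two-classes⇒free = witnesses⇒free A P P-missing P≉0 W W' cross (product-≉0 hP≉0 det≉0)
      where
      j = proj₁ (pivot (P ⨯ R) P∦R)
      k≉0 = proj₂ (pivot (P ⨯ R) P∦R)
      -- An axis outside the plane of P and R: then R × e does not vanish at P, and det(P, R, e) ≠
      -- 0.
      e = axis j 1#
      ℓ = P ⨯ R
      ℓ' = P ⨯ e
      h = R ⨯ e
      value : e ⊙ (P ⨯ R) ≈ at j (P ⨯ R)
      value = trans (VF.⊙-comm e (P ⨯ R)) (trans (⊙-axis (P ⨯ R) j 1#) (*-identityʳ _))
      hP≉0 : ¬ (h ⊙ P ≈ 0#)
      hP≉0 z = k≉0 (trans (sym value) (trans (sym (⨯-⊙ R e P)) z))
      det≉0 : ¬ (VF.det P R e ≈ 0#)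
      det≉0 z = k≉0 (trans (sym value) (trans (trans (VF.det-rotate e P R) refl) z))
      ℓ-vanishes : ∀ t → Missing A t → ℓ ⊙ t ≈ 0#
      ℓ-vanishes t m with only t m
      ... | inj₁ p = form-at-parallel P R t p
      ... | inj₂ p = trans (⨯-⊙ P R t) (trans (VF.det-rotate R t P) (trans (VF.det-rotate t P R)
              (trans (VF.⊙-comm P (R ⨯ t)) (trans (VF.⊙-comm (R ⨯ t) P) (⊙-zeroʳ P (R ⨯ t) p)))))
      W = form-witness A P ℓ (form-at-parallel P R P (⨯-self P)) ℓ-vanishes
      split : ∀ t → Missing A t → (ℓ' ⊙ t ≈ 0#) ⊎ (h ⊙ t ≈ 0#)
      split t m with only t m
      ... | inj₁ p = inj₁ (form-at-parallel P e t p)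
      ... | inj₂ p = inj₂ (form-at-parallel R e t p)
      W' = conic-witness A P ℓ' h (form-at-parallel P e P (⨯-self P)) split
      cross : ℓ ⨯ ((h ⊙ P) • ℓ') ≋ ((h ⊙ P) * VF.det P R e) • P
      cross = VF.≋-trans (pull (h ⊙ P) ℓ ℓ') (VF.≋-trans (VF.•-cong (refl {h ⊙ P}) (VF.⨯-⨯-common P R e)) (assoc³ (h ⊙ P) (VF.det P R e) P))
        where
        pull : ∀ k u v → u ⨯ (k • v) ≋ k • (u ⨯ v)
        pull k (a , b , c) (x , y , z) = minor b z c y , minor c x a z , minor a y b x
          where
          minor : ∀ b z c y → b * (k * z) - c * (k * y) ≈ k * (b * z - c * y)
          minor b z c y = solve 5 (λ k b z c y → b :* (k :* z) :- c :* (k :* y) := k :* (b :* z :- c :* y)) refl k b z c y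
        assoc³ : ∀ k l u → k • (l • u) ≋ (k * l) • u
        assoc³ k l (a , b , c) = sym (*-assoc k l a) , sym (*-assoc k l b) , sym (*-assoc k l c)

-- Homogeneous bases of free arrangements.

module HomogeneousBases {q : ℕ} (F : FiniteField q) where
  open FiniteField F hiding (zero; _≟_)
  open FiniteField F using (_≟_)
  open Arr F hiding (μ; L; dim; size; _+S_; _*S_)
  open Polynomials F
  open Domain F
  open LinearForms F
  open Derivations F
  open VanishingIdeal F using (module EF; module HF; module LF)
  open Construction F
  open VS using (R³; det; _⊙_; _≋_; _•_; _⊞_; 𝟘; combination; e₁; e₂; e₃)
  open RingSolver polyRing

  record Basis (A : Arrangement) : Set where
    field
      u v w       : R³
      u∈          : InDer (forms A) u
      v∈          : InDer (forms A) v
      w∈          : InDer (forms A) w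
      spans       : ∀ δ → InDer (forms A) δ → Σ R³ λ c → δ ≋ combination u v w c
      independent : ∀ c → combination u v w c ≋ 𝟘 → c ≋ 𝟘

  opaque
    unfolding _+ₚ_

    combD-∷ : ∀ {k} g (gs : Vec SPoly k) θ (θs : Vec Der k) → combD (g ∷ gs) (θ ∷ θs) ≡ g • θ ⊞ combD gs θs
    combD-∷ g gs θ θs = ≡.refl

  from-≈D : ∀ {f g} → f ≈D g → f ≋ g
  from-≈D (e₁ , e₂ , e₃) = coeffwise e₁ , coeffwise e₂ , coeffwise e₃

  to-≈D : ∀ {f g} → f ≋ g → f ≈D g
  to-≈D (e₁ , e₂ , e₃) = coeffs e₁ , coeffs e₂ , coeffs e₃

  InDer-• : ∀ A δ → InDer (forms A) (product (forms A) • δ)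
  InDer-• A δ = All.map (λ {α} α∣Q → ∣-resp (S.sym (VS.⊙-• (product (forms A)) (ι³ α) δ)) (∣-*ʳ (ι³ α ⊙ δ) α∣Q)) (form∣product (forms A))

  private
    -- Q e₁, Q e₂, Q e₃ are derivations with determinant Q³ ≠ 0, which combinations of two vectors
    -- cannot have.
    planar-absurd : ∀ A u v → (∀ δ → InDer (forms A) δ → Σ SPoly λ a → Σ SPoly λ b → δ ≋ a • u ⊞ b • v) → ⊥
    planar-absurd A u v spans = product-≄0 Q≄0 (product-≄0 Q≄0 Q≄0) (S.trans (S.sym (VS.det-scaled-basis Q))
        (S.trans (VS.det-cong (proj₂ (proj₂ s₁)) (proj₂ (proj₂ s₂)) (proj₂ (proj₂ s₃))) (VS.det-planar _ _ _ _ _ _ u v)))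
      where
      Q = product (forms A)
      Q≄0 = product-forms-≄0 (nonzero A)
      s₁ = spans (Q • e₁) (InDer-• A e₁)
      s₂ = spans (Q • e₂) (InDer-• A e₂)
      s₃ = spans (Q • e₃) (InDer-• A e₃)

    zero-comb : ∀ {k} (θs : Vec Der k) → combD (Vec.replicate k 0S) θs ≋ 𝟘
    zero-comb [] = VS.≋-refl
    zero-comb {suc k} (θ ∷ θs) = ≡.subst (_≋ 𝟘) (≡.sym (combD-∷ 0S (Vec.replicate k 0S) θ θs))
      (VS.≋-trans (VS.⊞-cong (VS.𝟘-• 0S θ S.refl) (zero-comb θs)) (S.+-identityˡ 0S , S.+-identityˡ 0S , S.+-identityˡ 0S))

    ⊞-𝟘 : ∀ u → u ⊞ 𝟘 ≋ u
    ⊞-𝟘 (a , b , c) = S.+-identityʳ a , S.+-identityʳ b , S.+-identityʳ c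

    𝟘≋ : ∀ u v → 𝟘 ≋ 0S • u ⊞ 0S • v
    𝟘≋ u v = VS.≋-sym (VS.≋-trans (VS.⊞-cong (VS.𝟘-• 0S u S.refl) (VS.𝟘-• 0S v S.refl)) (⊞-𝟘 𝟘))

  -- Freeness leaves the rank open. Ranks below three are too small to span the multiples Q eⱼ; from
  -- rank four on, four basis elements would be independent in rank three.
  basis : ∀ A → IsFree A → Basis A
  basis A (0 , [] , _ , spans , _) = ⊥-elim (planar-absurd A 𝟘 𝟘 λ δ δ∈ → go δ (spans δ (toInD A {δ} δ∈)))
    where
    go : ∀ δ → Σ (Vec SPoly 0) (λ gs → δ ≈D combD gs []) → Σ SPoly λ a → Σ SPoly λ b → δ ≋ a • 𝟘 ⊞ b • 𝟘
    go δ ([] , e) = 0S , 0S , VS.≋-trans (from-≈D {δ} {𝟘} e) (𝟘≋ 𝟘 𝟘)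
  basis A (1 , (u ∷ []) , _ , spans , _) = ⊥-elim (planar-absurd A u 𝟘 λ δ δ∈ → go δ (spans δ (toInD A {δ} δ∈)))
    where
    go : ∀ δ → Σ (Vec SPoly 1) (λ gs → δ ≈D combD gs (u ∷ [])) → Σ SPoly λ a → Σ SPoly λ b → δ ≋ a • u ⊞ b • 𝟘
    go δ (g ∷ [] , e) = g , 0S , VS.≋-trans (≡.subst (δ ≋_) (combD-∷ g [] u []) (from-≈D {δ} e))
      (VS.⊞-cong (VS.≋-refl {g • u}) (VS.≋-sym (VS.𝟘-• 0S 𝟘 S.refl)))
  basis A (2 , (u ∷ v ∷ []) , _ , spans , _) = ⊥-elim (planar-absurd A u v λ δ δ∈ → go δ (spans δ (toInD A {δ} δ∈)))
    where
    go : ∀ δ → Σ (Vec SPoly 2) (λ gs → δ ≈D combD gs (u ∷ v ∷ [])) → Σ SPoly λ a → Σ SPoly λ b → δ ≋ a • u ⊞ b • v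
    go δ (g ∷ m ∷ [] , e) = g , m , VS.≋-trans (≡.subst (δ ≋_) (≡.trans (combD-∷ g (m ∷ []) u (v ∷ [])) (≡.cong (g • u ⊞_) (combD-∷ m [] v []))) (from-≈D {δ} e))
      (VS.⊞-cong (VS.≋-refl {g • u}) (⊞-𝟘 (m • v)))
  basis A (3 , (u ∷ v ∷ w ∷ []) , (u∈ VecAll.∷ v∈ VecAll.∷ w∈ VecAll.∷ VecAll.[]) , spans , indep) = record
    { u = u ; v = v ; w = w ; u∈ = fromInD A {u} u∈ ; v∈ = fromInD A {v} v∈ ; w∈ = fromInD A {w} w∈
    ; spans = λ δ δ∈ → go δ (spans δ (toInD A {δ} δ∈))
    ; independent = λ (g , m , l) e → coeffwise (indep (g ∷ m ∷ l ∷ []) (zero-of g m l e) zero) ,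
        coeffwise (indep (g ∷ m ∷ l ∷ []) (zero-of g m l e) (suc zero)) , coeffwise (indep (g ∷ m ∷ l ∷ []) (zero-of g m l e) (suc (suc zero))) }
    where
    go : ∀ δ → Σ (Vec SPoly 3) (λ gs → δ ≈D combD gs (u ∷ v ∷ w ∷ [])) → Σ R³ λ c → δ ≋ combination u v w c
    go δ (g ∷ m ∷ l ∷ [] , e) = (g , m , l) , combD⇒comb₃ δ g m l u v w e
    zero-of : ∀ g m l → combination u v w (g , m , l) ≋ 𝟘 → combD (g ∷ m ∷ l ∷ []) (u ∷ v ∷ w ∷ []) ≈D 0D
    zero-of g m l e = flip (combD (g ∷ m ∷ l ∷ []) (u ∷ v ∷ w ∷ [])) (comb₃⇒combD 𝟘 g m l u v w (VS.≋-sym e))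
      where
      flip : ∀ f → 0D ≈D f → f ≈D 0D
      flip f (a , b , c) = (λ m → sym (a m)) , (λ m → sym (b m)) , (λ m → sym (c m))
  basis A (suc (suc (suc (suc k))) , (t ∷ u ∷ v ∷ w ∷ θs) , _ , _ , indep) = ⊥-elim (1≄0 (VS.independent₄⇒trivial t u v w four))
    where
    four : VS.Independent₄ t u v w
    four a b c d e = coeffwise (z zero) , coeffwise (z (suc zero)) , coeffwise (z (suc (suc zero))) , coeffwise (z (suc (suc (suc zero))))
      where
      zs = Vec.replicate k 0S
      gs = a ∷ b ∷ c ∷ d ∷ zs
      unfold : combD gs (t ∷ u ∷ v ∷ w ∷ θs) ≡ a • t ⊞ (b • u ⊞ (c • v ⊞ (d • w ⊞ combD zs θs)))
      unfold = ≡.trans (combD-∷ a (b ∷ c ∷ d ∷ zs) t (u ∷ v ∷ w ∷ θs)) (≡.cong (a • t ⊞_)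
        (≡.trans (combD-∷ b (c ∷ d ∷ zs) u (v ∷ w ∷ θs)) (≡.cong (b • u ⊞_)
        (≡.trans (combD-∷ c (d ∷ zs) v (w ∷ θs)) (≡.cong (c • v ⊞_) (combD-∷ d zs w θs))))))
      z = indep gs (to-≈D {combD gs (t ∷ u ∷ v ∷ w ∷ θs)} {𝟘} (≡.subst (_≋ 𝟘) (≡.sym unfold) (VS.≋-trans (VS.⊞-cong (VS.≋-refl {a • t}) (VS.⊞-cong (VS.≋-refl {b • u})
        (VS.⊞-cong (VS.≋-refl {c • v}) (VS.≋-trans (VS.⊞-cong (VS.≋-refl {d • w}) (zero-comb θs)) (⊞-𝟘 (d • w)))))) e)))

  comp³ : ℕ → R³ → R³
  comp³ d (a , b , c) = D.comp d a , D.comp d b , D.comp d c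

  Homogeneous³ : ℕ → R³ → Set
  Homogeneous³ d (a , b , c) = Homogeneous d a × Homogeneous d b × Homogeneous d c

  comp-homogeneous : ∀ d f → Homogeneous d (D.comp d f)
  comp-homogeneous d f = D.Supported-part (D.only d) f

  comp³-homogeneous : ∀ d θ → Homogeneous³ d (comp³ d θ)
  comp³-homogeneous d (a , b , c) = comp-homogeneous d a , comp-homogeneous d b , comp-homogeneous d c

  -- The component of f that a factor of degree a carries into degree d. For a > d it is zero, where
  -- truncated subtraction would select the wrong component.
  shift : ℕ → ℕ → SPoly → SPoly
  shift a d f with a ℕ.≤? d
  ... | yes _ = D.comp (d ℕ.∸ a) f
  ... | no _  = 0S

  comp-hom-* : ∀ a d p f → Homogeneous a p → D.comp (a ℕ.+ d) (p *ₚ f) ≃ p *ₚ D.comp d f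
  comp-hom-* a d p f hp = S.trans (D.part-cong (D.only (a ℕ.+ d)) (S.trans (S.*-cong (S.sym hp) split) (S.distribˡ pa fd fr)))
    (S.trans (S.reflexive (≡.trans (D.part-+ (D.only (a ℕ.+ d)) (pa *ₚ fd) (pa *ₚ fr))
       (≡.cong₂ _+ₚ_ (D.part-all (D.only (a ℕ.+ d)) same) (D.part-none (D.only (a ℕ.+ d)) different))))
     (S.trans (S.+-identityʳ (pa *ₚ fd)) (S.*-congʳ {fd} hp)))
    where
    others : ℕ → Bool
    others j = not (D.only d j)
    pa = D.comp a p
    fd = D.comp d f
    fr = D.part others f
    split : f ≃ fd +ₚ fr
    split = coeffwise λ m → sym (trans (coeffS-+ₚ fd fr m) (go m))
      where
      go : ∀ m → coeffS fd m + coeffS fr m ≈ coeffS f m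
      go m with d ℕ.≟ Weight.weight degree m
      ... | yes e = trans (+-cong (D.coeffS-part-true (D.only d) f m (D.only-true e))
              (D.coeffS-part-false others f m (≡.cong not (D.only-true e)))) (+-identityʳ _)
      ... | no ne = trans (+-cong (D.coeffS-part-false (D.only d) f m (D.only-false ne))
              (D.coeffS-part-true others f m (≡.cong not (D.only-false ne)))) (+-identityˡ _)
    same : D.Terms (λ k → D.only (a ℕ.+ d) k ≡ true) (pa *ₚ fd)
    same = D.Terms-* (λ k → D.only a k ≡ true) (λ k → D.only d k ≡ true) (λ k → D.only (a ℕ.+ d) k ≡ true)
      (λ {i} {j} h k → D.only-true (≡.cong₂ ℕ._+_ (D.only-true⁻ {a} {i} h) (D.only-true⁻ {d} {j} k)))
      (D.part-terms (D.only a) p) (D.part-terms (D.only d) f)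
    not-only : ∀ {j} → others j ≡ true → d ≢ j
    not-only {j} h e rewrite D.only-true {d} {j} e with () ← h
    different : D.Terms (λ k → D.only (a ℕ.+ d) k ≡ false) (pa *ₚ fr)
    different = D.Terms-* (λ k → D.only a k ≡ true) (λ k → others k ≡ true) (λ k → D.only (a ℕ.+ d) k ≡ false)
      (λ {i} {j} h k → D.only-false λ e → not-only {j} k (ℕP.+-cancelˡ-≡ a d j (≡.trans e (≡.cong (ℕ._+ j) (≡.sym (D.only-true⁻ {a} {i} h))))))
      (D.part-terms (D.only a) p) (D.part-terms others f)

  comp-low-* : ∀ a d p f → d ℕ.< a → Homogeneous a p → D.comp d (p *ₚ f) ≃ 0S
  comp-low-* a d p f d<a hp = S.trans (D.part-cong (D.only d) (S.*-congʳ {f} (S.sym hp))) (S.reflexive (D.part-none (D.only d)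
    (D.Terms-* (λ k → D.only a k ≡ true) (λ _ → ⊤) (λ k → D.only d k ≡ false)
      (λ {i} {j} h _ → D.only-false λ e → ℕP.<-irrefl e (ℕP.<-≤-trans d<a (ℕP.≤-trans (ℕP.≤-reflexive (D.only-true⁻ {a} {i} h)) (ℕP.m≤m+n i j))))
      (D.part-terms (D.only a) p) (All.universal (λ _ → tt) f))))

  comp-shift : ∀ a d p f → Homogeneous a p → D.comp d (p *ₚ f) ≃ p *ₚ shift a d f
  comp-shift a d p f hp with a ℕ.≤? d
  ... | no a≰d = S.trans (comp-low-* a d p f (ℕP.≰⇒> a≰d) hp) (S.sym (S.zeroʳ p))
  ... | yes a≤d = S.trans (S.reflexive (≡.cong (λ k → D.comp k (p *ₚ f)) (≡.sym (ℕP.m+[n∸m]≡n a≤d)))) (comp-hom-* a (d ℕ.∸ a) p f hp)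

  constS-homogeneous : ∀ c → Homogeneous 0 (constS c)
  constS-homogeneous c = S.refl

  comp-⊙ : ∀ d α θ → D.comp d (ι³ α ⊙ θ) ≃ ι³ α ⊙ comp³ d θ
  comp-⊙ d (a , b , c) (x , y , z) = S.trans (S.reflexive (≡.trans (D.part-+ (D.only d) (constS a *ₚ x) _)
      (≡.cong (D.comp d (constS a *ₚ x) +ₚ_) (D.part-+ (D.only d) (constS b *ₚ y) (constS c *ₚ z)))))
    (S.+-cong (comp-hom-* 0 d (constS a) x (constS-homogeneous a)) (S.+-cong (comp-hom-* 0 d (constS b) y (constS-homogeneous b))
      (comp-hom-* 0 d (constS c) z (constS-homogeneous c))))

  -- The forms are homogeneous, so taking components commutes with applying a derivation to α and
  -- with division by α: D(A) is a graded module.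
  InDer-comp : ∀ αs d θ → InDer αs θ → InDer αs (comp³ d θ)
  InDer-comp αs d θ = All.map (λ {α} (k , e) → shift 1 d k ,
    S.trans (S.sym (comp-⊙ d α θ)) (S.trans (D.part-cong (D.only d) e) (comp-shift 1 d (formPoly α) k (form-homogeneous α))))

  module Sums (R : CommutativeRing 0ℓ 0ℓ) where
    open CommutativeRing R using () renaming (Carrier to A; _+_ to _+A_)
    sumTo : ℕ → (ℕ → A) → A
    sumTo zero f = f 0
    sumTo (suc k) f = sumTo k f +A f (suc k)

    sumTo³ : ℕ → (ℕ → A × A × A) → A × A × A
    sumTo³ zero f = f 0
    sumTo³ (suc k) f = Vector3._⊞_ R (sumTo³ k f) (f (suc k))

  private
    module ΣS = Sums polyRing
    module ΣF = Sums commRing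

  decompose : ∀ k p → Bounded k p → p ≃ ΣS.sumTo k (λ d → D.comp d p)
  decompose k p b = S.trans (S.sym b) (go k)
    where
    go : ∀ k → D.part (D.upto k) p ≃ ΣS.sumTo k (λ d → D.comp d p)
    go zero = coeffwise at-0
      where
      at-0 : ∀ m → coeffS (D.part (D.upto 0) p) m ≈ coeffS (D.comp 0 p) m
      at-0 m with Weight.weight degree m ℕ.≟ 0
      ... | yes e = trans (D.coeffS-part-true (D.upto 0) p m (D.below-true {1} (s≤s (ℕP.≤-reflexive e)))) (sym (D.coeffS-part-true (D.only 0) p m (D.only-true (≡.sym e))))
      ... | no ne = trans (D.coeffS-part-false (D.upto 0) p m (D.below-false {1} λ l → ne (ℕP.n≤0⇒n≡0 (ℕP.≤-pred l)))) (sym (D.coeffS-part-false (D.only 0) p m (D.only-false (ne ∘ ≡.sym))))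
    go (suc k) = S.trans (coeffwise λ m → trans (step m) (sym (coeffS-+ₚ (D.part (D.upto k) p) (D.comp (suc k) p) m))) (S.+-congʳ (go k))
      where
      step : ∀ m → coeffS (D.part (D.upto (suc k)) p) m ≈ coeffS (D.part (D.upto k) p) m + coeffS (D.comp (suc k) p) m
      step m with Weight.weight degree m ℕ.≤? k
      ... | yes le = trans (D.coeffS-part-true (D.upto (suc k)) p m (D.below-true (s≤s (ℕP.m≤n⇒m≤1+n le))))
              (sym (trans (+-cong (D.coeffS-part-true (D.upto k) p m (D.below-true (s≤s le)))
                (D.coeffS-part-false (D.only (suc k)) p m (D.only-false λ e → ℕP.<-irrefl (≡.sym e) (s≤s le)))) (+-identityʳ _)))
      ... | no nle with suc k ℕ.≟ Weight.weight degree m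
      ...   | yes e = trans (D.coeffS-part-true (D.upto (suc k)) p m (D.below-true (s≤s (ℕP.≤-reflexive (≡.sym e)))))
              (sym (trans (+-cong (D.coeffS-part-false (D.upto k) p m (D.below-false (nle ∘ ℕP.≤-pred)))
                (D.coeffS-part-true (D.only (suc k)) p m (D.only-true e))) (+-identityˡ _)))
      ...   | no ne = trans (D.coeffS-part-false (D.upto (suc k)) p m (D.below-false λ l → nle (ℕP.≤-pred (ℕP.≤∧≢⇒< (ℕP.≤-pred l) (ne ∘ ≡.sym)))))
              (sym (trans (+-cong (D.coeffS-part-false (D.upto k) p m (D.below-false (nle ∘ ℕP.≤-pred)))
                (D.coeffS-part-false (D.only (suc k)) p m (D.only-false ne))) (+-identityˡ _)))

  decompose³ : ∀ θ → Σ ℕ λ k → θ ≋ ΣS.sumTo³ k (λ d → comp³ d θ)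
  decompose³ θ@(a , b , c) = k , VS.≋-trans (decompose k a (bounded-by a (ℕP.m≤m+n ka _)) ,
      decompose k b (bounded-by b (ℕP.≤-trans (ℕP.m≤m+n kb kc) (ℕP.m≤n+m (kb ℕ.+ kc) ka))) ,
      decompose k c (bounded-by c (ℕP.≤-trans (ℕP.m≤n+m kc kb) (ℕP.m≤n+m (kb ℕ.+ kc) ka)))) (split k)
    where
    ka = proj₁ (D.bounded a)
    kb = proj₁ (D.bounded b)
    kc = proj₁ (D.bounded c)
    k = ka ℕ.+ (kb ℕ.+ kc)
    bounded-by : ∀ p → proj₁ (D.bounded p) ℕ.≤ k → Bounded k p
    bounded-by p le = D.Bounded-mono {proj₁ (D.bounded p)} {k} p le (proj₂ (D.bounded p))
    split : ∀ k → (ΣS.sumTo k (λ d → D.comp d a) , ΣS.sumTo k (λ d → D.comp d b) , ΣS.sumTo k (λ d → D.comp d c)) ≋ ΣS.sumTo³ k (λ d → comp³ d θ)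
    split zero = VS.≋-refl
    split (suc k) = VS.⊞-cong (split k) VS.≋-refl

  origin : V3
  origin = 0# , 0# , 0#

  -- The constant term, defined as evaluation at the origin so that its multiplicativity comes for
  -- free.
  ε : SPoly → Carrier
  ε = EF.eval origin

  ε³ : R³ → V3
  ε³ = HF.eval³ origin

  ε-coeff : ∀ p → ε p ≈ coeffS p (0 , 0 , 0)
  ε-coeff p = trans (LF.lin-congʳ p go) (sym (coeffS-linear p (0 , 0 , 0)))
    where
    go : ∀ m → EF.monomial origin m ≈ indicator (0 , 0 , 0) m
    go (0 , 0 , 0) = trans (*-identityˡ _) (*-identityˡ _)
    go (suc a , b , c) = trans (*-congʳ (zeroˡ _)) (zeroˡ _)
    go (0 , suc b , c) = trans (*-identityˡ _) (trans (*-congʳ (zeroˡ _)) (zeroˡ _))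
    go (0 , 0 , suc c) = trans (*-identityˡ _) (trans (*-identityˡ _) (zeroˡ _))

  comp-0 : ∀ p → D.comp 0 p ≃ constS (ε p)
  comp-0 p = S.trans (bounded-0 (D.comp 0 p) (D.Hom⇒Bounded {0} (D.comp 0 p) (comp-homogeneous 0 p)))
    (term-cong (trans (D.coeffS-part-true (D.only 0) p (0 , 0 , 0) ≡.refl) (sym (ε-coeff p))))

  private
    ε³-sum : ∀ k f → ε³ (ΣS.sumTo³ k f) VF.≋ ΣF.sumTo³ k (ε³ ∘ f)
    ε³-sum zero f = VF.≋-refl
    ε³-sum (suc k) f = VF.≋-trans (EF.eval-+ origin _ _ , EF.eval-+ origin _ _ , EF.eval-+ origin _ _)
      (VF.⊞-cong (ε³-sum k f) VF.≋-refl)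

    det-sum₂ : ∀ u w k f → VF.det u (ΣF.sumTo³ k f) w ≈ ΣF.sumTo k (λ d → VF.det u (f d) w)
    det-sum₂ u w zero f = refl
    det-sum₂ u w (suc k) f = trans (VF.det-+₂ u _ _ w) (+-congʳ (det-sum₂ u w k f))

    det-sum₃ : ∀ u v k f → VF.det u v (ΣF.sumTo³ k f) ≈ ΣF.sumTo k (λ d → VF.det u v (f d))
    det-sum₃ u v zero f = refl
    det-sum₃ u v (suc k) f = trans (VF.det-+₃ u v _ _) (+-congʳ (det-sum₃ u v k f))

    nonzero-term : ∀ k f → ¬ (ΣF.sumTo k f ≈ 0#) → Σ ℕ λ d → ¬ (f d ≈ 0#)
    nonzero-term zero f h = 0 , h
    nonzero-term (suc k) f h with f (suc k) ≟ 0#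
    ... | no f≉0 = suc k , f≉0
    ... | yes f≈0 = nonzero-term k f λ s≈0 → h (trans (+-cong s≈0 f≈0) (+-identityˡ 0#))

  -- Generation is required only up to `scale`, whose constant term is nonzero. For homogeneous δ,
  -- comparing components of one degree replaces `scale` by that constant.
  record HomogeneousBasis (A : Arrangement) : Set where
    field
      v w      : R³
      a b      : ℕ
      v-hom    : Homogeneous³ a v
      w-hom    : Homogeneous³ b w
      v∈       : InDer (forms A) v
      w∈       : InDer (forms A) w
      scale    : SPoly
      ε-scale  : ¬ (ε scale ≈ 0#)
      generate : ∀ δ → InDer (forms A) δ → Σ R³ λ c → scale • δ ≋ combination X v w c

  module _ (A : Arrangement) (B : Basis A) (1≤n : 1 ℕ.≤ length (forms A)) where
    open Basis B
    private
      Φ = combination u v w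
      coordinates : ∀ δ → InDer (forms A) δ → R³
      coordinates δ δ∈ = proj₁ (spans δ δ∈)

      cX = coordinates X (InDer-X (forms A))

      -- Dividing α(X) = Σ cᵢ α(θᵢ) by α exhibits 1 as a combination of the coordinates of X.
      ε-cX≉0 : Nonzero (ε³ cX)
      ε-cX≉0 zero-cX = go (forms A) (nonzero A) 1≤n u∈ v∈ w∈
        where
        go : ∀ αs → All Nonzero αs → 1 ℕ.≤ length αs → InDer αs u → InDer αs v → InDer αs w → ⊥
        go (α ∷ _) (α≉0 ∷ _) _ ((hu , eu) ∷ _) ((hv , ev) ∷ _) ((hw , ew) ∷ _) = 1≉0 (trans (sym (trans (ε-coeff 1S) (+-identityʳ 1#)))
            (trans (EF.eval-cong origin one) (trans (HF.eval-⊙ origin cX (hu , hv , hw))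
              (trans (VF.⊙-cong zero-cX (VF.≋-refl {ε³ (hu , hv , hw)})) (trans (+-cong (zeroˡ _) (trans (+-cong (zeroˡ _) (zeroˡ _)) (+-identityˡ 0#))) (+-identityˡ 0#))))))
          where
          A' = formPoly α
          linear : ∀ c → ι³ α ⊙ Φ c ≃ c ⊙ (ι³ α ⊙ u , ι³ α ⊙ v , ι³ α ⊙ w)
          linear (g , m , l) = S.trans (⊙-⊞ (g • u) _) (S.+-cong (VS.⊙-• g (ι³ α) u) (S.trans (⊙-⊞ (m • v) (l • w)) (S.+-cong (VS.⊙-• m (ι³ α) v) (VS.⊙-• l (ι³ α) w))))
            where
            ⊙-⊞ : ∀ s t → ι³ α ⊙ (s ⊞ t) ≃ ι³ α ⊙ s +ₚ ι³ α ⊙ t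
            ⊙-⊞ (s₁ , s₂ , s₃) (t₁ , t₂ , t₃) = let (a , b , c) = ι³ α in
              solve 9 (λ a b c s₁ s₂ s₃ t₁ t₂ t₃ → a :* (s₁ :+ t₁) :+ (b :* (s₂ :+ t₂) :+ c :* (s₃ :+ t₃))
                := (a :* s₁ :+ (b :* s₂ :+ c :* s₃)) :+ (a :* t₁ :+ (b :* t₂ :+ c :* t₃))) S.refl a b c s₁ s₂ s₃ t₁ t₂ t₃
          factor : ∀ c → c ⊙ (A' *ₚ hu , A' *ₚ hv , A' *ₚ hw) ≃ A' *ₚ (c ⊙ (hu , hv , hw))
          factor (g , m , l) = solve 7 (λ A g m l u v w → g :* (A :* u) :+ (m :* (A :* v) :+ l :* (A :* w)) := A :* (g :* u :+ (m :* v :+ l :* w)))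
            S.refl A' g m l hu hv hw
          one : 1S ≃ cX ⊙ (hu , hv , hw)
          one = *-cancelˡ A' 1S _ (form-≄0 α≉0) (S.trans (S.*-identityʳ A') (S.trans (form-⊙ α)
            (S.trans (VS.⊙-cong (VS.≋-refl {ι³ α}) (proj₂ (spans X (InDer-X (forms A))))) (S.trans (linear cX)
              (S.trans (VS.⊙-cong (VS.≋-refl {cX}) (eu , ev , ew)) (factor cX))))))

      Φ-injective : ∀ c d → Φ c ≋ Φ d → c ≋ d
      Φ-injective c d h = cancel c d (independent (c ⊞ negₚ 1S • d) (VS.≋-trans (VS.combination-⊞ u v w c (negₚ 1S • d))
          (VS.≋-trans (VS.⊞-cong h (VS.combination-• (negₚ 1S) u v w d)) (self (Φ d)))))
        where
        self : ∀ x → x ⊞ negₚ 1S • x ≋ 𝟘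
        self (a , b , c) = go a , go b , go c
          where
          go : ∀ a → a +ₚ negₚ 1S *ₚ a ≃ 0S
          go a = solve 1 (λ a → a :+ (:- con ℤ.1ℤ) :* a := con ℤ.0ℤ) S.refl a
        cancel : ∀ c d → c ⊞ negₚ 1S • d ≋ 𝟘 → c ≋ d
        cancel (i , j , k) (i' , j' , k') (x , y , z) = go i i' x , go j j' y , go k k' z
          where
          go : ∀ c d → c +ₚ negₚ 1S *ₚ d ≃ 0S → c ≃ d
          go c d e = S.trans (solve 2 (λ c d → c := (c :+ (:- con ℤ.1ℤ) :* d) :+ d) S.refl c d) (S.trans (S.+-congʳ e) (S.+-identityˡ d))

      θ : Coordinate → R³
      θ j = at j (u , v , w)

      θ∈ : ∀ j → InDer (forms A) (θ j)
      θ∈ c₁ = u∈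
      θ∈ c₂ = v∈
      θ∈ c₃ = w∈

      Φ-unit : ∀ j → Φ (at j (e₁ , e₂ , e₃)) ≋ θ j
      Φ-unit c₁ = VS.combination-e₁ u v w
      Φ-unit c₂ = VS.combination-e₂ u v w
      Φ-unit c₃ = VS.combination-e₃ u v w

      ε-unit : ∀ j → ε³ (at j (e₁ , e₂ , e₃)) VF.≋ axis j 1#
      ε-unit c₁ = ε-1 , refl , refl
        where ε-1 = trans (ε-coeff 1S) (+-identityʳ 1#)
      ε-unit c₂ = refl , ε-1 , refl
        where ε-1 = trans (ε-coeff 1S) (+-identityʳ 1#)
      ε-unit c₃ = refl , refl , ε-1
        where ε-1 = trans (ε-coeff 1S) (+-identityʳ 1#)

      component∈ : ∀ j d → InDer (forms A) (comp³ d (θ j))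
      component∈ j d = InDer-comp (forms A) d (θ j) (θ∈ j)

      cθ : Coordinate → ℕ → R³
      cθ j d = coordinates (comp³ d (θ j)) (component∈ j d)

      Φ-sum : ∀ k f → Φ (ΣS.sumTo³ k f) ≋ ΣS.sumTo³ k (Φ ∘ f)
      Φ-sum zero f = VS.≋-refl
      Φ-sum (suc k) f = VS.≋-trans (VS.combination-⊞ u v w (ΣS.sumTo³ k f) (f (suc k))) (VS.⊞-cong (Φ-sum k f) VS.≋-refl)

      sum-cong³ : ∀ k {f g} → (∀ d → f d ≋ g d) → ΣS.sumTo³ k f ≋ ΣS.sumTo³ k g
      sum-cong³ zero h = h 0
      sum-cong³ (suc k) h = VS.⊞-cong (sum-cong³ k h) (h (suc k))

      bound : Coordinate → ℕ
      bound j = proj₁ (decompose³ (θ j))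

      -- A basis element is the sum of its homogeneous components, all of them derivations. By
      -- uniqueness of coordinates, their coordinate vectors add up to the unit vector.
      coordinates-sum : ∀ j → at j (e₁ , e₂ , e₃) ≋ ΣS.sumTo³ (bound j) (cθ j)
      coordinates-sum j = Φ-injective _ _ (VS.≋-trans (Φ-unit j) (VS.≋-trans (proj₂ (decompose³ (θ j)))
        (VS.≋-sym (VS.≋-trans (Φ-sum (bound j) (cθ j)) (sum-cong³ (bound j) λ d → VS.≋-sym (proj₂ (spans (comp³ d (θ j)) (component∈ j d))))))))

      axis-sum : ∀ j → axis j 1# VF.≋ ΣF.sumTo³ (bound j) (ε³ ∘ cθ j)
      axis-sum j = VF.≋-trans (VF.≋-sym (ε-unit j)) (VF.≋-trans (eval³-cong (coordinates-sum j)) (ε³-sum (bound j) (cθ j)))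
        where
        eval³-cong : ∀ {c d} → c ≋ d → ε³ c VF.≋ ε³ d
        eval³-cong (x , y , z) = EF.eval-cong origin x , EF.eval-cong origin y , EF.eval-cong origin z

      -- Cramer's rule among coordinate vectors: the coordinate determinant of X, v, w, as a factor,
      -- makes every coordinate vector a combination of theirs. Its constant term is the given
      -- nonzero determinant.
      build : ∀ j j' d₁ d₂ → ¬ (VF.det (ε³ cX) (ε³ (cθ j d₁)) (ε³ (cθ j' d₂)) ≈ 0#) → HomogeneousBasis A
      build j j' d₁ d₂ det≉0 = record
        { v = v' ; w = w' ; a = d₁ ; b = d₂
        ; v-hom = comp³-homogeneous d₁ (θ j) ; w-hom = comp³-homogeneous d₂ (θ j')
        ; v∈ = component∈ j d₁ ; w∈ = component∈ j' d₂
        ; scale = det cX cv cw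
        ; ε-scale = λ e → det≉0 (trans (sym (HF.eval-det origin cX cv cw)) e)
        ; generate = λ δ δ∈ → let c = coordinates δ δ∈ in (det c cv cw , det cX c cw , det cX cv c) , gen δ δ∈ }
        where
        cv = cθ j d₁
        cw = cθ j' d₂
        v' = comp³ d₁ (θ j)
        w' = comp³ d₂ (θ j')
        gen : ∀ δ δ∈ → let c = coordinates δ δ∈ in det cX cv cw • δ ≋ combination X v' w' (det c cv cw , det cX c cw , det cX cv c)
        gen δ δ∈ = VS.≋-trans (VS.•-cong S.refl (proj₂ (spans δ δ∈))) (VS.≋-trans (VS.≋-sym (VS.combination-• (det cX cv cw) u v w c))
          (VS.≋-trans (VS.combination-cong u v w (VS.cramer cX cv cw c))
          (VS.≋-trans (VS.combination-⊞ u v w (det c cv cw • cX) _) (VS.⊞-cong (back (det c cv cw) cX (proj₂ (spans X (InDer-X (forms A)))))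
          (VS.≋-trans (VS.combination-⊞ u v w (det cX c cw • cv) (det cX cv c • cw))
            (VS.⊞-cong (back (det cX c cw) cv (proj₂ (spans v' (component∈ j d₁)))) (back (det cX cv c) cw (proj₂ (spans w' (component∈ j' d₂))))))))))
          where
          c = coordinates δ δ∈
          back : ∀ k d {x} → x ≋ Φ d → Φ (k • d) ≋ k • x
          back k d e = VS.≋-trans (VS.combination-• k u v w d) (VS.•-cong S.refl (VS.≋-sym e))

      -- The axis is a sum of constant-term vectors, one for each component of the basis element. By
      -- linearity of the determinant, some component already gives a nonzero value.
      choose-w : ∀ j j' d₁ → ¬ (VF.det (ε³ cX) (ε³ (cθ j d₁)) (axis j' 1#) ≈ 0#) → HomogeneousBasis A
      choose-w j j' d₁ det≉0 = build j j' d₁ (proj₁ term) (proj₂ term)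
        where
        term = nonzero-term (bound j') (λ d → VF.det (ε³ cX) (ε³ (cθ j d₁)) (ε³ (cθ j' d))) λ e → det≉0
          (trans (VF.det-cong (VF.≋-refl {ε³ cX}) (VF.≋-refl {ε³ (cθ j d₁)}) (axis-sum j')) (trans (det-sum₃ (ε³ cX) (ε³ (cθ j d₁)) (bound j') (ε³ ∘ cθ j')) e))

      choose-v : ∀ j j' → ¬ (VF.det (ε³ cX) (axis j 1#) (axis j' 1#) ≈ 0#) → HomogeneousBasis A
      choose-v j j' det≉0 = choose-w j j' (proj₁ term) (proj₂ term)
        where
        term = nonzero-term (bound j) (λ d → VF.det (ε³ cX) (ε³ (cθ j d)) (axis j' 1#)) λ e → det≉0
          (trans (VF.det-cong (VF.≋-refl {ε³ cX}) (axis-sum j) (VF.≋-refl {axis j' 1#})) (trans (det-sum₂ (ε³ cX) (axis j' 1#) (bound j) (ε³ ∘ cθ j)) e))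

    homogeneous-basis : HomogeneousBasis A
    homogeneous-basis = choose-v (proj₁ axes) (proj₁ (proj₂ axes)) (proj₂ (proj₂ axes))
      where axes = frame (ε³ cX) ε-cX≉0

-- From a free arrangement to a complete intersection through the missed points.

module Necessity {q : ℕ} (F : FiniteField q) where
  open FiniteField F hiding (zero; _≟_)
  open Arr F hiding (μ; L; dim; size; _+S_; _*S_)
  open Polynomials F
  open Domain F
  open FieldLemmas F
  open Frobenius F
  open LinearForms F
  open Derivations F
  open VanishingIdeal F using (module EF; module HF)
  open Construction F
  open HomogeneousBases F
  open VS using (R³; det; _⊙_; _≋_; _•_; combination; e₁; e₂; e₃)
  open RingSolver polyRing

  module _ (W : Weight) where
    private module G = Graded W

    -- Weights of factors add. For a partial degree this says that a divisor involves no variable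
    -- absent from its nonzero multiple.
    divisor-bounded-0 : ∀ p g → p ∣ g → ¬ (g ≃ 0S) → G.Bounded 0 g → G.Bounded 0 p
    divisor-bounded-0 p g (h , e) g≄0 bg = ≡.subst (λ k → G.Bounded k p) a≡0 (proj₁ (proj₂ tp))
      where
      p≄0 : ¬ (p ≃ 0S)
      p≄0 z = g≄0 (S.trans e (S.trans (S.*-congʳ {h} z) (S.zeroˡ h)))
      h≄0 : ¬ (h ≃ 0S)
      h≄0 z = g≄0 (S.trans e (S.trans (S.*-congˡ {p} z) (S.zeroʳ p)))
      tp = G.top p p≄0
      th = G.top h h≄0
      a = proj₁ tp
      b = proj₁ th
      a≡0 : a ≡ 0
      a≡0 = ℕP.m+n≡0⇒m≡0 a (ℕP.n≤0⇒n≡0 (Tops.top≤bound W {a ℕ.+ b} {0} (p *ₚ h) (Tops.top-* W {a} {b} p h (proj₂ tp) (proj₂ th))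
        (G.Supported-resp (G.upto 0) e bg)))

    power-bounded-0 : ∀ x n → G.Bounded 0 1S → G.Bounded 0 x → G.Bounded 0 (x ^ n)
    power-bounded-0 x zero b1 b = b1
    power-bounded-0 x (suc n) b1 b = G.Bounded-* {0} {0} x (x ^ n) b (power-bounded-0 x n b1 b)

    minor-bounded-0 : ∀ x y → G.Bounded 0 1S → G.Bounded 0 x → G.Bounded 0 y → G.Bounded 0 (x *ₚ y ^ q +ₚ negₚ (y *ₚ x ^ q))
    minor-bounded-0 x y b1 bx by = G.Supported-+ (G.upto 0) _ _ (G.Bounded-* {0} {0} x (y ^ q) bx (power-bounded-0 y q b1 by))
      (G.Supported-neg (G.upto 0) _ (G.Bounded-* {0} {0} y (x ^ q) by (power-bounded-0 x q b1 bx)))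

  -- N_j does not contain the j-th variable, so a common divisor of the three entries contains no
  -- variable at all.
  common-divisor-constant : ∀ p → (∀ j → p ∣ at j N) → Σ Carrier λ c → p ≃ constS c
  common-divisor-constant p h = coeffS p (0 , 0 , 0) , coeffwise go
    where
    b₁ : Graded.Bounded degree₁ 0 p
    b₁ = divisor-bounded-0 degree₁ p (at c₁ N) (h c₁) (N-≄0 c₁) (minor-bounded-0 degree₁ (at c₂ X) (at c₃ X) S.refl S.refl S.refl)
    b₂ : Graded.Bounded degree₂ 0 p
    b₂ = divisor-bounded-0 degree₂ p (at c₂ N) (h c₂) (N-≄0 c₂) (minor-bounded-0 degree₂ (at c₃ X) (at c₁ X) S.refl S.refl S.refl)
    b₃ : Graded.Bounded degree₃ 0 p
    b₃ = divisor-bounded-0 degree₃ p (at c₃ N) (h c₃) (N-≄0 c₃) (minor-bounded-0 degree₃ (at c₁ X) (at c₂ X) S.refl S.refl S.refl)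
    go : ∀ m → coeffS p m ≈ coeffS (constS (coeffS p (0 , 0 , 0))) m
    go (0 , 0 , 0) = sym (+-identityʳ _)
    go (suc a , b , c) = Graded.supported⁻ degree₁ (Graded.upto degree₁ 0) p b₁ (suc a , b , c) ≡.refl
    go (0 , suc b , c) = Graded.supported⁻ degree₂ (Graded.upto degree₂ 0) p b₂ (0 , suc b , c) ≡.refl
    go (0 , 0 , suc c) = Graded.supported⁻ degree₃ (Graded.upto degree₃ 0) p b₃ (0 , 0 , suc c) ≡.refl

  -- The second alternative covers a > d, where no component of degree d - a exists.
  Shifted : ℕ → ℕ → SPoly → Set
  Shifted a d m = (a ℕ.≤ d × Homogeneous (d ℕ.∸ a) m) ⊎ (m ≃ 0S)

  shift-shifted : ∀ i a d f → Shifted a d (constS i *ₚ shift a d f)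
  shift-shifted i a d f with a ℕ.≤? d
  ... | yes a≤d = inj₁ (a≤d , D.Hom-* {0} {d ℕ.∸ a} (constS i) (D.comp (d ℕ.∸ a) f) (constS-homogeneous i) (comp-homogeneous (d ℕ.∸ a) f))
  ... | no _ = inj₂ (S.zeroʳ (constS i))

  shift-self : ∀ d f → shift d d f ≃ constS (ε f)
  shift-self d f with d ℕ.≤? d
  ... | no d≰d = ⊥-elim (d≰d ℕP.≤-refl)
  ... | yes _ = S.trans (S.reflexive (≡.cong (λ k → D.comp k f) (ℕP.n∸n≡0 d))) (comp-0 f)

  power-homogeneous : ∀ x n → Homogeneous 1 x → Homogeneous n (x ^ n)
  power-homogeneous x zero h = S.refl
  power-homogeneous x (suc n) h = D.Hom-* {1} {n} x (x ^ n) h (power-homogeneous x n h)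

  Xq-homogeneous : Homogeneous³ q Xq
  Xq-homogeneous = power-homogeneous (at c₁ X) q S.refl , power-homogeneous (at c₂ X) q S.refl , power-homogeneous (at c₃ X) q S.refl

  homogeneous-det : ∀ {a b} v w → Homogeneous³ a v → Homogeneous³ b w → Homogeneous (1 ℕ.+ (a ℕ.+ b)) (det X v w)
  homogeneous-det {a} {b} (v₁ , v₂ , v₃) (w₁ , w₂ , w₃) (p₁ , p₂ , p₃) (r₁ , r₂ , r₃) =
    sum (1 ℕ.+ (a ℕ.+ b)) _ _ (times (at c₁ X) _ S.refl (minor v₂ w₃ v₃ w₂ p₂ r₃ p₃ r₂))
      (sum (1 ℕ.+ (a ℕ.+ b)) _ _ (times (at c₂ X) _ S.refl (minor v₃ w₁ v₁ w₃ p₃ r₁ p₁ r₃))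
        (times (at c₃ X) _ S.refl (minor v₁ w₂ v₂ w₁ p₁ r₂ p₂ r₁)))
    where
    sum : ∀ k f g → Homogeneous k f → Homogeneous k g → Homogeneous k (f +ₚ g)
    sum k f g = D.Supported-+ (D.only k) f g
    times : ∀ x f → Homogeneous 1 x → Homogeneous (a ℕ.+ b) f → Homogeneous (1 ℕ.+ (a ℕ.+ b)) (x *ₚ f)
    times x f = D.Hom-* {1} {a ℕ.+ b} x f
    minor : ∀ f g f' g' → Homogeneous a f → Homogeneous b g → Homogeneous a f' → Homogeneous b g' → Homogeneous (a ℕ.+ b) (f *ₚ g +ₚ negₚ (f' *ₚ g'))
    minor f g f' g' p r p' r' = sum (a ℕ.+ b) (f *ₚ g) (negₚ (f' *ₚ g')) (D.Hom-* {a} {b} f g p r)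
      (D.Supported-neg (D.only (a ℕ.+ b)) (f' *ₚ g') (D.Hom-* {a} {b} f' g' p' r'))

  homogeneous-degree : ∀ {k l} p → Homogeneous k p → Homogeneous l p → ¬ (p ≃ 0S) → k ≡ l
  homogeneous-degree {k} {l} p hk hl p≄0 = ℕP.≤-antisym
    (Tops.top≤bound degree {k} {l} p (homogeneous-top {k} p hk p≄0) (D.Hom⇒Bounded {l} p hl))
    (Tops.top≤bound degree {l} {k} p (homogeneous-top {l} p hl p≄0) (D.Hom⇒Bounded {k} p hk))

  eval³-cong : ∀ R {c d} → c ≋ d → HF.eval³ R c VF.≋ HF.eval³ R d
  eval³-cong R (x , y , z) = EF.eval-cong R x , EF.eval-cong R y , EF.eval-cong R z

  eval³-combination : ∀ R u v w c → HF.eval³ R (combination u v w c) VF.≋ VF.combination (HF.eval³ R u) (HF.eval³ R v) (HF.eval³ R w) (HF.eval³ R c)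
  eval³-combination R (u₁ , u₂ , u₃) (v₁ , v₂ , v₃) (w₁ , w₂ , w₃) (g , m , l) = go u₁ v₁ w₁ , go u₂ v₂ w₂ , go u₃ v₃ w₃
    where
    go : ∀ u v w → EF.eval R (g *ₚ u +ₚ (m *ₚ v +ₚ l *ₚ w)) ≈ EF.eval R g * EF.eval R u + (EF.eval R m * EF.eval R v + EF.eval R l * EF.eval R w)
    go u v w = trans (EF.eval-+ R _ _) (+-cong (EF.eval-* R g u) (trans (EF.eval-+ R _ _) (+-cong (EF.eval-* R m v) (EF.eval-* R l w))))

  Xq-at-point : ∀ R → HF.eval³ R Xq VF.≋ R
  Xq-at-point R = go c₁ , go c₂ , go c₃
    where
    go : ∀ j → EF.eval R (at j X ^ q) ≈ at j R
    go j = trans (HF.eval-^ R (at j X) q) (trans (fermat _) (HF.eval-variable R j))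

  -- The coefficients m, l of X^q in a homogeneous basis X, v, w cut out the missing points.
  record CompleteIntersection (A : Arrangement) : Set where
    field
      m l       : SPoly
      dm dl     : ℕ
      m-hom     : Homogeneous (suc dm) m
      l-hom     : Homogeneous (suc dl) l
      degrees   : suc dm ℕ.+ suc dl ℕ.+ length (forms A) ≡ suc (2 ℕ.* q)
      m-missing : ∀ R → Missing A R → EF.eval R m ≈ 0#
      l-missing : ∀ R → Missing A R → EF.eval R l ≈ 0#
      coprime   : ∀ α → Nonzero α → formPoly α ∣ m → formPoly α ∣ l → ⊥
      m≄0       : ¬ (m ≃ 0S)
      l≄0       : ¬ (l ≃ 0S)

  module _ (A : Arrangement) (H : HomogeneousBasis A) where
    open HomogeneousBasis H
    private
      Q = product (forms A)
      n = length (forms A)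
      i = proj₁ (inverse (ε scale) ε-scale)

      -- Since δ is homogeneous of degree d, the degree-d component of `scale` times δ is the
      -- constant term of `scale` times δ. Dividing by it leaves homogeneous coefficients.
      generate-homogeneous : ∀ d δ → InDer (forms A) δ → Homogeneous³ d δ →
        Σ R³ λ c → δ ≋ combination X v w c × Shifted a d (at c₂ c) × Shifted b d (at c₃ c)
      generate-homogeneous d δ@(δ₁ , δ₂ , δ₃) δ∈ (k₁ , k₂ , k₃) =
        (constS i *ₚ shift 1 d h₁ , constS i *ₚ shift a d h₂ , constS i *ₚ shift b d h₃) ,
        ( go δ₁ (at c₁ X) (at c₁ v) (at c₁ w) k₁ S.refl (proj₁ v-hom) (proj₁ w-hom) (proj₁ g)
        , go δ₂ (at c₂ X) (at c₂ v) (at c₂ w) k₂ S.refl (proj₁ (proj₂ v-hom)) (proj₁ (proj₂ w-hom)) (proj₁ (proj₂ g))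
        , go δ₃ (at c₃ X) (at c₃ v) (at c₃ w) k₃ S.refl (proj₂ (proj₂ v-hom)) (proj₂ (proj₂ w-hom)) (proj₂ (proj₂ g)) ) ,
        shift-shifted i a d h₂ , shift-shifted i b d h₃
        where
        h = proj₁ (generate δ δ∈)
        h₁ = at c₁ h
        h₂ = at c₂ h
        h₃ = at c₃ h
        g = proj₂ (generate δ δ∈)
        one : constS i *ₚ constS (ε scale) ≃ 1S
        one = S.trans (S.sym (constS-* i (ε scale))) (term-cong (trans (*-comm i (ε scale)) (proj₂ (inverse (ε scale) ε-scale))))
        go : ∀ δ x y z → Homogeneous d δ → Homogeneous 1 x → Homogeneous a y → Homogeneous b z →
          scale *ₚ δ ≃ h₁ *ₚ x +ₚ (h₂ *ₚ y +ₚ h₃ *ₚ z) →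
          δ ≃ (constS i *ₚ shift 1 d h₁) *ₚ x +ₚ ((constS i *ₚ shift a d h₂) *ₚ y +ₚ (constS i *ₚ shift b d h₃) *ₚ z)
        go δ x y z hδ hx hy hz e = S.trans (S.trans (S.sym (S.*-identityˡ δ)) (S.trans (S.*-congʳ {δ} (S.sym one))
            (solve 3 (λ i s δ → i :* s :* δ := i :* (δ :* s)) S.refl (constS i) (constS (ε scale)) δ)))
          (S.trans (S.*-congˡ {constS i} comps)
            (solve 7 (λ i x y z p r s → i :* (x :* p :+ (y :* r :+ z :* s)) := (i :* p) :* x :+ ((i :* r) :* y :+ (i :* s) :* z)) S.refl
              (constS i) x y z (shift 1 d h₁) (shift a d h₂) (shift b d h₃)))
          where
          part : ∀ k x f → Homogeneous k x → D.comp d (f *ₚ x) ≃ x *ₚ shift k d f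
          part k x f hx = S.trans (D.part-cong (D.only d) (S.*-comm f x)) (comp-shift k d x f hx)
          comps : δ *ₚ constS (ε scale) ≃ x *ₚ shift 1 d h₁ +ₚ (y *ₚ shift a d h₂ +ₚ z *ₚ shift b d h₃)
          comps = S.trans (S.*-congˡ {δ} (S.sym (shift-self d scale))) (S.trans (S.sym (part d δ scale hδ)) (S.trans (D.part-cong (D.only d) e)
            (S.trans (S.reflexive (≡.trans (D.part-+ (D.only d) (h₁ *ₚ x) _) (≡.cong (D.comp d (h₁ *ₚ x) +ₚ_) (D.part-+ (D.only d) (h₂ *ₚ y) (h₃ *ₚ z)))))
              (S.+-cong (part 1 x h₁ hx) (S.+-cong (part a y h₂ hy) (part b z h₃ hz))))))

      genXq = generate-homogeneous q Xq (InDer-Xq (forms A)) Xq-homogeneous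
      c = proj₁ genXq
      g = at c₁ c
      m = at c₂ c
      l = at c₃ c

      unit : Coordinate → R³
      unit j = at j (e₁ , e₂ , e₃)

      unit-homogeneous : ∀ j → Homogeneous³ n (Q • unit j)
      unit-homogeneous j = times (at c₁ (unit j)) (entry₁ j) , times (at c₂ (unit j)) (entry₂ j) , times (at c₃ (unit j)) (entry₃ j)
        where
        entry₁ : ∀ j → Homogeneous 0 (at c₁ (unit j))
        entry₁ c₁ = S.refl
        entry₁ c₂ = S.refl
        entry₁ c₃ = S.refl
        entry₂ : ∀ j → Homogeneous 0 (at c₂ (unit j))
        entry₂ c₁ = S.refl
        entry₂ c₂ = S.refl
        entry₂ c₃ = S.refl
        entry₃ : ∀ j → Homogeneous 0 (at c₃ (unit j))
        entry₃ c₁ = S.refl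
        entry₃ c₂ = S.refl
        entry₃ c₃ = S.refl
        times : ∀ x → Homogeneous 0 x → Homogeneous n (Q *ₚ x)
        times x hx = ≡.subst (λ k → Homogeneous k (Q *ₚ x)) (ℕP.+-identityʳ n) (D.Hom-* {n} {0} Q x (product-homogeneous (forms A)) hx)

      gen : ∀ j → Σ R³ λ c → Q • unit j ≋ combination X v w c × Shifted a n (at c₂ c) × Shifted b n (at c₃ c)
      gen j = generate-homogeneous n (Q • unit j) (InDer-• A (unit j)) (unit-homogeneous j)

      K = det X v w
      K' = proj₁ (product∣det A X v w (InDer-X (forms A)) v∈ w∈)
      K≃QK' : K ≃ Q *ₚ K'
      K≃QK' = proj₂ (product∣det A X v w (InDer-X (forms A)) v∈ w∈)

      -- The 2 × 2 minor of the v- and w-coordinates of X^q and Q eⱼ.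
      cofactor : Coordinate → SPoly
      cofactor j = m *ₚ at c₃ (proj₁ (gen j)) +ₚ negₚ (l *ₚ at c₂ (proj₁ (gen j)))

      unit-⊙ : ∀ j u → unit j ⊙ u ≃ at j u
      unit-⊙ c₁ u = VS.e₁-⊙ u
      unit-⊙ c₂ u = VS.e₂-⊙ u
      unit-⊙ c₃ u = VS.e₃-⊙ u

      -- Evaluate det(X, X^q, Q eⱼ) directly and through the basis.
      N-formula : ∀ j → at j N ≃ cofactor j *ₚ K'
      N-formula j = *-cancelˡ Q _ _ (product-forms-≄0 (nonzero A)) (S.trans (S.sym direct) (S.trans via-basis
          (S.trans (S.*-congˡ {cofactor j} K≃QK') (solve 3 (λ c Q K → c :* (Q :* K) := Q :* (c :* K)) S.refl (cofactor j) Q K'))))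
        where
        δ = Q • unit j
        direct : det X Xq δ ≃ Q *ₚ at j N
        direct = S.trans (VS.det-as-⊙ X Xq δ) (S.trans (VS.⊙-comm δ N) (S.trans (VS.⊙-• Q N (unit j)) (S.*-congˡ {Q} (S.trans (VS.⊙-comm N (unit j)) (unit-⊙ j N)))))
        via-basis : det X Xq δ ≃ cofactor j *ₚ K
        via-basis = S.trans (VS.det-cong (VS.≋-refl {X}) (proj₁ (proj₂ genXq)) (proj₁ (proj₂ (gen j))))
          (VS.det-comb g m l (at c₁ (proj₁ (gen j))) (at c₂ (proj₁ (gen j))) (at c₃ (proj₁ (gen j))) X v w)

      -- K' is the quotient of det(X, v, w) by Q, and `N-formula` shows that it divides every entry
      -- of N. This is the converse direction of Saito's criterion.
      K'-constant : Σ Carrier λ k → K' ≃ constS k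
      K'-constant = common-divisor-constant K' λ j → cofactor j , S.trans (N-formula j) (S.*-comm (cofactor j) K')

      k = proj₁ K'-constant

      K'≄0 : ¬ (K' ≃ 0S)
      K'≄0 z = N-≄0 c₁ (S.trans (N-formula c₁) (S.trans (S.*-congˡ {cofactor c₁} z) (S.zeroʳ (cofactor c₁))))

      k≉0 : ¬ (k ≈ 0#)
      k≉0 k≈0 = K'≄0 (S.trans (proj₂ K'-constant) (S.trans (term-cong k≈0) constS-0))

      -- The determinant is nonzero, homogeneous of degree 1 + a + b, and a constant times Q.
      degree-sum : n ≡ 1 ℕ.+ (a ℕ.+ b)
      degree-sum = homogeneous-degree {n} {1 ℕ.+ (a ℕ.+ b)} K
        (D.Supported-resp (D.only n) (S.sym K≃kQ) (D.Hom-* {0} {n} (constS k) Q (constS-homogeneous k) (product-homogeneous (forms A))))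
        (homogeneous-det {a} {b} v w v-hom w-hom)
        (λ z → product-≄0 (product-forms-≄0 (nonzero A)) K'≄0 (S.trans (S.sym K≃QK') z))
        where
        K≃kQ : K ≃ constS k *ₚ Q
        K≃kQ = S.trans K≃QK' (S.trans (S.*-congˡ {Q} (proj₂ K'-constant)) (S.*-comm Q (constS k)))

      -- At a missed point R the values of X, v, w are independent, and X^q has the same value as X.
      -- Comparing coordinates in X^q = g X + m v + l w forces m(R) = l(R) = 0.
      module AtMissing (R : V3) (missing : Missing A R) where
        vR = HF.eval³ R v
        wR = HF.eval³ R w
        det≉0 : ¬ (VF.det R vR wR ≈ 0#)
        det≉0 z = product-≉0 missing k≉0 (trans (sym (trans (EF.eval-cong R K≃QK') (trans (EF.eval-* R Q K')
            (*-congˡ (trans (EF.eval-cong R (proj₂ K'-constant)) (EF.eval-const R k))))))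
          (trans (HF.eval-det R X v w) (trans (VF.det-cong (HF.eval-X³ R) (VF.≋-refl {vR}) (VF.≋-refl {wR})) z)))
        expansion-R : R VF.≋ VF.combination R vR wR (HF.eval³ R c)
        expansion-R = VF.≋-trans (VF.≋-sym (Xq-at-point R)) (VF.≋-trans (eval³-cong R (proj₁ (proj₂ genXq)))
          (VF.≋-trans (eval³-combination R X v w c) (VF.⊞-cong (VF.•-cong refl (HF.eval-X³ R)) VF.≋-refl)))
        m-zero : EF.eval R m ≈ 0#
        m-zero = no-zero-divisors (trans (*-comm _ _) (trans (sym (VF.det-comb₂ (EF.eval R g) (EF.eval R m) (EF.eval R l) R vR wR))
          (trans (VF.det-cong (VF.≋-refl {R}) (VF.≋-sym expansion-R) (VF.≋-refl {wR})) (VF.det-repeat₁₂ R wR)))) det≉0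
        l-zero : EF.eval R l ≈ 0#
        l-zero = no-zero-divisors (trans (*-comm _ _) (trans (sym (VF.det-comb₃ (EF.eval R g) (EF.eval R m) (EF.eval R l) R vR wR))
          (trans (VF.det-cong (VF.≋-refl {R}) (VF.≋-refl {vR}) (VF.≋-sym expansion-R)) (VF.det-repeat₁₃ R vR)))) det≉0

      divides-N : ∀ α → α ∣ m → α ∣ l → ∀ j → α ∣ at j N
      divides-N α α∣m α∣l j = ∣-resp (S.sym (N-formula j)) (∣-*ʳ K' (∣-+ (∣-*ʳ (at c₃ (proj₁ (gen j))) α∣m)
        (∣-neg {h = l *ₚ at c₂ (proj₁ (gen j))} (∣-*ʳ (at c₂ (proj₁ (gen j))) α∣l))))

    complete-intersection : ∀ P → Missing A P → CompleteIntersection A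
    complete-intersection P missing = build (proj₁ (proj₂ (proj₂ genXq))) (proj₂ (proj₂ (proj₂ genXq)))
      where
      module M = AtMissing P missing

      constant⇒zero : ∀ p k → p ≃ constS k → EF.eval P p ≈ 0# → p ≃ 0S
      constant⇒zero p k e z = S.trans e (S.trans (term-cong (trans (sym (trans (EF.eval-cong P e) (EF.eval-const P k))) z)) constS-0)

      ∣0 : ∀ {p z} → z ≃ 0S → p ∣ z
      ∣0 {p} z≃0 = 0S , S.trans z≃0 (S.sym (S.zeroʳ p))

      both-zero : m ≃ 0S → l ≃ 0S → ⊥
      both-zero m≃0 l≃0 = N-≄0 c₁ (S.trans (proj₂ d) (S.zeroˡ (proj₁ d)))
        where d = divides-N 0S (∣0 m≃0) (∣0 l≃0) c₁

      -- If m = 0, then l divides every entry of N and is constant; it vanishes at P, so it is zero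
      -- as well, and then N = 0.
      nonzero-m : ¬ (m ≃ 0S)
      nonzero-m m≃0 = both-zero m≃0 (constant⇒zero l (proj₁ cd) (proj₂ cd) M.l-zero)
        where cd = common-divisor-constant l (divides-N l (∣0 m≃0) (1S , S.sym (S.*-identityʳ l)))

      nonzero-l : ¬ (l ≃ 0S)
      nonzero-l l≃0 = both-zero (constant⇒zero m (proj₁ cd) (proj₂ cd) M.m-zero) l≃0
        where cd = common-divisor-constant m (divides-N m (1S , S.sym (S.*-identityʳ m)) (∣0 l≃0))

      -- A polynomial of degree zero that vanishes at the missed point P would be zero.
      positive : ∀ p → ¬ (p ≃ 0S) → EF.eval P p ≈ 0# → ∀ d → Homogeneous d p → Σ ℕ λ e → d ≡ suc e
      positive p p≄0 z zero h = ⊥-elim (p≄0 (constant⇒zero p _ (bounded-0 p (D.Hom⇒Bounded {0} p h)) z))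
      positive p p≄0 z (suc e) h = e , ≡.refl

      build : Shifted a q m → Shifted b q l → CompleteIntersection A
      build (inj₂ m≃0) _ = ⊥-elim (nonzero-m m≃0)
      build (inj₁ _) (inj₂ l≃0) = ⊥-elim (nonzero-l l≃0)
      build (inj₁ (a≤q , hm)) (inj₁ (b≤q , hl)) = record
        { m = m ; l = l ; dm = proj₁ pm ; dl = proj₁ pl
        ; m-hom = ≡.subst (λ k → Homogeneous k m) (proj₂ pm) hm ; l-hom = ≡.subst (λ k → Homogeneous k l) (proj₂ pl) hl
        ; degrees = sum-degrees
        ; m-missing = λ R mi → AtMissing.m-zero R mi ; l-missing = λ R mi → AtMissing.l-zero R mi
        ; coprime = λ α α≉0 α∣m α∣l → proj₂ (form∤N α α≉0) (divides-N (formPoly α) α∣m α∣l (proj₁ (form∤N α α≉0)))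
        ; m≄0 = nonzero-m ; l≄0 = nonzero-l }
        where
        pm = positive m nonzero-m M.m-zero (q ℕ.∸ a) hm
        pl = positive l nonzero-l M.l-zero (q ℕ.∸ b) hl
        -- Here deg m = q - a, deg l = q - b and |A| = 1 + a + b.
        sum-degrees : suc (proj₁ pm) ℕ.+ suc (proj₁ pl) ℕ.+ n ≡ suc (2 ℕ.* q)
        sum-degrees = ≡.trans (≡.cong₂ ℕ._+_ (≡.cong₂ ℕ._+_ (≡.sym (proj₂ pm)) (≡.sym (proj₂ pl))) degree-sum)
          (≡.trans (rearrange (q ℕ.∸ a) a (q ℕ.∸ b) b) (≡.cong suc (≡.cong₂ (λ x y → x ℕ.+ (y ℕ.+ 0)) (ℕP.m∸n+n≡m a≤q) (ℕP.m∸n+n≡m b≤q))))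
          where
          open ℕSolver using () renaming (solve to solveℕ; _:+_ to _⊕_; con to conℕ; _:=_ to _⊜_)
          rearrange : ∀ x a y b → x ℕ.+ y ℕ.+ (1 ℕ.+ (a ℕ.+ b)) ≡ suc ((x ℕ.+ a) ℕ.+ (y ℕ.+ b ℕ.+ 0))
          rearrange = solveℕ 4 (λ x a y b → x ⊕ y ⊕ (conℕ 1 ⊕ (a ⊕ b)) ⊜ conℕ 1 ⊕ ((x ⊕ a) ⊕ (y ⊕ b ⊕ conℕ 0))) ≡.refl

-- Polarisation of quadratic forms.

module QuadraticForms {q : ℕ} (F : FiniteField q) where
  open Polynomials F
  open Domain F
  open Derivations F using (module D; Homogeneous)

  module _ (𝔸 : Algebra) where
    open Algebra 𝔸
    open Eval 𝔸
    open Linear 𝔸 using (module R)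
    private module V = Vector3 ringA
    open R using () renaming (Carrier to A; _≈_ to _≈A_; _+_ to _+A_; _*_ to _*A_; -_ to -A_)
    open RingSolver ringA
    open V using (_•_; _⊞_)

    private
      -- The value at a u + b v, given the values f, g, h at u, u + v, v. The polar form is g - f -
      -- h, which is meaningful in characteristic two.
      target : (a b f g h : A) → A
      target a b f g h = (a *A a) *A f +A ((a *A b) *A (g +A (-A (f +A h))) +A (b *A b) *A h)

      -- Both sides of the polarisation identity are linear in the polynomial, so the six quadratic
      -- monomials suffice.
      monomial-quadratic : ∀ a b u v m → Weight.weight degree m ≡ 2 →
        monomial (a • u ⊞ b • v) m ≈A target a b (monomial u m) (monomial (u ⊞ v) m) (monomial v m)
      monomial-quadratic a b (x , y , z) (x' , y' , z') (2 , 0 , 0) _ = solve 4 (λ a b x x' →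
        let p = λ t → (t :* (t :* con ℤ.1ℤ)) :* (con ℤ.1ℤ :* con ℤ.1ℤ) in
        p (a :* x :+ b :* x') := (a :* a) :* p x :+ ((a :* b) :* (p (x :+ x') :- (p x :+ p x')) :+ (b :* b) :* p x')) R.refl a b x x'
      monomial-quadratic a b (x , y , z) (x' , y' , z') (0 , 2 , 0) _ = solve 4 (λ a b x x' →
        let p = λ t → con ℤ.1ℤ :* ((t :* (t :* con ℤ.1ℤ)) :* con ℤ.1ℤ) in
        p (a :* x :+ b :* x') := (a :* a) :* p x :+ ((a :* b) :* (p (x :+ x') :- (p x :+ p x')) :+ (b :* b) :* p x')) R.refl a b y y'
      monomial-quadratic a b (x , y , z) (x' , y' , z') (0 , 0 , 2) _ = solve 4 (λ a b x x' →
        let p = λ t → con ℤ.1ℤ :* (con ℤ.1ℤ :* (t :* (t :* con ℤ.1ℤ))) in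
        p (a :* x :+ b :* x') := (a :* a) :* p x :+ ((a :* b) :* (p (x :+ x') :- (p x :+ p x')) :+ (b :* b) :* p x')) R.refl a b z z'
      monomial-quadratic a b (x , y , z) (x' , y' , z') (1 , 1 , 0) _ = solve 6 (λ a b x x' y y' →
        let p = λ t s → (t :* con ℤ.1ℤ) :* ((s :* con ℤ.1ℤ) :* con ℤ.1ℤ) in
        p (a :* x :+ b :* x') (a :* y :+ b :* y') := (a :* a) :* p x y :+ ((a :* b) :* (p (x :+ x') (y :+ y') :- (p x y :+ p x' y')) :+ (b :* b) :* p x' y')) R.refl a b x x' y y'
      monomial-quadratic a b (x , y , z) (x' , y' , z') (1 , 0 , 1) _ = solve 6 (λ a b x x' y y' →
        let p = λ t s → (t :* con ℤ.1ℤ) :* (con ℤ.1ℤ :* (s :* con ℤ.1ℤ)) in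
        p (a :* x :+ b :* x') (a :* y :+ b :* y') := (a :* a) :* p x y :+ ((a :* b) :* (p (x :+ x') (y :+ y') :- (p x y :+ p x' y')) :+ (b :* b) :* p x' y')) R.refl a b x x' z z'
      monomial-quadratic a b (x , y , z) (x' , y' , z') (0 , 1 , 1) _ = solve 6 (λ a b x x' y y' →
        let p = λ t s → con ℤ.1ℤ :* ((t :* con ℤ.1ℤ) :* (s :* con ℤ.1ℤ)) in
        p (a :* x :+ b :* x') (a :* y :+ b :* y') := (a :* a) :* p x y :+ ((a :* b) :* (p (x :+ x') (y :+ y') :- (p x y :+ p x' y')) :+ (b :* b) :* p x' y')) R.refl a b y y' z z'
      monomial-quadratic a b u v (suc (suc (suc _)) , _ , _) ()
      monomial-quadratic a b u v (2 , suc _ , _) ()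
      monomial-quadratic a b u v (2 , 0 , suc _) ()
      monomial-quadratic a b u v (1 , suc (suc _) , _) ()
      monomial-quadratic a b u v (1 , 1 , suc _) ()
      monomial-quadratic a b u v (1 , 0 , 0) ()
      monomial-quadratic a b u v (1 , 0 , suc (suc _)) ()
      monomial-quadratic a b u v (0 , suc (suc (suc _)) , _) ()
      monomial-quadratic a b u v (0 , 2 , suc _) ()
      monomial-quadratic a b u v (0 , 1 , 0) ()
      monomial-quadratic a b u v (0 , 1 , suc (suc _)) ()
      monomial-quadratic a b u v (0 , 0 , 0) ()
      monomial-quadratic a b u v (0 , 0 , 1) ()
      monomial-quadratic a b u v (0 , 0 , suc (suc (suc _))) ()

      target-0 : ∀ a b → R.0# ≈A target a b R.0# R.0# R.0#
      target-0 a b = solve 2 (λ a b → con ℤ.0ℤ := (a :* a) :* con ℤ.0ℤ :+ ((a :* b) :* (con ℤ.0ℤ :- (con ℤ.0ℤ :+ con ℤ.0ℤ)) :+ (b :* b) :* con ℤ.0ℤ)) R.refl a b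

      target-+ : ∀ a b c f g h f' g' h' → (c *A target a b f g h) +A target a b f' g' h' ≈A target a b (c *A f +A f') (c *A g +A g') (c *A h +A h')
      target-+ a b c f g h f' g' h' = solve 9 (λ a b c f g h f' g' h' →
        let t = λ f g h → (a :* a) :* f :+ ((a :* b) :* (g :- (f :+ h)) :+ (b :* b) :* h) in
        c :* t f g h :+ t f' g' h' := t (c :* f :+ f') (c :* g :+ g') (c :* h :+ h')) R.refl a b c f g h f' g' h'

      terms-quadratic : ∀ a b u v p → D.Terms (_≡ 2) p → eval (a • u ⊞ b • v) p ≈A target a b (eval u p) (eval (u ⊞ v) p) (eval v p)
      terms-quadratic a b u v [] [] = target-0 a b
      terms-quadratic a b u v ((c , m) ∷ p) (e ∷ es) = R.trans (R.+-cong (R.*-congˡ (monomial-quadratic a b u v m e)) (terms-quadratic a b u v p es))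
        (target-+ a b (ι c) _ _ _ _ _ _)

      target-cong : ∀ a b {f g h f' g' h'} → f ≈A f' → g ≈A g' → h ≈A h' → target a b f g h ≈A target a b f' g' h'
      target-cong a b e e' e'' = R.+-cong (R.*-congˡ e) (R.+-cong (R.*-congˡ (R.+-cong e' (R.-‿cong (R.+-cong e e'')))) (R.*-congˡ e''))

    quadratic : ∀ a b u v p → Homogeneous 2 p → eval (a • u ⊞ b • v) p ≈A
      ((a *A a) *A eval u p +A ((a *A b) *A (eval (u ⊞ v) p +A (-A (eval u p +A eval v p))) +A (b *A b) *A eval v p))
    quadratic a b u v p hp = R.trans (eval-cong _ (S.sym hp)) (R.trans
      (terms-quadratic a b u v (D.comp 2 p) (All.map (λ {t} e → ≡.sym (D.only-true⁻ {2} {Weight.weight degree (proj₂ t)} e)) (D.part-terms (D.only 2) p)))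
      (target-cong a b (eval-cong u hp) (eval-cong (u ⊞ v) hp) (eval-cong v hp)))

-- Missed points of a free arrangement fall into few classes.

module MissingPoints {q : ℕ} (F : FiniteField q) where
  open FiniteField F hiding (zero; _≟_)
  open FiniteField F using (_≟_)
  open Arr F hiding (μ; L; dim; size; _+S_; _*S_)
  open Polynomials F
  open Domain F
  open FieldLemmas F
  open LinearForms F
  open Derivations F
  open VanishingIdeal F using (module EF)
  open Construction F
  open Necessity F
  open QuadraticForms F
  open VF using (_≋_; _⨯_; _⊙_; _•_; _⊞_; 𝟘; det)

  linear-form : ∀ p → Homogeneous 1 p → Σ V3 λ α → p ≃ formPoly α
  linear-form p hp = (coeffS p (1 , 0 , 0) , coeffS p (0 , 1 , 0) , coeffS p (0 , 0 , 1)) , coeffwise go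
    where
    off : ∀ m → D.only 1 (Weight.weight degree m) ≡ false → coeffS p m ≈ 0#
    off m e = D.supported⁻ (D.only 1) p hp m e
    go : ∀ m → coeffS p m ≈ coeffS (formPoly (coeffS p (1 , 0 , 0) , coeffS p (0 , 1 , 0) , coeffS p (0 , 0 , 1))) m
    go (1 , 0 , 0) = sym (+-identityʳ _)
    go (0 , 1 , 0) = sym (+-identityʳ _)
    go (0 , 0 , 1) = sym (+-identityʳ _)
    go (0 , 0 , 0) = off (0 , 0 , 0) ≡.refl
    go (0 , 0 , suc (suc c)) = off (0 , 0 , suc (suc c)) ≡.refl
    go (0 , 1 , suc c) = off (0 , 1 , suc c) ≡.refl
    go (0 , suc (suc b) , c) = off (0 , suc (suc b) , c) ≡.refl
    go (1 , suc b , c) = off (1 , suc b , c) ≡.refl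
    go (1 , 0 , suc c) = off (1 , 0 , suc c) ≡.refl
    go (suc (suc a) , b , c) = off (suc (suc a) , b , c) ≡.refl

  -- For the axis e of a nonzero coordinate γ_j, expanding e × (γ × α) = 0 gives α_j γ = γ_j α.
  parallel⇒scalar : ∀ γ α → Nonzero γ → γ ⨯ α ≋ 𝟘 → Σ Carrier λ k → α ≋ k • γ
  parallel⇒scalar γ α γ≉0 p = i * at j α , scaled α γ (VF.≋-trans (VF.≋-sym (VF.⨯-⨯ e γ α)) (VF.⨯-𝟘 e (γ ⨯ α) p))
    where
    j = proj₁ (pivot γ γ≉0)
    γⱼ≉0 = proj₂ (pivot γ γ≉0)
    i = proj₁ (inverse (at j γ) γⱼ≉0)
    e = axis j 1#
    value : ∀ u → e ⊙ u ≈ at j u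
    value u = trans (VF.⊙-comm e u) (trans (⊙-axis u j 1#) (*-identityʳ _))
    scaled : ∀ α' γ' → (e ⊙ α) • γ' ⊞ (- (e ⊙ γ)) • α' ≋ 𝟘 → α' ≋ (i * at j α) • γ'
    scaled (a , b , c) (x , y , z) (p , r , s) = go a x p , go b y r , go c z s
      where
      open RingSolver commRing
      go : ∀ a x → (e ⊙ α) * x + (- (e ⊙ γ)) * a ≈ 0# → a ≈ (i * at j α) * x
      go a x h = trans (sym (*-identityˡ a)) (trans (*-congʳ (sym (trans (*-comm i (at j γ)) (proj₂ (inverse (at j γ) γⱼ≉0)))))
        (trans (solve 5 (λ i g a al x → i :* g :* a := (i :* al) :* x :- i :* (al :* x :+ (:- g) :* a)) refl i (at j γ) a (at j α) x)
          (trans (+-congˡ (-‿cong (trans (*-congˡ (trans (+-cong (*-congʳ (sym (value α))) (*-congʳ (-‿cong (sym (value γ))))) h)) (zeroʳ i))))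
            (solve 1 (λ y → y :- con ℤ.0ℤ := y) refl _))))

  form-scale : ∀ k γ α → α ≋ k • γ → formPoly α ≃ formPoly γ *ₚ constS k
  form-scale k γ@(x , y , z) α (e₁ , e₂ , e₃) = S.trans (form-⊙ α) (S.trans
    (VS.⊙-cong {v = X} (S.trans (term-cong e₁) (constS-* k x) , S.trans (term-cong e₂) (constS-* k y) , S.trans (term-cong e₃) (constS-* k z)) VS.≋-refl)
    (S.trans (pull (constS k) (ι³ γ) X) (S.trans (S.*-comm (constS k) _) (S.*-congʳ (S.sym (form-⊙ γ))))))
    where
    pull : ∀ k u v → (k VS.• u) VS.⊙ v ≃ k *ₚ (u VS.⊙ v)
    pull k u v = S.trans (VS.⊙-comm (k VS.• u) v) (S.trans (VS.⊙-• k v u) (S.*-congˡ {k} (VS.⊙-comm v u)))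

  form-through : ∀ α P R → α ⊙ P ≈ 0# → α ⊙ R ≈ 0# → α ⨯ (P ⨯ R) ≋ 𝟘
  form-through α P R αP αR = VF.≋-trans (VF.⨯-⨯ α P R) (VF.≋-trans (VF.⊞-cong (VF.𝟘-• (α ⊙ R) P αR) (VF.𝟘-• (- (α ⊙ P)) R (trans (-‿cong αP) -0#≈0#)))
    (+-identityˡ 0# , +-identityˡ 0# , +-identityˡ 0#))
    where
    open Algebra.Properties.Ring ring using (-0#≈0#)

  form-at-missing : ∀ {A} p α → p ≃ formPoly α → (∀ R → Missing A R → EF.eval R p ≈ 0#) → ∀ R → Missing A R → α ⊙ R ≈ 0#
  form-at-missing p α e h R mi = trans (sym (EF.eval-form R α)) (trans (EF.eval-cong R (S.sym e)) (h R mi))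

  ∣-through : ∀ p α P R → p ≃ formPoly α → Nonzero (P ⨯ R) → α ⊙ P ≈ 0# → α ⊙ R ≈ 0# → formPoly (P ⨯ R) ∣ p
  ∣-through p α P R e γ≉0 αP αR = constS (proj₁ s) , S.trans e (form-scale (proj₁ s) (P ⨯ R) α (proj₂ s))
    where s = parallel⇒scalar (P ⨯ R) α γ≉0 (parallel-sym α (P ⨯ R) (form-through α P R αP αR))

  parallel? : ∀ u v → Dec (Parallel u v)
  parallel? u v with at c₁ (u ⨯ v) ≟ 0# | at c₂ (u ⨯ v) ≟ 0# | at c₃ (u ⨯ v) ≟ 0#
  ... | yes a | yes b | yes c = yes (a , b , c)
  ... | no ne | _ | _ = no (ne ∘ proj₁)
  ... | yes _ | no ne | _ = no (ne ∘ proj₁ ∘ proj₂)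
  ... | yes _ | yes _ | no ne = no (ne ∘ proj₂ ∘ proj₂)

  module _ (A : Arrangement) (C : CompleteIntersection A) where
    open CompleteIntersection C

    -- Both m and l are linear; if P and R were not parallel, the line joining them would divide
    -- both.
    one-class : dm ≡ 0 → dl ≡ 0 → ∀ P R → Missing A P → Missing A R → Parallel P R
    one-class dm≡0 dl≡0 P R mP mR with parallel? P R
    ... | yes p = p
    ... | no P∦R = ⊥-elim (coprime (P ⨯ R) P∦R
        (through m (≡.subst (λ k → Homogeneous (suc k) m) dm≡0 m-hom) m-missing)
        (through l (≡.subst (λ k → Homogeneous (suc k) l) dl≡0 l-hom) l-missing))
      where
      through : ∀ p → Homogeneous 1 p → (∀ R → Missing A R → EF.eval R p ≈ 0#) → formPoly (P ⨯ R) ∣ p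
      through p hp mi = ∣-through p (proj₁ lf) P R (proj₂ lf) P∦R (form-at-missing {A} p (proj₁ lf) (proj₂ lf) mi P mP) (form-at-missing {A} p (proj₁ lf) (proj₂ lf) mi R mR)
        where lf = linear-form p hp

  private
    constS-neg : ∀ x → constS (- x) ≃ negₚ (constS x)
    constS-neg x = S.trans (solve 2 (λ a b → a := (a :+ b) :- b) S.refl (constS (- x)) (constS x))
      (S.trans (S.+-congʳ (S.trans (S.sym (constS-+ (- x) x)) (S.trans (term-cong (-‿inverseˡ x)) constS-0))) (S.+-identityˡ (negₚ (constS x))))
      where open RingSolver polyRing

    ι³-⨯ : ∀ u v → ι³ (u ⨯ v) VS.≋ ι³ u VS.⨯ ι³ v
    ι³-⨯ (a , b , c) (x , y , z) = minor b z c y , minor c x a z , minor a y b x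
      where
      minor : ∀ b z c y → constS (b * z - c * y) ≃ constS b *ₚ constS z +ₚ negₚ (constS c *ₚ constS y)
      minor b z c y = S.trans (constS-+ (b * z) (- (c * y))) (S.+-cong (constS-* b z) (S.trans (constS-neg (c * y)) (S.-‿cong (constS-* c y))))

    open Algebra.Properties.Semiring.Exp semiring using () renaming (_^_ to _^F_)

    eval-ι³ : ∀ s p → eval (ι³ s) p ≃ constS (EF.eval s p)
    eval-ι³ s [] = S.sym constS-0
    eval-ι³ s ((c , m) ∷ p) = S.trans (S.+-cong (S.trans (S.*-congˡ {constS c} (mono s m)) (S.sym (constS-* c (EF.monomial s m)))) (eval-ι³ s p))
      (S.sym (constS-+ (c * EF.monomial s m) (EF.eval s p)))
      where
      power : ∀ x n → constS x ^ n ≃ constS (x ^F n)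
      power x zero = S.refl
      power x (suc n) = S.trans (S.*-congˡ {constS x} (power x n)) (S.sym (constS-* x (x ^F n)))
      mono : ∀ s m → monomial (ι³ s) m ≃ constS (EF.monomial s m)
      mono (x , y , z) (a , b , c) = S.trans (S.*-cong (power x a) (S.trans (S.*-cong (power y b) (power z c)) (S.sym (constS-* _ _)))) (S.sym (constS-* _ _))

  -- With Δ P₃ = a P₁ + b P₂ and a, b nonzero, vanishing at P₃ kills the polar term of P₁ and P₂.
  -- The conic then vanishes at all combinations of P₁ and P₂, also with polynomial coefficients,
  -- and so at the generic point t of the line α.
  module ThreePoints (α : V3) (α≉0 : Nonzero α) (p : SPoly) (p-hom : Homogeneous 2 p) (P₁ P₂ P₃ : V3)
      (α₁ : α ⊙ P₁ ≈ 0#) (α₂ : α ⊙ P₂ ≈ 0#) (α₃ : α ⊙ P₃ ≈ 0#)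
      (p₁ : EF.eval P₁ p ≈ 0#) (p₂ : EF.eval P₂ p ≈ 0#) (p₃ : EF.eval P₃ p ≈ 0#)
      (P₁∦P₂ : ¬ Parallel P₁ P₂) (P₁∦P₃ : ¬ Parallel P₁ P₃) (P₂∦P₃ : ¬ Parallel P₂ P₃) where
    private
      γ = P₁ ⨯ P₂
      j = proj₁ (pivot γ P₁∦P₂)
      f = axis j 1#
      Δ = det P₁ P₂ f

      Δ≉0 : ¬ (Δ ≈ 0#)
      Δ≉0 z = proj₂ (pivot γ P₁∦P₂) (trans (sym (trans (VF.det-as-⊙ P₁ P₂ f) (trans (VF.⊙-comm f γ) (trans (⊙-axis γ j 1#) (*-identityʳ _))))) z)

      γ-scalar : Σ Carrier λ k → γ ≋ k • α
      γ-scalar = parallel⇒scalar α γ α≉0 (form-through α P₁ P₂ α₁ α₂)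

      γ₃ : det P₁ P₂ P₃ ≈ 0#
      γ₃ = trans (VF.det-as-⊙ P₁ P₂ P₃) (trans (VF.⊙-cong (VF.≋-refl {P₃}) (proj₂ γ-scalar)) (trans (VF.⊙-• (proj₁ γ-scalar) P₃ α)
        (trans (*-congˡ (trans (VF.⊙-comm P₃ α) α₃)) (zeroʳ _))))

      a = det P₃ P₂ f
      b = det P₁ P₃ f

      drop-last : ∀ u w {k} → k ≈ 0# → u ⊞ k • w ≋ u
      drop-last (x , y , z) (x' , y' , z') k≈0 = go x x' , go y y' , go z z'
        where
        go : ∀ x x' → x + _ * x' ≈ x
        go x x' = trans (+-congˡ (trans (*-congʳ k≈0) (zeroˡ x'))) (+-identityʳ x)

      P₃-combination : Δ • P₃ ≋ a • P₁ ⊞ b • P₂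
      P₃-combination = VF.≋-trans (VF.cramer P₁ P₂ f P₃) (VF.⊞-cong (VF.≋-refl {a • P₁}) (drop-last (b • P₂) f γ₃))

      scale-kills : ∀ k u v → ¬ (k ≈ 0#) → u ⨯ (k • v) ≋ 𝟘 → u ⨯ v ≋ 𝟘
      scale-kills k (x , y , z) (x' , y' , z') k≉0 (e₁ , e₂ , e₃) = go y z' z y' e₁ , go z x' x z' e₂ , go x y' y x' e₃
        where
        open RingSolver commRing
        go : ∀ y z' z y' → y * (k * z') - z * (k * y') ≈ 0# → y * z' - z * y' ≈ 0#
        go y z' z y' e = no-zero-divisors (trans (solve 5 (λ k y z' z y' → k :* (y :* z' :- z :* y') := y :* (k :* z') :- z :* (k :* y')) refl k y z' z y') e) k≉0

      self-multiple : ∀ u k → u ⨯ (k • u) ≋ 𝟘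
      self-multiple (x , y , z) k = go y z , go z x , go x y
        where
        open RingSolver commRing
        go : ∀ y z → y * (k * z) - z * (k * y) ≈ 0#
        go y z = solve 3 (λ k y z → y :* (k :* z) :- z :* (k :* y) := con ℤ.0ℤ) refl k y z

      drop-first : ∀ u w {k} → k ≈ 0# → k • w ⊞ u ≋ u
      drop-first (x , y , z) (x' , y' , z') k≈0 = go x x' , go y y' , go z z'
        where
        go : ∀ x x' → _ * x' + x ≈ x
        go x x' = trans (+-congʳ (trans (*-congʳ k≈0) (zeroˡ x'))) (+-identityˡ x)

      a≉0 : ¬ (a ≈ 0#)
      a≉0 z = P₂∦P₃ (scale-kills Δ P₂ P₃ Δ≉0 (VF.≋-trans (VF.⨯-cong (VF.≋-refl {P₂}) (VF.≋-trans P₃-combination (drop-first (b • P₂) P₁ z))) (self-multiple P₂ b)))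

      b≉0 : ¬ (b ≈ 0#)
      b≉0 z = P₁∦P₃ (scale-kills Δ P₁ P₃ Δ≉0 (VF.≋-trans (VF.⨯-cong (VF.≋-refl {P₁}) (VF.≋-trans P₃-combination (drop-last (a • P₁) P₂ z))) (self-multiple P₁ a)))

      sum-zero : EF.eval (P₁ ⊞ P₂) p ≈ 0#
      sum-zero = no-zero-divisors (trans (sym reduced) zero-lhs) (product-≉0 a≉0 b≉0)
        where
        open RingSolver commRing
        -- The value at Δ P₃ is Δ² p(P₃), read off from the polarisation identity with second
        -- coefficient zero.
        zero-lhs : EF.eval (a • P₁ ⊞ b • P₂) p ≈ 0#
        zero-lhs = trans (EF.eval-congˡ p (VF.≋-sym P₃-combination)) (trans (EF.eval-congˡ p (VF.≋-sym (drop-last (Δ • P₃) P₃ refl)))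
          (trans (quadratic base Δ 0# P₃ P₃ p p-hom) (trans (+-cong (*-congˡ p₃) (+-cong (*-congʳ (zeroʳ Δ)) (*-congˡ p₃)))
            (solve 2 (λ d x → (d :* d) :* con ℤ.0ℤ :+ (con ℤ.0ℤ :* x :+ (con ℤ.0ℤ :* con ℤ.0ℤ) :* con ℤ.0ℤ) := con ℤ.0ℤ) refl Δ _))))
        reduced : EF.eval (a • P₁ ⊞ b • P₂) p ≈ (a * b) * EF.eval (P₁ ⊞ P₂) p
        reduced = trans (quadratic base a b P₁ P₂ p p-hom) (trans (+-cong (*-congˡ p₁) (+-cong (*-congˡ (+-congˡ (-‿cong (+-cong p₁ p₂)))) (*-congˡ p₂)))
          (solve 3 (λ a b x → (a :* a) :* con ℤ.0ℤ :+ ((a :* b) :* (x :- (con ℤ.0ℤ :+ con ℤ.0ℤ)) :+ (b :* b) :* con ℤ.0ℤ) := (a :* b) :* x) refl a b (EF.eval (P₁ ⊞ P₂) p)))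

      e = proj₁ (section α α≉0)
      αe≈1 = proj₂ (section α α≉0)
      t = projection α e
      I₁ = ι³ P₁
      I₂ = ι³ P₂
      If = ι³ f
      ΔS = VS.det I₁ I₂ If

      ΔS≃Δ : ΔS ≃ constS Δ
      ΔS≃Δ = S.trans (VS.det-as-⊙ I₁ I₂ If) (S.trans (VS.⊙-cong (VS.≋-refl {If}) (VS.≋-sym (ι³-⨯ P₁ P₂)))
        (S.trans (S.sym (constS-⊙ f γ)) (term-cong (sym (VF.det-as-⊙ P₁ P₂ f)))))

      t-on-line : VS.det I₁ I₂ t ≃ 0S
      t-on-line = S.trans (VS.det-as-⊙ I₁ I₂ t) (S.trans (VS.⊙-cong (VS.≋-refl {t}) (VS.≋-sym (ι³-⨯ P₁ P₂))) (S.trans (VS.⊙-comm t (ι³ γ))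
        (S.trans (S.sym (eval-form t γ)) (S.trans (eval-cong t (form-scale (proj₁ γ-scalar) α γ (proj₂ γ-scalar)))
          (S.trans (eval-* t (formPoly α) _) (S.trans (S.*-congʳ (eval-projection-self α e αe≈1)) (S.zeroˡ _)))))))

      aS = VS.det t I₂ If
      bS = VS.det I₁ t If

      -- Cramer's rule over the polynomial ring. The third coefficient is a scalar multiple of α(t),
      -- which vanishes since t is the projection along α.
      t-combination : ΔS VS.• t VS.≋ aS VS.• I₁ VS.⊞ bS VS.• I₂
      t-combination = VS.≋-trans (VS.cramer I₁ I₂ If t) (VS.⊞-cong (VS.≋-refl {aS VS.• I₁}) (drop (bS VS.• I₂) If t-on-line))
        where
        drop : ∀ u w {k} → k ≃ 0S → u VS.⊞ k VS.• w VS.≋ u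
        drop (x , y , z) (x' , y' , z') {k} k≃0 = go x x' , go y y' , go z z'
          where
          go : ∀ x x' → x +ₚ k *ₚ x' ≃ x
          go x x' = S.trans (S.+-congˡ {x} (S.trans (S.*-congʳ {x'} k≃0) (S.zeroˡ x'))) (S.+-identityʳ x)

      at-constant : ∀ s → EF.eval s p ≈ 0# → eval (ι³ s) p ≃ 0S
      at-constant s z = S.trans (eval-ι³ s p) (S.trans (term-cong z) constS-0)

      ι³-⊞ : ∀ u v → ι³ (u ⊞ v) VS.≋ ι³ u VS.⊞ ι³ v
      ι³-⊞ (x , y , z) (x' , y' , z') = constS-+ x x' , constS-+ y y' , constS-+ z z'

      at-t : eval t p ≃ 0S
      at-t = ≄0-cancel (eval t p) (product-≄0 ΔS≄0 ΔS≄0) (S.trans (S.sym lhs) zero-rhs)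
        where
        open RingSolver polyRing
        ΔS≄0 : ¬ (ΔS ≃ 0S)
        ΔS≄0 z = constS-≄0 Δ≉0 (S.trans (S.sym ΔS≃Δ) z)
        pad : ∀ u w → u VS.⊞ 0S VS.• w VS.≋ u
        pad (x , y , z) (x' , y' , z') = go x x' , go y y' , go z z'
          where
          go : ∀ x x' → x +ₚ 0S *ₚ x' ≃ x
          go x x' = S.trans (S.+-congˡ {x} (S.zeroˡ x')) (S.+-identityʳ x)
        lhs : eval (ΔS VS.• t) p ≃ (ΔS *ₚ ΔS) *ₚ eval t p
        lhs = S.trans (eval-congˡ p (VS.≋-sym (pad (ΔS VS.• t) t))) (S.trans (quadratic polyAlgebra ΔS 0S t t p p-hom)
          (solve 3 (λ d x y → (d :* d) :* x :+ ((d :* con ℤ.0ℤ) :* (y :- (x :+ x)) :+ (con ℤ.0ℤ :* con ℤ.0ℤ) :* x) := (d :* d) :* x) S.refl ΔS (eval t p) (eval (t VS.⊞ t) p)))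
        zero-rhs : eval (ΔS VS.• t) p ≃ 0S
        zero-rhs = S.trans (eval-congˡ p t-combination) (S.trans (quadratic polyAlgebra aS bS I₁ I₂ p p-hom)
          (S.trans (S.+-cong (S.*-congˡ {aS *ₚ aS} (at-constant P₁ p₁)) (S.+-cong (S.*-congˡ {aS *ₚ bS} (S.+-cong
              (S.trans (eval-congˡ p (VS.≋-sym (ι³-⊞ P₁ P₂))) (at-constant (P₁ ⊞ P₂) sum-zero)) (S.-‿cong (S.+-cong (at-constant P₁ p₁) (at-constant P₂ p₂)))))
              (S.*-congˡ {bS *ₚ bS} (at-constant P₂ p₂))))
            (solve 2 (λ a b → (a :* a) :* con ℤ.0ℤ :+ ((a :* b) :* (con ℤ.0ℤ :- (con ℤ.0ℤ :+ con ℤ.0ℤ)) :+ (b :* b) :* con ℤ.0ℤ) := con ℤ.0ℤ) S.refl aS bS)))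

    line-∣-conic : formPoly α ∣ p
    line-∣-conic = projection⇒∣ α e p at-t

  -- The linear one of m and l puts the three points on a line; this line then divides the quadratic
  -- one as well, against coprimality.
  at-most-two-classes : ∀ A (C : CompleteIntersection A) → let open CompleteIntersection C in
    (dm ≡ 0 × dl ≡ 1) ⊎ (dm ≡ 1 × dl ≡ 0) → ∀ P₁ P₂ P₃ → Missing A P₁ → Missing A P₂ → Missing A P₃ →
    ¬ Parallel P₁ P₂ → ¬ Parallel P₁ P₃ → ¬ Parallel P₂ P₃ → ⊥
  at-most-two-classes A C cases P₁ P₂ P₃ m₁ m₂ m₃ ∦₁₂ ∦₁₃ ∦₂₃ = go cases
    where
    open CompleteIntersection C
    contradiction : ∀ p r → Homogeneous 1 p → Homogeneous 2 r → ¬ (p ≃ 0S) → (∀ R → Missing A R → EF.eval R p ≈ 0#) → (∀ R → Missing A R → EF.eval R r ≈ 0#) →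
      (∀ α → Nonzero α → formPoly α ∣ p → formPoly α ∣ r → ⊥) → ⊥
    contradiction p r hp hr p≄0 mp mr co = co α α≉0 (1S , S.trans (proj₂ lf) (S.sym (S.*-identityʳ (formPoly α))))
        (ThreePoints.line-∣-conic α α≉0 r hr P₁ P₂ P₃ (on P₁ m₁) (on P₂ m₂) (on P₃ m₃) (mr P₁ m₁) (mr P₂ m₂) (mr P₃ m₃) ∦₁₂ ∦₁₃ ∦₂₃)
      where
      lf = linear-form p hp
      α = proj₁ lf
      on = form-at-missing {A} p α (proj₂ lf) mp
      α≉0 : Nonzero α
      α≉0 (e₁ , e₂ , e₃) = p≄0 (S.trans (proj₂ lf) (S.trans (form-scale 0# α α (tr e₁ , tr e₂ , tr e₃)) (S.trans (S.*-congˡ {formPoly α} constS-0) (S.zeroʳ (formPoly α)))))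
        where
        tr : ∀ {x} → x ≈ 0# → x ≈ 0# * x
        tr e = trans e (sym (zeroˡ _))
    go : (dm ≡ 0 × dl ≡ 1) ⊎ (dm ≡ 1 × dl ≡ 0) → ⊥
    go (inj₁ (e , e')) = contradiction m l (≡.subst (λ k → Homogeneous (suc k) m) e m-hom) (≡.subst (λ k → Homogeneous (suc k) l) e' l-hom) m≄0 m-missing l-missing coprime
    go (inj₂ (e , e')) = contradiction l m (≡.subst (λ k → Homogeneous (suc k) l) e' l-hom) (≡.subst (λ k → Homogeneous (suc k) m) e m-hom) l≄0 l-missing m-missing
      λ α α≉0 d d' → coprime α α≉0 d' d

-- Counting lists without repetitions.

module Counting where

  module _ {A : Set} (_~_ : A → A → Set) (~-sym : ∀ {x y} → x ~ y → y ~ x) (~-trans : ∀ {x y z} → x ~ y → y ~ z → x ~ z) where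

    private
      remove : ∀ {x} ys → Any (x ~_) ys → List A
      remove (y ∷ ys) (here _) = ys
      remove (y ∷ ys) (there a) = y ∷ remove ys a

      length-remove : ∀ {x} ys (a : Any (x ~_) ys) → length ys ≡ suc (length (remove ys a))
      length-remove (y ∷ ys) (here _) = ≡.refl
      length-remove (y ∷ ys) (there a) = ≡.cong suc (length-remove ys a)

      keep : ∀ {x z} ys (a : Any (x ~_) ys) → ¬ (x ~ z) → Any (z ~_) ys → Any (z ~_) (remove ys a)
      keep (y ∷ ys) (here x~y) x≁z (here z~y) = ⊥-elim (x≁z (~-trans x~y (~-sym z~y)))
      keep (y ∷ ys) (here x~y) x≁z (there b) = b
      keep (y ∷ ys) (there a) x≁z (here z~y) = here z~y
      keep (y ∷ ys) (there a) x≁z (there b) = there (keep ys a x≁z b)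

    distinct-length-≤ : ∀ xs ys → AllPairs (λ x y → ¬ (x ~ y)) xs → All (λ x → Any (x ~_) ys) xs → length xs ℕ.≤ length ys
    distinct-length-≤ [] ys _ _ = z≤n
    distinct-length-≤ (x ∷ xs) ys (x≁ ∷ d) (a ∷ as) = ≡.subst (suc (length xs) ℕ.≤_) (≡.sym (length-remove ys a))
      (s≤s (distinct-length-≤ xs (remove ys a) d (All.zipWith (λ (x≁z , b) → keep ys a x≁z b) (x≁ , as))))

  length-concatMap : ∀ {A B : Set} {k} (g : A → List B) xs → (∀ x → length (g x) ≡ k) → length (concatMap g xs) ≡ length xs ℕ.* k
  length-concatMap g [] h = ≡.refl
  length-concatMap g (x ∷ xs) h = ≡.trans (ListP.length-++ (g x)) (≡.cong₂ ℕ._+_ (h x) (length-concatMap g xs h))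

  Any-concatMap : ∀ {A B : Set} {P : B → Set} (g : A → List B) {xs} → Any (λ x → Any P (g x)) xs → Any P (concatMap g xs)
  Any-concatMap g a = AnyP.concat⁺ (AnyP.map⁺ a)

  AllPairs-concatMap : ∀ {A B : Set} {R : A → A → Set} {S : B → B → Set} (g : A → List B) {xs} → AllPairs R xs →
    (∀ x → AllPairs S (g x)) → (∀ {x x'} → R x x' → All (λ y → All (S y) (g x')) (g x)) → AllPairs S (concatMap g xs)
  AllPairs-concatMap g {[]} [] inner cross = []
  AllPairs-concatMap {S = S} g {x ∷ xs} (r ∷ d) inner cross = AllPairsP.++⁺ (inner x) (AllPairs-concatMap g d inner cross)
    (All.tabulate λ {y} y∈ → spread r y∈)
    where
    spread : ∀ {y xs} → All _ xs → y ∈ g x → All (S y) (concatMap g xs)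
    spread [] _ = []
    spread (r ∷ rs) y∈ = AllP.++⁺ (All.lookup (cross r) y∈) (spread rs y∈)

  all-true : ∀ {A : Set} (p : A → Bool) {xs} → All (λ x → p x ≡ true) xs → all p xs ≡ true
  all-true p [] = ≡.refl
  all-true p (e ∷ es) rewrite e = all-true p es

  all-true⁻ : ∀ {A : Set} (p : A → Bool) xs → all p xs ≡ true → All (λ x → p x ≡ true) xs
  all-true⁻ p [] _ = []
  all-true⁻ p (x ∷ xs) h with p x in e
  ... | true = e ∷ all-true⁻ p xs h
  ... | false with () ← h

  all-false⁻ : ∀ {A : Set} (p : A → Bool) xs → all p xs ≡ false → Any (λ x → p x ≡ false) xs
  all-false⁻ p (x ∷ xs) h with p x in e
  ... | true = there (all-false⁻ p xs h)
  ... | false = here e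

  any-true⁻ : ∀ {A : Set} (p : A → Bool) xs → any p xs ≡ true → Any (λ x → p x ≡ true) xs
  any-true⁻ p (x ∷ xs) h with p x in e
  ... | true = here e
  ... | false = there (any-true⁻ p xs h)

  any-false⁻ : ∀ {A : Set} (p : A → Bool) xs → any p xs ≡ false → All (λ x → p x ≡ false) xs
  any-false⁻ p [] h = []
  any-false⁻ p (x ∷ xs) h with p x in e
  ... | true with () ← h
  ... | false = e ∷ any-false⁻ p xs h

  filterᵇ-∷-true : ∀ {A : Set} (p : A → Bool) x xs → p x ≡ true → filterᵇ p (x ∷ xs) ≡ x ∷ filterᵇ p xs
  filterᵇ-∷-true p x xs e with p x
  ... | true = ≡.refl
  filterᵇ-∷-true p x xs () | false

  filterᵇ-∷-false : ∀ {A : Set} (p : A → Bool) x xs → p x ≡ false → filterᵇ p (x ∷ xs) ≡ filterᵇ p xs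
  filterᵇ-∷-false p x xs e with p x
  ... | false = ≡.refl
  filterᵇ-∷-false p x xs () | true

  All-filterᵇ : ∀ {A : Set} (p : A → Bool) xs → All (λ x → p x ≡ true) (filterᵇ p xs)
  All-filterᵇ p [] = []
  All-filterᵇ p (x ∷ xs) with p x in e
  ... | true = e ∷ All-filterᵇ p xs
  ... | false = All-filterᵇ p xs

  AllPairs-filterᵇ : ∀ {A : Set} {R : A → A → Set} (p : A → Bool) {xs} → AllPairs R xs → AllPairs R (filterᵇ p xs)
  AllPairs-filterᵇ p = AllPairsP.filter⁺ (T? ∘ p)

  Any-filterᵇ : ∀ {A : Set} {P : A → Set} (p : A → Bool) {xs} → Any (λ x → P x × p x ≡ true) xs → Any P (filterᵇ p xs)
  Any-filterᵇ p {x ∷ xs} (here (px , e)) rewrite filterᵇ-∷-true p x xs e = here px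
  Any-filterᵇ p {x ∷ xs} (there a) with p x
  ... | true = there (Any-filterᵇ p a)
  ... | false = Any-filterᵇ p a

  bool-cases : ∀ b → (b ≡ true) ⊎ (b ≡ false)
  bool-cases true = inj₁ ≡.refl
  bool-cases false = inj₂ ≡.refl

-- A flat of dimension d has q^d points.

module Cardinality {q : ℕ} (F : FiniteField q) where
  open FiniteField F hiding (zero)
  open Arr F
  open Counting
  open Frobenius F
  open RingSolver commRing
  private module VF = Vector3 commRing

  ≈₃-refl : ∀ {u} → u ≈₃ u
  ≈₃-refl = VF.≋-refl
  ≈₃-sym : ∀ {u v} → u ≈₃ v → v ≈₃ u
  ≈₃-sym = VF.≋-sym
  ≈₃-trans : ∀ {u v w} → u ≈₃ v → v ≈₃ w → u ≈₃ w
  ≈₃-trans = VF.≋-trans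

  ==-true : ∀ {x y} → x ≈ y → (x == y) ≡ true
  ==-true {x} {y} e with x ≟ y
  ... | yes _ = ≡.refl
  ... | no ne = ⊥-elim (ne e)

  ==-true⁻ : ∀ {x y} → (x == y) ≡ true → x ≈ y
  ==-true⁻ {x} {y} h with x ≟ y
  ... | yes e = e
  ==-true⁻ () | no _

  _∈₃_ : V3 → List V3 → Set
  p ∈₃ ps = Any (p ≈₃_) ps

  elems-complete : ∀ x → Any (x ≈_) elems
  elems-complete x = AnyP.map⁺ (Any.map (λ { ≡.refl → sym (enum-index x) }) (∈P.∈-allFin (index x)))

  points-complete : ∀ p → p ∈₃ points
  points-complete (x , y , z) = Any-concatMap _ (Any.map (λ x≈ → Any-concatMap _ (Any.map (λ y≈ →
    AnyP.map⁺ (Any.map (λ z≈ → x≈ , y≈ , z≈) (elems-complete z))) (elems-complete y))) (elems-complete x))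

  points-distinct : AllPairs (λ u v → ¬ (u ≈₃ v)) points
  points-distinct = AllPairs-concatMap _ elements-distinct
    (λ a → AllPairs-concatMap _ elements-distinct
      (λ b → AllPairsP.map⁺ (AllPairs.map (λ ne (_ , _ , e) → ne e) elements-distinct))
      (λ ne → AllP.map⁺ (All.universal (λ c → AllP.map⁺ (All.universal (λ c' (_ , e , _) → ne e) elems)) elems)))
    (λ {a} {a'} ne → AllP.concat⁺ (AllP.map⁺ (All.universal (λ b → AllP.map⁺ (All.universal (λ c →
      AllP.concat⁺ (AllP.map⁺ (All.universal (λ b' → AllP.map⁺ (All.universal (λ c' (e , _) → ne e) elems)) elems))) elems)) elems)))

  length-points : length points ≡ q ℕ.^ 3
  length-points = ≡.trans (length-concatMap _ elems λ a → length-concatMap _ elems λ b → ≡.trans (ListP.length-map _ elems) length-elements)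
    (≡.trans (≡.cong₂ ℕ._*_ length-elements (≡.cong (ℕ._* q) length-elements)) (≡.cong (q ℕ.*_) (≡.cong (q ℕ.*_) (≡.sym (ℕP.*-identityʳ q)))))

  ev-cong : ∀ α {p p'} → p ≈₃ p' → ev α p ≈ ev α p'
  ev-cong α e = VF.⊙-cong (VF.≋-refl {α}) e

  ev-linear : ∀ α k p p' → ev α ((k ·₃ p) +₃ p') ≈ k * ev α p + ev α p'
  ev-linear (a , b , c) k (x , y , z) (x' , y' , z') = solve 10 (λ a b c k x y z x' y' z' →
    a :* (k :* x :+ x') :+ (b :* (k :* y :+ y') :+ c :* (k :* z :+ z')) := k :* (a :* x :+ (b :* y :+ c :* z)) :+ (a :* x' :+ (b :* y' :+ c :* z')))
    refl a b c k x y z x' y' z'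

  ev-0 : ∀ α → ev α 0₃ ≈ 0#
  ev-0 (a , b , c) = solve 3 (λ a b c → a :* con ℤ.0ℤ :+ (b :* con ℤ.0ℤ :+ c :* con ℤ.0ℤ) := con ℤ.0ℤ) refl a b c

  member : List V3 → V3 → Bool
  member B p = all (λ α → ev α p == 0#) B

  Sat : List V3 → V3 → Set
  Sat B p = All (λ α → ev α p ≈ 0#) B

  member-true : ∀ {B p} → Sat B p → member B p ≡ true
  member-true {B} {p} s = all-true (λ α → ev α p == 0#) (All.map ==-true s)

  member-true⁻ : ∀ {B p} → member B p ≡ true → Sat B p
  member-true⁻ {B} {p} h = All.map ==-true⁻ (all-true⁻ (λ α → ev α p == 0#) B h)

  Sat-resp : ∀ {B p p'} → p ≈₃ p' → Sat B p → Sat B p'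
  Sat-resp e = All.map (λ {α} h → trans (sym (ev-cong α e)) h)

  Z : List V3 → List V3
  Z B = filterᵇ (member B) points

  pointsIn-flatOf : ∀ B → pointsIn (flatOf B) ≡ Z B
  pointsIn-flatOf B = go points
    where
    go : ∀ ps → map proj₁ (filterᵇ proj₂ (zip ps (map (member B) ps))) ≡ filterᵇ (member B) ps
    go [] = ≡.refl
    go (p ∷ ps) with member B p
    ... | true = ≡.cong (p ∷_) (go ps)
    ... | false = go ps

  Z-sat : ∀ B → All (Sat B) (Z B)
  Z-sat B = All.map member-true⁻ (All-filterᵇ (member B) points)

  Z-complete : ∀ B p → Sat B p → p ∈₃ Z B
  Z-complete B p s = Any-filterᵇ (member B) (Any.map (λ e → e , member-true (Sat-resp e s)) (points-complete p))

  Z-distinct : ∀ B → AllPairs (λ u v → ¬ (u ≈₃ v)) (Z B)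
  Z-distinct B = AllPairs-filterᵇ (member B) points-distinct

  Independent : List V3 → Set
  Independent vs = ∀ cs → length cs ≡ length vs → lincomb cs vs ≈₃ 0₃ → All (_≈ 0#) cs

  lincomb-cong : ∀ {cs cs'} vs → Pointwise _≈_ cs cs' → lincomb cs vs ≈₃ lincomb cs' vs
  lincomb-cong [] [] = ≈₃-refl
  lincomb-cong [] (_ ∷ _) = ≈₃-refl
  lincomb-cong (v ∷ vs) [] = ≈₃-refl
  lincomb-cong (v ∷ vs) (e ∷ es) = VF.⊞-cong (VF.•-cong e (VF.≋-refl {v})) (lincomb-cong vs es)

  lincomb-sat : ∀ B cs {vs} → All (Sat B) vs → Sat B (lincomb cs vs)
  lincomb-sat B [] _ = All.universal ev-0 B
  lincomb-sat B (c ∷ cs) [] = All.universal ev-0 B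
  lincomb-sat B (c ∷ cs) {v ∷ vs} (s ∷ ss) = All.zipWith (λ {α} (e , e') → trans (ev-linear α c v (lincomb cs vs))
    (trans (+-cong (trans (*-congˡ e) (zeroʳ c)) e') (+-identityˡ 0#))) (s , lincomb-sat B cs ss)

  lincomb-scale : ∀ k cs vs → lincomb (map (k *_) cs) vs ≈₃ (k ·₃ lincomb cs vs)
  lincomb-scale k [] vs = sym (zeroʳ k) , sym (zeroʳ k) , sym (zeroʳ k)
  lincomb-scale k (c ∷ cs) [] = sym (zeroʳ k) , sym (zeroʳ k) , sym (zeroʳ k)
  lincomb-scale k (c ∷ cs) ((x , y , z) ∷ vs) with lincomb-scale k cs vs
  ... | e₁ , e₂ , e₃ = go x e₁ , go y e₂ , go z e₃
    where
    go : ∀ x {r r'} → r ≈ k * r' → (k * c) * x + r ≈ k * (c * x + r')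
    go x {r} {r'} e = trans (+-congˡ e) (solve 4 (λ k c x r → (k :* c) :* x :+ k :* r := k :* (c :* x :+ r)) refl k c x r')

  private
    minus : List Carrier → List Carrier → List Carrier
    minus (c ∷ cs) (d ∷ ds) = (c - d) ∷ minus cs ds
    minus _ _ = []

    length-minus : ∀ cs ds n → length cs ≡ n → length ds ≡ n → length (minus cs ds) ≡ n
    length-minus [] [] n e _ = e
    length-minus (c ∷ cs) (d ∷ ds) (suc n) e e' = ≡.cong suc (length-minus cs ds n (ℕP.suc-injective e) (ℕP.suc-injective e'))
    length-minus [] (_ ∷ _) .0 ≡.refl ()
    length-minus (_ ∷ _) [] n e e' = ⊥-elim (ℕP.1+n≢0 (≡.trans e (≡.sym e')))

    lincomb-minus : ∀ cs ds vs → length cs ≡ length vs → length ds ≡ length vs → lincomb cs vs ≈₃ lincomb ds vs → lincomb (minus cs ds) vs ≈₃ 0₃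
    lincomb-minus cs ds vs lc ld e = ≈₃-trans (go cs ds vs lc ld) (cancel e)
      where
      sub : V3 → V3 → V3
      sub (a , b , c) (x , y , z) = a - x , b - y , c - z
      cancel : ∀ {u v} → u ≈₃ v → sub u v ≈₃ 0₃
      cancel (a , b , c) = z a , z b , z c
        where
        z : ∀ {x y} → x ≈ y → x - y ≈ 0#
        z e = trans (+-congʳ e) (-‿inverseʳ _)
      go : ∀ cs ds vs → length cs ≡ length vs → length ds ≡ length vs → lincomb (minus cs ds) vs ≈₃ sub (lincomb cs vs) (lincomb ds vs)
      go [] [] [] _ _ = z , z , z
        where z = solve 0 (con ℤ.0ℤ := con ℤ.0ℤ :- con ℤ.0ℤ) refl
      go (c ∷ cs) (d ∷ ds) ((x , y , z) ∷ vs) lc ld with go cs ds vs (ℕP.suc-injective lc) (ℕP.suc-injective ld)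
      ... | e₁ , e₂ , e₃ = step x e₁ , step y e₂ , step z e₃
        where
        step : ∀ x {r s t} → r ≈ s - t → (c - d) * x + r ≈ (c * x + s) - (d * x + t)
        step x {r} {s} {t} e = trans (+-congˡ e) (solve 5 (λ c d x s t → (c :- d) :* x :+ (s :- t) := (c :* x :+ s) :- (d :* x :+ t)) refl c d x s t)

    minus-zero : ∀ cs ds n → length cs ≡ n → length ds ≡ n → All (_≈ 0#) (minus cs ds) → Pointwise _≈_ cs ds
    minus-zero [] [] _ _ _ _ = []
    minus-zero [] (_ ∷ _) .0 ≡.refl () _
    minus-zero (_ ∷ _) [] n e e' _ = ⊥-elim (ℕP.1+n≢0 (≡.trans e (≡.sym e')))
    minus-zero (c ∷ cs) (d ∷ ds) (suc n) e e' (z ∷ zs) = trans (solve 2 (λ c d → c := (c :- d) :+ d) refl c d) (trans (+-congʳ z) (+-identityˡ d)) ∷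
      minus-zero cs ds n (ℕP.suc-injective e) (ℕP.suc-injective e') zs

  tuples-length : ∀ {X : Set} d (xs : List X) → All (λ cs → length cs ≡ d) (tuples d xs)
  tuples-length zero xs = ≡.refl ∷ []
  tuples-length (suc d) xs = AllP.concat⁺ (AllP.map⁺ (All.universal (λ x → AllP.map⁺ (All.map (≡.cong suc) (tuples-length d xs))) xs))

  tuples-count : ∀ {X : Set} d (xs : List X) → length (tuples d xs) ≡ length xs ℕ.^ d
  tuples-count zero xs = ≡.refl
  tuples-count (suc d) xs = length-concatMap _ xs λ x → ≡.trans (ListP.length-map _ (tuples d xs)) (tuples-count d xs)

  tuples-distinct : ∀ d → AllPairs (λ cs ds → ¬ Pointwise _≈_ cs ds) (tuples d elems)
  tuples-distinct zero = [] ∷ []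
  tuples-distinct (suc d) = AllPairs-concatMap _ elements-distinct
    (λ x → AllPairsP.map⁺ (AllPairs.map (λ ne → λ { (_ ∷ es) → ne es }) (tuples-distinct d)))
    (λ ne → AllP.map⁺ (All.universal (λ cs → AllP.map⁺ (All.universal (λ ds → λ { (e ∷ _) → ne e }) _)) _))

  tuples-complete : ∀ cs → Any (Pointwise _≈_ cs) (tuples (length cs) elems)
  tuples-complete [] = here []
  tuples-complete (c ∷ cs) = Any-concatMap _ (Any.map (λ e → AnyP.map⁺ (Any.map (e ∷_) (tuples-complete cs))) (elems-complete c))

  tuples-All : ∀ {X : Set} {P : X → Set} d xs → All P xs → All (All P) (tuples d xs)
  tuples-All zero xs h = [] ∷ []
  tuples-All (suc d) xs h = AllP.concat⁺ (AllP.map⁺ (All.map (λ p → AllP.map⁺ (All.map (p ∷_) (tuples-All d xs h))) h))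

  tuples-∷ : ∀ {X : Set} d {x} {xs ys : List X} → x ∈ ys → xs ∈ tuples d ys → (x ∷ xs) ∈ tuples (suc d) ys
  tuples-∷ d x∈ xs∈ = Any-concatMap _ (Any.map (λ { ≡.refl → AnyP.map⁺ (Any.map (λ { ≡.refl → ≡.refl }) xs∈) }) x∈)

  private
    zero-test : List V3 → List Carrier → Bool
    zero-test vs cs = not (isZero₃ (lincomb cs vs)) ∨ all (_== 0#) cs

    isZero-true : ∀ {v} → v ≈₃ 0₃ → isZero₃ v ≡ true
    isZero-true (a , b , c) rewrite ==-true a | ==-true b | ==-true c = ≡.refl

    isZero-true⁻ : ∀ v → isZero₃ v ≡ true → v ≈₃ 0₃
    isZero-true⁻ (a , b , c) h with a == 0# in e₁ | b == 0# in e₂ | c == 0# in e₃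
    ... | true | true | true = ==-true⁻ e₁ , ==-true⁻ e₂ , ==-true⁻ e₃

    not-or : ∀ {a b} → not a ∨ b ≡ true → a ≡ true → b ≡ true
    not-or {true} h _ = h

    not-or-false : ∀ {a b} → not a ∨ b ≡ false → (a ≡ true) × (b ≡ false)
    not-or-false {true} h = ≡.refl , h

  -- The Boolean test runs over enumerated scalars only; every list of coefficients is pointwise
  -- equal to an enumerated one.
  independentB⇒ : ∀ vs → independentB vs ≡ true → Independent vs
  independentB⇒ vs h cs len zero-comb = transfer (find (All.lookup (all-true⁻ (zero-test vs) _ h)) (≡.subst (λ n → Any (Pointwise _≈_ cs) (tuples n elems)) len (tuples-complete cs)))
    where
    find : ∀ {ys} → (∀ {ds} → ds ∈ ys → zero-test vs ds ≡ true) → Any (Pointwise _≈_ cs) ys → Σ (List Carrier) λ ds → Pointwise _≈_ cs ds × zero-test vs ds ≡ true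
    find f (here e) = _ , e , f (here ≡.refl)
    find f (there a) = find (f ∘ there) a
    transfer : Σ (List Carrier) (λ ds → Pointwise _≈_ cs ds × zero-test vs ds ≡ true) → All (_≈ 0#) cs
    transfer (ds , e , t) = back e (all-true⁻ (_== 0#) ds (not-or t (isZero-true (≈₃-trans (≈₃-sym (lincomb-cong vs e)) zero-comb))))
      where
      back : ∀ {cs ds} → Pointwise _≈_ cs ds → All (λ d → (d == 0#) ≡ true) ds → All (_≈ 0#) cs
      back [] [] = []
      back (e ∷ es) (z ∷ zs) = trans e (==-true⁻ z) ∷ back es zs

  dependentB⇒ : ∀ vs → independentB vs ≡ false → Σ (List Carrier) λ cs → length cs ≡ length vs × lincomb cs vs ≈₃ 0₃ × ¬ All (_≈ 0#) cs
  dependentB⇒ vs h = find (tuples-length (length vs) elems) (all-false⁻ (zero-test vs) _ h)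
    where
    find : ∀ {ys} → All (λ cs → length cs ≡ length vs) ys → Any (λ cs → zero-test vs cs ≡ false) ys →
      Σ (List Carrier) λ cs → length cs ≡ length vs × lincomb cs vs ≈₃ 0₃ × ¬ All (_≈ 0#) cs
    find (len ∷ _) (here {cs} e) = cs , len , isZero-true⁻ (lincomb cs vs) (proj₁ split) ,
        λ zs → clash (proj₂ split) (all-true (_== 0#) {cs} (All.map ==-true zs))
      where
      split = not-or-false {isZero₃ (lincomb cs vs)} {all (_== 0#) cs} e
      clash : ∀ {b} → b ≡ false → b ≡ true → ⊥
      clash ≡.refl ()
    find (_ ∷ ls) (there a) = find ls a

  -- The empty tuple is independent whichever way the zero test of its combination comes out.
  hasIndep-0 : ∀ X → hasIndep 0 X ≡ true
  hasIndep-0 X = go (not (isZero₃ 0₃))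
    where
    go : ∀ b → ((b ∨ true) ∧ true) ∨ false ≡ true
    go true = ≡.refl
    go false = ≡.refl

  module _ (B : List V3) where
    private
      X = flatOf B

    independent-tuple : ∀ d → hasIndep d X ≡ true → Σ (List V3) λ vs → vs ∈ tuples d (Z B) × length vs ≡ d × All (Sat B) vs × Independent vs
    independent-tuple d h = find (tuples-length d (Z B)) (tuples-All d (Z B) (Z-sat B))
        (any-true⁻ independentB (tuples d (Z B)) (≡.subst (λ ps → any independentB (tuples d ps) ≡ true) (pointsIn-flatOf B) h))
      where
      find : ∀ {ys} → All (λ vs → length vs ≡ d) ys → All (All (Sat B)) ys → Any (λ vs → independentB vs ≡ true) ys →
        Σ (List V3) λ vs → vs ∈ ys × length vs ≡ d × All (Sat B) vs × Independent vs
      find (l ∷ _) (s ∷ _) (here {vs} e) = vs , here ≡.refl , l , s , independentB⇒ vs e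
      find (_ ∷ ls) (_ ∷ ss) (there a) with find ls ss a
      ... | vs , m , rest = vs , there m , rest

    -- Distinct coefficient lists over an independent d-tuple give distinct points of the flat.
    card-lower : ∀ d → hasIndep d X ≡ true → q ℕ.^ d ℕ.≤ length (Z B)
    card-lower d h = ≡.subst (ℕ._≤ length (Z B)) (≡.trans (ListP.length-map _ (tuples d elems)) (≡.trans (tuples-count d elems) (≡.cong (ℕ._^ d) length-elements)))
        (distinct-length-≤ _≈₃_ ≈₃-sym ≈₃-trans (map (λ cs → lincomb cs vs) (tuples d elems)) (Z B) unique (AllP.map⁺ (All.universal (λ cs → Z-complete B _ (lincomb-sat B cs sat)) _)))
      where
      it = independent-tuple d h
      vs = proj₁ it
      len = proj₁ (proj₂ (proj₂ it))
      sat = proj₁ (proj₂ (proj₂ (proj₂ it)))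
      ind = proj₂ (proj₂ (proj₂ (proj₂ it)))
      inject : ∀ {xs} → All (λ cs → length cs ≡ d) xs → AllPairs (λ cs ds → ¬ Pointwise _≈_ cs ds) xs → AllPairs (λ cs ds → ¬ (lincomb cs vs ≈₃ lincomb ds vs)) xs
      inject [] [] = []
      inject (l ∷ ls) (ne ∷ nes) = All.zipWith (λ {ds} (l' , n) → injective l l' n) (ls , ne) ∷ inject ls nes
        where
        injective : ∀ {cs ds} → length cs ≡ d → length ds ≡ d → ¬ Pointwise _≈_ cs ds → ¬ (lincomb cs vs ≈₃ lincomb ds vs)
        injective {cs} {ds} l l' n e = n (minus-zero cs ds d l l' (ind (minus cs ds) (≡.trans (length-minus cs ds d l l') (≡.sym len))
          (lincomb-minus cs ds vs (≡.trans l (≡.sym len)) (≡.trans l' (≡.sym len)) e)))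
      unique : AllPairs (λ u v → ¬ (u ≈₃ v)) (map (λ cs → lincomb cs vs) (tuples d elems))
      unique = AllPairsP.map⁺ (inject (tuples-length d elems) (tuples-distinct d))

    -- Without d + 1 independent points, each point p depends on a fixed independent d-tuple, and
    -- the coefficient of p in the relation is nonzero. So p is one of the q^d combinations.
    card-upper : ∀ d → hasIndep d X ≡ true → hasIndep (suc d) X ≡ false → length (Z B) ℕ.≤ q ℕ.^ d
    card-upper d h h' = ≡.subst (length (Z B) ℕ.≤_) (≡.trans (ListP.length-map _ (tuples d elems)) (≡.trans (tuples-count d elems) (≡.cong (ℕ._^ d) length-elements)))
        (distinct-length-≤ _≈₃_ ≈₃-sym ≈₃-trans (Z B) (map (λ cs → lincomb cs vs) (tuples d elems)) (Z-distinct B) (All.tabulate spanned))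
      where
      it = independent-tuple d h
      vs = proj₁ it
      vs∈ = proj₁ (proj₂ it)
      len = proj₁ (proj₂ (proj₂ it))
      ind = proj₂ (proj₂ (proj₂ (proj₂ it)))
      dependent = any-false⁻ independentB (tuples (suc d) (Z B)) (≡.subst (λ ps → any independentB (tuples (suc d) ps) ≡ false) (pointsIn-flatOf B) h')
      spanned : ∀ {p} → p ∈ Z B → Any (p ≈₃_) (map (λ cs → lincomb cs vs) (tuples d elems))
      spanned {p} p∈ = use (dependentB⇒ (p ∷ vs) (All.lookup dependent (tuples-∷ d p∈ vs∈)))
        where
        use : Σ (List Carrier) (λ cs → length cs ≡ length (p ∷ vs) × lincomb cs (p ∷ vs) ≈₃ 0₃ × ¬ All (_≈ 0#) cs) → Any (p ≈₃_) (map (λ cs → lincomb cs vs) (tuples d elems))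
        use (c ∷ cs , l , z , nz) with c ≟ 0#
        ... | yes c≈0 = ⊥-elim (nz (c≈0 ∷ ind cs (ℕP.suc-injective l) (≈₃-trans (drop c≈0 p (lincomb cs vs)) z)))
          where
          drop : c ≈ 0# → ∀ u v → v ≈₃ ((c ·₃ u) +₃ v)
          drop c≈0 (x , y , z) (x' , y' , z') = go x x' , go y y' , go z z'
            where
            go : ∀ x x' → x' ≈ c * x + x'
            go x x' = sym (trans (+-congʳ (trans (*-congʳ c≈0) (zeroˡ x))) (+-identityˡ x'))
        ... | no c≉0 = AnyP.map⁺ (Any.map (λ e → ≈₃-trans solved (lincomb-cong vs e))
              (≡.subst (λ n → Any (Pointwise _≈_ ds) (tuples n elems)) (≡.trans (ListP.length-map _ cs) (≡.trans (ℕP.suc-injective l) len)) (tuples-complete ds)))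
          where
          i = proj₁ (inverse c c≉0)
          ds = map ((- i) *_) cs
          solved : p ≈₃ lincomb ds vs
          solved = ≈₃-trans (isolate p (lincomb cs vs) z) (≈₃-sym (lincomb-scale (- i) cs vs))
            where
            isolate : ∀ u v → ((c ·₃ u) +₃ v) ≈₃ 0₃ → u ≈₃ ((- i) ·₃ v)
            isolate (x , y , z) (x' , y' , z') (e₁ , e₂ , e₃) = go x x' e₁ , go y y' e₂ , go z z' e₃
              where
              go : ∀ x x' → c * x + x' ≈ 0# → x ≈ (- i) * x'
              go x x' e = trans (sym (*-identityˡ x)) (trans (*-congʳ (sym (proj₂ (inverse c c≉0))))
                (trans (solve 4 (λ c i x x' → c :* i :* x := i :* (c :* x :+ x') :+ (:- i) :* x') refl c i x x')
                  (trans (+-congʳ (trans (*-congˡ e) (zeroʳ i))) (+-identityˡ _))))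

    private
      -- In dimension three no further independence test bounds the flat from above; the number of
      -- all points does.
      card-cases : ∀ b₃ b₂ b₁ → hasIndep 3 X ≡ b₃ → hasIndep 2 X ≡ b₂ → hasIndep 1 X ≡ b₁ →
        length (Z B) ≡ q ℕ.^ (if b₃ then 3 else if b₂ then 2 else if b₁ then 1 else 0)
      card-cases true _ _ h₃ _ _ = ℕP.≤-antisym (≡.subst (length (Z B) ℕ.≤_) length-points (ListP.length-filter (T? ∘ member B) points)) (card-lower 3 h₃)
      card-cases false true _ h₃ h₂ _ = ℕP.≤-antisym (card-upper 2 h₂ h₃) (card-lower 2 h₂)
      card-cases false false true _ h₂ h₁ = ℕP.≤-antisym (card-upper 1 h₁ h₂) (card-lower 1 h₁)
      card-cases false false false _ _ h₁ = ℕP.≤-antisym (card-upper 0 (hasIndep-0 X) h₁) (card-lower 0 (hasIndep-0 X))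

    card : length (Z B) ≡ q ℕ.^ dim X
    card = card-cases (hasIndep 3 X) (hasIndep 2 X) (hasIndep 1 X) ≡.refl ≡.refl ≡.refl

  dim≤3 : ∀ X → dim X ℕ.≤ 3
  dim≤3 X = go (hasIndep 3 X) (hasIndep 2 X) (hasIndep 1 X)
    where
    go : ∀ b₃ b₂ b₁ → (if b₃ then 3 else if b₂ then 2 else if b₁ then 1 else 0) ℕ.≤ 3
    go true _ _ = ℕP.≤-refl
    go false true _ = s≤s (s≤s z≤n)
    go false false true = s≤s z≤n
    go false false false = z≤n

-- Finite sums of integers with Iverson brackets.

module IntegerSums where
  open ℤSolver

  infix 5 [_]_
  [_]_ : Bool → ℤ → ℤ
  [ b ] x = if b then x else 0ℤ

  ∑ : {A : Set} → List A → (A → ℤ) → ℤ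
  ∑ xs f = sumℤ (map f xs)

  ∑-cong : ∀ {A : Set} {xs : List A} {f g} → All (λ x → f x ≡ g x) xs → ∑ xs f ≡ ∑ xs g
  ∑-cong [] = ≡.refl
  ∑-cong (e ∷ es) = ≡.cong₂ ℤ._+_ e (∑-cong es)

  ∑-filterᵇ : ∀ {A : Set} (p : A → Bool) f xs → ∑ (filterᵇ p xs) f ≡ ∑ xs (λ x → [ p x ] f x)
  ∑-filterᵇ p f [] = ≡.refl
  ∑-filterᵇ p f (x ∷ xs) with p x
  ... | true = ≡.cong (λ z → f x ℤ.+ z) (∑-filterᵇ p f xs)
  ... | false = ≡.trans (∑-filterᵇ p f xs) (≡.sym (ℤP.+-identityˡ _))

  ∑-0 : ∀ {A : Set} (xs : List A) → ∑ xs (λ _ → 0ℤ) ≡ 0ℤ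
  ∑-0 [] = ≡.refl
  ∑-0 (x ∷ xs) = ≡.trans (ℤP.+-identityˡ _) (∑-0 xs)

  ∑-+ : ∀ {A : Set} (xs : List A) f g → ∑ xs (λ x → f x ℤ.+ g x) ≡ ∑ xs f ℤ.+ ∑ xs g
  ∑-+ [] f g = ≡.refl
  ∑-+ (x ∷ xs) f g = ≡.trans (≡.cong (λ z → f x ℤ.+ g x ℤ.+ z) (∑-+ xs f g))
    (solve 4 (λ a b c d → (a :+ b) :+ (c :+ d) := (a :+ c) :+ (b :+ d)) ≡.refl (f x) (g x) (∑ xs f) (∑ xs g))

  ∑-*ʳ : ∀ {A : Set} (xs : List A) f k → ∑ xs (λ x → f x ℤ.* k) ≡ ∑ xs f ℤ.* k
  ∑-*ʳ [] f k = ≡.sym (ℤP.*-zeroˡ k)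
  ∑-*ʳ (x ∷ xs) f k = ≡.trans (≡.cong (λ z → f x ℤ.* k ℤ.+ z) (∑-*ʳ xs f k)) (≡.sym (ℤP.*-distribʳ-+ k (f x) (∑ xs f)))

  ∑-swap : ∀ {A B : Set} (xs : List A) (ys : List B) (f : A → B → ℤ) → ∑ xs (λ x → ∑ ys (f x)) ≡ ∑ ys (λ y → ∑ xs (λ x → f x y))
  ∑-swap [] ys f = ≡.sym (∑-0 ys)
  ∑-swap (x ∷ xs) ys f = ≡.trans (≡.cong (λ z → ∑ ys (f x) ℤ.+ z) (∑-swap xs ys f)) (≡.sym (∑-+ ys (f x) (λ y → ∑ xs (λ x → f x y))))

  count-∑ : ∀ {A : Set} (p : A → Bool) xs → + length (filterᵇ p xs) ≡ ∑ xs (λ x → [ p x ] 1ℤ)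
  count-∑ p [] = ≡.refl
  count-∑ p (x ∷ xs) with p x
  ... | true = ≡.cong (λ z → 1ℤ ℤ.+ z) (count-∑ p xs)
  ... | false = ≡.trans (count-∑ p xs) (≡.sym (ℤP.+-identityˡ _))

  ∑-const : ∀ {A : Set} (p : A → Bool) k xs → ∑ xs (λ x → [ p x ] k) ≡ + length (filterᵇ p xs) ℤ.* k
  ∑-const p k xs = ≡.trans (∑-cong (All.universal (λ x → go (p x)) xs)) (≡.trans (∑-*ʳ xs (λ x → [ p x ] 1ℤ) k) (≡.cong (ℤ._* k) (≡.sym (count-∑ p xs))))
    where
    go : ∀ b → [ b ] k ≡ ([ b ] 1ℤ) ℤ.* k
    go true = ≡.sym (ℤP.*-identityˡ k)
    go false = ≡.sym (ℤP.*-zeroˡ k)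

  ^-pos : ∀ q n → (+ q) ℤ.^ n ≡ + (q ℕ.^ n)
  ^-pos q zero = ≡.refl
  ^-pos q (suc n) = ≡.trans (≡.cong (+ q ℤ.*_) (^-pos q n)) (≡.sym (ℤP.pos-* q (q ℕ.^ n)))

-- Möbius inversion on the lattice of flats.

module Characteristic {q : ℕ} (F : FiniteField q) where
  open FiniteField F hiding (zero)
  open Arr F
  open Counting
  open IntegerSums
  open Frobenius F
  open Cardinality F

  eqB⇒≡ : ∀ x y → eqB x y ≡ true → x ≡ y
  eqB⇒≡ [] [] _ = ≡.refl
  eqB⇒≡ (true ∷ x) (true ∷ y) h = ≡.cong (true ∷_) (eqB⇒≡ x y h)
  eqB⇒≡ (false ∷ x) (false ∷ y) h = ≡.cong (false ∷_) (eqB⇒≡ x y h)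

  eqB-refl : ∀ x → eqB x x ≡ true
  eqB-refl [] = ≡.refl
  eqB-refl (true ∷ x) = eqB-refl x
  eqB-refl (false ∷ x) = eqB-refl x

  eqB-false : ∀ {x y} → x ≢ y → eqB x y ≡ false
  eqB-false {x} {y} ne with eqB x y in e
  ... | true = ⊥-elim (ne (eqB⇒≡ x y e))
  ... | false = ≡.refl

  eqB-false⁻ : ∀ {x y} → eqB x y ≡ false → x ≢ y
  eqB-false⁻ {x} h ≡.refl with () ← ≡.trans (≡.sym h) (eqB-refl x)

  ∈-filterᵇ : ∀ {A : Set} (p : A → Bool) {x : A} {xs} → x ∈ xs → p x ≡ true → x ∈ filterᵇ p xs
  ∈-filterᵇ p x∈ e = Any-filterᵇ p (Any.map (λ { ≡.refl → ≡.refl , e }) x∈)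

  dedup-∈ : ∀ {x} xs → x ∈ xs → x ∈ dedup xs
  dedup-∈ (y ∷ xs) (here ≡.refl) = here ≡.refl
  dedup-∈ {x} (y ∷ xs) (there x∈) = place (bool-cases (eqB y x))
    where
    place : (eqB y x ≡ true) ⊎ (eqB y x ≡ false) → x ∈ dedup (y ∷ xs)
    place (inj₁ e) = here (≡.sym (eqB⇒≡ y x e))
    place (inj₂ e) = there (∈-filterᵇ (λ y' → not (eqB y y')) (dedup-∈ xs x∈) (≡.cong not e))

  dedup-All : ∀ {P : Flat → Set} xs → All P xs → All P (dedup xs)
  dedup-All [] [] = []
  dedup-All (x ∷ xs) (p ∷ ps) = p ∷ AllP.filter⁺ _ (dedup-All xs ps)

  dedup-distinct : ∀ xs → AllPairs _≢_ (dedup xs)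
  dedup-distinct [] = []
  dedup-distinct (x ∷ xs) = All.map (λ {y} e x≡y → clash (eqB-refl x) (≡.subst (λ y → not (eqB x y) ≡ true) (≡.sym x≡y) e)) (All-filterᵇ (λ y → not (eqB x y)) (dedup xs))
      ∷ AllPairs-filterᵇ _ (dedup-distinct xs)
    where
    clash : ∀ {b} → b ≡ true → not b ≡ true → ⊥
    clash ≡.refl ()

  ∑-single : ∀ {x xs} (f : Flat → ℤ) → AllPairs _≢_ xs → x ∈ xs → ∑ xs (λ y → [ eqB x y ] f y) ≡ f x
  ∑-single {x} {.x ∷ xs} f (x≢ ∷ _) (here ≡.refl) = ≡.trans (≡.cong₂ ℤ._+_ (≡.cong ([_] f x) (eqB-refl x))
    (≡.trans (∑-cong (All.map (λ {y} ne → ≡.cong ([_] f y) (eqB-false ne)) x≢)) (∑-0 xs))) (ℤP.+-identityʳ _)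
  ∑-single {x} {y ∷ xs} f (y≢ ∷ d) (there x∈) = ≡.trans (≡.cong₂ ℤ._+_ (≡.cong ([_] f y) (eqB-false (λ e → All.lookup y≢ x∈ (≡.sym e)))) (∑-single f d x∈)) (ℤP.+-identityˡ _)

  subsets-All : ∀ {X : Set} {P : X → Set} {xs} → All P xs → All (All P) (subsets xs)
  subsets-All [] = [] ∷ []
  subsets-All (p ∷ ps) = AllP.++⁺ (subsets-All ps) (AllP.map⁺ (All.map (p ∷_) (subsets-All ps)))

  filter∈subsets : ∀ {X : Set} (p : X → Bool) xs → filterᵇ p xs ∈ subsets xs
  filter∈subsets p [] = here ≡.refl
  filter∈subsets p (x ∷ xs) with p x
  ... | true = ∈P.∈-++⁺ʳ (subsets xs) (∈P.∈-map⁺ (x ∷_) (filter∈subsets p xs))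
  ... | false = ∈P.∈-++⁺ˡ (filter∈subsets p xs)

  []∈subsets : ∀ {X : Set} (xs : List X) → [] ∈ subsets xs
  []∈subsets [] = here ≡.refl
  []∈subsets (x ∷ xs) = ∈P.∈-++⁺ˡ ([]∈subsets xs)

  singleton∈subsets : ∀ {X : Set} {x : X} xs → x ∈ xs → (x ∷ []) ∈ subsets xs
  singleton∈subsets (x ∷ xs) (here ≡.refl) = ∈P.∈-++⁺ʳ (subsets xs) (∈P.∈-map⁺ (x ∷_) ([]∈subsets xs))
  singleton∈subsets (y ∷ xs) (there x∈) = ∈P.∈-++⁺ˡ (singleton∈subsets xs x∈)

  private
    implies : Bool → Bool → Bool
    implies x y = not x ∨ y

    implies-true : ∀ {x y} → (x ≡ true → y ≡ true) → implies x y ≡ true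
    implies-true {true} h = h ≡.refl
    implies-true {false} h = ≡.refl

    true≢false : true ≢ false
    true≢false ()

    subB-map : ∀ (f g : V3 → Bool) ps → All (λ p → f p ≡ true → g p ≡ true) ps → subB (map f ps) (map g ps) ≡ true
    subB-map f g [] [] = ≡.refl
    subB-map f g (p ∷ ps) (h ∷ hs) rewrite implies-true h = subB-map f g ps hs

    subB-map⁻ : ∀ (f g : V3 → Bool) ps → subB (map f ps) (map g ps) ≡ true → All (λ p → f p ≡ true → g p ≡ true) ps
    subB-map⁻ f g [] _ = []
    subB-map⁻ f g (p ∷ ps) h with f p in e₁ | g p in e₂
    ... | true | true = (λ _ → e₂) ∷ subB-map⁻ f g ps h
    ... | false | _ = (λ e → ⊥-elim (true≢false (≡.trans (≡.sym e) e₁))) ∷ subB-map⁻ f g ps h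

    count-≡ : ∀ (f g : V3 → Bool) ps → map f ps ≡ map g ps → length (filterᵇ f ps) ≡ length (filterᵇ g ps)
    count-≡ f g [] _ = ≡.refl
    count-≡ f g (p ∷ ps) e with f p | g p | ListP.∷-injective e
    ... | true | true | _ , e' = ≡.cong suc (count-≡ f g ps e')
    ... | false | false | _ , e' = count-≡ f g ps e'
    ... | true | false | () , _
    ... | false | true | () , _

    count-sub : ∀ (f g : V3 → Bool) ps → All (λ p → f p ≡ true → g p ≡ true) ps →
      (map f ps ≡ map g ps) ⊎ (length (filterᵇ f ps) ℕ.< length (filterᵇ g ps))
    count-sub f g [] [] = inj₁ ≡.refl
    count-sub f g (p ∷ ps) (h ∷ hs) with f p | g p | count-sub f g ps hs
    ... | true | true | inj₁ e = inj₁ (≡.cong (true ∷_) e)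
    ... | true | true | inj₂ l = inj₂ (s≤s l)
    ... | true | false | _ = ⊥-elim (true≢false (≡.sym (h ≡.refl)))
    ... | false | false | inj₁ e = inj₁ (≡.cong (false ∷_) e)
    ... | false | false | inj₂ l = inj₂ l
    ... | false | true | inj₁ e = inj₂ (s≤s (ℕP.≤-reflexive (count-≡ f g ps e)))
    ... | false | true | inj₂ l = inj₂ (ℕP.m≤n⇒m≤1+n l)

  IsFlat : List V3 → Flat → Set
  IsFlat αs X = Σ (List V3) λ B → X ≡ flatOf B × All (_∈ αs) B

  subB-flat : ∀ B B' → (∀ p → Sat B p → Sat B' p) → subB (flatOf B) (flatOf B') ≡ true
  subB-flat B B' h = subB-map (member B) (member B') points (All.universal (λ p s → member-true (h p (member-true⁻ s))) points)

  subB-flat⁻ : ∀ B B' → subB (flatOf B) (flatOf B') ≡ true → ∀ p → Sat B p → Sat B' p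
  subB-flat⁻ B B' h p s = find (subB-map⁻ (member B) (member B') points h) (points-complete p)
    where
    find : ∀ {ps} → All (λ p → member B p ≡ true → member B' p ≡ true) ps → p ∈₃ ps → Sat B' p
    find (f ∷ _) (here e) = Sat-resp (≈₃-sym e) (member-true⁻ (f (member-true (Sat-resp e s))))
    find (_ ∷ fs) (there a) = find fs a

  module _ where
    ^-reflects-≤ : ∀ {a b} → q ℕ.^ a ℕ.≤ q ℕ.^ b → a ℕ.≤ b
    ^-reflects-≤ {a} {b} le with a ℕ.≤? b
    ... | yes a≤b = a≤b
    ... | no a≰b = ⊥-elim (ℕP.<⇒≱ (ℕP.^-monoʳ-< q 1<q (ℕP.≰⇒> a≰b)) le)

    ^-reflects-< : ∀ {a b} → q ℕ.^ a ℕ.< q ℕ.^ b → a ℕ.< b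
    ^-reflects-< {a} {b} lt with a ℕ.<? b
    ... | yes a<b = a<b
    ... | no a≮b = ⊥-elim (ℕP.<⇒≱ lt (ℕP.^-monoʳ-≤ q {{ℕ.>-nonZero (ℕP.<⇒≤ 1<q)}} (ℕP.≮⇒≥ a≮b)))

  -- A proper subset has fewer points, and a flat of dimension d has q^d of them.
  subB-dim : ∀ B B' → subB (flatOf B) (flatOf B') ≡ true → flatOf B ≢ flatOf B' → dim (flatOf B) ℕ.< dim (flatOf B')
  subB-dim B B' h ne = [ (λ e → ⊥-elim (ne e)) , (λ l → ^-reflects-< (≡.subst₂ ℕ._<_ (card B) (card B') l)) ]′
    (count-sub (member B) (member B') points (subB-map⁻ (member B) (member B') points h))

  Z-[] : ∀ ps → filterᵇ (member []) ps ≡ ps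
  Z-[] [] = ≡.refl
  Z-[] (p ∷ ps) = ≡.cong (p ∷_) (Z-[] ps)

  dim-V : dim Vflat ≡ 3
  dim-V = ℕP.≤-antisym (dim≤3 Vflat) (^-reflects-≤ (ℕP.≤-reflexive (≡.trans (≡.sym length-points) (≡.trans (≡.cong length (≡.sym (Z-[] points))) (card [])))))

  sub-V : ∀ B → subB (flatOf B) Vflat ≡ true
  sub-V B = subB-flat B [] λ _ _ → []

  dim-3⇒V : ∀ B → 3 ℕ.≤ dim (flatOf B) → flatOf B ≡ Vflat
  dim-3⇒V B h with eqB (flatOf B) Vflat in e
  ... | true = eqB⇒≡ _ _ e
  ... | false = ⊥-elim (ℕP.<⇒≱ (ℕP.<-≤-trans (subB-dim B [] (sub-V B) (eqB-false⁻ e)) (dim≤3 Vflat)) h)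

  module _ (A : Arrangement) where
    private
      αs = forms A
      Lf = L A

    L-flat : All (IsFlat αs) Lf
    L-flat = dedup-All (map flatOf (subsets αs)) (AllP.map⁺ (All.map (λ {B} h → B , ≡.refl , h) (subsets-All (All.tabulate (λ x → x)))))

    L-distinct : AllPairs _≢_ Lf
    L-distinct = dedup-distinct (map flatOf (subsets αs))

    flatOf∈L : ∀ {B} → B ∈ subsets αs → flatOf B ∈ Lf
    flatOf∈L B∈ = dedup-∈ (map flatOf (subsets αs)) (∈P.∈-map⁺ flatOf B∈)

    V∈L : Vflat ∈ Lf
    V∈L = flatOf∈L ([]∈subsets αs)

    private
      strict : Flat → Flat → Bool
      strict X Y = subB X Y ∧ not (eqB X Y)

      strict⁻ : ∀ {X Y} → strict X Y ≡ true → subB X Y ≡ true × eqB X Y ≡ false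
      strict⁻ {X} {Y} h with subB X Y | eqB X Y
      ... | true | false = ≡.refl , ≡.refl

      strict-dim : ∀ {X Y} → IsFlat αs X → IsFlat αs Y → strict X Y ≡ true → dim X ℕ.< dim Y
      strict-dim {X} {Y} (B , ≡.refl , _) (B' , ≡.refl , _) h = subB-dim B B' (proj₁ (strict⁻ {X} {Y} h)) (eqB-false⁻ (proj₂ (strict⁻ {X} {Y} h)))

      mu-V : ∀ n X → eqB X Vflat ≡ true → muFuel n Lf X ≡ 1ℤ
      mu-V zero X e = ≡.refl
      mu-V (suc n) X e = ≡.cong (λ b → if b then 1ℤ else ℤ.- sumℤ (map (muFuel n Lf) (filterᵇ (strict X) Lf))) e

      mu-step : ∀ n X → eqB X Vflat ≡ false → muFuel (suc n) Lf X ≡ ℤ.- ∑ Lf (λ Y → [ strict X Y ] muFuel n Lf Y)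
      mu-step n X e = ≡.trans (≡.cong (λ b → if b then 1ℤ else ℤ.- sumℤ (map (muFuel n Lf) (filterᵇ (strict X) Lf))) e)
        (≡.cong ℤ.-_ (∑-filterᵇ (strict X) (muFuel n Lf) Lf))

      guarded : ∀ b {x y} → (b ≡ true → x ≡ y) → ([ b ] x) ≡ ([ b ] y)
      guarded true h = h ≡.refl
      guarded false h = ≡.refl

      -- The recursion defining μ on X needs fuel at least the codimension of X.
      mu-fuel : ∀ n n' X → IsFlat αs X → 3 ℕ.≤ n ℕ.+ dim X → 3 ℕ.≤ n' ℕ.+ dim X → muFuel n Lf X ≡ muFuel n' Lf X
      mu-fuel n n' X flat h h' = [ (λ e → ≡.trans (mu-V n X e) (≡.sym (mu-V n' X e))) , (λ e → go n n' h h' e) ]′ (bool-cases (eqB X Vflat))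
        where
        not-V : eqB X Vflat ≡ false → ¬ (3 ℕ.≤ dim X)
        not-V e d = eqB-false⁻ e (≡.trans (proj₁ (proj₂ flat)) (dim-3⇒V (proj₁ flat) (≡.subst (λ X → 3 ℕ.≤ dim X) (proj₁ (proj₂ flat)) d)))
        up : ∀ n {d} → dim X ℕ.< d → 3 ℕ.≤ suc n ℕ.+ dim X → 3 ℕ.≤ n ℕ.+ d
        up n lt h = ℕP.≤-trans h (ℕP.≤-trans (ℕP.≤-reflexive (≡.sym (ℕP.+-suc n (dim X)))) (ℕP.+-monoʳ-≤ n lt))
        go : ∀ n n' → 3 ℕ.≤ n ℕ.+ dim X → 3 ℕ.≤ n' ℕ.+ dim X → eqB X Vflat ≡ false → muFuel n Lf X ≡ muFuel n' Lf X
        go zero n' h h' e = ⊥-elim (not-V e h)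
        go (suc n) zero h h' e = ⊥-elim (not-V e h')
        go (suc n) (suc n') h h' e = ≡.trans (mu-step n X e) (≡.trans (≡.cong ℤ.-_ (∑-cong (All.map (λ {Y} flatY → guarded (strict X Y) λ s →
          mu-fuel n n' Y flatY (up n (strict-dim flat flatY s) h) (up n' (strict-dim flat flatY s) h')) L-flat))) (≡.sym (mu-step n' X e)))

      μ-step : ∀ X → IsFlat αs X → eqB X Vflat ≡ false → μ A X ≡ ℤ.- ∑ Lf (λ Y → [ strict X Y ] μ A Y)
      μ-step X flat e = ≡.trans (mu-step 3 X e) (≡.cong ℤ.-_ (∑-cong (All.map (λ {Y} flatY → guarded (strict X Y) λ s →
        mu-fuel 3 4 Y flatY (ℕP.m≤m+n 3 (dim Y)) (ℕP.m≤n⇒m≤1+n (ℕP.m≤m+n 3 (dim Y)))) L-flat)))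

      sub-refl : ∀ {X} → IsFlat αs X → subB X X ≡ true
      sub-refl (B , ≡.refl , _) = subB-flat B B λ _ s → s

      split-sub : ∀ {X Y} → IsFlat αs X → ([ subB X Y ] μ A Y) ≡ ([ eqB X Y ] μ A Y) ℤ.+ ([ strict X Y ] μ A Y)
      split-sub {X} {Y} flat = go (subB X Y) (eqB X Y) λ e → ≡.subst (λ Y → subB X Y ≡ true) (eqB⇒≡ X Y e) (sub-refl flat)
        where
        go : ∀ s e {x} → (e ≡ true → s ≡ true) → ([ s ] x) ≡ ([ e ] x) ℤ.+ ([ s ∧ not e ] x)
        go true true h = ≡.sym (ℤP.+-identityʳ _)
        go true false h = ≡.sym (ℤP.+-identityˡ _)
        go false true h = ⊥-elim (true≢false (≡.sym (h ≡.refl)))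
        go false false h = ≡.refl

    -- The recursion defining μ, read as a sum over all flats containing X; at X = V only V itself
    -- contributes.
    Möbius : ∀ {X} → X ∈ Lf → ∑ Lf (λ Y → [ subB X Y ] μ A Y) ≡ [ eqB X Vflat ] 1ℤ
    Möbius {X} X∈ = ≡.trans (∑-cong (All.universal (λ Y → split-sub {X} {Y} flat) Lf)) (≡.trans (∑-+ Lf _ _)
        (≡.trans (≡.cong (ℤ._+ ∑ Lf (λ Y → [ strict X Y ] μ A Y)) (∑-single (μ A) L-distinct X∈)) ([ at-V , below-V ]′ (bool-cases (eqB X Vflat)))))
      where
      flat = All.lookup L-flat X∈
      above-V : ∀ {Y} → IsFlat αs Y → eqB X Vflat ≡ true → strict X Y ≡ true → ⊥
      above-V {Y} flatY e s = ℕP.<⇒≱ (strict-dim flat flatY s) (≡.subst (dim Y ℕ.≤_) (≡.sym (≡.trans (≡.cong dim (eqB⇒≡ X Vflat e)) dim-V)) (dim≤3 Y))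
      none : ∀ b {x} → (b ≡ true → ⊥) → ([ b ] x) ≡ 0ℤ
      none true h = ⊥-elim (h ≡.refl)
      none false h = ≡.refl
      at-V : eqB X Vflat ≡ true → μ A X ℤ.+ ∑ Lf (λ Y → [ strict X Y ] μ A Y) ≡ [ eqB X Vflat ] 1ℤ
      at-V e = ≡.trans (≡.cong₂ ℤ._+_ (mu-V 4 X e) (≡.trans (∑-cong (All.map (λ {Y} flatY → none (strict X Y) (above-V flatY e)) L-flat)) (∑-0 Lf)))
        (≡.sym (≡.cong ([_] 1ℤ) e))
      below-V : eqB X Vflat ≡ false → μ A X ℤ.+ ∑ Lf (λ Y → [ strict X Y ] μ A Y) ≡ [ eqB X Vflat ] 1ℤ
      below-V e = ≡.trans (≡.cong (ℤ._+ ∑ Lf (λ Y → [ strict X Y ] μ A Y)) (μ-step X flat e))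
        (≡.trans (ℤP.+-inverseˡ (∑ Lf (λ Y → [ strict X Y ] μ A Y))) (≡.sym (≡.cong ([_] 1ℤ) e)))

    private
      -- All forms vanishing at p: their flat is the smallest one containing p.
      B[_] : V3 → List V3
      B[ p ] = filterᵇ (λ α → ev α p == 0#) αs

      Sat-B : ∀ p → Sat B[ p ] p
      Sat-B p = All.map ==-true⁻ (All-filterᵇ (λ α → ev α p == 0#) αs)

      span∈L : ∀ p → flatOf B[ p ] ∈ Lf
      span∈L p = flatOf∈L (filter∈subsets (λ α → ev α p == 0#) αs)

      ≡-by-true : ∀ {a b} → (a ≡ true → b ≡ true) → (b ≡ true → a ≡ true) → a ≡ b
      ≡-by-true {true} {true} _ _ = ≡.refl
      ≡-by-true {false} {false} _ _ = ≡.refl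
      ≡-by-true {true} {false} h _ with () ← h ≡.refl
      ≡-by-true {false} {true} _ h with () ← h ≡.refl

      -- Replaces membership of points by inclusion of flats, so that counting points becomes a sum
      -- over the order relation of the lattice.
      member-sub : ∀ B → All (_∈ αs) B → ∀ p → member B p ≡ subB (flatOf B[ p ]) (flatOf B)
      member-sub B B⊆ p = ≡-by-true
        (λ h → subB-flat B[ p ] B λ p' s → All.zipWith (λ (α∈ , e) → All.lookup s (∈-filterᵇ (λ α → ev α p == 0#) α∈ (==-true e))) (B⊆ , member-true⁻ h))
        (λ h → member-true (subB-flat⁻ B[ p ] B h p (Sat-B p)))

    missing : V3 → Bool
    missing p = all (λ α → not (ev α p == 0#)) αs

    missing-true : ∀ {p} → All (λ α → ¬ (ev α p ≈ 0#)) αs → missing p ≡ true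
    missing-true {p} h = all-true (λ α → not (ev α p == 0#)) (All.map go h)
      where
      go : ∀ {α} → ¬ (ev α p ≈ 0#) → not (ev α p == 0#) ≡ true
      go {α} ne with ev α p ≟ 0#
      ... | yes e = ⊥-elim (ne e)
      ... | no _ = ≡.refl

    missing-true⁻ : ∀ {p} → missing p ≡ true → All (λ α → ¬ (ev α p ≈ 0#)) αs
    missing-true⁻ {p} h = All.map go (all-true⁻ (λ α → not (ev α p == 0#)) αs h)
      where
      go : ∀ {α} → not (ev α p == 0#) ≡ true → ¬ (ev α p ≈ 0#)
      go {α} h e with ev α p ≟ 0#
      go () e | yes _
      go h e | no ne = ne e

    missing-points : List V3
    missing-points = filterᵇ missing points

    flat≢V : ∀ {B α} → α ∈ B → ¬ (α ≈₃ 0₃) → flatOf B ≢ Vflat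
    flat≢V {B} {α} α∈ α≉0 e = α≉0 (zero-form α λ p → All.lookup (subB-flat⁻ [] B (≡.subst (λ X → subB Vflat X ≡ true) (≡.sym e) (sub-V [])) p []) α∈)
      where
      zero-form : ∀ α → (∀ p → ev α p ≈ 0#) → α ≈₃ 0₃
      zero-form α h = ≈₃-trans (VF.⊙-nondegenerate α λ c → trans (VF.⊙-comm c α) (h c)) ≈₃-refl
        where module VF = Vector3 commRing

    private
      -- A nonzero form vanishing at p keeps the flat below V; if there is none, the flat is the
      -- empty intersection.
      V-missing : ∀ p → eqB (flatOf B[ p ]) Vflat ≡ missing p
      V-missing p = ≡-by-true
        (λ e → missing-true (All.tabulate λ {α} α∈ z → flat≢V {B[ p ]} (∈-filterᵇ (λ α → ev α p == 0#) α∈ (==-true z)) (All.lookup (nonzero A) α∈) (eqB⇒≡ _ _ e)))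
        (λ h → ≡.trans (≡.cong (λ B → eqB (flatOf B) Vflat) (empty αs (missing-true⁻ h))) (eqB-refl Vflat))
        where
        empty : ∀ αs → All (λ α → ¬ (ev α p ≈ 0#)) αs → filterᵇ (λ α → ev α p == 0#) αs ≡ []
        empty [] [] = ≡.refl
        empty (α ∷ αs) (ne ∷ nes) = ≡.trans (filterᵇ-∷-false (λ α → ev α p == 0#) α αs (go ne)) (empty αs nes)
          where
          go : ¬ (ev α p ≈ 0#) → (ev α p == 0#) ≡ false
          go ne with ev α p ≟ 0#
          ... | yes e = ⊥-elim (ne e)
          ... | no _ = ≡.refl

      card-sum : ∀ {X} → IsFlat αs X → (+ q) ℤ.^ dim X ≡ ∑ points (λ p → [ subB (flatOf B[ p ]) X ] 1ℤ)
      card-sum (B , ≡.refl , B⊆) = ≡.trans (^-pos q (dim (flatOf B))) (≡.trans (≡.cong +_ (≡.sym (card B))) (≡.trans (count-∑ (member B) points)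
        (∑-cong (All.universal (λ p → ≡.cong ([_] 1ℤ) (member-sub B B⊆ p)) points))))

    -- χ(A, q) counts the points on no hyperplane: sum the Möbius identity over the flats through each point.
    chi-count : chiAt A (+ q) ≡ + length missing-points
    chi-count = ≡.trans (∑-cong (All.map (λ {X} flat → ≡.trans (≡.cong (μ A X ℤ.*_) (card-sum flat)) (distribute X)) L-flat))
      (≡.trans (∑-swap Lf points (λ X p → [ subB (flatOf B[ p ]) X ] μ A X))
      (≡.trans (∑-cong (All.universal (λ p → ≡.trans (Möbius (span∈L p)) (≡.cong ([_] 1ℤ) (V-missing p))) points)) (≡.sym (count-∑ missing points))))
      where
      distribute : ∀ X → μ A X ℤ.* ∑ points (λ p → [ subB (flatOf B[ p ]) X ] 1ℤ) ≡ ∑ points (λ p → [ subB (flatOf B[ p ]) X ] μ A X)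
      distribute X = ≡.trans (ℤP.*-comm (μ A X) _) (≡.trans (≡.sym (∑-*ʳ points _ (μ A X)))
        (∑-cong (All.universal (λ p → go (subB (flatOf B[ p ]) X)) points)))
        where
        go : ∀ b → ([ b ] 1ℤ) ℤ.* μ A X ≡ [ b ] μ A X
        go true = ℤP.*-identityˡ (μ A X)
        go false = ℤP.*-zeroˡ (μ A X)

    -- The sum is χ(A, 1). Every flat contains the origin, so this is the Möbius identity for the
    -- smallest flat through the origin, which is not V.
    chi-one : 1 ℕ.≤ length αs → ∑ Lf (μ A) ≡ 0ℤ
    chi-one 1≤n = ≡.trans (∑-cong (All.map (λ {X} flat → ≡.sym (≡.cong ([_] μ A X) (contains flat))) L-flat))
      (≡.trans (Möbius (span∈L 0₃)) (≡.cong ([_] 1ℤ) (≡.trans (V-missing 0₃) (not-missing αs 1≤n))))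
      where
      contains : ∀ {X} → IsFlat αs X → subB (flatOf B[ 0₃ ]) X ≡ true
      contains (B , ≡.refl , B⊆) = ≡.trans (≡.sym (member-sub B B⊆ 0₃)) (member-true (All.universal ev-0 B))
      not-missing : ∀ αs → 1 ℕ.≤ length αs → all (λ α → not (ev α 0₃ == 0#)) αs ≡ false
      not-missing (α ∷ αs) _ rewrite ==-true (ev-0 α) = ≡.refl

-- The coefficients of χ, and χ determined by its value at q.

module Coefficients {q : ℕ} (F : FiniteField q) where
  open FiniteField F hiding (zero)
  open Arr F
  open Counting
  open IntegerSums
  open Frobenius F
  open Cardinality F
  open Characteristic F
  open LinearForms F using (section)
  open MissingPoints F using (parallel⇒scalar)
  private module VF = Vector3 commRing

  ≡ᵇ-true : ∀ {a b} → a ≡ b → (a ℕ.≡ᵇ b) ≡ true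
  ≡ᵇ-true {a} {b} e = Equivalence.to T-≡ (ℕP.≡⇒≡ᵇ a b e)

  ≡ᵇ-true⁻ : ∀ {a b} → (a ℕ.≡ᵇ b) ≡ true → a ≡ b
  ≡ᵇ-true⁻ {a} {b} e = ℕP.≡ᵇ⇒≡ a b (Equivalence.from T-≡ e)

  bool-≡ : ∀ {a b} → (a ≡ true → b ≡ true) → (b ≡ true → a ≡ true) → a ≡ b
  bool-≡ {true} {true} _ _ = ≡.refl
  bool-≡ {false} {false} _ _ = ≡.refl
  bool-≡ {true} {false} h _ with () ← h ≡.refl
  bool-≡ {false} {true} _ h with () ← h ≡.refl

  hyperplane : V3 → Flat
  hyperplane α = flatOf (α ∷ [])

  -- Every point is a multiple of e plus a point of the hyperplane, where α(e) = 1.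
  dim-hyperplane : ∀ α → ¬ (α ≈₃ 0₃) → dim (hyperplane α) ≡ 2
  dim-hyperplane α α≉0 = ℕP.≤-antisym upper lower
    where
    e = proj₁ (section α α≉0)
    upper : dim (hyperplane α) ℕ.≤ 2
    upper = ℕP.≤-pred (ℕP.≤-trans (subB-dim (α ∷ []) [] (sub-V (α ∷ [])) ≢V) (dim≤3 Vflat))
      where
      ≢V : hyperplane α ≢ Vflat
      ≢V h = α≉0 (≈₃-trans (VF.⊙-nondegenerate α λ c → trans (VF.⊙-comm c α)
        (All.head (subB-flat⁻ [] (α ∷ []) (≡.subst (λ X → subB Vflat X ≡ true) (≡.sym h) (sub-V [])) c []))) ≈₃-refl)
    translates : List V3
    translates = concatMap (λ k → map (λ h → (k ·₃ e) +₃ h) (Z (α ∷ []))) elems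
    length-translates : length translates ≡ q ℕ.^ suc (dim (hyperplane α))
    length-translates = ≡.trans (length-concatMap _ elems λ k → ≡.trans (ListP.length-map _ (Z (α ∷ []))) (card (α ∷ []))) (≡.cong (ℕ._* q ℕ.^ dim (hyperplane α)) length-elements)
    reached : ∀ p → Any (p ≈₃_) translates
    reached p = Any-concatMap _ (Any.map (λ {k} ek → AnyP.map⁺ (Any.map (λ {h} eh → combine ek eh) (Z-complete (α ∷ []) remainder (vanish ∷ [])))) (elems-complete (ev α p)))
      where
      remainder = ((- ev α p) ·₃ e) +₃ p
      vanish : ev α remainder ≈ 0#
      vanish = trans (ev-linear α (- ev α p) e p) (trans (+-congʳ (trans (*-congˡ (proj₂ (section α α≉0))) (*-identityʳ _))) (-‿inverseˡ _))
      combine : ∀ {k h} → ev α p ≈ k → remainder ≈₃ h → p ≈₃ ((k ·₃ e) +₃ h)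
      combine {k} {h} ek eh = ≈₃-trans (restore (ev α p) e p) (VF.⊞-cong (VF.•-cong ek (VF.≋-refl {e})) eh)
        where
        open RingSolver commRing
        restore : ∀ k u v → v ≈₃ ((k ·₃ u) +₃ (((- k) ·₃ u) +₃ v))
        restore k (x , y , z) (x' , y' , z') = go x x' , go y y' , go z z'
          where
          go : ∀ x x' → x' ≈ k * x + ((- k) * x + x')
          go x x' = solve 3 (λ k x x' → x' := k :* x :+ ((:- k) :* x :+ x')) refl k x x'
    lower : 2 ℕ.≤ dim (hyperplane α)
    lower = ℕP.≤-pred (^-reflects-≤ (≡.subst₂ ℕ._≤_ length-points length-translates
      (distinct-length-≤ _≈₃_ ≈₃-sym ≈₃-trans points translates points-distinct (All.universal reached points))))

  -- Every c × β lies on the hyperplane of β, so α(c × β) = c · (β × α) vanishes for all c, and β ×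
  -- α = 0.
  hyperplane-injective : ∀ α β → ¬ (β ≈₃ 0₃) → hyperplane α ≡ hyperplane β → Σ Carrier λ k → α ≈₃ (k ·₃ β)
  hyperplane-injective α β β≉0 h = parallel⇒scalar β α β≉0 (VF.⊙-nondegenerate (β VF.⨯ α) λ c →
    trans (sym (VF.det-rotate α c β)) (All.head (subB-flat⁻ (β ∷ []) (α ∷ [])
      (≡.trans (≡.cong (λ X → subB X (hyperplane α)) (≡.sym h)) (subB-flat (α ∷ []) (α ∷ []) λ _ s → s)) (c VF.⨯ β) (VF.det-repeat₁₃ β c ∷ []))))

  module _ (A : Arrangement) where
    private
      Lf = L A
      αs = forms A

      chiCoeff-∑ : ∀ d → chiCoeff A d ≡ ∑ Lf (λ X → [ dim X ℕ.≡ᵇ d ] μ A X)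
      chiCoeff-∑ d = ∑-filterᵇ (λ X → dim X ℕ.≡ᵇ d) (μ A) Lf

    μ-V : μ A Vflat ≡ 1ℤ
    μ-V = ≡.cong (λ b → if b then 1ℤ else ℤ.- sumℤ (map (muFuel 3 Lf) (filterᵇ (λ Y → subB Vflat Y ∧ not (eqB Vflat Y)) Lf))) (eqB-refl Vflat)

    private
      dim-3-V : ∀ {X} → IsFlat αs X → (dim X ℕ.≡ᵇ 3) ≡ eqB Vflat X
      dim-3-V (B , ≡.refl , _) = bool-≡
        (λ e → ≡.subst (λ X → eqB Vflat X ≡ true) (≡.sym (dim-3⇒V B (ℕP.≤-reflexive (≡.sym (≡ᵇ-true⁻ e))))) (eqB-refl Vflat))
        (λ e → ≡ᵇ-true (≡.trans (≡.cong dim (≡.sym (eqB⇒≡ Vflat (flatOf B) e))) dim-V))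

    chi-3 : chiCoeff A 3 ≡ 1ℤ
    chi-3 = ≡.trans (chiCoeff-∑ 3) (≡.trans (∑-cong (All.map (λ {X} flat → ≡.cong ([_] μ A X) (dim-3-V flat)) (L-flat A)))
      (≡.trans (∑-single (μ A) (L-distinct A) (V∈L A)) μ-V))

    private
      -- Dimension is strictly monotone, so only X itself and V contain a two-dimensional flat X.
      -- This yields μ(X) = -1.
      dim-2-sub : ∀ {X Y} → IsFlat αs X → IsFlat αs Y → dim X ≡ 2 → ([ subB X Y ] μ A Y) ≡ ([ eqB X Y ] μ A Y) ℤ.+ ([ eqB Vflat Y ] μ A Y)
      dim-2-sub {X} {Y} (B , ≡.refl , _) (B' , ≡.refl , _) d = go (subB X Y) (eqB X Y) (eqB Vflat Y)
          (λ e → ≡.subst (λ Y → subB X Y ≡ true) (eqB⇒≡ X Y e) (subB-flat B B λ _ s → s))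
          (λ e → ≡.subst (λ Y → subB X Y ≡ true) (eqB⇒≡ Vflat Y e) (sub-V B))
          (λ e e' → X≢V (≡.trans (eqB⇒≡ X Y e) (≡.sym (eqB⇒≡ Vflat Y e'))))
          (λ s e → ≡.subst (λ Y → eqB Vflat Y ≡ true) (≡.sym (dim-3⇒V B' (ℕP.≤-trans (ℕP.≤-reflexive (≡.cong suc (≡.sym d))) (subB-dim B B' s (eqB-false⁻ e))))) (eqB-refl Vflat))
        where
        X≢V : X ≢ Vflat
        X≢V e with () ← ≡.trans (≡.sym d) (≡.trans (≡.cong dim e) dim-V)
        go : ∀ s e v {x} → (e ≡ true → s ≡ true) → (v ≡ true → s ≡ true) → (e ≡ true → v ≡ true → ⊥) → (s ≡ true → e ≡ false → v ≡ true) →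
          ([ s ] x) ≡ ([ e ] x) ℤ.+ ([ v ] x)
        go s true true _ _ h _ = ⊥-elim (h ≡.refl ≡.refl)
        go true true false _ _ _ _ = ≡.sym (ℤP.+-identityʳ _)
        go true false true _ _ _ _ = ≡.sym (ℤP.+-identityˡ _)
        go true false false _ _ _ h with () ← h ≡.refl ≡.refl
        go false false false _ _ _ _ = ≡.refl
        go false true false h _ _ _ with () ← h ≡.refl
        go false false true _ h _ _ with () ← h ≡.refl

      μ-dim-2 : ∀ {X} → X ∈ Lf → dim X ≡ 2 → μ A X ≡ -[1+ 0 ]
      μ-dim-2 {X} X∈ d = cancel (≡.trans (≡.sym (≡.trans (∑-cong (All.map (λ flatY → dim-2-sub flatX flatY d) (L-flat A))) (≡.trans (∑-+ Lf _ _)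
          (≡.cong₂ ℤ._+_ (∑-single (μ A) (L-distinct A) X∈) (≡.trans (∑-single (μ A) (L-distinct A) (V∈L A)) μ-V)))))
          (≡.trans (Möbius A X∈) (≡.cong ([_] 1ℤ) (eqB-false X≢V))))
        where
        flatX = All.lookup (L-flat A) X∈
        X≢V : X ≢ Vflat
        X≢V e with () ← ≡.trans (≡.sym d) (≡.trans (≡.cong dim e) dim-V)
        cancel : ∀ {x} → x ℤ.+ 1ℤ ≡ 0ℤ → x ≡ -[1+ 0 ]
        cancel {x} e = ≡.trans (solve 1 (λ x → x := (x :+ con 1ℤ) :- con 1ℤ) ≡.refl x) (≡.cong (ℤ._- 1ℤ) e)
          where open ℤSolver

      -- A two-dimensional flat lies in the hyperplane of its first form and equals it by dimension;
      -- non-proportional forms have different hyperplanes.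
      number-of-hyperplanes : length (filterᵇ (λ X → dim X ℕ.≡ᵇ 2) Lf) ≡ length αs
      number-of-hyperplanes = ≡.trans (ℕP.≤-antisym
          (distinct-length-≤ _≡_ ≡.sym ≡.trans (filterᵇ is-2 Lf) (map hyperplane αs) (AllPairs-filterᵇ is-2 (L-distinct A)) all-hyperplanes)
          (distinct-length-≤ _≡_ ≡.sym ≡.trans (map hyperplane αs) (filterᵇ is-2 Lf) distinct-hyperplanes all-in))
        (ListP.length-map hyperplane αs)
        where
        is-2 : Flat → Bool
        is-2 X = dim X ℕ.≡ᵇ 2
        classify : ∀ {X} → IsFlat αs X → dim X ≡ 2 → Any (X ≡_) (map hyperplane αs)
        classify ([] , ≡.refl , _) d with () ← ≡.trans (≡.sym d) dim-V
        classify (α ∷ B , ≡.refl , (α∈ ∷ _)) d = AnyP.map⁺ (Any.map (λ { ≡.refl → same (bool-cases (eqB (flatOf (α ∷ B)) (hyperplane α))) }) α∈)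
          where
          same : (eqB (flatOf (α ∷ B)) (hyperplane α) ≡ true) ⊎ (eqB (flatOf (α ∷ B)) (hyperplane α) ≡ false) → flatOf (α ∷ B) ≡ hyperplane α
          same (inj₁ e) = eqB⇒≡ _ _ e
          same (inj₂ e) = ⊥-elim (ℕP.<-irrefl (≡.trans d (≡.sym (dim-hyperplane α (All.lookup (nonzero A) α∈))))
            (subB-dim (α ∷ B) (α ∷ []) (subB-flat (α ∷ B) (α ∷ []) λ { _ (s ∷ _) → s ∷ [] }) (eqB-false⁻ e)))
        all-hyperplanes : All (λ X → Any (X ≡_) (map hyperplane αs)) (filterᵇ is-2 Lf)
        all-hyperplanes = All.zipWith (λ (flat , e) → classify flat (≡ᵇ-true⁻ e)) (AllP.filter⁺ (T? ∘ is-2) (L-flat A) , All-filterᵇ is-2 Lf)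
        all-in : All (λ X → Any (X ≡_) (filterᵇ is-2 Lf)) (map hyperplane αs)
        all-in = AllP.map⁺ (All.tabulate λ {α} α∈ → ∈-filterᵇ is-2 (flatOf∈L A (singleton∈subsets αs α∈)) (≡ᵇ-true (dim-hyperplane α (All.lookup (nonzero A) α∈))))
        distinct-hyperplanes : AllPairs _≢_ (map hyperplane αs)
        distinct-hyperplanes = AllPairsP.map⁺ (go (nonzero A) (distinct A))
          where
          go : ∀ {αs} → All (λ α → ¬ (α ≈₃ 0₃)) αs → AllPairs (λ α β → ¬ (Σ Carrier λ k → α ≈₃ (k ·₃ β))) αs → AllPairs (λ α β → hyperplane α ≢ hyperplane β) αs
          go [] [] = []
          go (_ ∷ nz) (ne ∷ d) = All.zipWith (λ {β} (β≉0 , n) e → n (hyperplane-injective _ β β≉0 e)) (nz , ne) ∷ go nz d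

    chi-2 : chiCoeff A 2 ≡ + length αs ℤ.* -[1+ 0 ]
    chi-2 = ≡.trans (chiCoeff-∑ 2) (≡.trans (∑-cong (All.tabulate λ {X} X∈ → guarded (dim X ℕ.≡ᵇ 2) λ e → μ-dim-2 X∈ (≡ᵇ-true⁻ e)))
        (≡.trans (∑-const (λ X → dim X ℕ.≡ᵇ 2) -[1+ 0 ] Lf) (≡.cong (λ n → + n ℤ.* -[1+ 0 ]) number-of-hyperplanes)))
      where
      guarded : ∀ b {x y} → (b ≡ true → x ≡ y) → ([ b ] x) ≡ ([ b ] y)
      guarded true h = h ≡.refl
      guarded false h = ≡.refl

    chi-large : ∀ d → chiCoeff A (4 ℕ.+ d) ≡ 0ℤ
    chi-large d = ≡.trans (chiCoeff-∑ (4 ℕ.+ d)) (≡.trans (∑-cong (All.universal (λ X → ≡.cong ([_] μ A X) (small (dim X) (dim≤3 X))) Lf)) (∑-0 Lf))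
      where
      small : ∀ k → k ℕ.≤ 3 → (k ℕ.≡ᵇ 4 ℕ.+ d) ≡ false
      small 0 _ = ≡.refl
      small 1 _ = ≡.refl
      small 2 _ = ≡.refl
      small 3 _ = ≡.refl
      small (suc (suc (suc (suc k)))) (s≤s (s≤s (s≤s ())))

    -- Used for the powers q^dim, giving χ(q), and for the constant 1, giving χ(1).
    by-dimension : ∀ (f : ℕ → ℤ) → ∑ Lf (λ X → μ A X ℤ.* f (dim X)) ≡
      chiCoeff A 0 ℤ.* f 0 ℤ.+ (chiCoeff A 1 ℤ.* f 1 ℤ.+ (chiCoeff A 2 ℤ.* f 2 ℤ.+ chiCoeff A 3 ℤ.* f 3))
    by-dimension f = ≡.trans (∑-cong (All.universal (λ X → pointwise (μ A X) (dim X) (dim≤3 X)) Lf))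
      (≡.trans (∑-+ Lf (t 0) _) (≡.cong₂ ℤ._+_ (collect 0) (≡.trans (∑-+ Lf (t 1) _) (≡.cong₂ ℤ._+_ (collect 1)
        (≡.trans (∑-+ Lf (t 2) (t 3)) (≡.cong₂ ℤ._+_ (collect 2) (collect 3)))))))
      where
      t : ℕ → Flat → ℤ
      t d X = ([ dim X ℕ.≡ᵇ d ] μ A X) ℤ.* f d
      collect : ∀ d → ∑ Lf (t d) ≡ chiCoeff A d ℤ.* f d
      collect d = ≡.trans (∑-*ʳ Lf (λ X → [ dim X ℕ.≡ᵇ d ] μ A X) (f d)) (≡.cong (ℤ._* f d) (≡.sym (chiCoeff-∑ d)))
      pointwise : ∀ m k → k ℕ.≤ 3 → m ℤ.* f k ≡ ([ k ℕ.≡ᵇ 0 ] m) ℤ.* f 0 ℤ.+ (([ k ℕ.≡ᵇ 1 ] m) ℤ.* f 1 ℤ.+ (([ k ℕ.≡ᵇ 2 ] m) ℤ.* f 2 ℤ.+ ([ k ℕ.≡ᵇ 3 ] m) ℤ.* f 3))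
      pointwise m 0 _ = solve 5 (λ m a b c d → m :* a := m :* a :+ (con 0ℤ :* b :+ (con 0ℤ :* c :+ con 0ℤ :* d))) ≡.refl m (f 0) (f 1) (f 2) (f 3)
        where open ℤSolver
      pointwise m 1 _ = solve 5 (λ m a b c d → m :* b := con 0ℤ :* a :+ (m :* b :+ (con 0ℤ :* c :+ con 0ℤ :* d))) ≡.refl m (f 0) (f 1) (f 2) (f 3)
        where open ℤSolver
      pointwise m 2 _ = solve 5 (λ m a b c d → m :* c := con 0ℤ :* a :+ (con 0ℤ :* b :+ (m :* c :+ con 0ℤ :* d))) ≡.refl m (f 0) (f 1) (f 2) (f 3)
        where open ℤSolver
      pointwise m 3 _ = solve 5 (λ m a b c d → m :* d := con 0ℤ :* a :+ (con 0ℤ :* b :+ (con 0ℤ :* c :+ m :* d))) ≡.refl m (f 0) (f 1) (f 2) (f 3)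
        where open ℤSolver
      pointwise m (suc (suc (suc (suc k)))) (s≤s (s≤s (s≤s ())))

    private
      -- The product (t - 1)(t - b)(t - c); both target polynomials have this shape with b + c = |A|
      -- - 1.
      cubic : ℤ → ℤ → ZPoly
      cubic b c = mulZ (linZ 1ℤ) (mulZ (linZ b) (linZ c))

      open ℤSolver

      cubic-0 : ∀ b c → coeffZ (cubic b c) 0 ≡ ℤ.- (b ℤ.* c)
      cubic-0 b c = solve 2 (λ b c → con (ℤ.- 1ℤ) :* ((:- b) :* (:- c) :+ con 0ℤ) :+ con 0ℤ := :- (b :* c)) ≡.refl b c

      cubic-1 : ∀ b c → coeffZ (cubic b c) 1 ≡ b ℤ.+ c ℤ.+ b ℤ.* c
      cubic-1 b c = solve 2 (λ b c → con (ℤ.- 1ℤ) :* ((:- b) :* con 1ℤ :+ (con 1ℤ :* (:- c) :+ con 0ℤ)) :+ (con 1ℤ :* ((:- b) :* (:- c) :+ con 0ℤ) :+ con 0ℤ) := b :+ c :+ b :* c) ≡.refl b c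

      cubic-2 : ∀ b c → coeffZ (cubic b c) 2 ≡ ℤ.- (1ℤ ℤ.+ b ℤ.+ c)
      cubic-2 b c = solve 2 (λ b c → con (ℤ.- 1ℤ) :* (con 1ℤ :* con 1ℤ) :+ (con 1ℤ :* ((:- b) :* con 1ℤ :+ (con 1ℤ :* (:- c) :+ con 0ℤ))) := :- (con 1ℤ :+ b :+ c)) ≡.refl b c

    -- c₂ = −n and c₃ = 1 always hold, and χ(1) = 0; so χ is determined by its value at q.
    chi-criterion : ∀ b c → 1 ℕ.≤ length αs → + length αs ≡ 1ℤ ℤ.+ b ℤ.+ c →
      ChiIs A (cubic b c) ⇔ + length (missing-points A) ≡ (+ q ℤ.- 1ℤ) ℤ.* ((+ q ℤ.- b) ℤ.* (+ q ℤ.- c))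
    chi-criterion b c 1≤n n≡ = mk⇔ to from
      where
      Q = + q
      C = chiCoeff A
      at-q : + length (missing-points A) ≡ C 0 ℤ.* 1ℤ ℤ.+ (C 1 ℤ.* (Q ℤ.* 1ℤ) ℤ.+ (C 2 ℤ.* (Q ℤ.* (Q ℤ.* 1ℤ)) ℤ.+ C 3 ℤ.* (Q ℤ.* (Q ℤ.* (Q ℤ.* 1ℤ)))))
      at-q = ≡.trans (≡.sym (chi-count A)) (by-dimension (Q ℤ.^_))
      at-1 : C 0 ℤ.* 1ℤ ℤ.+ (C 1 ℤ.* 1ℤ ℤ.+ (C 2 ℤ.* 1ℤ ℤ.+ C 3 ℤ.* 1ℤ)) ≡ 0ℤ
      at-1 = ≡.trans (≡.sym (by-dimension (λ _ → 1ℤ))) (≡.trans (∑-cong (All.universal (λ X → ℤP.*-identityʳ (μ A X)) Lf)) (chi-one A 1≤n))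
      C₂ : C 2 ≡ ℤ.- (1ℤ ℤ.+ b ℤ.+ c)
      C₂ = ≡.trans chi-2 (≡.trans (≡.cong (ℤ._* -[1+ 0 ]) n≡) (solve 2 (λ b c → (con 1ℤ :+ b :+ c) :* con -[1+ 0 ] := :- (con 1ℤ :+ b :+ c)) ≡.refl b c))
      to : ChiIs A (cubic b c) → + length (missing-points A) ≡ (Q ℤ.- 1ℤ) ℤ.* ((Q ℤ.- b) ℤ.* (Q ℤ.- c))
      to h = ≡.trans at-q (≡.trans (≡.cong₂ (λ x y → x ℤ.* 1ℤ ℤ.+ (y ℤ.* (Q ℤ.* 1ℤ) ℤ.+ (C 2 ℤ.* (Q ℤ.* (Q ℤ.* 1ℤ)) ℤ.+ C 3 ℤ.* (Q ℤ.* (Q ℤ.* (Q ℤ.* 1ℤ))))))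
          (≡.trans (h 0) (cubic-0 b c)) (≡.trans (h 1) (cubic-1 b c)))
        (≡.trans (≡.cong₂ (λ x y → ℤ.- (b ℤ.* c) ℤ.* 1ℤ ℤ.+ ((b ℤ.+ c ℤ.+ b ℤ.* c) ℤ.* (Q ℤ.* 1ℤ) ℤ.+ (x ℤ.* (Q ℤ.* (Q ℤ.* 1ℤ)) ℤ.+ y ℤ.* (Q ℤ.* (Q ℤ.* (Q ℤ.* 1ℤ)))))) C₂ chi-3)
        (solve 3 (λ Q b c → (:- (b :* c)) :* con 1ℤ :+ ((b :+ c :+ b :* c) :* (Q :* con 1ℤ) :+ ((:- (con 1ℤ :+ b :+ c)) :* (Q :* (Q :* con 1ℤ)) :+ con 1ℤ :* (Q :* (Q :* (Q :* con 1ℤ)))))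
          := (Q :- con 1ℤ) :* ((Q :- b) :* (Q :- c))) ≡.refl Q b c)))
      from : + length (missing-points A) ≡ (Q ℤ.- 1ℤ) ℤ.* ((Q ℤ.- b) ℤ.* (Q ℤ.- c)) → ChiIs A (cubic b c)
      from h = λ { 0 → C₀ ; 1 → ≡.trans C₁ (≡.sym (cubic-1 b c)) ; 2 → ≡.trans C₂ (≡.sym (cubic-2 b c)) ; 3 → chi-3 ; (suc (suc (suc (suc d)))) → chi-large d }
        where
        sub-at-1 : C 0 ≡ ℤ.- (C 1 ℤ.+ (C 2 ℤ.+ C 3))
        sub-at-1 = ≡.trans (solve 4 (λ w x y z → w := (w :* con 1ℤ :+ (x :* con 1ℤ :+ (y :* con 1ℤ :+ z :* con 1ℤ))) :- (x :+ (y :+ z))) ≡.refl (C 0) (C 1) (C 2) (C 3))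
          (≡.trans (≡.cong (ℤ._- (C 1 ℤ.+ (C 2 ℤ.+ C 3))) at-1) (ℤP.+-identityˡ _))
        -- χ(q) - χ(1) no longer contains the constant coefficient. With the two leading
        -- coefficients known, it fixes q - 1 times the linear one.
        difference : (Q ℤ.- 1ℤ) ℤ.* C 1 ≡ (Q ℤ.- 1ℤ) ℤ.* (b ℤ.+ c ℤ.+ b ℤ.* c)
        difference = ≡.trans
          (≡.trans (solve 4 (λ Q x y z → (Q :- con 1ℤ) :* x := (:- (x :+ (y :+ z))) :* con 1ℤ :+ (x :* (Q :* con 1ℤ) :+ (y :* (Q :* (Q :* con 1ℤ)) :+ z :* (Q :* (Q :* (Q :* con 1ℤ)))))
              :- (y :* (Q :* Q :- con 1ℤ) :+ z :* (Q :* Q :* Q :- con 1ℤ))) ≡.refl Q (C 1) (C 2) (C 3))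
            (≡.cong₂ (λ x y → x ℤ.- y) (≡.trans (≡.cong (λ w → w ℤ.* 1ℤ ℤ.+ (C 1 ℤ.* (Q ℤ.* 1ℤ) ℤ.+ (C 2 ℤ.* (Q ℤ.* (Q ℤ.* 1ℤ)) ℤ.+ C 3 ℤ.* (Q ℤ.* (Q ℤ.* (Q ℤ.* 1ℤ)))))) (≡.sym sub-at-1))
                (≡.trans (≡.sym at-q) h))
              (≡.cong₂ (λ y z → y ℤ.* (Q ℤ.* Q ℤ.- 1ℤ) ℤ.+ z ℤ.* (Q ℤ.* Q ℤ.* Q ℤ.- 1ℤ)) C₂ chi-3)))
          (solve 3 (λ Q b c → (Q :- con 1ℤ) :* ((Q :- b) :* (Q :- c)) :- ((:- (con 1ℤ :+ b :+ c)) :* (Q :* Q :- con 1ℤ) :+ con 1ℤ :* (Q :* Q :* Q :- con 1ℤ))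
            := (Q :- con 1ℤ) :* (b :+ c :+ b :* c)) ≡.refl Q b c)
        Q-1≢0 : Q ℤ.- 1ℤ ≢ 0ℤ
        Q-1≢0 e = ℕP.<-irrefl (≡.sym (ℤP.+-injective (ℤP.i-j≡0⇒i≡j Q 1ℤ e))) 1<q
        C₁ : C 1 ≡ b ℤ.+ c ℤ.+ b ℤ.* c
        C₁ = ℤP.*-cancelˡ-≡ (Q ℤ.- 1ℤ) (C 1) _ {{ℤ.≢-nonZero Q-1≢0}} difference
        C₀ : C 0 ≡ coeffZ (cubic b c) 0
        C₀ = ≡.trans sub-at-1 (≡.trans (≡.cong₂ (λ x y → ℤ.- (x ℤ.+ y)) C₁ (≡.cong₂ ℤ._+_ C₂ chi-3))
          (≡.trans (solve 2 (λ b c → :- ((b :+ c :+ b :* c) :+ (:- (con 1ℤ :+ b :+ c) :+ con 1ℤ)) := :- (b :* c)) ≡.refl b c) (≡.sym (cubic-0 b c))))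

-- Counting missed points by classes of scalar multiples.

module MissingClasses {q : ℕ} (F : FiniteField q) where
  open FiniteField F hiding (zero; _*_)
  open FiniteField F using () renaming (_*_ to _·_)
  open Arr F
  open Counting
  open FieldLemmas F
  open Frobenius F
  open LinearForms F using (Nonzero; product)
  open VanishingIdeal F using (module EF)
  open Construction F using (Parallel; Missing; missing-nonzero; parallel-sym)
  open MissingPoints F using (parallel⇒scalar; parallel?)
  open Cardinality F
  open Characteristic F using (missing; missing-true; missing-true⁻; missing-points)
  private module VF = Vector3 commRing

  private
    is-unit : Carrier → Bool
    is-unit x = not (x == 0#)

    is-unit-true : ∀ {x} → ¬ (x ≈ 0#) → is-unit x ≡ true
    is-unit-true {x} ne with x ≟ 0#
    ... | yes e = ⊥-elim (ne e)
    ... | no _ = ≡.refl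

    is-unit-true⁻ : ∀ {x} → is-unit x ≡ true → ¬ (x ≈ 0#)
    is-unit-true⁻ {x} h e with x ≟ 0#
    is-unit-true⁻ () e | yes _
    ... | no ne = ne e

  units : List Carrier
  units = filterᵇ is-unit elems

  units-nonzero : All (λ x → ¬ (x ≈ 0#)) units
  units-nonzero = All.map is-unit-true⁻ (All-filterᵇ is-unit elems)

  units-complete : ∀ {x} → ¬ (x ≈ 0#) → Any (x ≈_) units
  units-complete {x} x≉0 = Any-filterᵇ is-unit (Any.map (λ e → e , is-unit-true (λ z → x≉0 (trans e z))) (elems-complete x))

  units-distinct : AllPairs (λ x y → ¬ (x ≈ y)) units
  units-distinct = AllPairs-filterᵇ is-unit elements-distinct

  length-units : suc (length units) ≡ q
  length-units = ≡.trans (ℕP.≤-antisym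
      (distinct-length-≤ _≈_ sym trans (0# ∷ units) elems (All.map (λ ne e → ne (sym e)) units-nonzero ∷ units-distinct) (elems-complete 0# ∷ All.universal elems-complete units))
      (distinct-length-≤ _≈_ sym trans elems (0# ∷ units) elements-distinct (All.universal covered elems)))
    length-elements
    where
    covered : ∀ x → Any (x ≈_) (0# ∷ units)
    covered x with x ≟ 0#
    ... | yes e = here e
    ... | no ne = there (units-complete ne)

  multiples : V3 → List V3
  multiples P = map (_·₃ P) units

  length-multiples : ∀ P → length (multiples P) ≡ length units
  length-multiples P = ListP.length-map (_·₃ P) units

  multiples-parallel : ∀ P → All (Parallel P) (multiples P)
  multiples-parallel P = AllP.map⁺ (All.universal (λ k → self P k) units)
    where
    open RingSolver commRing
    self : ∀ P k → Parallel P (k ·₃ P)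
    self (x , y , z) k = go y z , go z x , go x y
      where
      go : ∀ y z → y · (k · z) - z · (k · y) ≈ 0#
      go y z = solve 3 (λ k y z → y :* (k :* z) :- z :* (k :* y) := con ℤ.0ℤ) refl k y z

  multiples-distinct : ∀ P → Nonzero P → AllPairs (λ u v → ¬ (u ≈₃ v)) (multiples P)
  multiples-distinct P@(x , y , z) P≉0 = AllPairsP.map⁺ (AllPairs.map (λ {k} {l} k≉l e → P≉0 (vanish k≉l x (proj₁ e) , vanish k≉l y (proj₁ (proj₂ e)) , vanish k≉l z (proj₂ (proj₂ e)))) units-distinct)
    where
    open RingSolver commRing
    vanish : ∀ {k l} → ¬ (k ≈ l) → ∀ x → k · x ≈ l · x → x ≈ 0#
    vanish {k} {l} k≉l x e = no-zero-divisors (trans (solve 3 (λ k l x → (k :- l) :* x := k :* x :- l :* x) refl k l x) (trans (+-congʳ e) (-‿inverseʳ _)))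
      λ z → k≉l (trans (solve 2 (λ k l → k := (k :- l) :+ l) refl k l) (trans (+-congʳ z) (+-identityˡ l)))

  multiples-complete : ∀ P R → Nonzero P → Nonzero R → Parallel P R → R ∈₃ multiples P
  multiples-complete P R P≉0 R≉0 p = AnyP.map⁺ (Any.map (λ e → ≈₃-trans (proj₂ s) (VF.•-cong e (VF.≋-refl {P}))) (units-complete k≉0))
    where
    s = parallel⇒scalar P R P≉0 p
    k≉0 : ¬ (proj₁ s ≈ 0#)
    k≉0 z = R≉0 (≈₃-trans (proj₂ s) (VF.𝟘-• (proj₁ s) P z))

  -- The zero vector is parallel to everything, hence the condition on the middle vector.
  parallel-trans : ∀ P R S → Nonzero R → Parallel P R → Parallel R S → Parallel P S
  parallel-trans P R S R≉0 p r = ≈₃-trans (VF.⨯-cong (proj₂ sP) (proj₂ sS)) (both (proj₁ sP) (proj₁ sS) R)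
    where
    open RingSolver commRing
    sP = parallel⇒scalar R P R≉0 (parallel-sym P R p)
    sS = parallel⇒scalar R S R≉0 r
    both : ∀ k l R → Parallel (k ·₃ R) (l ·₃ R)
    both k l (x , y , z) = go y z , go z x , go x y
      where
      go : ∀ y z → (k · y) · (l · z) - (k · z) · (l · y) ≈ 0#
      go y z = solve 4 (λ k l y z → (k :* y) :* (l :* z) :- (k :* z) :* (l :* y) := con ℤ.0ℤ) refl k l y z

  parallel-resp : ∀ P {R S} → R ≈₃ S → Parallel P R → Parallel P S
  parallel-resp P e p = ≈₃-trans (VF.⨯-cong (VF.≋-refl {P}) (≈₃-sym e)) p

  parallel-to-one : ∀ P P' R → (¬ Parallel P R → ¬ Parallel P' R → ⊥) → Parallel P R ⊎ Parallel P' R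
  parallel-to-one P P' R h with parallel? P R | parallel? P' R
  ... | yes p | _ = inj₁ p
  ... | no _ | yes p = inj₂ p
  ... | no ∦ | no ∦' = ⊥-elim (h ∦ ∦')

  module _ (A : Arrangement) (1≤n : 1 ℕ.≤ length (forms A)) where
    private
      ms = missing-points A
      u = length units

    private
      Missing⇒All : ∀ {R} αs → ¬ (EF.eval R (product αs) ≈ 0#) → All (λ α → ¬ (ev α R ≈ 0#)) αs
      Missing⇒All [] _ = []
      Missing⇒All {R} (α ∷ αs) m = (λ z → m (trans (EF.eval-* R _ (product αs)) (trans (*-congʳ (trans (EF.eval-form R α) z)) (zeroˡ _))))
        ∷ Missing⇒All αs (λ z → m (trans (EF.eval-* R _ (product αs)) (trans (*-congˡ z) (zeroʳ _))))

      All⇒Missing : ∀ {R} αs → All (λ α → ¬ (ev α R ≈ 0#)) αs → ¬ (EF.eval R (product αs) ≈ 0#)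
      All⇒Missing {R} [] [] z = 1≉0 (trans (sym (trans (EF.eval-const R 1#) refl)) z)
      All⇒Missing {R} (α ∷ αs) (ne ∷ nes) z = product-≉0 (λ e → ne (trans (sym (EF.eval-form R α)) e)) (All⇒Missing αs nes) (trans (sym (EF.eval-* R _ (product αs))) z)

    missing-complete : ∀ R → Missing A R → R ∈₃ ms
    missing-complete R m = Any-filterᵇ (missing A) (Any.map (λ e → e , missing-true A (All.map (λ {α} ne z → ne (trans (ev-cong α e) z)) (Missing⇒All (forms A) m))) (points-complete R))

    missing-sound : All (Missing A) ms
    missing-sound = All.map (λ h → All⇒Missing (forms A) (missing-true⁻ A h)) (All-filterᵇ (missing A) points)

    missing-distinct : AllPairs (λ u v → ¬ (u ≈₃ v)) ms
    missing-distinct = AllPairs-filterᵇ (missing A) points-distinct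

    private
      ≉0 : ∀ {R} → Missing A R → Nonzero R
      ≉0 {R} = missing-nonzero A R 1≤n

    multiples-missing : ∀ P → Missing A P → All (_∈₃ ms) (multiples P)
    multiples-missing P m = AllP.map⁺ (All.map (λ {k} k≉0 → missing-complete (k ·₃ P) (All⇒Missing (forms A)
      (All.map (λ {α} ne z → product-≉0 k≉0 ne (trans (sym (VF.⊙-• k α P)) z)) (Missing⇒All (forms A) m)))) units-nonzero)

    one-class-count : ∀ P → Missing A P → (∀ R → Missing A R → Parallel P R) → length ms ≡ u
    one-class-count P m only = ≡.trans (ℕP.≤-antisym
        (distinct-length-≤ _≈₃_ ≈₃-sym ≈₃-trans ms (multiples P) missing-distinct (All.map (λ {R} mR → multiples-complete P R (≉0 m) (≉0 mR) (only R mR)) missing-sound))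
        (distinct-length-≤ _≈₃_ ≈₃-sym ≈₃-trans (multiples P) ms (multiples-distinct P (≉0 m)) (multiples-missing P m))) (length-multiples P)

    private
      new-class : ∀ {P R} → ¬ Parallel P R → All (λ S → ¬ (R ≈₃ S)) (multiples P)
      new-class {P} {R} ∦ = All.map (λ {S} p e → ∦ (parallel-resp P (≈₃-sym e) p)) (multiples-parallel P)

    -- A missed point outside the class of P would come in addition to the q - 1 nonzero multiples
    -- of P, exceeding the count.
    count-one-class : ∀ P → Missing A P → length ms ≡ u → ∀ R → Missing A R → Parallel P R
    count-one-class P m c R mR with parallel? P R
    ... | yes p = p
    ... | no ∦ = ⊥-elim (ℕP.<-irrefl (≡.trans (length-multiples P) (≡.sym c)) (distinct-length-≤ _≈₃_ ≈₃-sym ≈₃-trans (R ∷ multiples P) ms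
        (new-class {P} {R} ∦ ∷ multiples-distinct P (≉0 m)) (missing-complete R mR ∷ multiples-missing P m)))

    module _ (P P' : V3) (m : Missing A P) (m' : Missing A P') (P∦P' : ¬ Parallel P P') where
      private
        both = multiples P ++ multiples P'

        length-both : length both ≡ u ℕ.+ u
        length-both = ≡.trans (ListP.length-++ (multiples P)) (≡.cong₂ ℕ._+_ (length-multiples P) (length-multiples P'))

        ∦-multiple : ∀ {S S'} → Parallel P S → Nonzero S → Parallel P' S' → ¬ (S ≈₃ S')
        ∦-multiple {S} {S'} p S≉0 p' e = P∦P' (parallel-trans P S P' S≉0 p (parallel-sym P' S (parallel-resp P' (≈₃-sym e) p')))

        multiple-nonzero : All Nonzero (multiples P)
        multiple-nonzero = All.map found (multiples-missing P m)
          where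
          found : ∀ {S} → S ∈₃ ms → Nonzero S
          found {S} a z = go missing-sound a
            where
            go : ∀ {xs} → All (Missing A) xs → Any (S ≈₃_) xs → ⊥
            go (mR ∷ _) (here e) = ≉0 mR (≈₃-trans (≈₃-sym e) z)
            go (_ ∷ ms) (there a) = go ms a

        both-distinct : AllPairs (λ u v → ¬ (u ≈₃ v)) both
        both-distinct = AllPairsP.++⁺ (multiples-distinct P (≉0 m)) (multiples-distinct P' (≉0 m'))
          (All.zipWith (λ {S} (p , S≉0) → All.map (λ {S'} p' → ∦-multiple {S} {S'} p S≉0 p') (multiples-parallel P')) (multiples-parallel P , multiple-nonzero))

        both-missing : All (_∈₃ ms) both
        both-missing = AllP.++⁺ (multiples-missing P m) (multiples-missing P' m')

      two-class-count : (∀ R → Missing A R → Parallel P R ⊎ Parallel P' R) → length ms ≡ u ℕ.+ u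
      two-class-count only = ≡.trans (ℕP.≤-antisym
          (distinct-length-≤ _≈₃_ ≈₃-sym ≈₃-trans ms both missing-distinct (All.map (λ {R} mR → covered R mR (only R mR)) missing-sound))
          (distinct-length-≤ _≈₃_ ≈₃-sym ≈₃-trans both ms both-distinct both-missing)) length-both
        where
        covered : ∀ R → Missing A R → Parallel P R ⊎ Parallel P' R → R ∈₃ both
        covered R mR (inj₁ p) = AnyP.++⁺ˡ (multiples-complete P R (≉0 m) (≉0 mR) p)
        covered R mR (inj₂ p) = AnyP.++⁺ʳ (multiples P) (multiples-complete P' R (≉0 m') (≉0 mR) p)

      -- The multiples of P and P' already exhaust the count, leaving no room for a point of a third
      -- class.
      count-two-class : length ms ≡ u ℕ.+ u → ∀ R → Missing A R → Parallel P R ⊎ Parallel P' R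
      count-two-class c R mR with parallel? P R | parallel? P' R
      ... | yes p | _ = inj₁ p
      ... | no _ | yes p = inj₂ p
      ... | no ∦ | no ∦' = ⊥-elim (ℕP.<-irrefl (≡.trans length-both (≡.sym c)) (distinct-length-≤ _≈₃_ ≈₃-sym ≈₃-trans (R ∷ both) ms
          (AllP.++⁺ (new-class {P} {R} ∦) (new-class {P'} {R} ∦') ∷ both-distinct) (missing-complete R mR ∷ both-missing)))

    another-class : ∀ P → (∀ R → Missing A R → Parallel P R) ⊎ Σ V3 λ P' → Missing A P' × ¬ Parallel P P'
    another-class P = search ms missing-sound λ R m → missing-complete R m
      where
      search : ∀ xs → All (Missing A) xs → (∀ R → Missing A R → R ∈₃ xs) → (∀ R → Missing A R → Parallel P R) ⊎ Σ V3 λ P' → Missing A P' × ¬ Parallel P P'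
      search xs mxs complete with All.all? (parallel? P) xs
      ... | yes h = inj₁ λ R mR → find h (complete R mR)
        where
        find : ∀ {R xs} → All (Parallel P) xs → R ∈₃ xs → Parallel P R
        find (p ∷ _) (here e) = parallel-resp P (≈₃-sym e) p
        find (_ ∷ ps) (there a) = find ps a
      ... | no ¬h = inj₂ (pick mxs (AllP.¬All⇒Any¬ (parallel? P) xs ¬h))
        where
        pick : ∀ {xs} → All (Missing A) xs → Any (λ R → ¬ Parallel P R) xs → Σ V3 λ P' → Missing A P' × ¬ Parallel P P'
        pick (m ∷ _) (here {R} ne) = R , m , ne
        pick (_ ∷ ms) (there a) = pick ms a

    some-missing : length ms ≢ 0 → Σ V3 (Missing A)
    some-missing ne = first ms missing-sound ne
      where
      first : ∀ xs → All (Missing A) xs → length xs ≢ 0 → Σ V3 (Missing A)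
      first [] _ ne = ⊥-elim (ne ≡.refl)
      first (R ∷ _) (m ∷ _) _ = R , m

open import Data.Nat using (_*_; _∸_)

-- Both equivalences, for 2q - 1 and 2q - 2 hyperplanes.

module Theorem {q : ℕ} (F : FiniteField q) (A : Arr.Arrangement F) (χ≢0 : ¬ (Arr.chiAt F A (+ q) ≡ 0ℤ)) where
  open Arr F
  open Frobenius F using (1<q)
  open Construction F using (Parallel; Missing; missing-nonzero; module OneClass; two-classes⇒free)
  open HomogeneousBases F using (basis; homogeneous-basis)
  open Necessity F using (CompleteIntersection; complete-intersection)
  open MissingPoints F using (one-class; at-most-two-classes)
  open Characteristic F using (missing-points; chi-count)
  open Coefficients F using (chi-criterion)
  open MissingClasses F

  private
    n = length (forms A)
    -- This is q - 1; writing q as 1 + u removes the truncated subtractions from the arithmetic.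
    u = length units

    q≡1+u : q ≡ suc u
    q≡1+u = ≡.sym length-units

    0<u : 0 ℕ.< u
    0<u = ℕP.≤-pred (≡.subst (1 ℕ.<_) q≡1+u 1<q)

    count≢0 : length (missing-points A) ≢ 0
    count≢0 e = χ≢0 (≡.trans (chi-count A) (≡.cong +_ e))

    module _ (1≤n : 1 ℕ.≤ n) where
      P : V3
      P = proj₁ (some-missing A 1≤n count≢0)

      P-missing : Missing A P
      P-missing = proj₂ (some-missing A 1≤n count≢0)

      intersection : IsFree A → CompleteIntersection A
      intersection free = complete-intersection A (homogeneous-basis A (basis A free) 1≤n) P P-missing

    +q : + q ≡ 1ℤ ℤ.+ + u
    +q = ≡.cong +_ q≡1+u

    2q : 2 * q ≡ suc u ℕ.+ suc u
    2q = ≡.trans (≡.cong (2 *_) q≡1+u) (≡.cong (suc u ℕ.+_) (ℕP.+-identityʳ (suc u)))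

  module _ (size≡ : size A ≡ 2 * q ∸ 1) where
    private
      n≡ : n ≡ u ℕ.+ suc u
      n≡ = ≡.trans size≡ (≡.cong (_∸ 1) 2q)

      1≤n : 1 ℕ.≤ n
      1≤n = ≡.subst (1 ℕ.≤_) (≡.sym n≡) (ℕP.≤-trans 0<u (ℕP.m≤m+n u (suc u)))

      n∸q : n ∸ q ≡ u
      n∸q = ≡.trans (≡.cong₂ _∸_ n≡ q≡1+u) (ℕP.m+n∸n≡m u (suc u))

      -- For |A| = 2q - 1 the degrees of m and l add up to 2, and both are positive: two lines.
      degrees : ∀ a b → suc a ℕ.+ suc b ℕ.+ n ≡ suc (2 * q) → a ≡ 0 × b ≡ 0
      degrees a b e = ℕP.m+n≡0⇒m≡0 a a+b≡0 , ℕP.m+n≡0⇒n≡0 a a+b≡0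
        where
        open ℕSolver
        a+b≡0 : a ℕ.+ b ≡ 0
        a+b≡0 = ℕP.+-cancelʳ-≡ (suc (suc (u ℕ.+ suc u))) (a ℕ.+ b) 0 (≡.trans
          (solve 3 (λ a b n → a :+ b :+ (con 2 :+ n) := con 1 :+ a :+ (con 1 :+ b) :+ n) ≡.refl a b (u ℕ.+ suc u))
          (≡.trans (≡.cong (suc a ℕ.+ suc b ℕ.+_) (≡.sym n≡)) (≡.trans e (≡.cong suc 2q))))

      -- The two factors other than q - 1 have value 1 at q: a single class of q - 1 points.
      target : ∀ {k} → + k ≡ (+ q ℤ.- 1ℤ) ℤ.* ((+ q ℤ.- (+ q ℤ.- 1ℤ)) ℤ.* (+ q ℤ.- (+ q ℤ.- 1ℤ))) ⇔ k ≡ u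
      target {k} = mk⇔ (λ e → ℤP.+-injective (≡.trans e value)) (λ e → ≡.trans (≡.cong +_ e) (≡.sym value))
        where
        value : (+ q ℤ.- 1ℤ) ℤ.* ((+ q ℤ.- (+ q ℤ.- 1ℤ)) ℤ.* (+ q ℤ.- (+ q ℤ.- 1ℤ))) ≡ + u
        value = ≡.trans (≡.cong (λ Q → (Q ℤ.- 1ℤ) ℤ.* ((Q ℤ.- (Q ℤ.- 1ℤ)) ℤ.* (Q ℤ.- (Q ℤ.- 1ℤ)))) +q)
          (solve 1 (λ u → let Q = con 1ℤ :+ u in (Q :- con 1ℤ) :* ((Q :- (Q :- con 1ℤ)) :* (Q :- (Q :- con 1ℤ))) := u) ≡.refl (+ u))
          where open ℤSolver

      criterion : ChiIs A (target1 q) ⇔ + length (missing-points A) ≡ (+ q ℤ.- 1ℤ) ℤ.* ((+ q ℤ.- (+ q ℤ.- 1ℤ)) ℤ.* (+ q ℤ.- (+ q ℤ.- 1ℤ)))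
      criterion = chi-criterion A (+ q ℤ.- 1ℤ) (+ q ℤ.- 1ℤ) 1≤n
        (≡.trans (≡.cong +_ n≡) (≡.trans (solve 1 (λ u → u :+ (con 1ℤ :+ u) := con 1ℤ :+ ((con 1ℤ :+ u) :- con 1ℤ) :+ ((con 1ℤ :+ u) :- con 1ℤ)) ≡.refl (+ u))
          (≡.cong (λ Q → 1ℤ ℤ.+ (Q ℤ.- 1ℤ) ℤ.+ (Q ℤ.- 1ℤ)) (≡.sym +q))))
        where open ℤSolver

    private
      all-parallel : CompleteIntersection A → ∀ R → Missing A R → Parallel (P 1≤n) R
      all-parallel C R m = one-class A C (proj₁ d) (proj₂ d) (P 1≤n) R (P-missing 1≤n) m
        where d = degrees (CompleteIntersection.dm C) (CompleteIntersection.dl C) (CompleteIntersection.degrees C)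

      free⇒count : IsFree A → length (missing-points A) ≡ u
      free⇒count free = one-class-count A 1≤n (P 1≤n) (P-missing 1≤n) (all-parallel (intersection 1≤n free))

      count⇒free : length (missing-points A) ≡ u → IsFree A
      count⇒free c = OneClass.one-class⇒free A (P 1≤n) (P-missing 1≤n) (missing-nonzero A (P 1≤n) 1≤n (P-missing 1≤n))
        (count-one-class A 1≤n (P 1≤n) (P-missing 1≤n) c)
        (≡.trans (≡.cong (λ k → 1 ℕ.+ (k ℕ.+ k)) n∸q) (≡.trans (≡.sym (ℕP.+-suc u u)) (≡.sym n≡)))

    free⇔chi₁ : IsFree A ⇔ ChiIs A (target1 q)
    free⇔chi₁ = mk⇔ (λ free → Equivalence.from criterion (Equivalence.from target (free⇒count free)))
      (λ chi → count⇒free (Equivalence.to target (Equivalence.to criterion chi)))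

  module _ (size≡ : size A ≡ 2 * q ∸ 2) where
    private
      n≡ : n ≡ u ℕ.+ u
      n≡ = ≡.trans size≡ (≡.trans (≡.cong (_∸ 2) 2q) (≡.cong (_∸ 1) (ℕP.+-suc u u)))

      1≤n : 1 ℕ.≤ n
      1≤n = ≡.subst (1 ℕ.≤_) (≡.sym n≡) (ℕP.≤-trans 0<u (ℕP.m≤m+n u u))

      -- This is q - 2 = |A| - q, the degree bound of a derivation obtained from a line.
      u' : ℕ
      u' = ℕ.pred u

      u≡ : u ≡ suc u'
      u≡ = ≡.sym (ℕP.suc-pred u {{ℕ.>-nonZero 0<u}})

      n∸q : n ∸ q ≡ u'
      n∸q = ≡.trans (≡.cong₂ _∸_ (≡.trans n≡ (≡.trans (≡.cong (ℕ._+ u) u≡) (≡.sym (ℕP.+-suc u' u)))) q≡1+u) (ℕP.m+n∸n≡m u' (suc u))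

      1+n∸q : suc n ∸ q ≡ u
      1+n∸q = ≡.trans (≡.cong₂ _∸_ (≡.trans (≡.cong suc n≡) (≡.sym (ℕP.+-suc u u))) q≡1+u) (ℕP.m+n∸n≡m u (suc u))

      -- For |A| = 2q - 2 the degrees of m and l add up to 3: a line and a conic, in either order.
      degrees : ∀ a b → suc a ℕ.+ suc b ℕ.+ n ≡ suc (2 * q) → (a ≡ 0 × b ≡ 1) ⊎ (a ≡ 1 × b ≡ 0)
      degrees a b e = split a b a+b≡1
        where
        open ℕSolver
        a+b≡1 : a ℕ.+ b ≡ 1
        a+b≡1 = ℕP.+-cancelʳ-≡ (suc (suc (u ℕ.+ u))) (a ℕ.+ b) 1 (≡.trans
          (solve 3 (λ a b n → a :+ b :+ (con 2 :+ n) := con 1 :+ a :+ (con 1 :+ b) :+ n) ≡.refl a b (u ℕ.+ u))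
          (≡.trans (≡.cong (suc a ℕ.+ suc b ℕ.+_) (≡.sym n≡)) (≡.trans e (≡.cong suc (≡.trans 2q (≡.cong suc (ℕP.+-suc u u)))))))
        split : ∀ a b → a ℕ.+ b ≡ 1 → (a ≡ 0 × b ≡ 1) ⊎ (a ≡ 1 × b ≡ 0)
        split 0 .1 ≡.refl = inj₁ (≡.refl , ≡.refl)
        split 1 0 ≡.refl = inj₂ (≡.refl , ≡.refl)

      -- The last factor has the value q - (q - 2) = 2: two classes of q - 1 points each.
      target : ∀ {k} → + k ≡ (+ q ℤ.- 1ℤ) ℤ.* ((+ q ℤ.- (+ q ℤ.- 1ℤ)) ℤ.* (+ q ℤ.- (+ q ℤ.- + 2))) ⇔ k ≡ u ℕ.+ u
      target {k} = mk⇔ (λ e → ℤP.+-injective (≡.trans e value)) (λ e → ≡.trans (≡.cong +_ e) (≡.sym value))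
        where
        value : (+ q ℤ.- 1ℤ) ℤ.* ((+ q ℤ.- (+ q ℤ.- 1ℤ)) ℤ.* (+ q ℤ.- (+ q ℤ.- + 2))) ≡ + (u ℕ.+ u)
        value = ≡.trans (≡.cong (λ Q → (Q ℤ.- 1ℤ) ℤ.* ((Q ℤ.- (Q ℤ.- 1ℤ)) ℤ.* (Q ℤ.- (Q ℤ.- + 2)))) +q)
          (solve 1 (λ u → let Q = con 1ℤ :+ u in (Q :- con 1ℤ) :* ((Q :- (Q :- con 1ℤ)) :* (Q :- (Q :- con (+ 2)))) := u :+ u) ≡.refl (+ u))
          where open ℤSolver

      criterion : ChiIs A (target2 q) ⇔ + length (missing-points A) ≡ (+ q ℤ.- 1ℤ) ℤ.* ((+ q ℤ.- (+ q ℤ.- 1ℤ)) ℤ.* (+ q ℤ.- (+ q ℤ.- + 2)))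
      criterion = chi-criterion A (+ q ℤ.- 1ℤ) (+ q ℤ.- + 2) 1≤n
        (≡.trans (≡.cong +_ n≡) (≡.trans (solve 1 (λ u → u :+ u := con 1ℤ :+ ((con 1ℤ :+ u) :- con 1ℤ) :+ ((con 1ℤ :+ u) :- con (+ 2))) ≡.refl (+ u))
          (≡.cong (λ Q → 1ℤ ℤ.+ (Q ℤ.- 1ℤ) ℤ.+ (Q ℤ.- + 2)) (≡.sym +q))))
        where open ℤSolver

      P₁ = P 1≤n
      m₁ = P-missing 1≤n
      P₁≉0 = missing-nonzero A P₁ 1≤n m₁

      -- A single class of missing points would need more than 2q − 2 forms.
      not-one-class : ¬ (∀ R → Missing A R → Parallel P₁ R)
      not-one-class only = ℕP.<-irrefl ≡.refl (ℕP.≤-trans (ℕP.≤-reflexive (≡.sym smaller)) (OneClass.one-class⇒many-forms A P₁ m₁ P₁≉0 only))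
        where
        smaller : n ≡ suc (1 ℕ.+ ((n ∸ q) ℕ.+ (n ∸ q)))
        smaller = ≡.trans n≡ (≡.trans (≡.cong₂ ℕ._+_ u≡ u≡) (≡.trans (≡.cong suc (ℕP.+-suc u' u')) (≡.cong (λ k → suc (1 ℕ.+ (k ℕ.+ k))) (≡.sym n∸q))))

      second : (∀ R → Missing A R → Parallel P₁ R) ⊎ (Σ V3 λ P' → Missing A P' × ¬ Parallel P₁ P') → Σ V3 λ P' → Missing A P' × ¬ Parallel P₁ P'
      second (inj₁ only) = ⊥-elim (not-one-class only)
      second (inj₂ s) = s

      S = second (another-class A 1≤n P₁)
      P₂ = proj₁ S
      m₂ = proj₁ (proj₂ S)
      ∦ = proj₂ (proj₂ S)

      at-most-two : CompleteIntersection A → ∀ R → Missing A R → Parallel P₁ R ⊎ Parallel P₂ R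
      at-most-two C R m = parallel-to-one P₁ P₂ R (at-most-two-classes A C
        (degrees (CompleteIntersection.dm C) (CompleteIntersection.dl C) (CompleteIntersection.degrees C)) P₁ P₂ R m₁ m₂ m ∦)

      free⇒count : IsFree A → length (missing-points A) ≡ u ℕ.+ u
      free⇒count free = two-class-count A 1≤n P₁ P₂ m₁ m₂ ∦ (at-most-two (intersection 1≤n free))

      count⇒free : length (missing-points A) ≡ u ℕ.+ u → IsFree A
      count⇒free c = two-classes⇒free A P₁ P₂ m₁ P₁≉0 ∦ (count-two-class A 1≤n P₁ P₂ m₁ m₂ ∦ c)
        (≡.trans (≡.cong₂ (λ k l → 1 ℕ.+ (k ℕ.+ l)) n∸q 1+n∸q) (≡.trans (≡.cong (ℕ._+ u) (≡.sym u≡)) (≡.sym n≡)))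

    free⇔chi₂ : IsFree A ⇔ ChiIs A (target2 q)
    free⇔chi₂ = mk⇔ (λ free → Equivalence.from criterion (Equivalence.from target (free⇒count free)))
      (λ chi → count⇒free (Equivalence.to target (Equivalence.to criterion chi)))

mainTheorem7 : (q : ℕ) → IsPrimePower q → (F : FiniteField q) → (A : Arr.Arrangement F) →
    ¬ (Arr.chiAt F A (ℤ.+ q) ≡ ℤ.0ℤ) →
    ((Arr.size F A ≡ 2 * q ∸ 1 → (Arr.IsFree F A ⇔ Arr.ChiIs F A (target1 q)))
    × (Arr.size F A ≡ 2 * q ∸ 2 → (Arr.IsFree F A ⇔ Arr.ChiIs F A (target2 q))))
mainTheorem7 q _ F A χ≢0 = Theorem.free⇔chi₁ F A χ≢0 , Theorem.free⇔chi₂ F A χ≢0
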